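{- Let $d\ge 2$ and $g\ge 1$ be integers and let $\Delta\subseteq\mathbb{Q}^d$ be a $d$-dimensional Fano simplex of Gorenstein index $g$. \begin{enumerate} \item If $(d,g)=(2,1)$, then $\mathrm{Vol}(\Delta)\le 9$, with equality if and only if $\Delta\cong\Delta(P)$ for $P=\begin{pmatrix}1&1&-2\\0&3&-3\end{pmatrix}$. \item If $(d,g)\neq(2,1)$, then $\mathrm{Vol}(\Delta)\le \dfrac{2t_{g,d}^2}{g^2}$. Equality holds if and only if either $(d,g)=(3,1)$ and $\Delta\cong\Delta(P_1)$ with $P_1=\begin{pmatrix}1&1&1&-5\\0&2&2&-4\\0&0&6&-6\end{pmatrix}$, or $\Delta\cong\Delta(P_2)$, where $P_2$ is the $d\times(d+1)$ integer matrix whose first $d-1$ columns are the standard basis vectors $e_1,\dots,e_{d-1}$, whose $d$-th column is $\big(c_1,\dots,c_{d-1},\tfrac{t_{g,d}}{g}\big)^T$ with $c_k=\frac{s_{g,k}-g}{s_{g,k}}\cdot\frac{t_{g,d}}{g}$, and whose last column is $\big(-b_1,\dots,-b_{d-1},-\tfrac{t_{g,d}}{g}\big)^T$ with $b_k=\frac{s_{g,k}+g}{s_{g,k}}\cdot\frac{t_{g,d}}{g}$ ($k=1,\dots,d-1$). \end{enumerate}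
   Context: A lattice simplex in $\mathbb{Q}^d$ is a full-dimensional simplex with vertices in $\mathbb{Z}^d$. A Fano simplex is a lattice simplex containing the origin in its interior whose vertices are primitive lattice vectors. Two simplices are isomorphic ($\cong$) if some $\varphi\in\mathrm{GL}(d,\mathbb{Z})$ maps one onto the other. For a $d\times(d+1)$ matrix $P$, $\Delta(P)$ denotes the convex hull of its columns. The normalized volume is $\mathrm{Vol}(\Delta)=d!\cdot\mathrm{vol}(\Delta)$ (Euclidean volume). For a simplex $\Delta$ containing the origin in its interior (an IP simplex), its dual is $\Delta^*=\{u\in\mathbb{Q}^d:\langle u,v\rangle\ge -1\ \forall v\in\Delta\}$; $g_{\mathbb{Q}}(\Delta)$ is the smallest positive integer $k$ such that $k\Delta$ is a lattice simplex, and the Gorenstein index is $g(\Delta)=g_{\mathbb{Q}}(\Delta)\,g_{\mathbb{Q}}(\Delta^*)$ (for a lattice simplex, the smallest $g\ge1$ with $g\Delta^*$ a lattice simplex). The $g$-Sylvester sequence is $s_{g,1}=g+1$, $s_{g,k+1}=s_{g,k}(s_{g,k}-1)+1$, and the truncated $g$-Sylvester sequence is $t_{g,k}=s_{g,k}-1$. -}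

module Defs where

open import Level using (0ℓ)
open import Data.Bool.Base using (if_then_else_)
open import Data.Fin.Base as Fin using (Fin; zero; suc; toℕ; fromℕ)
import Data.Fin.Properties as Fin
open import Data.Integer.Base as ℤ using (ℤ; +_; -[1+_])
open import Data.Integer.Divisibility using (_∣_)
import Data.Integer.Properties as ℤ
open import Data.Nat.Base as ℕ using (ℕ; zero; suc; 2+; NonZero; _!)
import Data.Nat.Properties as ℕ
open import Data.Product.Base using (∃; ∃-syntax; _×_)
open import Data.Rational.Base as ℚ
  using (ℚ; 0ℚ; 1ℚ; _+_; _*_; _-_; -_; _/_; _≤_; _<_)
open import Data.Rational.Literals using (fromℤ)
import Data.Rational.Properties as ℚ
open import Data.Vec.Functional using (Vector; []; _∷_; insertAt; map; transpose)
open import Relation.Binary.PropositionalEquality.Core using (_≡_; _≢_)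
open import Relation.Nullary.Decidable.Core using (does)
open import Relation.Unary using (Pred; _∈_; _⊆_; _≐_; _⊥_)

open import Algebra.Properties.Semiring.Sum ℤ.+-*-semiring
  using () renaming (sum to sumℤ)
open import Algebra.Properties.CommutativeMonoid.Sum ℚ.+-0-commutativeMonoid
  using (sum)
open import Algebra.Properties.CommutativeMonoid.Sum ℚ.*-1-commutativeMonoid
  using () renaming (sum to product)

private
  variable
    m n d : ℕ

------------------------------------------------------------------------
-- Vectors, matrices and subsets of ℚᵈ

Matrix : Set → ℕ → ℕ → Set
Matrix A m n = Vector (Vector A n) m

Subset : ℕ → Set₁
Subset d = Pred (Vector ℚ d) 0ℓ

toℚ : Matrix ℤ m n → Matrix ℚ m n
toℚ = map (map fromℤ)

identity : Matrix ℤ n n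
identity i j = if does (i Fin.≟ j) then + 1 else + 0

_⊗_ : Matrix ℤ n n → Matrix ℤ n n → Matrix ℤ n n
(A ⊗ B) i k = sumℤ λ j → A i j ℤ.* B j k

_·_ : Matrix ℚ m n → Vector ℚ n → Vector ℚ m
(A · x) i = sum λ j → A i j * x j

⟨_,_⟩ : Vector ℚ d → Vector ℚ d → ℚ
⟨ u , v ⟩ = sum λ i → u i * v i

-- Vectors are functions, so equality of points is pointwise throughout.

image : (Vector ℚ d → Vector ℚ d) → Subset d → Subset d
image f S y = ∃[ x ] x ∈ S × (∀ i → f x i ≡ y i)

_⋆_ : ℕ → Subset d → Subset d
k ⋆ S = image (λ x i → fromℤ (+ k) * x i) S

Interior : Subset d → Subset d
Interior S p =
  ∃[ ε ] 0ℚ < ε × (∀ x → (∀ i → ℚ.∣ x i - p i ∣ < ε) → x ∈ S)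

origin : Vector ℚ d
origin _ = 0ℚ

------------------------------------------------------------------------
-- Lattice simplices and Fano simplices

-- The convex hull of the columns of P.
Δ[_] : Matrix ℚ d n → Subset d
Δ[ P ] x =
  ∃[ λs ] (∀ j → 0ℚ ≤ λs j) × sum λs ≡ 1ℚ × (∀ i → (P · λs) i ≡ x i)

AffinelyIndependent : Matrix ℚ d n → Set
AffinelyIndependent P =
  ∀ μ → sum μ ≡ 0ℚ → (∀ i → (P · μ) i ≡ 0ℚ) → ∀ j → μ j ≡ 0ℚ

-- S is the full-dimensional simplex whose vertices are the columns of V.
IsLatticeSimplexOn : Matrix ℤ d (suc d) → Subset d → Set
IsLatticeSimplexOn V S = AffinelyIndependent (toℚ V) × S ≐ Δ[ toℚ V ]

IsLatticeSimplex : Subset d → Set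
IsLatticeSimplex {d} S = ∃[ V ] IsLatticeSimplexOn {d} V S

Primitive : Vector ℤ d → Set
Primitive v = ∀ k → (∀ i → + k ∣ v i) → k ≡ 1

record IsFanoSimplex {d : ℕ} (S : Subset d) : Set where
  field
    vertices    : Matrix ℤ d (suc d)
    simplex     : IsLatticeSimplexOn vertices S
    interior    : origin ∈ Interior S
    primitivity : ∀ j → Primitive (transpose vertices j)

------------------------------------------------------------------------
-- Isomorphism by GL(d,ℤ)

record GL (d : ℕ) : Set where
  field
    matrix   : Matrix ℤ d d
    inverse  : Matrix ℤ d d
    inverseˡ : ∀ i j → (inverse ⊗ matrix) i j ≡ identity i j
    inverseʳ : ∀ i j → (matrix ⊗ inverse) i j ≡ identity i j

infix 4 _≅_

_≅_ : Subset d → Subset d → Set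
_≅_ {d} S T = ∃ λ (φ : GL d) → image (toℚ (GL.matrix φ) ·_) S ≐ T

------------------------------------------------------------------------
-- Dual and Gorenstein index

Dual : Subset d → Subset d
Dual S u = ∀ v → v ∈ S → - 1ℚ ≤ ⟨ u , v ⟩

record Isgℚ {d : ℕ} (S : Subset d) (k : ℕ) : Set where
  field
    positive : 1 ℕ.≤ k
    integral : IsLatticeSimplex (k ⋆ S)
    minimal  : ∀ j → 1 ℕ.≤ j → IsLatticeSimplex (j ⋆ S) → k ℕ.≤ j

IsGorensteinIndex : Subset d → ℕ → Set
IsGorensteinIndex S g =
  ∃[ k ] ∃[ l ] Isgℚ S k × Isgℚ (Dual S) l × g ≡ k ℕ.* l

------------------------------------------------------------------------
-- Volume

-- Half-open boxes ∏ᵢ [lower i , upper i).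
record Box (d : ℕ) : Set where
  field
    lower upper : Vector ℚ d
    ordered     : ∀ i → lower i ≤ upper i

  points : Subset d
  points x = ∀ i → lower i ≤ x i × x i < upper i

  size : ℚ
  size = product λ i → upper i - lower i

open Box

⋃ : Vector (Box d) n → Subset d
⋃ Bs x = ∃[ j ] x ∈ points (Bs j)

-- Euclidean volume as Jordan content: v is approximated from below by
-- disjoint boxes inside S and from above by boxes covering S.  Since the
-- inner sums never exceed the outer ones, S has at most one volume.  Only
-- rational points occur, which changes nothing for polytopes with rational
-- vertices.
record IsVolume {d : ℕ} (S : Subset d) (v : ℚ) : Set where
  field
    inner : ∀ ε → 0ℚ < ε → ∃[ n ] ∃ λ (Bs : Vector (Box d) n) →
      (∀ j k → j ≢ k → points (Bs j) ⊥ points (Bs k)) ×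
      ⋃ Bs ⊆ S ×
      v - ε ≤ sum (map size Bs)
    outer : ∀ ε → 0ℚ < ε → ∃[ n ] ∃ λ (Bs : Vector (Box d) n) →
      S ⊆ ⋃ Bs ×
      sum (map size Bs) ≤ v + ε

IsNormalizedVolume : Subset d → ℚ → Set
IsNormalizedVolume {d} S V = ∃[ v ] IsVolume S v × V ≡ fromℤ (+ (d !)) * v

------------------------------------------------------------------------
-- Sylvester sequences

-- Indexed from 1, as is customary; the value at index 0 is never used.
s : ℕ → ℕ → ℕ
s g 0      = 1
s g 1      = g ℕ.+ 1
s g (2+ k) = s g (suc k) ℕ.* (s g (suc k) ℕ.∸ 1) ℕ.+ 1

t : ℕ → ℕ → ℕ
t g k = s g k ℕ.∸ 1

s-nonZero : ∀ g k → NonZero (s g k)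
s-nonZero g 0      = _
s-nonZero g 1      = ℕ.≢-nonZero (ℕ.m+1+n≢0 g)
s-nonZero g (2+ k) = ℕ.≢-nonZero (ℕ.m+1+n≢0 (s g (suc k) ℕ.* (s g (suc k) ℕ.∸ 1)))

-- 2 t² / g²
bound : ∀ g .{{_ : NonZero g}} → ℕ → ℚ
bound g d = _/_ (+ (2 ℕ.* t g d ℕ.^ 2)) (g ℕ.^ 2) {{ℕ.m^n≢0 g 2}}

------------------------------------------------------------------------
-- The extremal simplices

P : Matrix ℤ 2 3
P = (+ 1 ∷ + 1 ∷ ℤ.- + 2 ∷ [])
  ∷ (+ 0 ∷ + 3 ∷ ℤ.- + 3 ∷ [])
  ∷ []

P₁ : Matrix ℤ 3 4
P₁ = (+ 1 ∷ + 1 ∷ + 1 ∷ ℤ.- + 5 ∷ [])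
   ∷ (+ 0 ∷ + 2 ∷ + 2 ∷ ℤ.- + 4 ∷ [])
   ∷ (+ 0 ∷ + 0 ∷ + 6 ∷ ℤ.- + 6 ∷ [])
   ∷ []

snoc : {A : Set} → Vector A n → A → Vector A (suc n)
snoc {n} xs x = insertAt xs (fromℕ n) x

-- Since t g d = g * s g 1 * ... * s g (d ∸ 1), all entries of P₂ are
-- integers; ℚ is used only to write the fractions directly.
P₂ : ∀ g .{{_ : NonZero g}} d → Matrix ℚ d (suc d)
P₂ g zero    = []
P₂ g (suc n) = transpose (snoc (snoc basis lastButOne) final)
  where
  q : ℚ
  q = + t g (suc n) / g

  over-s : ℤ → Fin n → ℚ
  over-s z k = _/_ z (s g (suc (toℕ k))) {{s-nonZero g (suc (toℕ k))}}

  c b : Vector ℚ n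
  c k = over-s (+ s g (suc (toℕ k)) ℤ.- + g) k * q
  b k = over-s (+ s g (suc (toℕ k)) ℤ.+ + g) k * q

  basis : Vector (Vector ℚ (suc n)) n
  basis k = snoc (map fromℤ (identity k)) 0ℚ

  lastButOne final : Vector ℚ (suc n)
  lastButOne = snoc c q
  final      = snoc (map -_ b) (- q)

{-# OPTIONS --safe #-}
module Submission where

-- Let βⱼ be the barycentric coordinates of the origin in Δ and aⱼ = g / βⱼ. Scaling the vertices of the dual by g gives
-- lattice vectors nᵢ with ⟨nᵢ , vⱼ⟩ = - g for i ≠ j and ⟨nᵢ , vᵢ⟩ = aᵢ - g, so the aⱼ are integers with ∑ 1 / aⱼ = 1 / g.
-- Replacing one row (g , nᵢ) by (1 , 0 , … , 0) yields an integral matrix U whose product with the matrix of the points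
-- (1 , vⱼ) is triangular with diagonal a₀ , … , a_{d-1} , 1. Since the vⱼ are primitive, g divides det U, hence
-- g Vol Δ ≤ a₀ ⋯ a_{d-1}.
--
-- For ascending aⱼ this product is at most 2 t² / g, where t = t_{g,d}: at the last place where a prefix product of the
-- 1 / aⱼ is larger than that of the Sylvester solution, majorization (by weighted AM-GM and Abel summation) bounds the
-- remaining sum from above, while integrality bounds it from below. If the bound is attained the aⱼ are known and
-- ∣det U∣ = g, so that vᵢ and vⱼ are congruent modulo every common divisor of aᵢ and aⱼ coprime to g. These congruences
-- factor the vertex matrix as B Q with B integral and Q the matrix of the model, and equality of the volumes gives
-- det B = ± 1.
--
-- Jordan content is multiplied by ∣det A∣ under A, because A is a product of swaps, scalings and shears; the standard
-- simplex is measured by slicing, so Vol Δ is the determinant of the points (1 , vⱼ).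

open import Defs hiding (s; t; P; bound)
open import Level using (0ℓ)
open import Algebra.Bundles using (CommutativeRing; module CommutativeRing; CommutativeMonoid)
open import Algebra.Structures using (IsCommutativeRing)
open import Data.Empty using (⊥; ⊥-elim)
open import Data.Fin.Base as Fin using (Fin; zero; suc; toℕ; fromℕ; punchIn; punchOut; inject₁)
open import Data.Fin.Permutation as Perm using (Permutation′; _⟨$⟩ʳ_; _⟨$⟩ˡ_)
import Data.Fin.Properties as Fin
open import Data.Fin.Relation.Unary.Top using (view; ‵fromℕ; ‵inject₁)
open import Data.Integer.Base as ℤ using (ℤ; -[1+_])
import Data.Integer.Properties as ℤ
open import Data.Nat.Base as ℕ using (ℕ; zero; suc; NonZero; z≤n; s≤s)
open import Data.Nat.Coprimality as Coprimality using (Coprime; coprime?; coprime-divisor; coprime-/gcd)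
import Data.Nat.Divisibility as ℕ
open import Data.Nat.DivMod using (m/n*n≡m)
open import Data.Nat.GCD using (gcd; gcd[m,n]∣m; gcd[m,n]∣n; gcd-greatest; gcd[m,n]≢0)
import Data.Nat.Properties as ℕ
open import Data.Product.Base using (∃-syntax; Σ-syntax; _×_; _,_; proj₁; proj₂)
open import Data.Rational.Base as ℚ using (ℚ; 0ℚ; 1ℚ; _≤_; _<_)
open import Data.Rational.Literals using (fromℤ)
import Data.Rational.Properties as ℚ
import Data.Rational.Unnormalised.Base as ℚᵘ
import Data.Rational.Unnormalised.Properties as ℚᵘ
open import Data.Sum.Base using (_⊎_; inj₁; inj₂)
open import Data.Vec.Functional using (map)
open import Data.Vec.Functional.Properties using (insertAt-lookup; insertAt-punchIn)
open import Function.Base using (_∘_; id)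
open import Function.Bundles using (_⇔_; mk⇔)
open import Relation.Binary.Definitions using (tri<; tri≈; tri>)
open import Relation.Binary.PropositionalEquality
  using (_≡_; _≢_; refl; sym; trans; cong; cong₂; subst; subst₂; module ≡-Reasoning)
open import Relation.Nullary using (¬_; yes; no; Dec; contradiction)
open import Relation.Nullary.Decidable using (dec⇒maybe; ¬?; toWitness)
open import Tactic.RingSolver.Core.AlmostCommutativeRing using (AlmostCommutativeRing; fromCommutativeRing)
open import Tactic.RingSolver using (solve-∀)
open import Algebra.Properties.Semiring.Sum ℤ.+-*-semiring using () renaming (sum to sumℤ)

-- The product a₀ ⋯ a_{d-1} leaves out the last denominator, while the sum of the reciprocals
-- contains it. Since 1 / a_d ≤ 1 / a_{d-1}, the last two fractions are merged into a single term z
-- = 2 / a_{d-1}, and 1 / a₀, ..., 1 / a_{d-2}, z are compared with the d numbers 1 / s₁, ..., 1 /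
-- s_{d-1}, 1 / t, whose sum is 1 / g. The obstacle is that z may exceed its predecessors: it has to
-- be sorted into the sequence, and prefixes that contain it need an inequality of their own. That
-- inequality rests on 2 / (a₀ ⋯ a_{d-3}) ≤ g, which fails for (d , g) = (2 , 1) alone; there (3 , 3
-- , 3) beats the Sylvester solution (2 , 4 , 4). Equality with z in an earlier position produces
-- two sporadic solutions, (2 , 6 , 6 , 6) for g = 1 and (6 , 6 , 6) for g = 2. The first belongs to
-- P₁; the second cannot come from a Fano simplex, because one of the vertices would be divisible by
-- 2.

infixl 7 _*_
infixl 6 _+_ _-_
infix 8 -_

-- Opaque copies of the arithmetic of ℚ: the originals match on their arguments, so
-- Agda cannot infer x and y from x * y.
opaque
  _+_ _*_ : ℚ → ℚ → ℚ
  _+_ = ℚ._+_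
  _*_ = ℚ._*_
  -_ ∣_∣ : ℚ → ℚ
  -_ = ℚ.-_
  ∣_∣ = ℚ.∣_∣

_-_ : ℚ → ℚ → ℚ
p - q = p + - q

opaque
  unfolding _+_

  +-*-isCommutativeRing : IsCommutativeRing _≡_ _+_ _*_ -_ 0ℚ 1ℚ
  +-*-isCommutativeRing = ℚ.+-*-isCommutativeRing

+-*-commutativeRing : CommutativeRing 0ℓ 0ℓ
+-*-commutativeRing = record { isCommutativeRing = +-*-isCommutativeRing }

opaque
  unfolding _+_

  ring : AlmostCommutativeRing 0ℓ 0ℓ
  ring = fromCommutativeRing +-*-commutativeRing λ x → dec⇒maybe (0ℚ ℚ.≟ x)

open CommutativeRing +-*-commutativeRing using
  ( +-comm; +-assoc; +-identityˡ; +-identityʳ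
  ; *-comm; *-assoc; *-identityˡ; *-identityʳ; distribˡ; +-commutativeMonoid; *-commutativeMonoid)
  renaming (-‿inverseˡ to +-inverseˡ; -‿inverseʳ to +-inverseʳ; zeroˡ to *-zeroˡ; zeroʳ to *-zeroʳ)

open import Algebra.Properties.CommutativeMonoid.Sum +-commutativeMonoid
  using (sum; sum-cong-≗; sum-replicate-zero; sum-remove; ∑-distrib-+; ∑-comm; sum-permute; sum-init-last)
open import Algebra.Properties.CommutativeMonoid.Sum *-commutativeMonoid
  using () renaming
  ( sum to product; sum-cong-≗ to product-cong-≗; sum-remove to product-remove
  ; sum-init-last to product-init-last)
open import Algebra.Properties.Semiring.Sum (CommutativeRing.semiring +-*-commutativeRing)
  using (*-distribˡ-sum; *-distribʳ-sum)

opaque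
  unfolding _+_

  +-mono-≤ : ∀ {p q r s} → p ≤ q → r ≤ s → p + r ≤ q + s
  +-mono-≤ = ℚ.+-mono-≤

  +-mono-<-≤ : ∀ {p q r s} → p < q → r ≤ s → p + r < q + s
  +-mono-<-≤ = ℚ.+-mono-<-≤

  *-monoˡ : ∀ {p q r} → 0ℚ ≤ r → p ≤ q → r * p ≤ r * q
  *-monoˡ {r = r} h = ℚ.*-monoˡ-≤-nonNeg r {{ℚ.nonNegative h}}

  *-monoʳ : ∀ {p q r} → 0ℚ ≤ r → p ≤ q → p * r ≤ q * r
  *-monoʳ {r = r} h = ℚ.*-monoʳ-≤-nonNeg r {{ℚ.nonNegative h}}

  *-monoˡ-< : ∀ {p q r} → 0ℚ < r → p < q → r * p < r * q
  *-monoˡ-< {r = r} h = ℚ.*-monoʳ-<-pos r {{ℚ.positive h}}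

  *-monoʳ-< : ∀ {p q r} → 0ℚ < r → p < q → p * r < q * r
  *-monoʳ-< {r = r} h = ℚ.*-monoˡ-<-pos r {{ℚ.positive h}}

  *-cancel-≤ : ∀ {p q r} → 0ℚ < r → r * p ≤ r * q → p ≤ q
  *-cancel-≤ {r = r} h = ℚ.*-cancelˡ-≤-pos r {{ℚ.positive h}}

  *-cancel-< : ∀ {p q r} → 0ℚ ≤ r → r * p < r * q → p < q
  *-cancel-< {r = r} h = ℚ.*-cancelˡ-<-nonNeg r {{ℚ.nonNegative h}}

  0≤* : ∀ {p q} → 0ℚ ≤ p → 0ℚ ≤ q → 0ℚ ≤ p * q
  0≤* {p} {q} h k = ℚ.nonNegative⁻¹ (p ℚ.* q)
    {{ℚ.nonNeg*nonNeg⇒nonNeg p {{ℚ.nonNegative h}} q {{ℚ.nonNegative k}}}}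

  0<* : ∀ {p q} → 0ℚ < p → 0ℚ < q → 0ℚ < p * q
  0<* {p} {q} h k = ℚ.positive⁻¹ (p ℚ.* q)
    {{ℚ.pos*pos⇒pos p {{ℚ.positive h}} q {{ℚ.positive k}}}}

  0≤+ : ∀ {p q} → 0ℚ ≤ p → 0ℚ ≤ q → 0ℚ ≤ p + q
  0≤+ = ℚ.+-mono-≤

  0<+ : ∀ {p q} → 0ℚ < p → 0ℚ ≤ q → 0ℚ < p + q
  0<+ = ℚ.+-mono-<-≤

  ∣∣-triangle : ∀ p q → ∣ p + q ∣ ≤ ∣ p ∣ + ∣ q ∣
  ∣∣-triangle = ℚ.∣p+q∣≤∣p∣+∣q∣

  ∣∣-* : ∀ p q → ∣ p * q ∣ ≡ ∣ p ∣ * ∣ q ∣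
  ∣∣-* = ℚ.∣p*q∣≡∣p∣*∣q∣

  ∣∣-neg : ∀ p → ∣ - p ∣ ≡ ∣ p ∣
  ∣∣-neg = ℚ.∣-p∣≡∣p∣

  ∣∣-pos : ∀ {p} → 0ℚ ≤ p → ∣ p ∣ ≡ p
  ∣∣-pos = ℚ.0≤p⇒∣p∣≡p

  0≤∣∣ : ∀ p → 0ℚ ≤ ∣ p ∣
  0≤∣∣ = ℚ.0≤∣p∣

  ∣∣≡0 : ∀ {p} → ∣ p ∣ ≡ 0ℚ → p ≡ 0ℚ
  ∣∣≡0 {p} = ℚ.∣p∣≡0⇒p≡0 p

  ∣∣-cases : ∀ p → ∣ p ∣ ≡ p ⊎ ∣ p ∣ ≡ - p
  ∣∣-cases = ℚ.∣p∣≡p∨∣p∣≡-p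

+-monoˡ-≤ : ∀ r {p q} → p ≤ q → p + r ≤ q + r
+-monoˡ-≤ r h = +-mono-≤ h ℚ.≤-refl

+-monoʳ-≤ : ∀ r {p q} → p ≤ q → r + p ≤ r + q
+-monoʳ-≤ r h = +-mono-≤ (ℚ.≤-refl {r}) h

+-monoˡ-< : ∀ r {p q} → p < q → p + r < q + r
+-monoˡ-< r h = +-mono-<-≤ h ℚ.≤-refl

+-monoʳ-< : ∀ r {p q} → p < q → r + p < r + q
+-monoʳ-< r {p} {q} h = subst₂ _<_ (+-comm p r) (+-comm q r) (+-monoˡ-< r h)

2ℚ : ℚ
2ℚ = 1ℚ + 1ℚ

-- Ordered field

diff-≤ : ∀ {p q} → p ≤ q → 0ℚ ≤ q - p
diff-≤ {p} {q} h = subst (_≤ q - p) (+-inverseʳ p) (+-monoˡ-≤ (- p) h)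

diff-< : ∀ {p q} → p < q → 0ℚ < q - p
diff-< {p} {q} h = subst (_< q - p) (+-inverseʳ p) (+-monoˡ-< (- p) h)

≤-by : ∀ {p q} c → 0ℚ ≤ c → q ≡ p + c → p ≤ q
≤-by {p} {q} c h e = subst₂ _≤_ (+-identityʳ p) (sym e) (+-monoʳ-≤ p h)

<-by : ∀ {p q} c → 0ℚ < c → q ≡ p + c → p < q
<-by {p} {q} c h e = subst₂ _<_ (+-identityʳ p) (sym e) (+-monoʳ-< p h)

undiff-≤ : ∀ {p q} → 0ℚ ≤ q - p → p ≤ q
undiff-≤ {p} {q} h = ≤-by (q - p) h (lem p q)
  where
  opaque
    unfolding ring
    lem : ∀ p q → q ≡ p + (q - p)
    lem = solve-∀ ring

undiff-< : ∀ {p q} → 0ℚ < q - p → p < q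
undiff-< {p} {q} h = <-by (q - p) h (lem p q)
  where
  opaque
    unfolding ring
    lem : ∀ p q → q ≡ p + (q - p)
    lem = solve-∀ ring

0<1 : 0ℚ < 1ℚ
0<1 = ℚ.positive⁻¹ 1ℚ

0≤1 : 0ℚ ≤ 1ℚ
0≤1 = ℚ.<⇒≤ 0<1

0<2 : 0ℚ < 2ℚ
0<2 = 0<+ 0<1 0≤1

>⇒≢0 : ∀ {p} → 0ℚ < p → p ≢ 0ℚ
>⇒≢0 h e = ℚ.<⇒≢ h (sym e)

*-mono : ∀ {p q r s} → 0ℚ ≤ r → 0ℚ ≤ q → p ≤ q → r ≤ s → p * r ≤ q * s
*-mono h k a b = ℚ.≤-trans (*-monoʳ h a) (*-monoˡ k b)

infix 9 _⁻¹

opaque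
  unfolding _*_

  -- The convention 0 ⁻¹ = 0 makes the inverse total; the definition is opaque, and everything about
  -- it goes back to `⁻¹-inverse`.
  _⁻¹ : ℚ → ℚ
  p ⁻¹ with p ℚ.≟ 0ℚ
  ... | yes _ = 0ℚ
  ... | no ne = ℚ.1/_ p {{ℚ.≢-nonZero ne}}

  ⁻¹-inverse : ∀ {p} → p ≢ 0ℚ → p * p ⁻¹ ≡ 1ℚ
  ⁻¹-inverse {p} ne with p ℚ.≟ 0ℚ
  ... | yes e = contradiction e ne
  ... | no ne′ = ℚ.*-inverseʳ p {{ℚ.≢-nonZero ne′}}

0<⁻¹ : ∀ {p} → 0ℚ < p → 0ℚ < p ⁻¹
0<⁻¹ {p} h = *-cancel-< (ℚ.<⇒≤ h)
  (subst₂ _<_ (sym (*-zeroʳ p)) (sym (⁻¹-inverse (>⇒≢0 h))) 0<1)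

*-cancel-≡ : ∀ {r p q} → r ≢ 0ℚ → r * p ≡ r * q → p ≡ q
*-cancel-≡ {r} {p} {q} ne e = begin
  p                ≡⟨ lem p ⟨
  r ⁻¹ * (r * p)   ≡⟨ cong (r ⁻¹ *_) e ⟩
  r ⁻¹ * (r * q)   ≡⟨ lem q ⟩
  q                ∎
  where
  open ≡-Reasoning
  lem : ∀ x → r ⁻¹ * (r * x) ≡ x
  lem x = trans (sym (*-assoc (r ⁻¹) r x))
    (trans (cong (_* x) (trans (*-comm (r ⁻¹) r) (⁻¹-inverse ne))) (*-identityˡ x))

*-≢0 : ∀ {p q} → p ≢ 0ℚ → q ≢ 0ℚ → p * q ≢ 0ℚ
*-≢0 {p} {q} hp hq e = hq (*-cancel-≡ hp (trans e (sym (*-zeroʳ p))))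

neg-0 : - 0ℚ ≡ 0ℚ
neg-0 = lem
  where
  opaque
    unfolding ring
    lem : - 0ℚ ≡ 0ℚ
    lem = refl

x+x≡0⇒x≡0 : ∀ {x} → x + x ≡ 0ℚ → x ≡ 0ℚ
x+x≡0⇒x≡0 {x} e = *-cancel-≡ (>⇒≢0 0<2) (trans (lem x) (trans e (sym (*-zeroʳ 2ℚ))))
  where
  opaque
    unfolding ring
    lem : ∀ x → (1ℚ + 1ℚ) * x ≡ x + x
    lem = solve-∀ ring

-- Integers inside ℚ

opaque
  unfolding _+_

  fromℤ-+ : ∀ a b → fromℤ (a ℤ.+ b) ≡ fromℤ a + fromℤ b
  fromℤ-+ a b = ℚ.toℚᵘ-injective (ℚᵘ.≃-trans
    (ℚᵘ.*≡* (cong (ℤ._* ℤ.+ 1) (sym (cong₂ ℤ._+_ (ℤ.*-identityʳ a) (ℤ.*-identityʳ b)))))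
    (ℚᵘ.≃-sym (ℚ.toℚᵘ-homo-+ (fromℤ a) (fromℤ b))))

  fromℤ-* : ∀ a b → fromℤ (a ℤ.* b) ≡ fromℤ a * fromℤ b
  fromℤ-* a b = ℚ.toℚᵘ-injective (ℚᵘ.≃-trans (ℚᵘ.*≡* refl) (ℚᵘ.≃-sym (ℚ.toℚᵘ-homo-* (fromℤ a) (fromℤ b))))

  fromℤ-neg : ∀ a → fromℤ (ℤ.- a) ≡ - fromℤ a
  fromℤ-neg (ℤ.+ zero) = refl
  fromℤ-neg (ℤ.+ suc n) = refl
  fromℤ-neg -[1+ n ] = refl

  fromℤ-∣∣ : ∀ a → fromℤ (ℤ.+ ℤ.∣ a ∣) ≡ ∣ fromℤ a ∣
  fromℤ-∣∣ a = refl

fromℤ-injective : ∀ {a b} → fromℤ a ≡ fromℤ b → a ≡ b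
fromℤ-injective e = cong ℚ.↥_ e

fromℤ-≤ : ∀ {a b} → a ℤ.≤ b → fromℤ a ≤ fromℤ b
fromℤ-≤ {a} {b} h = ℚ.*≤* (subst₂ ℤ._≤_ (sym (ℤ.*-identityʳ a)) (sym (ℤ.*-identityʳ b)) h)

fromℤ-<⁻¹ : ∀ {a b} → fromℤ a < fromℤ b → a ℤ.< b
fromℤ-<⁻¹ {a} {b} h = subst₂ ℤ._<_ (ℤ.*-identityʳ a) (ℤ.*-identityʳ b) (ℚ.drop-*<* h)

fromNat : ℕ → ℚ
fromNat n = fromℤ (ℤ.+ n)

-- Integrality is a predicate on rationals, so that inverses, determinants and arithmetic of
-- integers live in one ring.
IsInt : ℚ → Set
IsInt q = ∃[ z ] q ≡ fromℤ z

int-+ : ∀ {p q} → IsInt p → IsInt q → IsInt (p + q)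
int-+ (a , refl) (b , refl) = a ℤ.+ b , sym (fromℤ-+ a b)

int-* : ∀ {p q} → IsInt p → IsInt q → IsInt (p * q)
int-* (a , refl) (b , refl) = a ℤ.* b , sym (fromℤ-* a b)

int-neg : ∀ {p} → IsInt p → IsInt (- p)
int-neg (a , refl) = ℤ.- a , sym (fromℤ-neg a)

int-0 : IsInt 0ℚ
int-0 = ℤ.+ 0 , refl

int-1 : IsInt 1ℚ
int-1 = ℤ.+ 1 , refl

int-sum : ∀ {n} {f : Fin n → ℚ} → (∀ i → IsInt (f i)) → IsInt (sum f)
int-sum {zero} h = int-0
int-sum {suc n} h = int-+ (h zero) (int-sum (h ∘ suc))

int-pos : ∀ {q} → IsInt q → 0ℚ < q → 1ℚ ≤ q
int-pos (z , refl) h = fromℤ-≤ (ℤ.i<j⇒suc[i]≤j (fromℤ-<⁻¹ h))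

-- Sums

sum-cong : ∀ {n} {f g : Fin n → ℚ} → (∀ i → f i ≡ g i) → sum f ≡ sum g
sum-cong = sum-cong-≗

product-cong : ∀ {n} {f g : Fin n → ℚ} → (∀ i → f i ≡ g i) → product f ≡ product g
product-cong = product-cong-≗

sum-0 : ∀ {n} {f : Fin n → ℚ} → (∀ i → f i ≡ 0ℚ) → sum f ≡ 0ℚ
sum-0 {n} h = trans (sum-cong h) (sum-replicate-zero n)

sum-linear : ∀ {n} c {f g h : Fin n → ℚ} → (∀ i → f i ≡ c * g i + h i) → sum f ≡ c * sum g + sum h
sum-linear c {f} {g} {h} e = trans (sum-cong e)
  (trans (∑-distrib-+ (λ i → c * g i) h) (cong (_+ sum h) (sym (*-distribˡ-sum c g))))

sum-*ˡ : ∀ {n} c (f : Fin n → ℚ) → sum (λ i → c * f i) ≡ c * sum f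
sum-*ˡ c f = sym (*-distribˡ-sum c f)

sum-*ʳ : ∀ {n} c (f : Fin n → ℚ) → sum (λ i → f i * c) ≡ sum f * c
sum-*ʳ c f = sym (*-distribʳ-sum c f)

sum-≤ : ∀ {n} {f g : Fin n → ℚ} → (∀ i → f i ≤ g i) → sum f ≤ sum g
sum-≤ {zero} h = ℚ.≤-refl
sum-≤ {suc n} h = +-mono-≤ (h zero) (sum-≤ (h ∘ suc))

sum-≥0 : ∀ {n} {f : Fin n → ℚ} → (∀ i → 0ℚ ≤ f i) → 0ℚ ≤ sum f
sum-≥0 {zero} h = ℚ.≤-refl
sum-≥0 {suc n} h = 0≤+ (h zero) (sum-≥0 (h ∘ suc))

-- Kronecker's delta, by recursion on both indices rather than by deciding equality, so that it
-- computes on the lower right block of a block matrix.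
δ : ∀ {n} → Fin n → Fin n → ℚ
δ zero zero = 1ℚ
δ zero (suc j) = 0ℚ
δ (suc i) zero = 0ℚ
δ (suc i) (suc j) = δ i j

δ-refl : ∀ {n} (i : Fin n) → δ i i ≡ 1ℚ
δ-refl zero = refl
δ-refl (suc i) = δ-refl i

δ-≢ : ∀ {n} {i j : Fin n} → i ≢ j → δ i j ≡ 0ℚ
δ-≢ {i = zero} {zero} ne = contradiction refl ne
δ-≢ {i = zero} {suc j} ne = refl
δ-≢ {i = suc i} {zero} ne = refl
δ-≢ {i = suc i} {suc j} ne = δ-≢ (ne ∘ cong suc)

sum-δˡ : ∀ {n} (i : Fin n) (f : Fin n → ℚ) → sum (λ j → δ i j * f j) ≡ f i
sum-δˡ zero f = trans (cong₂ _+_ (*-identityˡ (f zero)) (sum-0 (λ j → *-zeroˡ (f (suc j))))) (+-identityʳ _)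
sum-δˡ (suc i) f = trans (cong₂ _+_ (*-zeroˡ (f zero)) (sum-δˡ i (f ∘ suc))) (+-identityˡ _)

δ-sym : ∀ {n} (i j : Fin n) → δ i j ≡ δ j i
δ-sym zero zero = refl
δ-sym zero (suc j) = refl
δ-sym (suc i) zero = refl
δ-sym (suc i) (suc j) = δ-sym i j

sum-δʳ : ∀ {n} (i : Fin n) (f : Fin n → ℚ) → sum (λ j → f j * δ j i) ≡ f i
sum-δʳ i f = trans (sum-cong (λ j → trans (*-comm (f j) (δ j i)) (cong (_* f j) (δ-sym j i)))) (sum-δˡ i f)

sum-single : ∀ {n} (i : Fin n) {f : Fin n → ℚ} → (∀ j → j ≢ i → f j ≡ 0ℚ) → sum f ≡ f i
sum-single {suc n} i {f} h = trans (sum-remove {i = i} f)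
  (trans (cong (λ x → f i + x) (sum-0 (λ k → h (punchIn i k) (Fin.punchInᵢ≢i i k)))) (+-identityʳ (f i)))

-- Determinants

M : ℕ → Set
M n = Fin n → Fin n → ℚ

infix 4 _≈_

_≈_ : ∀ {m n} → (A B : Fin m → Fin n → ℚ) → Set
A ≈ B = ∀ i j → A i j ≡ B i j

sgn : ∀ {n} → Fin n → ℚ
sgn zero = 1ℚ
sgn (suc i) = - sgn i

minor : ∀ {n} → M (suc n) → Fin (suc n) → M n
minor A j r c = A (suc r) (punchIn j c)

det : ∀ {n} → M n → ℚ
det {zero} A = 1ℚ
det {suc n} A = sum λ j → sgn j * A zero j * det (minor A j)

det-cong : ∀ {n} {A B : M n} → A ≈ B → det A ≡ det B
det-cong {zero} e = refl
det-cong {suc n} e = sum-cong λ j →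
  cong₂ _*_ (cong (sgn j *_) (e zero j)) (det-cong (λ r c → e (suc r) (punchIn j c)))

-- Additivity and homogeneity are combined in one statement, of which zero rows, scalings and shears
-- are instances.
det-linear : ∀ {n} (i : Fin n) c {A B C : M n} →
  (∀ r → r ≢ i → ∀ k → A r k ≡ B r k) → (∀ r → r ≢ i → ∀ k → A r k ≡ C r k) →
  (∀ k → A i k ≡ c * B i k + C i k) → det A ≡ c * det B + det C
det-linear {suc n} zero c {A} {B} {C} hB hC e = sum-linear c λ j →
  trans (cong₂ (λ x y → sgn j * x * y) (e j) (det-cong (λ r k → hB (suc r) (λ ()) (punchIn j k))))
  (trans (lem (sgn j) c (B zero j) (C zero j) (det (minor B j)))
    (cong (λ y → c * (sgn j * B zero j * det (minor B j)) + sgn j * C zero j * y)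
      (det-cong λ r k → trans (sym (hB (suc r) (λ ()) (punchIn j k))) (hC (suc r) (λ ()) (punchIn j k)))))
  where
  opaque
    unfolding ring
    lem : ∀ s c b d m → s * (c * b + d) * m ≡ c * (s * b * m) + s * d * m
    lem = solve-∀ ring
det-linear {suc n} (suc i) c {A} {B} {C} hB hC e = sum-linear c λ j →
  trans (cong (sgn j * A zero j *_) (det-linear i c
    (λ r ne k → hB (suc r) (ne ∘ Fin.suc-injective) (punchIn j k))
    (λ r ne k → hC (suc r) (ne ∘ Fin.suc-injective) (punchIn j k))
    (λ k → e (punchIn j k))))
  (trans (lem (sgn j) (A zero j) c (det (minor B j)) (det (minor C j)))
    (cong₂ (λ x y → c * (sgn j * x * det (minor B j)) + sgn j * y * det (minor C j))
      (hB zero (λ ()) j) (hC zero (λ ()) j)))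
  where
  opaque
    unfolding ring
    lem : ∀ s a c x y → s * a * (c * x + y) ≡ c * (s * a * x) + s * a * y
    lem = solve-∀ ring

-- Two columns may be deleted in either order; this identifies the double minors that occur in the
-- expansion along two rows.
punchIn-punchOut-comm : ∀ {n} {a b : Fin (suc (suc n))} (ne : a ≢ b) (ne′ : b ≢ a) c →
  punchIn a (punchIn (punchOut ne) c) ≡ punchIn b (punchIn (punchOut ne′) c)
punchIn-punchOut-comm {a = zero} {zero} ne _ c = contradiction refl ne
punchIn-punchOut-comm {a = zero} {suc b} ne _ c = refl
punchIn-punchOut-comm {a = suc a} {zero} ne _ c = refl
punchIn-punchOut-comm {suc n} {suc a} {suc b} ne ne′ zero = refl
punchIn-punchOut-comm {suc n} {suc a} {suc b} ne ne′ (suc c) =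
  cong suc (punchIn-punchOut-comm (ne ∘ cong suc) (ne′ ∘ cong suc) c)

sgn-punchOut : ∀ {n} {a b : Fin (suc n)} (ne : a ≢ b) (ne′ : b ≢ a) →
  sgn a * sgn (punchOut ne) + sgn b * sgn (punchOut ne′) ≡ 0ℚ
sgn-punchOut {a = zero} {zero} ne _ = contradiction refl ne
sgn-punchOut {suc n} {zero} {suc b} ne _ = lem (sgn b)
  where
  opaque
    unfolding ring
    lem : ∀ s → 1ℚ * s + (- s) * 1ℚ ≡ 0ℚ
    lem = solve-∀ ring
sgn-punchOut {suc n} {suc a} {zero} ne _ = lem (sgn a)
  where
  opaque
    unfolding ring
    lem : ∀ s → (- s) * 1ℚ + 1ℚ * s ≡ 0ℚ
    lem = solve-∀ ring
sgn-punchOut {suc n} {suc a} {suc b} ne ne′ =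
  trans (lem (sgn a) _ (sgn b) _) (sgn-punchOut (ne ∘ cong suc) (ne′ ∘ cong suc))
  where
  opaque
    unfolding ring
    lem : ∀ s t u v → (- s) * (- t) + (- u) * (- v) ≡ s * t + u * v
    lem = solve-∀ ring

-- Extended by a zero diagonal, `F` becomes an antisymmetric square array `G`. Exchanging the order
-- of summation shows that its sum S satisfies S + S = 0.
sum-pairs-antisym : ∀ {n} (F : Fin (suc n) → Fin n → ℚ) →
  (∀ {a b} (ne : a ≢ b) (ne′ : b ≢ a) → F a (punchOut ne) + F b (punchOut ne′) ≡ 0ℚ) →
  sum (λ a → sum (F a)) ≡ 0ℚ
sum-pairs-antisym {n} F h = trans (sum-cong λ a → sym (G-sum a)) (x+x≡0⇒x≡0 (begin
  sum (λ a → sum (G a)) + sum (λ a → sum (G a))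
    ≡⟨ cong (_+_ (sum (λ a → sum (G a)))) (∑-comm G) ⟩
  sum (λ a → sum (G a)) + sum (λ a → sum (λ b → G b a))
    ≡⟨ ∑-distrib-+ (λ a → sum (G a)) (λ a → sum (λ b → G b a)) ⟨
  sum (λ a → sum (G a) + sum (λ b → G b a))
    ≡⟨ sum-0 (λ a → trans (sym (∑-distrib-+ (G a) (λ b → G b a))) (sum-0 (G-anti a))) ⟩
  0ℚ ∎))
  where
  open ≡-Reasoning
  G : Fin (suc n) → Fin (suc n) → ℚ
  G a b with a Fin.≟ b
  ... | yes _ = 0ℚ
  ... | no ne = F a (punchOut ne)
  G-diag : ∀ a → G a a ≡ 0ℚ
  G-diag a with a Fin.≟ a
  ... | yes _ = refl
  ... | no ne = contradiction refl ne
  G-off : ∀ a k → G a (punchIn a k) ≡ F a k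
  G-off a k with a Fin.≟ punchIn a k
  ... | yes e = contradiction (sym e) (Fin.punchInᵢ≢i a k)
  ... | no ne = cong (F a) (trans (Fin.punchOut-cong a refl) (Fin.punchOut-punchIn a))
  G-sum : ∀ a → sum (G a) ≡ sum (F a)
  G-sum a = trans (sum-remove {i = a} (G a))
    (trans (cong₂ _+_ (G-diag a) (sum-cong (G-off a))) (+-identityˡ _))
  G-anti : ∀ a b → G a b + G b a ≡ 0ℚ
  G-anti a b with a Fin.≟ b | b Fin.≟ a
  ... | yes _ | yes _ = +-identityˡ 0ℚ
  ... | yes e | no ne = contradiction (sym e) ne
  ... | no ne | yes e = contradiction (sym e) ne
  ... | no ne | no ne′ = h ne ne′

Alternating : ∀ {n} → Fin n → Fin n → Set
Alternating {n} i j = ∀ (A : M n) → (∀ k → A i k ≡ A j k) → det A ≡ 0ℚ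

-- In the expansion along the first two rows, the terms for the columns (a , b) and (b , a) have the
-- same double minor and opposite signs.
alternating-01 : ∀ {n} → Alternating {suc (suc n)} zero (suc zero)
alternating-01 {n} A e = trans
  (sum-cong λ a → sym (sum-*ˡ (sgn a * A zero a) (λ k → sgn k * A (suc zero) (punchIn a k) * det
      (minor (minor A a) k))))
  (sum-pairs-antisym F anti)
  where
  F : Fin (suc (suc n)) → Fin (suc n) → ℚ
  F a k = sgn a * A zero a * (sgn k * A (suc zero) (punchIn a k) * det (minor (minor A a) k))
  opaque
    unfolding ring
    lem : ∀ s t u v x y m → s * x * (t * y * m) + u * y * (v * x * m) ≡ (s * t + u * v) * (x * y * m)
    lem = solve-∀ ring
  anti : ∀ {a b} (ne : a ≢ b) (ne′ : b ≢ a) → F a (punchOut ne) + F b (punchOut ne′) ≡ 0ℚ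
  anti {a} {b} ne ne′ = trans
    (cong₂ _+_
      (cong (λ y → sgn a * A zero a * (sgn (punchOut ne) * y * det (minor (minor A a) (punchOut ne))))
        (trans (cong (A (suc zero)) (Fin.punchIn-punchOut ne)) (sym (e b))))
      (cong₂ (λ y m → sgn b * A zero b * (sgn (punchOut ne′) * y * m))
        (trans (cong (A (suc zero)) (Fin.punchIn-punchOut ne′)) (sym (e a)))
        (det-cong λ r c → cong (A (suc (suc r))) (punchIn-punchOut-comm ne′ ne c))))
    (trans (lem (sgn a) (sgn (punchOut ne)) (sgn b) (sgn (punchOut ne′)) (A zero a) (A zero b) _)
      (trans (cong (_* (A zero a * A zero b * det (minor (minor A a) (punchOut ne)))) (sgn-punchOut ne ne′))
          (*-zeroˡ _)))

module SetRows {n} (i j : Fin n) (i≢j : i ≢ j) (A : M n) where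

  R : (x y : Fin n → ℚ) → M n
  R x y r with r Fin.≟ i | r Fin.≟ j
  ... | yes _ | _ = x
  ... | no _ | yes _ = y
  ... | no _ | no _ = A r

  R-i : ∀ x y k → R x y i k ≡ x k
  R-i x y k with i Fin.≟ i
  ... | yes _ = refl
  ... | no ne = contradiction refl ne

  R-j : ∀ x y k → R x y j k ≡ y k
  R-j x y k with j Fin.≟ i | j Fin.≟ j
  ... | yes e | _ = contradiction (sym e) i≢j
  ... | no _ | yes _ = refl
  ... | no _ | no ne = contradiction refl ne

  R-rest : ∀ x y r → r ≢ i → r ≢ j → ∀ k → R x y r k ≡ A r k
  R-rest x y r h h′ k with r Fin.≟ i | r Fin.≟ j
  ... | yes e | _ = contradiction e h
  ... | no _ | yes e = contradiction e h′
  ... | no _ | no _ = refl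

  R-congⁱ : ∀ x x′ y r → r ≢ i → ∀ k → R x y r k ≡ R x′ y r k
  R-congⁱ x x′ y r h k with r Fin.≟ i | r Fin.≟ j
  ... | yes e | _ = contradiction e h
  ... | no _ | yes _ = refl
  ... | no _ | no _ = refl

  R-congʲ : ∀ x y y′ r → r ≢ j → ∀ k → R x y r k ≡ R x y′ r k
  R-congʲ x y y′ r h k with r Fin.≟ i | r Fin.≟ j
  ... | yes e | _ = refl
  ... | no _ | yes e = contradiction e h
  ... | no _ | no _ = refl

-- Polarization: with `w = u + v` in both rows the determinant vanishes, and expanding it leaves the
-- two mixed terms. `Alternating i j` is a hypothesis because the swap is used inside the induction
-- that proves alternation.
det-swap : ∀ {n} (i j : Fin n) → i ≢ j → Alternating i j → ∀ (A B : M n) →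
  (∀ k → B i k ≡ A j k) → (∀ k → B j k ≡ A i k) →
  (∀ r → r ≢ i → r ≢ j → ∀ k → B r k ≡ A r k) → det B ≡ - det A
det-swap {n} i j i≢j alt A B hi hj hr = trans (det-cong B≈) (trans (lem (det (R u v)) (det (R v u)) zero-sum)
    (cong -_ (sym (det-cong A≈))))
  where
  open SetRows i j i≢j A
  u v w : Fin n → ℚ
  u = A i
  v = A j
  w k = u k + v k
  lem : ∀ p q → p + q ≡ 0ℚ → q ≡ - p
  lem p q e = trans (lem″ p q) (trans (cong (_- p) e) (+-identityˡ _))
    where
    opaque
      unfolding ring
      lem″ : ∀ p q → q ≡ p + q - p
      lem″ = solve-∀ ring
  opaque
    unfolding ring
    eq : ∀ a b → a + b ≡ 1ℚ * a + b
    eq = solve-∀ ring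
  splitⁱ : ∀ y → det (R w y) ≡ 1ℚ * det (R u y) + det (R v y)
  splitⁱ y = det-linear i 1ℚ (R-congⁱ w u y) (R-congⁱ w v y)
    λ k → trans (R-i w y k) (trans (eq (u k) (v k)) (cong₂ (λ a b → 1ℚ * a + b) (sym (R-i u y k)) (sym (R-i v y k))))
  splitʲ : ∀ x → det (R x w) ≡ 1ℚ * det (R x u) + det (R x v)
  splitʲ x = det-linear j 1ℚ (R-congʲ x w u) (R-congʲ x w v)
    λ k → trans (R-j x w k) (trans (eq (u k) (v k)) (cong₂ (λ a b → 1ℚ * a + b) (sym (R-j x u k)) (sym (R-j x v k))))
  same : ∀ x → det (R x x) ≡ 0ℚ
  same x = alt (R x x) (λ k → trans (R-i x x k) (sym (R-j x x k)))
  opaque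
    unfolding ring
    lem′ : ∀ p q → p + q ≡ 1ℚ * (1ℚ * 0ℚ + p) + (1ℚ * q + 0ℚ)
    lem′ = solve-∀ ring
  zero-sum : det (R u v) + det (R v u) ≡ 0ℚ
  zero-sum = trans (lem′ (det (R u v)) (det (R v u)))
    (trans (cong₂ (λ a b → 1ℚ * (1ℚ * a + det (R u v)) + (1ℚ * det (R v u) + b)) (sym (same u)) (sym (same v)))
    (trans (cong₂ (λ a b → 1ℚ * a + b) (sym (splitʲ u)) (sym (splitʲ v)))
    (trans (sym (splitⁱ w)) (same w))))
  A≈ : A ≈ R u v
  A≈ r k with r Fin.≟ i | r Fin.≟ j
  ... | yes refl | _ = refl
  ... | no _ | yes refl = refl
  ... | no _ | no _ = refl
  B≈ : B ≈ R v u
  B≈ r k with r Fin.≟ i | r Fin.≟ j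
  ... | yes refl | _ = hi k
  ... | no _ | yes refl = hj k
  ... | no h | no h′ = hr r h h′ k

alternating-suc : ∀ {n} {i j : Fin n} → Alternating i j → Alternating (suc i) (suc j)
alternating-suc alt A e = sum-0 λ c →
  trans (cong (sgn c * A zero c *_) (alt (minor A c) (λ k → e (punchIn c k)))) (*-zeroʳ _)

-- A swap of two rows below the first brings the equal row to the second place, where
-- `alternating-01` applies. Such a swap needs alternation only for matrices that are smaller by
-- one.
alternating-0 : ∀ {n} (j : Fin (suc n)) → (∀ (i j : Fin (suc n)) → i ≢ j → Alternating i j) →
  Alternating {suc (suc n)} zero (suc j)
alternating-0 zero alt = alternating-01
alternating-0 {suc n} (suc j) alt A e = trans
  (lem (det A) (det B) (det-swap 1F j′ (λ ()) (alternating-suc (alt zero (suc j) (λ ()))) A B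
    (R-i (A j′) (A 1F)) (R-j (A j′) (A 1F)) (R-rest (A j′) (A 1F))))
  (trans (cong -_ (alternating-01 B λ k →
      trans (R-rest (A j′) (A 1F) zero (λ ()) (λ ()) k) (trans (e k) (sym (R-i (A j′) (A 1F) k))))) neg-0)
  where
  1F j′ : Fin (suc (suc (suc n)))
  1F = suc zero
  j′ = suc (suc j)
  open SetRows 1F j′ (λ ()) A
  B : M (suc (suc (suc n)))
  B = R (A j′) (A 1F)
  lem : ∀ a b → b ≡ - a → a ≡ - b
  lem a b h = trans (lem′ a) (cong -_ (sym h))
    where
    opaque
      unfolding ring
      lem′ : ∀ a → a ≡ - (- a)
      lem′ = solve-∀ ring

det-alternating : ∀ {n} (i j : Fin n) → i ≢ j → Alternating i j
det-alternating zero zero ne = contradiction refl ne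
det-alternating {suc (suc n)} zero (suc j) ne = alternating-0 j det-alternating
det-alternating {suc (suc n)} (suc i) zero ne A e = alternating-0 i det-alternating A (sym ∘ e)
det-alternating (suc i) (suc j) ne = alternating-suc (det-alternating i j (ne ∘ cong suc))

setRow : ∀ {m n} → (Fin m → Fin n → ℚ) → Fin m → (Fin n → ℚ) → Fin m → Fin n → ℚ
setRow A i w r with r Fin.≟ i
... | yes _ = w
... | no _ = A r

setRow-hit : ∀ {m n} (A : Fin m → Fin n → ℚ) i w k → setRow A i w i k ≡ w k
setRow-hit A i w k with i Fin.≟ i
... | yes _ = refl
... | no ne = contradiction refl ne

setRow-miss : ∀ {m n} (A : Fin m → Fin n → ℚ) i w r → r ≢ i → ∀ k → setRow A i w r k ≡ A r k
setRow-miss A i w r ne k with r Fin.≟ i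
... | yes e = contradiction e ne
... | no _ = refl

det-zeroRow : ∀ {n} (i : Fin n) {A : M n} → (∀ k → A i k ≡ 0ℚ) → det A ≡ 0ℚ
det-zeroRow i {A} h = trans (det-linear i (- 1ℚ) {A} {A} {A} (λ _ _ _ → refl) (λ _ _ _ → refl)
    (λ k → trans (h k) (trans (lem 0ℚ) (cong (λ x → - 1ℚ * x + x) (sym (h k)))))) (sym (lem (det A)))
  where
  opaque
    unfolding ring
    lem : ∀ x → 0ℚ ≡ - 1ℚ * x + x
    lem = solve-∀ ring

det-scale : ∀ {n} (i : Fin n) c {A B : M n} → (∀ k → A i k ≡ c * B i k) →
  (∀ r → r ≢ i → ∀ k → A r k ≡ B r k) → det A ≡ c * det B
det-scale i c {A} {B} h hr = trans (det-linear i c {A} {B} {C} hr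
    (λ r ne k → trans (hr r ne k) (sym (setRow-miss B i _ r ne k)))
    (λ k → trans (h k) (trans (lem (c * B i k)) (cong (_+_ (c * B i k)) (sym (setRow-hit B i _ k))))))
  (trans (cong (_+_ (c * det B)) (det-zeroRow i {C} (setRow-hit B i _))) (sym (lem _)))
  where
  C = setRow B i (λ _ → 0ℚ)
  opaque
    unfolding ring
    lem : ∀ x → x ≡ x + 0ℚ
    lem = solve-∀ ring

det-shear : ∀ {n} (i j : Fin n) c {A B : M n} → i ≢ j → (∀ k → A i k ≡ B i k + c * B j k) →
  (∀ r → r ≢ i → ∀ k → A r k ≡ B r k) → det A ≡ det B
det-shear i j c {A} {B} i≢j h hr = trans (det-linear i c {A} {C} {B}
    (λ r ne k → trans (hr r ne k) (sym (setRow-miss B i _ r ne k))) hr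
    (λ k → trans (h k) (trans (+-comm (B i k) _) (cong (λ x → c * x + B i k) (sym (setRow-hit B i _ k))))))
  (trans (cong (λ x → c * x + det B) (det-alternating i j i≢j C
     (λ k → trans (setRow-hit B i _ k) (sym (setRow-miss B i _ j (i≢j ∘ sym) k))))) (lem c (det B)))
  where
  C = setRow B i (B j)
  opaque
    unfolding ring
    lem : ∀ c x → c * 0ℚ + x ≡ x
    lem = solve-∀ ring

det-zeroColumn : ∀ {n} {A : M (suc n)} → (∀ i → A i zero ≡ 0ℚ) → det A ≡ 0ℚ
det-zeroColumn {n} {A} h = sum-0 term
  where
  opaque
    unfolding ring
    lem : ∀ s m → s * 0ℚ * m ≡ 0ℚ
    lem = solve-∀ ring
  term : ∀ j → sgn j * A zero j * det (minor A j) ≡ 0ℚ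
  term zero = trans (cong (λ x → sgn {suc n} zero * x * det (minor A zero)) (h zero)) (lem (sgn {suc n} zero) _)
  term (suc {suc _} j) =
      trans (cong (sgn (suc j) * A zero (suc j) *_) (det-zeroColumn {A = minor A (suc j)} (λ i → h (suc i))))
      (*-zeroʳ _)

det-firstRow : ∀ {n} {A : M (suc n)} → (∀ j → A zero (suc j) ≡ 0ℚ) → det A ≡ A zero zero * det (minor A zero)
det-firstRow {n} {A} h = trans (cong₂ _+_ (cong (_* det (minor A zero)) (*-identityˡ (A zero zero)))
    (sum-0 λ j → trans (cong (λ x → sgn (suc j) * x * det (minor A (suc j))) (h j)) (lem (sgn (suc j)) _)))
  (+-identityʳ _)
  where
  opaque
    unfolding ring
    lem : ∀ s m → s * 0ℚ * m ≡ 0ℚ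
    lem = solve-∀ ring

det-firstColumn : ∀ {n} {A : M (suc n)} → (∀ i → A (suc i) zero ≡ 0ℚ) → det A ≡ A zero zero * det (minor A zero)
det-firstColumn {n} {A} h = trans (cong₂ _+_ (cong (_* det (minor A zero)) (*-identityˡ (A zero zero)))
    (sum-0 term)) (+-identityʳ _)
  where
  term : ∀ j → sgn (suc j) * A zero (suc j) * det (minor A (suc j)) ≡ 0ℚ
  term zero = trans (cong (sgn {suc n} (suc zero) * A zero (suc zero) *_) (det-zeroColumn {A = minor A (suc zero)}
      (λ i → h i))) (*-zeroʳ _)
  term (suc j) = trans (cong (sgn (suc (suc j)) * A zero (suc (suc j)) *_) (det-zeroColumn {A = minor A (suc (suc j))}
      (λ i → h i))) (*-zeroʳ _)

det-lower : ∀ {n} {A : M n} → (∀ {i j} → i Fin.< j → A i j ≡ 0ℚ) → det A ≡ product (λ i → A i i)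
det-lower {zero} h = refl
det-lower {suc n} {A} h = trans (det-firstRow {A = A} (λ j → h {zero} {suc j} (s≤s z≤n)))
  (cong (A zero zero *_) (det-lower (λ lt → h (s≤s lt))))

det-upper : ∀ {n} {A : M n} → (∀ {i j} → j Fin.< i → A i j ≡ 0ℚ) → det A ≡ product (λ i → A i i)
det-upper {zero} h = refl
det-upper {suc n} {A} h = trans (det-firstColumn {A = A} (λ j → h {suc j} {zero} (s≤s z≤n)))
  (cong (A zero zero *_) (det-upper (λ lt → h (s≤s lt))))

int-sgn : ∀ {n} (i : Fin n) → IsInt (sgn i)
int-sgn zero = int-1
int-sgn (suc i) = int-neg (int-sgn i)

int-det : ∀ {n} {A : M n} → (∀ i j → IsInt (A i j)) → IsInt (det A)
int-det {zero} h = int-1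
int-det {suc n} h = int-sum λ j → int-* (int-* (int-sgn j) (h zero j)) (int-det λ r c → h (suc r) (punchIn j c))

∣sum∣≤ : ∀ {n} (f : Fin n → ℚ) → ∣ sum f ∣ ≤ sum (λ i → ∣ f i ∣)
∣sum∣≤ {zero} f = ℚ.≤-reflexive (∣∣-pos ℚ.≤-refl)
∣sum∣≤ {suc n} f = ℚ.≤-trans (∣∣-triangle (f zero) (sum (f ∘ suc))) (+-monoʳ-≤ ∣ f zero ∣ (∣sum∣≤ (f ∘ suc)))

∣sgn∣ : ∀ {n} (i : Fin n) → ∣ sgn i ∣ ≡ 1ℚ
∣sgn∣ zero = ∣∣-pos 0≤1
∣sgn∣ (suc i) = trans (∣∣-neg (sgn i)) (∣sgn∣ i)

-- Row sums are bounded by 1 instead of being equal to 1, because this is what minors inherit in the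
-- Laplace expansion. The bound serves to compare simplices contained in each other, whose vertices
-- are related by matrices of barycentric coordinates.
det-substochastic : ∀ {n} {A : M n} → (∀ i j → 0ℚ ≤ A i j) → (∀ i → sum (A i) ≤ 1ℚ) → ∣ det A ∣ ≤ 1ℚ
det-substochastic {zero} h s = ℚ.≤-reflexive (∣∣-pos 0≤1)
det-substochastic {suc n} {A} h s = ℚ.≤-trans (∣sum∣≤ (λ j → sgn j * A zero j * det (minor A j)))
  (ℚ.≤-trans (sum-≤ term) (s zero))
  where
  smaller : ∀ j r → sum (minor A j r) ≤ 1ℚ
  smaller j r = ℚ.≤-trans (≤-by (A (suc r) j) (h (suc r) j)
    (trans (sum-remove {i = j} (A (suc r))) (+-comm _ _))) (s (suc r))
  term : ∀ j → ∣ sgn j * A zero j * det (minor A j) ∣ ≤ A zero j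
  term j = ℚ.≤-trans (ℚ.≤-reflexive (trans (∣∣-* (sgn j * A zero j) _)
      (cong (_* ∣ det (minor A j) ∣) (trans (∣∣-* (sgn j) _)
        (trans (cong₂ _*_ (∣sgn∣ j) (∣∣-pos (h zero j))) (*-identityˡ _))))))
    (ℚ.≤-trans (*-monoˡ (h zero j) (det-substochastic (λ r c → h (suc r) (punchIn j c)) (smaller j)))
      (ℚ.≤-reflexive (*-identityʳ _)))

-- Gaussian elimination

infixl 7 _⊡_
infixr 7 _▹_

_⊡_ : ∀ {l m n} → (Fin l → Fin m → ℚ) → (Fin m → Fin n → ℚ) → Fin l → Fin n → ℚ
(A ⊡ B) i k = sum λ j → A i j * B j k

_▹_ : ∀ {m n} → (Fin m → Fin n → ℚ) → (Fin n → ℚ) → Fin m → ℚ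
(A ▹ x) i = sum λ j → A i j * x j

-- Invertibility in the form of a list of row operations. Multiplicativity of the determinant,
-- transposition, solvability of linear equations and the change of content are all proved by
-- induction on it. Rows are never exchanged: when a pivot vanishes, `gauss` adds another row to the
-- first one instead.
data Elem {n} : M n → Set where
  base : ∀ {A} → A ≈ δ → Elem A
  shear : ∀ {A B} i j c → i ≢ j → Elem B → (∀ k → A i k ≡ B i k + c * B j k) →
    (∀ r → r ≢ i → ∀ k → A r k ≡ B r k) → Elem A
  scale : ∀ {A B} i c → c ≢ 0ℚ → Elem B → (∀ k → A i k ≡ c * B i k) →
    (∀ r → r ≢ i → ∀ k → A r k ≡ B r k) → Elem A

elem-cong : ∀ {n} {A B : M n} → A ≈ B → Elem B → Elem A
elem-cong e (base h) = base λ i j → trans (e i j) (h i j)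
elem-cong e (shear i j c ne E h hr) = shear i j c ne E (λ k → trans (e i k) (h k))
    (λ r nr k → trans (e r k) (hr r nr k))
elem-cong e (scale i c c≢0 E h hr) = scale i c c≢0 E (λ k → trans (e i k) (h k))
    (λ r nr k → trans (e r k) (hr r nr k))

det-δ : ∀ n → det {n} δ ≡ 1ℚ
det-δ n = trans (det-lower {n} {A = δ} (λ lt → δ-≢ (Fin.<⇒≢ lt))) (trans (product-cong {n} (λ i → δ-refl i)) (ones n))
  where
  ones : ∀ n → product {n} (λ _ → 1ℚ) ≡ 1ℚ
  ones zero = refl
  ones (suc n) = trans (*-identityˡ _) (ones n)

det-⊡ : ∀ {n} {A : M n} → Elem A → ∀ B → det (A ⊡ B) ≡ det A * det B
det-⊡ {n} {A} (base e) B = trans (det-cong λ i k → trans (sum-cong λ j → cong (_* B j k) (e i j))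
    (sum-δˡ i (λ j → B j k)))
  (trans (sym (*-identityˡ (det B))) (cong (_* det B) (sym (trans (det-cong e) (det-δ n)))))
det-⊡ {A = A} (shear {B = C} i j c ne E h hr) B = trans
  (det-shear i j c {A ⊡ B} {C ⊡ B} ne (λ k → trans (sum-cong λ l → cong (_* B l k) (h l))
      (trans (sum-linear c λ l → lem (C i l) c (C j l) (B l k)) (+-comm _ _)))
    (λ r nr k → sum-cong λ l → cong (_* B l k) (hr r nr l)))
  (trans (det-⊡ E B) (cong (_* det B) (sym (det-shear i j c ne h hr))))
  where
  opaque
    unfolding ring
    lem : ∀ x c y b → (x + c * y) * b ≡ c * (y * b) + x * b
    lem = solve-∀ ring
det-⊡ {A = A} (scale {B = C} i c _ E h hr) B = trans
  (det-scale i c {A ⊡ B} {C ⊡ B}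
      (λ k → trans (sum-cong λ l → trans (cong (_* B l k) (h l)) (*-assoc c (C i l) (B l k)))
      (sum-*ˡ c (λ l → C i l * B l k)))
    (λ r nr k → sum-cong λ l → cong (_* B l k) (hr r nr l)))
  (trans (cong (c *_) (det-⊡ E B)) (trans (sym (*-assoc c (det C) (det B)))
      (cong (_* det B) (sym (det-scale i c h hr)))))

det≢0 : ∀ {n} {A : M n} → Elem A → det A ≢ 0ℚ
det≢0 {n} (base e) h = ℚ.1≢0 (trans (sym (trans (det-cong e) (det-δ n))) h)
det≢0 (shear i j c ne E h hr) z = det≢0 E (trans (sym (det-shear i j c ne h hr)) z)
det≢0 (scale i c c≢0 E h hr) z = *-≢0 c≢0 (det≢0 E) (trans (sym (det-scale i c h hr)) z)

-- Every vector is reached from 0 by adding multiples of basis vectors one at a time; each such step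
-- costs one row operation in `elem-block` and `elem-addFirst`, and one use of linearity in
-- `det-combination`.
vector-induction : ∀ {n} (P : (Fin n → ℚ) → Set) → (∀ {u v} → (∀ i → u i ≡ v i) → P u → P v) → P (λ _ → 0ℚ) →
  (∀ {u} i c → P u → P (λ k → u k + c * δ i k)) → ∀ w → P w
vector-induction {zero} P resp p0 step w = resp (λ ()) p0
vector-induction {suc n} P resp p0 step w =
    resp eq (step zero (w zero) (vector-induction {n} (λ u → P (cons u)) resp′ p0′ step′ (w ∘ suc)))
  where
  cons : (Fin n → ℚ) → Fin (suc n) → ℚ
  cons u zero = 0ℚ
  cons u (suc i) = u i
  resp′ : ∀ {u v} → (∀ i → u i ≡ v i) → P (cons u) → P (cons v)
  resp′ e = resp λ { zero → refl ; (suc i) → e i }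
  p0′ : P (cons λ _ → 0ℚ)
  p0′ = resp (λ { zero → refl ; (suc i) → refl }) p0
  opaque
    unfolding ring
    lem : ∀ c → 0ℚ + c * 0ℚ ≡ 0ℚ
    lem = solve-∀ ring
    lem₁ : ∀ x → 0ℚ + x * 1ℚ ≡ x
    lem₁ = solve-∀ ring
    lem₂ : ∀ x c → x + c * 0ℚ ≡ x
    lem₂ = solve-∀ ring
  step′ : ∀ {u} i c → P (cons u) → P (cons (λ k → u k + c * δ i k))
  step′ i c p = resp (λ { zero → lem c ; (suc k) → refl }) (step (suc i) c p)
  eq : ∀ i → cons (w ∘ suc) i + w zero * δ zero i ≡ w i
  eq zero = lem₁ (w zero)
  eq (suc i) = lem₂ (w (suc i)) (w zero)

block : ∀ {n} → (Fin n → ℚ) → M n → M (suc n)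
block u N zero zero = 1ℚ
block u N zero (suc j) = u j
block u N (suc i) zero = 0ℚ
block u N (suc i) (suc j) = N i j

elem-block : ∀ {n} (u : Fin n → ℚ) {N} → Elem N → Elem (block u N)
elem-block u {N} (base e) = elem-cong {B = block u δ} (λ { zero zero → refl ; zero (suc j) → refl ; (suc i) zero →
    refl ; (suc i) (suc j) → e i j })
  (vector-induction (λ u → Elem (block u δ))
    (λ h → elem-cong λ { zero zero → refl ; zero (suc j) → sym (h j) ; (suc i) zero → refl ; (suc i) (suc j) → refl })
    (base λ { zero zero → refl ; zero (suc j) → refl ; (suc i) zero → refl ; (suc i) (suc j) → refl })
    (λ i c E → shear zero (suc i) c (λ ()) E (λ { zero → lem c ; (suc k) → refl })
      λ { zero ne → contradiction refl ne ; (suc r) ne zero → refl ; (suc r) ne (suc k) → refl })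
    u)
  where
  opaque
    unfolding ring
    lem : ∀ c → 1ℚ ≡ 1ℚ + c * 0ℚ
    lem = solve-∀ ring
elem-block u (shear i j c ne E h hr) = shear (suc i) (suc j) c (ne ∘ Fin.suc-injective) (elem-block u E)
  (λ { zero → lem c ; (suc k) → h k })
  λ { zero _ zero → refl ; zero _ (suc k) → refl ; (suc r) nr zero → refl ; (suc r) nr (suc k) →
      hr r (nr ∘ cong suc) k }
  where
  opaque
    unfolding ring
    lem : ∀ c → 0ℚ ≡ 0ℚ + c * 0ℚ
    lem = solve-∀ ring
elem-block u (scale i c c≢0 E h hr) = scale (suc i) c c≢0 (elem-block u E)
  (λ { zero → sym (*-zeroʳ c) ; (suc k) → h k })
  λ { zero _ zero → refl ; zero _ (suc k) → refl ; (suc r) nr zero → refl ; (suc r) nr (suc k) →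
      hr r (nr ∘ cong suc) k }

addFirst : ∀ {n} → M (suc n) → (Fin n → ℚ) → M (suc n)
addFirst N w zero k = N zero k
addFirst N w (suc i) k = N (suc i) k + w i * N zero k

elem-addFirst : ∀ {n} {N : M (suc n)} → Elem N → ∀ w → Elem (addFirst N w)
elem-addFirst {n} {N} E = vector-induction (λ w → Elem (addFirst N w))
  (λ h → elem-cong λ { zero k → refl ; (suc i) k → cong (λ x → N (suc i) k + x * N zero k) (sym (h i)) })
  (elem-cong (λ { zero k → refl ; (suc i) k → lem (N (suc i) k) (N zero k) }) E)
  (λ {u} i c F → shear (suc i) zero c (λ ()) F
    (λ k → trans (cong (λ x → N (suc i) k + (u i + c * x) * N zero k) (δ-refl i)) (lem₁ _ _ c _))
    λ { zero _ k → refl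
      ; (suc r) nr k → trans (cong (λ x → N (suc r) k + (u r + c * x) * N zero k) (δ-≢ (λ e → nr (cong suc (sym e)))))
          (lem₂ _ _ c _) })
  where
  opaque
    unfolding ring
    lem : ∀ a b → a + 0ℚ * b ≡ a
    lem = solve-∀ ring
    lem₁ : ∀ a u c b → a + (u + c * 1ℚ) * b ≡ a + u * b + c * b
    lem₁ = solve-∀ ring
    lem₂ : ∀ a u c b → a + (u + c * 0ℚ) * b ≡ a + u * b
    lem₂ = solve-∀ ring

Kernel : ∀ {n} → M n → Set
Kernel A = ∃[ μ ] (∃[ i ] μ i ≢ 0ℚ) × (∀ i → (A ▹ μ) i ≡ 0ℚ)

-- `N` is the Schur complement of the pivot: A arises from `block u N` by adding multiples of the
-- first row to the others and scaling the first row by the pivot. A kernel vector of `N` lifts to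
-- one of A by solving the first equation.
gauss-pivot : ∀ {n} → (∀ N → Elem {n} N ⊎ Kernel N) → ∀ (A : M (suc n)) → A zero zero ≢ 0ℚ → Elem A ⊎ Kernel A
gauss-pivot {n} rec A p≢0 = result (rec N)
  where
  p : ℚ
  p = A zero zero
  u w : Fin n → ℚ
  u j = p ⁻¹ * A zero (suc j)
  w i = A (suc i) zero
  N : M n
  N i j = A (suc i) (suc j) - w i * u j
  cancel : ∀ x → x ≡ p * (p ⁻¹ * x)
  cancel x = trans (sym (*-identityˡ x)) (trans (cong (_* x) (sym (⁻¹-inverse p≢0))) (*-assoc p (p ⁻¹) x))
  opaque
    unfolding ring
    lem₁ : ∀ w → w ≡ 0ℚ + w * 1ℚ
    lem₁ = solve-∀ ring
    lem₂ : ∀ a x → a ≡ a - x + x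
    lem₂ = solve-∀ ring
    lem₃ : ∀ p s → p * (- s) + p * s ≡ 0ℚ
    lem₃ = solve-∀ ring
    lem₄ : ∀ a w u m → a * m ≡ w * (u * m) + (a - w * u) * m
    lem₄ = solve-∀ ring
    lem₅ : ∀ w s x → w * (- s) + (w * s + x) ≡ x
    lem₅ = solve-∀ ring
  result : Elem N ⊎ Kernel N → Elem A ⊎ Kernel A
  result (inj₁ E) = inj₁ (scale {B = addFirst (block u N) w} zero p p≢0 (elem-addFirst (elem-block u E) w)
    (λ { zero → sym (*-identityʳ p) ; (suc k) → cancel (A zero (suc k)) })
    λ { zero nr → contradiction refl nr ; (suc r) _ zero → lem₁ (w r) ; (suc r) _ (suc k) → lem₂ (A (suc r) (suc k))
        (w r * u k) })
  result (inj₂ (μ , (i , μi≢0) , h)) = inj₂ (ν , (suc i , μi≢0) , λ { zero → row₀ ; (suc r) → row r })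
    where
    s : ℚ
    s = sum λ j → u j * μ j
    ν : Fin (suc n) → ℚ
    ν zero = - s
    ν (suc j) = μ j
    row₀ : (A ▹ ν) zero ≡ 0ℚ
    row₀ = trans (cong (_+_ (p * - s))
        (trans (sum-cong λ j → trans (cong (_* μ j) (cancel (A zero (suc j)))) (*-assoc p (u j) (μ j)))
      (sum-*ˡ p (λ j → u j * μ j)))) (lem₃ p s)
    row : ∀ r → (A ▹ ν) (suc r) ≡ 0ℚ
    row r = trans (cong (_+_ (w r * - s)) (sum-linear (w r) {g = λ j → u j * μ j} {h = λ j → N r j * μ j} λ j →
        lem₄ (A (suc r) (suc j)) (w r) (u j) (μ j)))
      (trans (lem₅ (w r) s _) (h r))

gauss : ∀ {n} (A : M n) → Elem A ⊎ Kernel A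
gauss {zero} A = inj₁ (base λ ())
gauss {suc n} A with A zero zero ℚ.≟ 0ℚ
... | no ne = gauss-pivot gauss A ne
... | yes A₀₀≡0 with Fin.any? (λ i → ¬? (A (suc i) zero ℚ.≟ 0ℚ))
...   | no none = inj₂ ((λ j → δ j zero) , (zero , ℚ.1≢0) , λ i → trans (sum-δʳ zero (A i)) (column i))
  where
  column : ∀ i → A i zero ≡ 0ℚ
  column zero = A₀₀≡0
  column (suc i) with A (suc i) zero ℚ.≟ 0ℚ
  ... | yes e = e
  ... | no ne = contradiction (i , ne) none
...   | yes (i , ne) = result (gauss-pivot gauss B B₀₀≢0)
  where
  -- The first column has a nonzero entry in row `suc i`; adding this row to the first one creates a
  -- pivot.
  B : M (suc n)
  B zero k = A zero k + A (suc i) k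
  B (suc r) k = A (suc r) k
  B₀₀≢0 : B zero zero ≢ 0ℚ
  B₀₀≢0 e = ne (trans (sym (trans (cong (_+ A (suc i) zero) A₀₀≡0) (+-identityˡ _))) e)
  opaque
    unfolding ring
    lem : ∀ a b → a ≡ a + b + (- 1ℚ) * b
    lem = solve-∀ ring
    lem₁ : ∀ a b m → a * m ≡ (- 1ℚ) * (b * m) + (a + b) * m
    lem₁ = solve-∀ ring
    lem₂ : (- 1ℚ) * 0ℚ + 0ℚ ≡ 0ℚ
    lem₂ = solve-∀ ring
  result : Elem B ⊎ Kernel B → Elem A ⊎ Kernel A
  result (inj₁ E) = inj₁ (shear zero (suc i) (- 1ℚ) (λ ()) E (λ k → lem (A zero k) (A (suc i) k))
    λ { zero nr → contradiction refl nr ; (suc r) _ k → refl })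
  result (inj₂ (μ , nz , h)) =
      inj₂ (μ , nz , λ { zero → trans (sum-linear (- 1ℚ) {g = λ j → A (suc i) j * μ j} {h = λ j → B zero j * μ j}
      (λ j → lem₁ (A zero j) (A (suc i) j) (μ j)))
      (trans (cong₂ (λ x y → - 1ℚ * x + y) (h (suc i)) (h zero)) lem₂)
    ; (suc r) → h (suc r) })

-- Inverses

▹-⊡ : ∀ {l m n} (A : Fin l → Fin m → ℚ) (B : Fin m → Fin n → ℚ) x i → (A ▹ (B ▹ x)) i ≡ ((A ⊡ B) ▹ x) i
▹-⊡ A B x i = begin
  sum (λ j → A i j * sum (λ k → B j k * x k))     ≡⟨ sum-cong (λ j → sym (sum-*ˡ (A i j) (λ k → B j k * x k))) ⟩
  sum (λ j → sum (λ k → A i j * (B j k * x k)))   ≡⟨ ∑-comm (λ j k → A i j * (B j k * x k)) ⟩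
  sum (λ k → sum (λ j → A i j * (B j k * x k)))   ≡⟨ sum-cong
      (λ k → trans (sum-cong λ j → sym (*-assoc (A i j) (B j k) (x k))) (sum-*ʳ (x k) (λ j → A i j * B j k))) ⟩
  sum (λ k → sum (λ j → A i j * B j k) * x k)     ∎
  where open ≡-Reasoning

⊡-assoc : ∀ {l m n p} (A : Fin l → Fin m → ℚ) (B : Fin m → Fin n → ℚ) (C : Fin n → Fin p → ℚ) →
    A ⊡ (B ⊡ C) ≈ (A ⊡ B) ⊡ C
⊡-assoc A B C i k = ▹-⊡ A B (λ j → C j k) i

⊡-cong : ∀ {l m n} {A A′ : Fin l → Fin m → ℚ} {B B′ : Fin m → Fin n → ℚ} → A ≈ A′ → B ≈ B′ → A ⊡ B ≈ A′ ⊡ B′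
⊡-cong e e′ i k = sum-cong λ j → cong₂ _*_ (e i j) (e′ j k)

⊡-δˡ : ∀ {m n} (A : Fin m → Fin n → ℚ) → δ ⊡ A ≈ A
⊡-δˡ A i k = sum-δˡ i (λ j → A j k)

⊡-δʳ : ∀ {m n} (A : Fin m → Fin n → ℚ) → A ⊡ δ ≈ A
⊡-δʳ A i k = sum-δʳ k (A i)

▹-cong : ∀ {m n} (A : Fin m → Fin n → ℚ) {x y : Fin n → ℚ} → (∀ j → x j ≡ y j) → ∀ i → (A ▹ x) i ≡ (A ▹ y) i
▹-cong A e i = sum-cong λ j → cong (A i j *_) (e j)

▹-congˡ : ∀ {m n} {A B : Fin m → Fin n → ℚ} → A ≈ B → ∀ x i → (A ▹ x) i ≡ (B ▹ x) i
▹-congˡ e x i = sum-cong λ j → cong (_* x j) (e i j)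

▹-δ : ∀ {n} (x : Fin n → ℚ) i → (δ ▹ x) i ≡ x i
▹-δ x i = sum-δˡ i x

elem-surjective : ∀ {n} {A : M n} → Elem A → ∀ y → ∃[ x ] ∀ i → (A ▹ x) i ≡ y i
elem-surjective (base e) y = y , λ i → trans (▹-congˡ e y i) (▹-δ y i)
elem-surjective {A = A} (shear {B = B} i j c ne E h hr) y = x , solves
  where
  y′ : Fin _ → ℚ
  y′ r with r Fin.≟ i
  ... | yes _ = y i - c * y j
  ... | no _ = y r
  y′-i : y′ i ≡ y i - c * y j
  y′-i with i Fin.≟ i
  ... | yes _ = refl
  ... | no ni = contradiction refl ni
  y′-≢ : ∀ r → r ≢ i → y′ r ≡ y r
  y′-≢ r nr with r Fin.≟ i
  ... | yes e = contradiction e nr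
  ... | no _ = refl
  x : Fin _ → ℚ
  x = proj₁ (elem-surjective E y′)
  Bx : ∀ r → (B ▹ x) r ≡ y′ r
  Bx = proj₂ (elem-surjective E y′)
  opaque
    unfolding ring
    lem : ∀ b c d x → (b + c * d) * x ≡ c * (d * x) + b * x
    lem = solve-∀ ring
    lem′ : ∀ c a b → c * b + (a - c * b) ≡ a
    lem′ = solve-∀ ring
  solves : ∀ r → (A ▹ x) r ≡ y r
  solves r with r Fin.≟ i
  ... | no nr = trans (sum-cong λ k → cong (_* x k) (hr r nr k)) (trans (Bx r) (y′-≢ r nr))
  ... | yes refl = trans (sum-linear c {g = λ k → B j k * x k} {h = λ k → B i k * x k} λ k →
      trans (cong (_* x k) (h k)) (lem (B i k) c (B j k) (x k)))
    (trans (cong₂ (λ a b → c * a + b) (trans (Bx j) (y′-≢ j (ne ∘ sym))) (trans (Bx i) y′-i)) (lem′ c (y i) (y j)))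
elem-surjective {A = A} (scale {B = B} i c c≢0 E h hr) y = x , solves
  where
  y′ : Fin _ → ℚ
  y′ r with r Fin.≟ i
  ... | yes _ = c ⁻¹ * y i
  ... | no _ = y r
  y′-i : y′ i ≡ c ⁻¹ * y i
  y′-i with i Fin.≟ i
  ... | yes _ = refl
  ... | no ni = contradiction refl ni
  y′-≢ : ∀ r → r ≢ i → y′ r ≡ y r
  y′-≢ r nr with r Fin.≟ i
  ... | yes e = contradiction e nr
  ... | no _ = refl
  x : Fin _ → ℚ
  x = proj₁ (elem-surjective E y′)
  Bx : ∀ r → (B ▹ x) r ≡ y′ r
  Bx = proj₂ (elem-surjective E y′)
  solves : ∀ r → (A ▹ x) r ≡ y r
  solves r with r Fin.≟ i
  ... | no nr = trans (sum-cong λ k → cong (_* x k) (hr r nr k)) (trans (Bx r) (y′-≢ r nr))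
  ... | yes refl = trans (sum-cong λ k → trans (cong (_* x k) (h k)) (*-assoc c (B i k) (x k)))
      (trans (sum-*ˡ c (λ k → B i k * x k))
    (trans (cong (c *_) (trans (Bx i) y′-i)) (trans (sym (*-assoc c (c ⁻¹) (y i)))
        (trans (cong (_* y i) (⁻¹-inverse c≢0)) (*-identityˡ (y i))))))

elem-injective : ∀ {n} {A : M n} → Elem A → ∀ {x} → (∀ i → (A ▹ x) i ≡ 0ℚ) → ∀ i → x i ≡ 0ℚ
elem-injective (base e) {x} z i = trans (sym (trans (▹-congˡ e x i) (▹-δ x i))) (z i)
elem-injective {A = A} (shear {B = B} i j c ne E h hr) {x} z = elem-injective E Bx
  where
  opaque
    unfolding ring
    lem : ∀ b c d x → b * x ≡ (- c) * (d * x) + (b + c * d) * x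
    lem = solve-∀ ring
    lem′ : ∀ c → (- c) * 0ℚ + 0ℚ ≡ 0ℚ
    lem′ = solve-∀ ring
  Bx : ∀ r → (B ▹ x) r ≡ 0ℚ
  Bx r with r Fin.≟ i
  ... | no nr = trans (sum-cong λ k → cong (_* x k) (sym (hr r nr k))) (z r)
  ... | yes refl = trans (sum-linear (- c) {g = λ k → B j k * x k} {h = λ k → A i k * x k} λ k →
      trans (lem (B i k) c (B j k) (x k)) (cong (λ a → - c * (B j k * x k) + a * x k) (sym (h k))))
    (trans (cong₂ (λ a b → - c * a + b) (trans (sum-cong λ k → cong (_* x k) (sym (hr j (ne ∘ sym) k))) (z j)) (z i))
        (lem′ c))
elem-injective {A = A} (scale {B = B} i c c≢0 E h hr) {x} z = elem-injective E Bx
  where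
  Bx : ∀ r → (B ▹ x) r ≡ 0ℚ
  Bx r with r Fin.≟ i
  ... | no nr = trans (sum-cong λ k → cong (_* x k) (sym (hr r nr k))) (z r)
  ... | yes refl = *-cancel-≡ c≢0 (trans (sym (sum-*ˡ c (λ k → B i k * x k)))
      (trans (sum-cong λ k → trans (sym (*-assoc c (B i k) (x k))) (cong (_* x k) (sym (h k))))
      (trans (z i) (sym (*-zeroʳ c)))))

▹-minus : ∀ {m n} (A : Fin m → Fin n → ℚ) x y i → (A ▹ (λ j → x j - y j)) i ≡ (A ▹ x) i - (A ▹ y) i
▹-minus A x y i = trans (sum-linear (- 1ℚ) {g = λ j → A i j * y j} {h = λ j → A i j * x j} λ j →
    lem (A i j) (x j) (y j)) (lem′ _ _)
  where
  opaque
    unfolding ring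
    lem : ∀ a x y → a * (x - y) ≡ (- 1ℚ) * (a * y) + a * x
    lem = solve-∀ ring
    lem′ : ∀ x y → (- 1ℚ) * y + x ≡ x - y
    lem′ = solve-∀ ring

x-y≡0⇒x≡y : ∀ {x y} → x - y ≡ 0ℚ → x ≡ y
x-y≡0⇒x≡y {x} {y} e = trans (lem x y) (trans (cong (_+ y) e) (+-identityˡ y))
  where
  opaque
    unfolding ring
    lem : ∀ x y → x ≡ x - y + y
    lem = solve-∀ ring

elem-cancel : ∀ {n} {A : M n} → Elem A → ∀ {x y} → (∀ i → (A ▹ x) i ≡ (A ▹ y) i) → ∀ i → x i ≡ y i
elem-cancel {A = A} E {x} {y} e i =
    x-y≡0⇒x≡y (elem-injective E (λ r → trans (▹-minus A x y r) (trans (cong (_- (A ▹ y) r) (e r)) (+-inverseʳ _))) i)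

elem-inverse : ∀ {n} {A : M n} → Elem A → ∃[ N ] A ⊡ N ≈ δ × N ⊡ A ≈ δ
elem-inverse {n} {A} E = N , AN , λ i k → elem-cancel E {λ r → (N ⊡ A) r k} {λ r → δ r k}
    (λ r → trans (⊡-assoc A N A r k) (trans (⊡-cong {B = A} AN (λ _ _ → refl) r k)
        (trans (⊡-δˡ A r k) (sym (⊡-δʳ A r k))))) i
  where
  N : M n
  N i k = proj₁ (elem-surjective E (λ r → δ r k)) i
  AN : A ⊡ N ≈ δ
  AN i k = proj₂ (elem-surjective E (λ r → δ r k)) i

trivialKernel⇒elem : ∀ {n} (A : M n) → (∀ {μ} → (∀ i → (A ▹ μ) i ≡ 0ℚ) → ∀ i → μ i ≡ 0ℚ) → Elem A
trivialKernel⇒elem A h with gauss A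
... | inj₁ E = E
... | inj₂ (μ , (i , ne) , z) = contradiction (h z i) ne

leftInverse⇒elem : ∀ {n} {A N : M n} → N ⊡ A ≈ δ → Elem A
leftInverse⇒elem {A = A} {N} e = trivialKernel⇒elem A λ {μ} z i →
  trans (sym (▹-δ μ i))
      (trans (sym (▹-congˡ e μ i))
      (trans (sym (▹-⊡ N A μ i)) (sum-0 λ j → trans (cong (N i j *_) (z j)) (*-zeroʳ (N i j)))))

leftInverse⇒rightInverse : ∀ {n} {A N : M n} → N ⊡ A ≈ δ → A ⊡ N ≈ δ
leftInverse⇒rightInverse {A = A} {N} e i k = trans (⊡-cong {A = A} {B = N} {B′ = N′} (λ _ _ → refl) N≈N′ i k)
    (proj₁ (proj₂ inv) i k)
  where
  inv = elem-inverse (leftInverse⇒elem e)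
  N′ = proj₁ inv
  N≈N′ : N ≈ N′
  N≈N′ r c = trans (sym (⊡-δʳ N r c)) (trans (sym (⊡-cong {A = N} (λ _ _ → refl) (proj₁ (proj₂ inv)) r c))
    (trans (⊡-assoc N A N′ r c) (trans (⊡-cong {B = N′} e (λ _ _ → refl) r c) (⊡-δˡ N′ r c))))

det-inverse : ∀ {n} {A N : M n} → Elem A → A ⊡ N ≈ δ → det A * det N ≡ 1ℚ
det-inverse {n} {A} {N} E e = trans (sym (det-⊡ E N)) (trans (det-cong e) (det-δ n))

_ᵀ : ∀ {m n} → (Fin m → Fin n → ℚ) → Fin n → Fin m → ℚ
(A ᵀ) i j = A j i

elem-ᵀ : ∀ {n} {A : M n} → Elem A → Elem (A ᵀ)
elem-ᵀ {A = A} E = leftInverse⇒elem {N = N ᵀ} λ i k →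
  trans (sum-cong λ j → *-comm (N j i) (A k j)) (trans (proj₁ (proj₂ (elem-inverse E)) k i) (δ-sym k i))
  where N = proj₁ (elem-inverse E)

-- A row operation on A is an operation on the columns of the transpose, that is, multiplication
-- from the right by a transposed elementary matrix `S`. As B ᵀ is again invertible, `det-⊡` applies
-- to the product.
det-ᵀ : ∀ {n} {A : M n} → Elem A → det (A ᵀ) ≡ det A
det-ᵀ (base e) = det-cong λ i j → trans (e j i) (trans (δ-sym j i) (sym (e i j)))
det-ᵀ {n} {A} (shear {B = B} i j c ne E h hr) = trans (det-cong eq)
  (trans (det-⊡ (elem-ᵀ E) S)
      (trans (cong₂ _*_ (det-ᵀ E) (trans (det-shear j i c {S} {δ} (ne ∘ sym) S-j S-≢) (det-δ n)))
  (trans (*-identityʳ _) (sym (det-shear i j c ne h hr)))))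
  where
  S : M _
  S r k = δ r k + c * (δ r j * δ i k)
  opaque
    unfolding ring
    lem₁ : ∀ x c y → x + c * (1ℚ * y) ≡ x + c * y
    lem₁ = solve-∀ ring
    lem₂ : ∀ x c y → x + c * (0ℚ * y) ≡ x
    lem₂ = solve-∀ ring
    lem₃ : ∀ b x c y z → b * (x + c * (y * z)) ≡ c * z * (b * y) + b * x
    lem₃ = solve-∀ ring
    lem₄ : ∀ c b x → x + c * b ≡ c * 1ℚ * b + x
    lem₄ = solve-∀ ring
    lem₅ : ∀ c b x → x ≡ c * 0ℚ * b + x
    lem₅ = solve-∀ ring
  S-j : ∀ k → S j k ≡ δ j k + c * δ i k
  S-j k = trans (cong (λ d → δ j k + c * (d * δ i k)) (δ-refl j)) (lem₁ (δ j k) c (δ i k))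
  S-≢ : ∀ r → r ≢ j → ∀ k → S r k ≡ δ r k
  S-≢ r nr k = trans (cong (λ d → δ r k + c * (d * δ i k)) (δ-≢ nr)) (lem₂ (δ r k) c (δ i k))
  expand : ∀ r k → ((B ᵀ) ⊡ S) r k ≡ c * δ i k * B j r + B k r
  expand r k = trans (sum-linear (c * δ i k) {g = λ l → B l r * δ l j} {h = λ l → B l r * δ l k} λ l →
      lem₃ (B l r) (δ l k) c (δ l j) (δ i k))
    (cong₂ (λ a b → c * δ i k * a + b) (sum-δʳ j (λ l → B l r)) (sum-δʳ k (λ l → B l r)))
  eq : A ᵀ ≈ (B ᵀ) ⊡ S
  eq r k with k Fin.≟ i
  ... | yes refl = trans (h r)
      (trans (lem₄ c (B j r) (B i r)) (trans (cong (λ d → c * d * B j r + B i r) (sym (δ-refl i)))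
      (sym (expand r i))))
  ... | no nk = trans (hr k nk r)
      (trans (lem₅ c (B j r) (B k r)) (trans (cong (λ d → c * d * B j r + B k r) (sym (δ-≢ (nk ∘ sym))))
      (sym (expand r k))))
det-ᵀ {n} {A} (scale {B = B} i c c≢0 E h hr) = trans (det-cong eq)
  (trans (det-⊡ (elem-ᵀ E) S)
      (trans (cong₂ _*_ (det-ᵀ E) (trans (det-scale i c {S} {δ} S-i S-≢)
      (trans (cong (c *_) (det-δ n)) (*-identityʳ c))))
  (trans (*-comm (det B) c) (sym (det-scale i c h hr)))))
  where
  S : M _
  S r k = δ r k + (c - 1ℚ) * (δ r i * δ i k)
  opaque
    unfolding ring
    lem₁ : ∀ x c → x + (c - 1ℚ) * (1ℚ * x) ≡ c * x
    lem₁ = solve-∀ ring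
    lem₂ : ∀ x c y → x + (c - 1ℚ) * (0ℚ * y) ≡ x
    lem₂ = solve-∀ ring
    lem₃ : ∀ b x c y z → b * (x + (c - 1ℚ) * (y * z)) ≡ (c - 1ℚ) * z * (b * y) + b * x
    lem₃ = solve-∀ ring
    lem₄ : ∀ c x → c * x ≡ (c - 1ℚ) * 1ℚ * x + x
    lem₄ = solve-∀ ring
    lem₅ : ∀ c b x → x ≡ (c - 1ℚ) * 0ℚ * b + x
    lem₅ = solve-∀ ring
  S-i : ∀ k → S i k ≡ c * δ i k
  S-i k = trans (cong (λ d → δ i k + (c - 1ℚ) * (d * δ i k)) (δ-refl i)) (lem₁ (δ i k) c)
  S-≢ : ∀ r → r ≢ i → ∀ k → S r k ≡ δ r k
  S-≢ r nr k = trans (cong (λ d → δ r k + (c - 1ℚ) * (d * δ i k)) (δ-≢ nr)) (lem₂ (δ r k) c (δ i k))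
  expand : ∀ r k → ((B ᵀ) ⊡ S) r k ≡ (c - 1ℚ) * δ i k * B i r + B k r
  expand r k = trans (sum-linear ((c - 1ℚ) * δ i k) {g = λ l → B l r * δ l i} {h = λ l → B l r * δ l k} λ l →
      lem₃ (B l r) (δ l k) c (δ l i) (δ i k))
    (cong₂ (λ a b → (c - 1ℚ) * δ i k * a + b) (sum-δʳ i (λ l → B l r)) (sum-δʳ k (λ l → B l r)))
  eq : A ᵀ ≈ (B ᵀ) ⊡ S
  eq r k with k Fin.≟ i
  ... | yes refl = trans (h r)
      (trans (lem₄ c (B i r)) (trans (cong (λ d → (c - 1ℚ) * d * B i r + B i r) (sym (δ-refl i))) (sym (expand r i))))
  ... | no nk = trans (hr k nk r)
      (trans (lem₅ c (B i r) (B k r)) (trans (cong (λ d → (c - 1ℚ) * d * B i r + B k r) (sym (δ-≢ (nk ∘ sym))))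
      (sym (expand r k))))

-- Cramer's rule

-- Both sides are linear in x. For a basis vector other than the i-th the new matrix has two equal
-- rows, and for the i-th it is A itself.
det-combination : ∀ {n} (A : M n) i x → det (setRow A i (λ k → sum λ r → x r * A r k)) ≡ x i * det A
det-combination {n} A i = vector-induction P resp p0 step
  where
  comb : (Fin n → ℚ) → Fin n → ℚ
  comb x k = sum λ r → x r * A r k
  P : (Fin n → ℚ) → Set
  P x = det (setRow A i (comb x)) ≡ x i * det A
  setRow-cong : ∀ {w w′ : Fin n → ℚ} → (∀ k → w k ≡ w′ k) → setRow A i w ≈ setRow A i w′
  setRow-cong e r k with r Fin.≟ i
  ... | yes _ = e k
  ... | no _ = refl
  resp : ∀ {x y} → (∀ i → x i ≡ y i) → P x → P y
  resp e p = trans (det-cong (setRow-cong λ k → sum-cong λ r → cong (_* A r k) (sym (e r))))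
      (trans p (cong (_* det A) (e i)))
  p0 : P (λ _ → 0ℚ)
  p0 = trans (det-zeroRow i λ k → trans (setRow-hit A i _ k) (sum-0 λ r → *-zeroˡ (A r k))) (sym (*-zeroˡ (det A)))
  opaque
    unfolding ring
    lem : ∀ x c d a → (x + c * d) * a ≡ c * (d * a) + x * a
    lem = solve-∀ ring
    lem′ : ∀ c d x a → c * (d * a) + x * a ≡ (x + c * d) * a
    lem′ = solve-∀ ring
  single : ∀ r → det (setRow A i (A r)) ≡ δ r i * det A
  single r with r Fin.≟ i
  ... | yes refl = trans (det-cong self) (trans (sym (*-identityˡ _)) (cong (_* det A) (sym (δ-refl i))))
    where
    self : setRow A i (A i) ≈ A
    self r k with r Fin.≟ i
    ... | yes refl = refl
    ... | no _ = refl
  ... | no ne = trans (det-alternating i r (ne ∘ sym) (setRow A i (A r)) λ k → trans (setRow-hit A i _ k)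
      (sym (setRow-miss A i _ r ne k)))
    (trans (sym (*-zeroˡ _)) (cong (_* det A) (sym (δ-≢ ne))))
  step : ∀ {x} r c → P x → P (λ k → x k + c * δ r k)
  step {x} r c p = trans (det-linear i c {B = setRow A i (A r)} {C = setRow A i (comb x)}
      (λ s ns k → trans (setRow-miss A i _ s ns k) (sym (setRow-miss A i _ s ns k)))
      (λ s ns k → trans (setRow-miss A i _ s ns k) (sym (setRow-miss A i _ s ns k)))
      (λ k → trans (setRow-hit A i _ k) (trans (sum-linear c {g = λ s → δ r s * A s k} {h = λ s → x s * A s k} λ s →
          lem (x s) c (δ r s) (A s k))
        (cong₂ (λ a b → c * a + b) (trans (sum-δˡ r (λ s → A s k)) (sym (setRow-hit A i _ k)))
            (sym (setRow-hit A i _ k))))))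
    (trans (cong₂ (λ a b → c * a + b) (single r) p) (lem′ c (δ r i) (x i) (det A)))

-- Since `N ⊡ A ≈ δ`, the combination of the rows of A with coefficients `N k` is a basis vector. By
-- `det-combination`, det A times `N k i` is then the determinant of A with row i replaced by this
-- vector, which is an integral matrix.
int-adjugate : ∀ {n} {A N : M n} → (∀ i j → IsInt (A i j)) → N ⊡ A ≈ δ → ∀ i j → IsInt (det A * N i j)
int-adjugate {A = A} {N} h e k i = subst IsInt (trans (det-combination A i (N k)) (*-comm (N k i) (det A)))
  (int-det entries)
  where
  intδ : ∀ {n} (a b : Fin n) → IsInt (δ a b)
  intδ zero zero = int-1
  intδ zero (suc b) = int-0
  intδ (suc a) zero = int-0
  intδ (suc a) (suc b) = intδ a b
  entries : ∀ r c → IsInt (setRow A i (λ c → sum λ r → N k r * A r c) r c)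
  entries r c with r Fin.≟ i
  ... | yes _ = subst IsInt (sym (e k c)) (intδ k c)
  ... | no _ = h r c

open import Algebra.Properties.Semiring.Exp (CommutativeRing.semiring +-*-commutativeRing) using (_^_)

-- Choosing small rationals

fromNat-suc : ∀ n → fromNat (suc n) ≡ 1ℚ + fromNat n
fromNat-suc n = fromℤ-+ (ℤ.+ 1) (ℤ.+ n)

fromNat-* : ∀ m n → fromNat (m ℕ.* n) ≡ fromNat m * fromNat n
fromNat-* m n = trans (cong fromℤ (ℤ.pos-* m n)) (fromℤ-* (ℤ.+ m) (ℤ.+ n))

fromNat-≤ : ∀ {m n} → m ℕ.≤ n → fromNat m ≤ fromNat n
fromNat-≤ h = fromℤ-≤ (ℤ.+≤+ h)

0≤fromNat : ∀ n → 0ℚ ≤ fromNat n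
0≤fromNat n = fromNat-≤ z≤n

0<fromNat : ∀ n → 0ℚ < fromNat (suc n)
0<fromNat n = ℚ.<-≤-trans 0<1 (fromNat-≤ {1} (s≤s z≤n))

archimedes : ∀ x → ∃[ n ] x ≤ fromNat n
archimedes (ℚ.mkℚ (ℤ.+ n) d c) = n , ℚ.*≤* (subst₂ ℤ._≤_ (sym (ℤ.*-identityʳ (ℤ.+ n))) (ℤ.pos-* n (suc d))
    (ℤ.+≤+ (ℕ.m≤m*n n (suc d))))
archimedes (ℚ.mkℚ -[1+ n ] d c) = 0 , ℚ.*≤* (subst (ℤ._≤ ℤ.+ 0 ℤ.* ℤ.+ suc d) (sym (ℤ.*-identityʳ -[1+ n ])) ℤ.-≤+)

shrink : ∀ {c ε} → 0ℚ ≤ c → 0ℚ < ε → ∃[ η ] 0ℚ < η × c * η ≤ ε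
shrink {c} {ε} hc hε = ε * i , 0<* hε (0<⁻¹ 0<c+1) , ≤-by (ε * i) (ℚ.<⇒≤ (0<* hε (0<⁻¹ 0<c+1)))
  (trans (sym (*-identityʳ ε)) (trans (cong (ε *_) (sym (⁻¹-inverse (>⇒≢0 0<c+1)))) (lem c ε i)))
  where
  0<c+1 : 0ℚ < 1ℚ + c
  0<c+1 = 0<+ 0<1 hc
  i : ℚ
  i = (1ℚ + c) ⁻¹
  opaque
    unfolding ring
    lem : ∀ c e i → e * ((1ℚ + c) * i) ≡ c * (e * i) + e * i
    lem = solve-∀ ring

half : ∀ {ε} → 0ℚ < ε → ∃[ η ] 0ℚ < η × η + η ≤ ε
half h with η , 0<η , le ← shrink (ℚ.<⇒≤ 0<2) h = η , 0<η , subst (_≤ _) (lem η) le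
  where
  opaque
    unfolding ring
    lem : ∀ x → (1ℚ + 1ℚ) * x ≡ x + x
    lem = solve-∀ ring

-- With more than c r / ε pieces, an error proportional to the mesh h stays below ε. The length r
-- may be 0, hence the conditional positivity of h.
subdivide : ∀ {r c ε} → 0ℚ ≤ r → 0ℚ ≤ c → 0ℚ < ε → ∃[ n ] ∃[ h ] (0ℚ < r → 0ℚ < h) × 0ℚ ≤ h × fromNat (suc n) * h ≡ r
    × c * h ≤ ε
subdivide {r} {c} {ε} hr hc hε with n , le ← archimedes (c * r * ε ⁻¹) =
  n , r * i , (λ p → 0<* p 0<i) , 0≤* hr (ℚ.<⇒≤ 0<i) ,
  trans (lem₁ N r i) (trans (cong (r *_) (⁻¹-inverse (>⇒≢0 0<N))) (*-identityʳ r)) ,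
  *-cancel-≤ 0<N (subst₂ _≤_
      (sym (trans (lem₂ N c r i) (trans (cong (c * r *_) (⁻¹-inverse (>⇒≢0 0<N))) (*-identityʳ (c * r))))) refl
    (subst₂ _≤_ (trans (lem₃ ε (c * r) (ε ⁻¹)) (trans (cong (c * r *_) (⁻¹-inverse (>⇒≢0 hε))) (*-identityʳ (c * r))))
        (*-comm ε N)
      (*-monoˡ (ℚ.<⇒≤ hε) (ℚ.≤-trans le (fromNat-≤ (ℕ.n≤1+n n))))))
  where
  N i : ℚ
  N = fromNat (suc n)
  i = N ⁻¹
  0<N : 0ℚ < N
  0<N = 0<fromNat n
  0<i : 0ℚ < i
  0<i = 0<⁻¹ 0<N
  opaque
    unfolding ring
    lem₁ : ∀ N r i → N * (r * i) ≡ r * (N * i)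
    lem₁ = solve-∀ ring
    lem₂ : ∀ N c r i → N * (c * (r * i)) ≡ c * r * (N * i)
    lem₂ = solve-∀ ring
    lem₃ : ∀ e x i → e * (x * i) ≡ x * (e * i)
    lem₃ = solve-∀ ring

-- Inner and outer content

module JordanContent where

  open Box

  private
    variable
      d m n : ℕ
      S S′ S₁ S₂ : Subset d
      v v₁ v₂ w w₁ w₂ : ℚ

  vol : Box d → ℚ
  vol B = product λ i → upper B i - lower B i

  append : ∀ {A : Set} → (Fin m → A) → (Fin n → A) → Fin (m ℕ.+ n) → A
  append {zero} xs ys = ys
  append {suc m} xs ys zero = xs zero
  append {suc m} xs ys (suc i) = append (xs ∘ suc) ys i

  append-split : ∀ {A : Set} (Q : A → Set) (xs : Fin m → A) (ys : Fin n → A) →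
    (∀ i → Q (xs i)) → (∀ i → Q (ys i)) → ∀ i → Q (append xs ys i)
  append-split {zero} Q xs ys hx hy i = hy i
  append-split {suc m} Q xs ys hx hy zero = hx zero
  append-split {suc m} Q xs ys hx hy (suc i) = append-split Q (xs ∘ suc) ys (hx ∘ suc) hy i

  append-∃ˡ : ∀ {A : Set} (Q : A → Set) (xs : Fin m → A) (ys : Fin n → A) → ∃[ i ] Q (xs i) →
      ∃[ i ] Q (append xs ys i)
  append-∃ˡ Q xs ys (zero , q) = zero , q
  append-∃ˡ Q xs ys (suc i , q) with k , r ← append-∃ˡ Q (xs ∘ suc) ys (i , q) = suc k , r

  append-∃ʳ : ∀ {A : Set} (Q : A → Set) (xs : Fin m → A) (ys : Fin n → A) → ∃[ i ] Q (ys i) →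
      ∃[ i ] Q (append xs ys i)
  append-∃ʳ {zero} Q xs ys q = q
  append-∃ʳ {suc m} Q xs ys q with k , r ← append-∃ʳ Q (xs ∘ suc) ys q = suc k , r

  sum-append : ∀ {A : Set} (f : A → ℚ) (xs : Fin m → A) (ys : Fin n → A) →
    sum (f ∘ append xs ys) ≡ sum (f ∘ xs) + sum (f ∘ ys)
  sum-append {zero} f xs ys = sym (+-identityˡ _)
  sum-append {suc m} f xs ys = trans (cong (_+_ (f (xs zero))) (sum-append f (xs ∘ suc) ys)) (sym (+-assoc _ _ _))

  Disjoint : Box d → Box d → Set
  Disjoint B C = ∀ x → points B x → points C x → ⊥

  PairwiseDisjoint : (Fin n → Box d) → Set
  PairwiseDisjoint Bs = ∀ j k → j ≢ k → Disjoint (Bs j) (Bs k)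

  append-disjoint : {xs : Fin m → Box d} {ys : Fin n → Box d} → PairwiseDisjoint xs → PairwiseDisjoint ys →
    (∀ i j → Disjoint (xs i) (ys j)) → PairwiseDisjoint (append xs ys)
  append-disjoint {zero} px py c = py
  append-disjoint {suc m} px py c zero zero ne = contradiction refl ne
  append-disjoint {suc m} {xs = xs} {ys} px py c zero (suc k) ne =
    append-split (Disjoint (xs zero)) (xs ∘ suc) ys (λ i → px zero (suc i) (λ ())) (c zero) k
  append-disjoint {suc m} {xs = xs} {ys} px py c (suc j) zero ne x p q =
    append-split (Disjoint (xs zero)) (xs ∘ suc) ys (λ i → px zero (suc i) (λ ())) (c zero) j x q p
  append-disjoint {suc m} px py c (suc j) (suc k) ne =
    append-disjoint (λ i i′ ni → px (suc i) (suc i′) (ni ∘ Fin.suc-injective)) py (c ∘ suc) j k (ne ∘ cong suc)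

  Packing : Subset d → ℚ → Set
  Packing {d} S w = ∃[ n ] Σ[ Bs ∈ (Fin n → Box d) ] PairwiseDisjoint Bs × (∀ j x → points (Bs j) x → S x) × sum
      (vol ∘ Bs) ≡ w

  Cover : Subset d → ℚ → Set
  Cover {d} S w = ∃[ n ] Σ[ Bs ∈ (Fin n → Box d) ] (∀ x → S x → ∃[ j ] points (Bs j) x) × sum (vol ∘ Bs) ≡ w

  -- Only a lower bound for the inner content, as `OuterContent` is only an upper bound for the
  -- outer one. The two bounds are propagated separately and meet in `Content`.
  InnerContent : Subset d → ℚ → Set
  InnerContent S v = ∀ ε → 0ℚ < ε → ∃[ w ] v ≤ w + ε × Packing S w

  OuterContent : Subset d → ℚ → Set
  OuterContent S v = ∀ ε → 0ℚ < ε → ∃[ w ] w ≤ v + ε × Cover S w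

  inner-mono : (∀ x → S x → S′ x) → v₂ ≤ v₁ → InnerContent S v₁ → InnerContent S′ v₂
  inner-mono sub le I ε hε with w , lw , n , Bs , dis , inc , eq ← I ε hε =
    w , ℚ.≤-trans le lw , n , Bs , dis , (λ j x p → sub x (inc j x p)) , eq

  outer-mono : (∀ x → S′ x → S x) → v₁ ≤ v₂ → OuterContent S v₁ → OuterContent S′ v₂
  outer-mono sub le O ε hε with w , lw , n , Bs , cov , eq ← O ε hε =
    w , ℚ.≤-trans lw (+-monoˡ-≤ ε le) , n , Bs , (λ x p → cov x (sub x p)) , eq

  inner-∅ : v ≤ 0ℚ → InnerContent S v
  inner-∅ le ε hε = 0ℚ , ℚ.≤-trans le (subst (0ℚ ≤_) (sym (+-identityˡ ε)) (ℚ.<⇒≤ hε)) , 0 ,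
      (λ ()) , (λ ()) , (λ ()) , refl

  outer-∅ : (∀ x → S x → ⊥) → OuterContent S 0ℚ
  outer-∅ e ε hε = 0ℚ , subst (0ℚ ≤_) (sym (+-identityˡ ε)) (ℚ.<⇒≤ hε) , 0 , (λ ()) , (λ x p → ⊥-elim (e x p)) , refl

  ≤+ : ∀ {p ε} → 0ℚ < ε → p ≤ p + ε
  ≤+ h = ≤-by _ (ℚ.<⇒≤ h) refl

  inner-box : (B : Box d) → (∀ x → points B x → S x) → InnerContent S (vol B)
  inner-box B inc ε hε = vol B , ≤+ hε , 1 , (λ _ → B) , (λ { zero zero ne → contradiction refl ne }) , (λ _ → inc) ,
      +-identityʳ _

  outer-box : (B : Box d) → (∀ x → S x → points B x) → OuterContent S (vol B)
  outer-box B inc ε hε = vol B , ≤+ hε , 1 , (λ _ → B) , (λ x p → zero , inc x p) , +-identityʳ _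

  opaque
    unfolding ring
    +-swap : ∀ a b e f → a + e + (b + f) ≡ a + b + (e + f)
    +-swap = solve-∀ ring

  inner-∪ : (∀ x → S₁ x → S₂ x → ⊥) → (∀ x → S₁ x → S x) → (∀ x → S₂ x → S x) →
    InnerContent S₁ v₁ → InnerContent S₂ v₂ → InnerContent S (v₁ + v₂)
  inner-∪ dis s₁ s₂ I₁ I₂ ε hε with half hε
  ... | η , 0<η , le with I₁ η 0<η | I₂ η 0<η
  ... | w₁ , l₁ , n₁ , B₁ , d₁ , i₁ , e₁ | w₂ , l₂ , n₂ , B₂ , d₂ , i₂ , e₂ =
    w₁ + w₂ , ℚ.≤-trans (+-mono-≤ l₁ l₂) (subst (_≤ _) (sym (+-swap w₁ w₂ η η)) (+-monoʳ-≤ (w₁ + w₂) le)) ,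
    n₁ ℕ.+ n₂ , append B₁ B₂ ,
    append-disjoint d₁ d₂ (λ i j x p q → dis x (i₁ i x p) (i₂ j x q)) ,
    append-split (λ B → ∀ x → points B x → _) B₁ B₂ (λ i x p → s₁ x (i₁ i x p)) (λ i x p → s₂ x (i₂ i x p)) ,
    trans (sum-append vol B₁ B₂) (cong₂ _+_ e₁ e₂)

  outer-∪ : (∀ x → S x → S₁ x ⊎ S₂ x) → OuterContent S₁ v₁ → OuterContent S₂ v₂ → OuterContent S (v₁ + v₂)
  outer-∪ {S = S} {v₁ = v₁} {v₂ = v₂} split O₁ O₂ ε hε with half hε
  ... | η , 0<η , le with O₁ η 0<η | O₂ η 0<η
  ... | w₁ , l₁ , n₁ , B₁ , c₁ , e₁ | w₂ , l₂ , n₂ , B₂ , c₂ , e₂ =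
    w₁ + w₂ , ℚ.≤-trans (+-mono-≤ l₁ l₂) (subst (_≤ _) (sym (+-swap v₁ v₂ η η)) (+-monoʳ-≤ (v₁ + v₂) le)) ,
    n₁ ℕ.+ n₂ , append B₁ B₂ , cov , trans (sum-append vol B₁ B₂) (cong₂ _+_ e₁ e₂)
    where
    cov : ∀ x → S x → ∃[ j ] points (append B₁ B₂ j) x
    cov x p with split x p
    ... | inj₁ q = append-∃ˡ (λ B → points B x) B₁ B₂ (c₁ x q)
    ... | inj₂ q = append-∃ʳ (λ B → points B x) B₁ B₂ (c₂ x q)

  -- Allows slicing arguments to give away an error that is small with the mesh.
  inner-limit : (∀ ε → 0ℚ < ε → ∃[ v′ ] v ≤ v′ + ε × InnerContent S v′) → InnerContent S v
  inner-limit {v = v} h ε hε with half hε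
  ... | η , 0<η , le with h η 0<η
  ... | v′ , l , I with I η 0<η
  ... | w , l′ , p = w ,
      ℚ.≤-trans l (ℚ.≤-trans (+-monoˡ-≤ η l′) (subst (_≤ w + ε) (sym (+-assoc w η η)) (+-monoʳ-≤ w le))) , p

  outer-limit : (∀ ε → 0ℚ < ε → ∃[ v′ ] v′ ≤ v + ε × OuterContent S v′) → OuterContent S v
  outer-limit {v = v} h ε hε with half hε
  ... | η , 0<η , le with h η 0<η
  ... | v′ , l , O with O η 0<η
  ... | w , l′ , p = w ,
      ℚ.≤-trans l′ (ℚ.≤-trans (+-monoˡ-≤ η l) (subst (_≤ v + ε) (sym (+-assoc v η η)) (+-monoʳ-≤ v le))) , p

  -- Prisms over a set

  prism : (a b : ℚ) → a ≤ b → Box d → Box (suc d)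
  prism a b le B = record
    { lower = λ { zero → a ; (suc i) → lower B i }
    ; upper = λ { zero → b ; (suc i) → upper B i }
    ; ordered = λ { zero → le ; (suc i) → ordered B i } }

  inner-prism : ∀ a b → a ≤ b → (∀ x → a ≤ x zero → x zero < b → S (x ∘ suc) → S′ x) →
    InnerContent S v → InnerContent S′ ((b - a) * v)
  inner-prism {v = v} a b le inc I ε hε with η , 0<η , lη ← shrink (diff-≤ le) hε with w , lw , n , Bs , dis , sub ,
      eq ← I η 0<η =
    (b - a) * w , ℚ.≤-trans (*-monoˡ (diff-≤ le) lw) (subst (_≤ _) (sym (distribˡ (b - a) w η))
        (+-monoʳ-≤ ((b - a) * w) lη)) ,
    n , (λ j → prism a b le (Bs j)) ,
    (λ j k ne x p q → dis j k ne (x ∘ suc) (p ∘ suc) (q ∘ suc)) ,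
    (λ j x p → inc x (proj₁ (p zero)) (proj₂ (p zero)) (sub j (x ∘ suc) (p ∘ suc))) ,
    trans (sum-*ˡ (b - a) (vol ∘ Bs)) (cong ((b - a) *_) eq)

  outer-prism : ∀ a b → a ≤ b → (∀ x → S′ x → (a ≤ x zero × x zero < b) × S (x ∘ suc)) →
    OuterContent S v → OuterContent S′ ((b - a) * v)
  outer-prism {S′ = S′} {v = v} a b le inc O ε hε with η , 0<η , lη ← shrink (diff-≤ le) hε with w , lw , n , Bs ,
      cov , eq ← O η 0<η =
    (b - a) * w , ℚ.≤-trans (*-monoˡ (diff-≤ le) lw) (subst (_≤ _) (sym (distribˡ (b - a) v η))
        (+-monoʳ-≤ ((b - a) * v) lη)) ,
    n , (λ j → prism a b le (Bs j)) ,
    (λ x p → proj₁ (cov (x ∘ suc) (proj₂ (inc x p))) ,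
      λ { zero → proj₁ (inc x p) ; (suc i) → proj₂ (cov (x ∘ suc) (proj₂ (inc x p))) i }) ,
    trans (sum-*ˡ (b - a) (vol ∘ Bs)) (cong ((b - a) *_) eq)

  -- Preimages

  -- Preimages preserve unions, inclusions and disjointness, so the effect of f on content is
  -- determined by the preimages of single boxes.
  inner-preimage : ∀ (f : (Fin d → ℚ) → Fin d → ℚ) {c} → 0ℚ ≤ c →
    (∀ B → InnerContent (λ x → points B (f x)) (c * vol B)) → InnerContent S v → InnerContent (λ x → S (f x)) (c * v)
  inner-preimage {S = S} {v = v} f {c} hc box I = inner-limit λ ε hε → go ε (shrink hc hε)
    where
    family : ∀ {n} (Bs : Fin n → Box _) → PairwiseDisjoint Bs → (∀ j x → points (Bs j) x → S x) →
      InnerContent (λ x → ∃[ j ] points (Bs j) (f x)) (c * sum (vol ∘ Bs))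
    family {zero} Bs dis inc = inner-∅ (ℚ.≤-reflexive (*-zeroʳ c))
    family {suc n} Bs dis inc = subst (InnerContent _) (sym (distribˡ c _ _))
      (inner-∪ (λ { x p (j , q) → dis zero (suc j) (λ ()) (f x) p q }) (λ x p → zero , p)
          (λ { x (j , q) → suc j , q })
        (box (Bs zero)) (family (Bs ∘ suc) (λ i j ne → dis (suc i) (suc j) (ne ∘ Fin.suc-injective)) (inc ∘ suc)))
    go : ∀ ε → (∃[ η ] 0ℚ < η × c * η ≤ ε) → ∃[ v′ ] c * v ≤ v′ + ε × InnerContent (λ x → S (f x)) v′
    go ε (η , 0<η , lη) with w , lw , n , Bs , dis , inc , refl ← I η 0<η =
      c * w , ℚ.≤-trans (*-monoˡ hc lw) (subst (_≤ _) (sym (distribˡ c w η)) (+-monoʳ-≤ (c * w) lη)) ,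
      inner-mono (λ { x (j , p) → inc j (f x) p }) ℚ.≤-refl (family Bs dis inc)

  outer-preimage : ∀ (f : (Fin d → ℚ) → Fin d → ℚ) {c} → 0ℚ ≤ c →
    (∀ B → OuterContent (λ x → points B (f x)) (c * vol B)) → OuterContent S v → OuterContent (λ x → S (f x)) (c * v)
  outer-preimage {S = S} {v = v} f {c} hc box O = outer-limit λ ε hε → go ε (shrink hc hε)
    where
    family : ∀ {n} (Bs : Fin n → Box _) → OuterContent (λ x → ∃[ j ] points (Bs j) (f x)) (c * sum (vol ∘ Bs))
    family {zero} Bs = outer-mono (λ x p → p) (ℚ.≤-reflexive (sym (*-zeroʳ c))) (outer-∅ λ { x (() , _) })
    family {suc n} Bs = subst (OuterContent _) (sym (distribˡ c _ _))
      (outer-∪ (λ { x (zero , p) → inj₁ p ; x (suc j , p) → inj₂ (j , p) }) (box (Bs zero)) (family (Bs ∘ suc)))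
    go : ∀ ε → (∃[ η ] 0ℚ < η × c * η ≤ ε) → ∃[ v′ ] v′ ≤ c * v + ε × OuterContent (λ x → S (f x)) v′
    go ε (η , 0<η , lη) with w , lw , n , Bs , cov , refl ← O η 0<η =
      c * w , ℚ.≤-trans (*-monoˡ hc lw) (subst (_≤ _) (sym (distribˡ c v η)) (+-monoʳ-≤ (c * v) lη)) ,
      outer-mono (λ x p → cov (f x) p) ℚ.≤-refl (family Bs)
  -- Translations, scalings and shears

  <-≤-connex : ∀ p q → p < q ⊎ q ≤ p
  <-≤-connex p q with p ℚ.<? q
  ... | yes lt = inj₁ lt
  ... | no nlt = inj₂ (ℚ.≮⇒≥ nlt)

  neg-≤ : ∀ {p q} → p ≤ q → - q ≤ - p
  neg-≤ {p} {q} h = undiff-≤ (subst (0ℚ ≤_) (lem p q) (diff-≤ h))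
    where
    opaque
      unfolding ring
      lem : ∀ p q → q - p ≡ - p - - q
      lem = solve-∀ ring

  neg-< : ∀ {p q} → p < q → - q < - p
  neg-< {p} {q} h = undiff-< (subst (0ℚ <_) (lem p q) (diff-< h))
    where
    opaque
      unfolding ring
      lem : ∀ p q → q - p ≡ - p - - q
      lem = solve-∀ ring

  opaque
    unfolding ring
    neg-neg : ∀ x → - - x ≡ x
    neg-neg = solve-∀ ring

  0<∣∣ : ∀ {p} → p ≢ 0ℚ → 0ℚ < ∣ p ∣
  0<∣∣ {p} ne with <-≤-connex 0ℚ ∣ p ∣
  ... | inj₁ h = h
  ... | inj₂ h = contradiction (∣∣≡0 (ℚ.≤-antisym h (0≤∣∣ p))) ne

  move-+ : ∀ {a b c} → a ≤ b + c → a - c ≤ b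
  move-+ {a} {b} {c} h = subst (a - c ≤_) (lem b c) (+-monoˡ-≤ (- c) h)
    where
    opaque
      unfolding ring
      lem : ∀ b c → b + c - c ≡ b
      lem = solve-∀ ring

  move-- : ∀ {a b c} → a - c ≤ b → a ≤ b + c
  move-- {a} {b} {c} h = subst (_≤ b + c) (lem a c) (+-monoˡ-≤ c h)
    where
    opaque
      unfolding ring
      lem : ∀ b c → b - c + c ≡ b
      lem = solve-∀ ring

  move-+< : ∀ {a b c} → a + c < b → a < b - c
  move-+< {a} {b} {c} h = subst (_< b - c) (lem a c) (+-monoˡ-< (- c) h)
    where
    opaque
      unfolding ring
      lem : ∀ b c → b + c - c ≡ b
      lem = solve-∀ ring

  move--< : ∀ {a b c} → a < b - c → a + c < b
  move--< {a} {b} {c} h = subst (a + c <_) (lem b c) (+-monoˡ-< c h)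
    where
    opaque
      unfolding ring
      lem : ∀ b c → b - c + c ≡ b
      lem = solve-∀ ring

  translateBox : (Fin d → ℚ) → Box d → Box d
  translateBox p B = record
    { lower = λ i → lower B i - p i ; upper = λ i → upper B i - p i
    ; ordered = λ i → +-monoˡ-≤ (- p i) (ordered B i) }

  vol-translateBox : ∀ (p : Fin d → ℚ) B → vol (translateBox p B) ≡ vol B
  vol-translateBox p B = product-cong λ i → lem (upper B i) (lower B i) (p i)
    where
    opaque
      unfolding ring
      lem : ∀ a b c → a - c - (b - c) ≡ a - b
      lem = solve-∀ ring

  inner-translate : ∀ (p : Fin d → ℚ) → InnerContent S v → InnerContent (λ x → S (λ i → x i + p i)) v
  inner-translate p I = subst (InnerContent _) (*-identityˡ _) (inner-preimage _ 0≤1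
    (λ B → subst (InnerContent _) (trans (vol-translateBox p B) (sym (*-identityˡ _))) (inner-box (translateBox p B)
      λ x h i → move-- (proj₁ (h i)) , move--< (proj₂ (h i)))) I)

  outer-translate : ∀ (p : Fin d → ℚ) → OuterContent S v → OuterContent (λ x → S (λ i → x i + p i)) v
  outer-translate p O = subst (OuterContent _) (*-identityˡ _) (outer-preimage _ 0≤1
    (λ B → subst (OuterContent _) (trans (vol-translateBox p B) (sym (*-identityˡ _))) (outer-box (translateBox p B)
      λ x h i → move-+ (proj₁ (h i)) , move-+< (proj₂ (h i)))) O)

  infixl 30 _[_≔_]

  _[_≔_] : ∀ {A : Set} → (Fin n → A) → Fin n → A → Fin n → A
  (f [ i ≔ a ]) r with r Fin.≟ i
  ... | yes _ = a
  ... | no _ = f r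

  ≔-hit : ∀ {A : Set} (f : Fin n → A) i a → (f [ i ≔ a ]) i ≡ a
  ≔-hit f i a with i Fin.≟ i
  ... | yes _ = refl
  ... | no ne = contradiction refl ne

  ≔-miss : ∀ {A : Set} (f : Fin n → A) i a {r} → r ≢ i → (f [ i ≔ a ]) r ≡ f r
  ≔-miss f i a {r} ne with r Fin.≟ i
  ... | yes e = contradiction e ne
  ... | no _ = refl

  resize : (B : Box d) (i : Fin d) (a b : ℚ) → a ≤ b → Box d
  resize B i a b le = record { lower = lower B [ i ≔ a ] ; upper = upper B [ i ≔ b ] ; ordered = ord }
    where
    ord : ∀ r → (lower B [ i ≔ a ]) r ≤ (upper B [ i ≔ b ]) r
    ord r with r Fin.≟ i
    ... | yes _ = le
    ... | no _ = ordered B r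

  resize⁺ : ∀ (B : Box d) i a b le x → a ≤ x i → x i < b → (∀ r → r ≢ i → lower B r ≤ x r × x r < upper B r) →
    points (resize B i a b le) x
  resize⁺ B i a b le x l u h r with r Fin.≟ i
  ... | yes refl = l , u
  ... | no ne = h r ne

  resize⁻ : ∀ (B : Box d) i a b le x → points (resize B i a b le) x →
    (a ≤ x i × x i < b) × (∀ r → r ≢ i → lower B r ≤ x r × x r < upper B r)
  resize⁻ B i a b le x p = subst₂ (λ l u → l ≤ x i × x i < u) (≔-hit (lower B) i a) (≔-hit (upper B) i b) (p i) ,
    λ r ne → subst₂ (λ l u → l ≤ x r × x r < u) (≔-miss (lower B) i a ne) (≔-miss (upper B) i b ne) (p r)

  product-≥0 : ∀ {f : Fin n → ℚ} → (∀ i → 0ℚ ≤ f i) → 0ℚ ≤ product f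
  product-≥0 {zero} h = 0≤1
  product-≥0 {suc n} h = 0≤* (h zero) (product-≥0 (h ∘ suc))

  -- The content of a face of the box orthogonal to direction i, by which a change of length in this
  -- direction is multiplied.
  coarea : Box (suc d) → Fin (suc d) → ℚ
  coarea B i = product λ r → upper B (punchIn i r) - lower B (punchIn i r)

  coarea-≥0 : ∀ (B : Box (suc d)) i → 0ℚ ≤ coarea B i
  coarea-≥0 B i = product-≥0 λ r → diff-≤ (ordered B (punchIn i r))

  vol-coarea : ∀ (B : Box (suc d)) i → vol B ≡ (upper B i - lower B i) * coarea B i
  vol-coarea B i = product-remove {i = i} (λ r → upper B r - lower B r)

  vol-resize : ∀ (B : Box (suc d)) i a b le → vol (resize B i a b le) ≡ (b - a) * coarea B i
  vol-resize B i a b le = trans (vol-coarea (resize B i a b le) i)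
    (cong₂ _*_ (cong₂ _-_ (≔-hit (upper B) i b) (≔-hit (lower B) i a))
      (product-cong λ r → cong₂ _-_ (≔-miss (upper B) i b (Fin.punchInᵢ≢i i r))
          (≔-miss (lower B) i a (Fin.punchInᵢ≢i i r))))

  -- `R` is the product of the widths in the directions other than i and j. It is common to all
  -- boxes that differ from B in these two directions only, so that slices of a sheared box can be
  -- added up.
  vol-resize² : ∀ (B : Box d) i j → i ≢ j → ∃[ R ] 0ℚ ≤ R × vol B ≡ (upper B i - lower B i) *
      ((upper B j - lower B j) * R) ×
    (∀ a b le p q le′ → vol (resize (resize B j p q le′) i a b le) ≡ (b - a) * ((q - p) * R))
  vol-resize² {suc zero} B zero zero ne = contradiction refl ne
  vol-resize² {suc (suc d)} B i j i≢j = R , product-≥0 {n = d} (λ r → diff-≤ (ordered B (punchIn i (punchIn k r)))) ,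
    trans (vol-coarea B i) (cong ((upper B i - lower B i) *_) (coarea≡ B)) ,
    λ a b le p q le′ → trans (vol-resize (resize B j p q le′) i a b le)
      (cong ((b - a) *_) (trans (coarea≡ (resize B j p q le′)) (cong₂ _*_
        (cong₂ _-_ (≔-hit (upper B) j q) (≔-hit (lower B) j p))
        (product-cong λ r → cong₂ _-_ (≔-miss (upper B) j q (≢j r)) (≔-miss (lower B) j p (≢j r))))))
    where
    k : Fin (suc d)
    k = punchOut i≢j
    width : Box (suc (suc d)) → Fin (suc (suc d)) → ℚ
    width B r = upper B r - lower B r
    R : ℚ
    R = product λ r → width B (punchIn i (punchIn k r))
    ≢j : ∀ r → punchIn i (punchIn k r) ≢ j
    ≢j r e = Fin.punchInᵢ≢i k r (Fin.punchIn-injective i _ _ (trans e (sym (Fin.punchIn-punchOut i≢j))))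
    coarea≡ : ∀ B → coarea B i ≡ width B j * product (λ r → width B (punchIn i (punchIn k r)))
    coarea≡ B = trans (product-remove {i = k} (λ r → width B (punchIn i r)))
      (cong (λ x → width B x * product (λ r → width B (punchIn i (punchIn k r)))) (Fin.punchIn-punchOut i≢j))

  scaleMap : Fin d → ℚ → (Fin d → ℚ) → Fin d → ℚ
  scaleMap i c x = x [ i ≔ c * x i ]

  shearMap : Fin d → Fin d → ℚ → (Fin d → ℚ) → Fin d → ℚ
  shearMap i j c x = x [ i ≔ x i + c * x j ]

  module ScaleBox {d} (B : Box (suc d)) (i : Fin (suc d)) (c : ℚ) (c≢0 : c ≢ 0ℚ) where

    l u R k : ℚ
    l = lower B i
    u = upper B i
    R = coarea B i
    k = ∣ c ∣ ⁻¹

    0<∣c∣ : 0ℚ < ∣ c ∣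
    0<∣c∣ = 0<∣∣ c≢0

    0<k : 0ℚ < k
    0<k = 0<⁻¹ 0<∣c∣

    ck : ∣ c ∣ * k ≡ 1ℚ
    ck = ⁻¹-inverse (>⇒≢0 0<∣c∣)

    P : Subset (suc d)
    P x = points B (scaleMap i c x)

    P⁺ : ∀ x → l ≤ c * x i → c * x i < u → (∀ r → r ≢ i → lower B r ≤ x r × x r < upper B r) → P x
    P⁺ x h h′ o r with r Fin.≟ i
    ... | yes refl = h , h′
    ... | no ne = o r ne

    P⁻ : ∀ x → P x → (l ≤ c * x i × c * x i < u) × (∀ r → r ≢ i → lower B r ≤ x r × x r < upper B r)
    P⁻ x p = subst (λ y → l ≤ y × y < u) (≔-hit x i _) (p i) ,
      λ r ne → subst (λ y → lower B r ≤ y × y < upper B r) (≔-miss x i _ ne) (p r)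

    opaque
      unfolding ring
      lem : ∀ k u l R → (k * u - k * l) * R ≡ k * ((u - l) * R)
      lem = solve-∀ ring

    module Pos (pos : ∣ c ∣ ≡ c) where
      0<c : 0ℚ < c
      0<c = subst (0ℚ <_) pos 0<∣c∣
      ck′ : c * k ≡ 1ℚ
      ck′ = trans (cong (_* k) (sym pos)) ck
      ckx : ∀ x → c * (k * x) ≡ x
      ckx x = trans (sym (*-assoc c k x)) (trans (cong (_* x) ck′) (*-identityˡ x))
      kl≤ku : k * l ≤ k * u
      kl≤ku = *-monoˡ (ℚ.<⇒≤ 0<k) (ordered B i)
      box : Box (suc d)
      box = resize B i (k * l) (k * u) kl≤ku
      vol-box : vol box ≡ k * vol B
      vol-box = trans (vol-resize B i (k * l) (k * u) kl≤ku)
          (trans (lem k u l R) (cong (k *_) (sym (vol-coarea B i))))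
      inner : InnerContent P (k * vol B)
      inner = subst (InnerContent P) vol-box (inner-box box λ x p → let q , o = resize⁻ B i _ _ kl≤ku x p in
        P⁺ x (subst (_≤ c * x i) (ckx l) (*-monoˡ (ℚ.<⇒≤ 0<c) (proj₁ q)))
            (subst (c * x i <_) (ckx u) (*-monoˡ-< 0<c (proj₂ q))) o)
      outer : OuterContent P (k * vol B)
      outer = subst (OuterContent P) vol-box (outer-box box λ x p → let q , o = P⁻ x p in
        resize⁺ B i _ _ kl≤ku x (*-cancel-≤ 0<c (subst (_≤ c * x i) (sym (ckx l)) (proj₁ q)))
          (*-cancel-< (ℚ.<⇒≤ 0<c) (subst (c * x i <_) (sym (ckx u)) (proj₂ q))) o)

    -- A reflection turns [l , u) into (- u , - l], which is moved by η to be half-open on the right side.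
    module Neg (neg : ∣ c ∣ ≡ - c) where
      ckx : ∀ x → - c * (k * x) ≡ x
      ckx x = trans (sym (*-assoc (- c) k x)) (trans (cong (λ a → a * k * x) (sym neg))
          (trans (cong (_* x) ck) (*-identityˡ x)))
      0<-c : 0ℚ < - c
      0<-c = subst (0ℚ <_) neg 0<∣c∣
      flip : ∀ x → - (c * x) ≡ - c * x
      flip = lem′ c
        where
        opaque
          unfolding ring
          lem′ : ∀ c x → - (c * x) ≡ - c * x
          lem′ = solve-∀ ring
      a b : ℚ
      a = k * (- u)
      b = k * (- l)
      a≤b : a ≤ b
      a≤b = *-monoˡ (ℚ.<⇒≤ 0<k) (neg-≤ (ordered B i))
      opaque
        unfolding ring
        lem₂ : ∀ k u l R → k * ((u - l) * R) ≡ (k * (- l) - k * (- u)) * R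
        lem₂ = solve-∀ ring
      k*vol : k * vol B ≡ (b - a) * R
      k*vol = trans (cong (k *_) (vol-coarea B i)) (lem₂ k u l R)
      from : ∀ (x : Fin (suc d) → ℚ) → - c * a < - c * x i → - c * x i ≤ - c * b → l ≤ c * x i × c * x i < u
      from x h h′ = subst₂ _≤_ (neg-neg l) (trans (cong -_ (sym (flip (x i)))) (neg-neg _))
          (neg-≤ (subst (- c * x i ≤_) (ckx (- l)) h′)) ,
        subst₂ _<_ (trans (cong -_ (sym (flip (x i)))) (neg-neg _)) (neg-neg u)
            (neg-< (subst (_< - c * x i) (ckx (- u)) h))
      to : ∀ (x : Fin (suc d) → ℚ) → l ≤ c * x i → c * x i < u → a ≤ x i × x i ≤ b
      to x h h′ = ℚ.<⇒≤ (*-cancel-< (ℚ.<⇒≤ 0<-c) (subst₂ _<_ (sym (ckx (- u))) (flip (x i)) (neg-< h′))) ,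
        *-cancel-≤ 0<-c (subst₂ _≤_ (flip (x i)) (sym (ckx (- l))) (neg-≤ h))
      opaque
        unfolding ring
        lem₃ : ∀ a b h R → (b - a) * R ≡ (b - (a + h)) * R + R * h
        lem₃ = solve-∀ ring
        lem₄ : ∀ a b h R → (b + h - a) * R ≡ (b - a) * R + R * h
        lem₄ = solve-∀ ring
      inner : InnerContent P (k * vol B)
      inner = inner-limit λ ε hε → go ε (shrink (coarea-≥0 B i) hε)
        where
        go : ∀ ε → ∃[ η ] 0ℚ < η × R * η ≤ ε → ∃[ v′ ] k * vol B ≤ v′ + ε × InnerContent P v′
        go ε (η , 0<η , lη) = (b - (a + η)) * R , ℚ.≤-trans (ℚ.≤-reflexive (trans k*vol (lem₃ a b η R)))
            (+-monoʳ-≤ _ lη) , content (ℚ.≤-total (a + η) b)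
          where
          content : a + η ≤ b ⊎ b ≤ a + η → InnerContent P ((b - (a + η)) * R)
          content (inj₁ le) = subst (InnerContent P) (vol-resize B i (a + η) b le)
              (inner-box (resize B i (a + η) b le) λ x p →
            let q , o = resize⁻ B i _ _ le x p
                r = from x (*-monoˡ-< 0<-c (ℚ.<-≤-trans (<-by η 0<η refl) (proj₁ q)))
                    (*-monoˡ (ℚ.<⇒≤ 0<-c) (ℚ.<⇒≤ (proj₂ q)))
            in P⁺ x (proj₁ r) (proj₂ r) o)
          content (inj₂ le) = inner-∅ (subst ((b - (a + η)) * R ≤_) (*-zeroˡ R) (*-monoʳ (coarea-≥0 B i)
            (subst (b - (a + η) ≤_) (+-inverseʳ (a + η)) (+-monoˡ-≤ (- (a + η)) le))))
      outer : OuterContent P (k * vol B)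
      outer = outer-limit λ ε hε → go ε (shrink (coarea-≥0 B i) hε)
        where
        go : ∀ ε → ∃[ η ] 0ℚ < η × R * η ≤ ε → ∃[ v′ ] v′ ≤ k * vol B + ε × OuterContent P v′
        go ε (η , 0<η , lη) = (b + η - a) * R ,
            ℚ.≤-trans (ℚ.≤-reflexive (trans (lem₄ a b η R) (cong (_+ R * η) (sym k*vol))))
            (+-monoʳ-≤ (k * vol B) lη) ,
          subst (OuterContent P) (vol-resize B i a (b + η) le) (outer-box (resize B i a (b + η) le) λ x p →
            let q , o = P⁻ x p ; r = to x (proj₁ q) (proj₂ q) in
            resize⁺ B i _ _ le x (proj₁ r) (ℚ.≤-<-trans (proj₂ r) (<-by η 0<η refl)) o)
          where
          le : a ≤ b + η
          le = ℚ.≤-trans a≤b (≤+ 0<η)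

    inner : InnerContent P (k * vol B)
    inner with ∣∣-cases c
    ... | inj₁ e = Pos.inner e
    ... | inj₂ e = Neg.inner e

    outer : OuterContent P (k * vol B)
    outer with ∣∣-cases c
    ... | inj₁ e = Pos.outer e
    ... | inj₂ e = Neg.outer e

  inner-scale : ∀ (i : Fin d) c → c ≢ 0ℚ → InnerContent S v → InnerContent (λ x → S (scaleMap i c x)) (∣ c ∣ ⁻¹ * v)
  inner-scale {suc d} i c c≢0 = inner-preimage (scaleMap i c) (ℚ.<⇒≤ (0<⁻¹ (0<∣∣ c≢0))) λ B → ScaleBox.inner B i c c≢0

  outer-scale : ∀ (i : Fin d) c → c ≢ 0ℚ → OuterContent S v → OuterContent (λ x → S (scaleMap i c x)) (∣ c ∣ ⁻¹ * v)
  outer-scale {suc d} i c c≢0 = outer-preimage (scaleMap i c) (ℚ.<⇒≤ (0<⁻¹ (0<∣∣ c≢0))) λ B → ScaleBox.outer B i c c≢0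

  -- `μ` is the value of t ↦ c t at the left or at the right end of the interval, according to the
  -- sign of c.
  linear-range : ∀ c p h → 0ℚ ≤ h → ∃[ μ ] ∀ t → p ≤ t → t ≤ p + h → μ ≤ c * t × c * t ≤ μ + ∣ c ∣ * h
  linear-range c p h 0≤h with ∣∣-cases c
  ... | inj₁ e = c * p , λ t l u → *-monoˡ 0≤c l , ℚ.≤-trans (*-monoˡ 0≤c u)
      (ℚ.≤-reflexive (trans (distribˡ c p h) (cong (λ a → c * p + a * h) (sym e))))
    where
    0≤c : 0ℚ ≤ c
    0≤c = subst (0ℚ ≤_) e (0≤∣∣ c)
  ... | inj₂ e = c * (p + h) , λ t l u →
      undiff-≤ (subst (0ℚ ≤_) (lem₁ c t (p + h)) (0≤* 0≤-c (diff-≤ u))) ,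
      ℚ.≤-trans (undiff-≤ (subst (0ℚ ≤_) (lem₂ c t p h) (0≤* 0≤-c (diff-≤ l))))
          (ℚ.≤-reflexive (cong (λ a → c * (p + h) + a * h) (sym e)))
    where
    0≤-c : 0ℚ ≤ - c
    0≤-c = subst (0ℚ ≤_) e (0≤∣∣ c)
    opaque
      unfolding ring
      lem₁ : ∀ c t q → - c * (q - t) ≡ c * t - c * q
      lem₁ = solve-∀ ring
      lem₂ : ∀ c t p h → - c * (t - p) ≡ c * (p + h) + - c * h - c * t
      lem₂ = solve-∀ ring

  -- A sheared box is cut across direction j into slices of thickness h, each of which is a box in
  -- direction i up to ∣c∣ h.
  module ShearBox {d} (B : Box d) (i j : Fin d) (i≢j : i ≢ j) (c : ℚ) where

    l u W R : ℚ
    l = lower B i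
    u = upper B i
    W = u - l
    R = proj₁ (vol-resize² B i j i≢j)

    0≤R : 0ℚ ≤ R
    0≤R = proj₁ (proj₂ (vol-resize² B i j i≢j))

    vol-B : vol B ≡ W * ((upper B j - lower B j) * R)
    vol-B = proj₁ (proj₂ (proj₂ (vol-resize² B i j i≢j)))

    vol-slice : ∀ a b le p q le′ → vol (resize (resize B j p q le′) i a b le) ≡ (b - a) * ((q - p) * R)
    vol-slice = proj₂ (proj₂ (proj₂ (vol-resize² B i j i≢j)))

    Q : ℚ → ℚ → Subset d
    Q p q x = (l ≤ x i + c * x j × x i + c * x j < u) × (p ≤ x j × x j < q) ×
      (∀ r → r ≢ i → r ≢ j → lower B r ≤ x r × x r < upper B r)

    opaque
      unfolding ring
      lem-slice : ∀ u l μ h → u - (μ + h) - (l - μ) ≡ u - l - h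
      lem-slice = solve-∀ ring
      lem-slice⁺ : ∀ u l μ h → u - μ - (l - (μ + h)) ≡ u - l + h
      lem-slice⁺ = solve-∀ ring
      p+h-p : ∀ p h → p + h - p ≡ h
      p+h-p = solve-∀ ring
      undo : ∀ x y → x - y + y ≡ x
      undo = solve-∀ ring

    inner-slice : ∀ p h → 0ℚ ≤ h → InnerContent (Q p (p + h)) ((W - ∣ c ∣ * h) * (h * R))
    inner-slice p h 0≤h with linear-range c p h 0≤h
    ... | μ , range with ℚ.≤-total (l - μ) (u - (μ + ∣ c ∣ * h))
    -- If the side W is no longer than the variation of the shear across the slice, the claimed
    -- value is not positive and the empty packing suffices.
    ...   | inj₂ le = inner-∅ (subst₂ _≤_ (cong (_* (h * R)) (lem-slice u l μ (∣ c ∣ * h))) (*-zeroˡ (h * R))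
              (*-monoʳ (0≤* 0≤h 0≤R) (subst (u - (μ + ∣ c ∣ * h) - (l - μ) ≤_) (+-inverseʳ (l - μ))
                  (+-monoˡ-≤ (- (l - μ)) le))))
    ...   | inj₁ le = subst (InnerContent (Q p (p + h)))
        (trans (vol-slice _ _ le p (p + h) p≤)
            (trans (cong (λ a → (u - (μ + ∣ c ∣ * h) - (l - μ)) * (a * R)) (p+h-p p h))
            (cong (_* (h * R)) (lem-slice u l μ (∣ c ∣ * h)))))
        (inner-box (resize (resize B j p (p + h) p≤) i (l - μ) (u - (μ + ∣ c ∣ * h)) le) inside)
      where
      p≤ : p ≤ p + h
      p≤ = ≤-by h 0≤h refl
      inside : ∀ x → points (resize (resize B j p (p + h) p≤) i (l - μ) (u - (μ + ∣ c ∣ * h)) le) x → Q p (p + h) x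
      inside x pt = (subst (_≤ x i + c * x j) (undo l μ) (+-mono-≤ (proj₁ qᵢ) (proj₁ r)) ,
          subst (x i + c * x j <_) (undo u (μ + ∣ c ∣ * h)) (+-mono-<-≤ (proj₂ qᵢ) (proj₂ r))) ,
          qⱼ , λ s si sj → subst₂ (λ a b → a ≤ x s × x s < b) (≔-miss (lower B) j p sj)
              (≔-miss (upper B) j (p + h) sj) (o s si)
        where
        i-part = resize⁻ (resize B j p (p + h) p≤) i _ _ le x pt
        qᵢ = proj₁ i-part
        o = proj₂ i-part
        qⱼ : p ≤ x j × x j < p + h
        qⱼ = subst₂ (λ a b → a ≤ x j × x j < b) (≔-hit (lower B) j p) (≔-hit (upper B) j (p + h)) (o j (i≢j ∘ sym))
        r = range (x j) (proj₁ qⱼ) (ℚ.<⇒≤ (proj₂ qⱼ))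

    outer-slice : ∀ p h → 0ℚ ≤ h → OuterContent (Q p (p + h)) ((W + ∣ c ∣ * h) * (h * R))
    outer-slice p h 0≤h with linear-range c p h 0≤h
    ... | μ , range = subst (OuterContent (Q p (p + h)))
        (trans (vol-slice _ _ le p (p + h) p≤) (cong₂ (λ a b → a * (b * R)) (lem-slice⁺ u l μ (∣ c ∣ * h))
            (p+h-p p h)))
        (outer-box (resize (resize B j p (p + h) p≤) i (l - (μ + ∣ c ∣ * h)) (u - μ) le) inside)
      where
      p≤ : p ≤ p + h
      p≤ = ≤-by h 0≤h refl
      le : l - (μ + ∣ c ∣ * h) ≤ u - μ
      le = undiff-≤ (subst (0ℚ ≤_) (sym (lem-slice⁺ u l μ (∣ c ∣ * h)))
          (0≤+ (diff-≤ (ordered B i)) (0≤* (0≤∣∣ c) 0≤h)))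
      opaque
        unfolding ring
        cancel : ∀ x y → x + y - y ≡ x
        cancel = solve-∀ ring
      inside : ∀ x → Q p (p + h) x → points (resize (resize B j p (p + h) p≤) i (l - (μ + ∣ c ∣ * h)) (u - μ) le) x
      inside x ((h₁ , h₂) , qⱼ , o) = resize⁺ (resize B j p (p + h) p≤) i _ _ le x
          (subst (l - (μ + ∣ c ∣ * h) ≤_) (cancel (x i) (c * x j)) (+-mono-≤ h₁ (neg-≤ (proj₂ r))))
          (subst (_< u - μ) (cancel (x i) (c * x j)) (+-mono-<-≤ h₂ (neg-≤ (proj₁ r))))
          others
        where
        r = range (x j) (proj₁ qⱼ) (ℚ.<⇒≤ (proj₂ qⱼ))
        others : ∀ s → s ≢ i → (lower B [ j ≔ p ]) s ≤ x s × x s < (upper B [ j ≔ p + h ]) s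
        others s si with s Fin.≟ j
        ... | yes refl = qⱼ
        ... | no sj = o s si sj

    +-step : ∀ p n h → p + h + fromNat n * h ≡ p + fromNat (suc n) * h
    +-step p n h = trans (lem p (fromNat n) h) (cong (λ a → p + a * h) (sym (fromNat-suc n)))
      where
      opaque
        unfolding ring
        lem : ∀ p n h → p + h + n * h ≡ p + (1ℚ + n) * h
        lem = solve-∀ ring

    *-step : ∀ n x → x + fromNat n * x ≡ fromNat (suc n) * x
    *-step n x = trans (lem (fromNat n) x) (cong (_* x) (sym (fromNat-suc n)))
      where
      opaque
        unfolding ring
        lem : ∀ n x → x + n * x ≡ (1ℚ + n) * x
        lem = solve-∀ ring

    p≤p+nh : ∀ p n {h} → 0ℚ ≤ h → p ≤ p + fromNat n * h
    p≤p+nh p n {h} 0≤h = ≤-by (fromNat n * h) (0≤* (0≤fromNat n) 0≤h) refl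

    inner-slices : ∀ n p h → 0ℚ ≤ h → InnerContent (Q p (p + fromNat n * h)) (fromNat n * ((W - ∣ c ∣ * h) * (h * R)))
    inner-slices zero p h 0≤h = inner-∅ (ℚ.≤-reflexive (*-zeroˡ _))
    inner-slices (suc n) p h 0≤h = subst (InnerContent _) (*-step n _) (inner-∪
      (λ x s₁ s₂ → ℚ.<-irrefl refl (ℚ.<-≤-trans (proj₂ (proj₁ (proj₂ s₁))) (proj₁ (proj₁ (proj₂ s₂)))))
      (λ x s → proj₁ s , (proj₁ (proj₁ (proj₂ s)) , ℚ.<-≤-trans (proj₂ (proj₁ (proj₂ s)))
          (ℚ.≤-trans (p≤p+nh (p + h) n 0≤h) (ℚ.≤-reflexive (+-step p n h)))) , proj₂ (proj₂ s))
      (λ x s → proj₁ s , (ℚ.≤-trans (≤-by h 0≤h refl) (proj₁ (proj₁ (proj₂ s))) , subst (x j <_) (+-step p n h)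
          (proj₂ (proj₁ (proj₂ s)))) , proj₂ (proj₂ s))
      (inner-slice p h 0≤h) (inner-slices n (p + h) h 0≤h))

    outer-slices : ∀ n p h → 0ℚ ≤ h → OuterContent (Q p (p + fromNat n * h)) (fromNat n * ((W + ∣ c ∣ * h) * (h * R)))
    outer-slices zero p h 0≤h = outer-mono (λ x s → s) (ℚ.≤-reflexive (sym (*-zeroˡ _))) (outer-∅ λ x s →
      ℚ.<-irrefl refl (ℚ.<-≤-trans (proj₂ (proj₁ (proj₂ s)))
          (subst (_≤ x j) (sym (trans (cong (_+_ p) (*-zeroˡ h)) (+-identityʳ p))) (proj₁ (proj₁ (proj₂ s))))))
    outer-slices (suc n) p h 0≤h = subst (OuterContent _) (*-step n _) (outer-∪ split (outer-slice p h 0≤h)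
        (outer-slices n (p + h) h 0≤h))
      where
      split : ∀ x → Q p (p + fromNat (suc n) * h) x → Q p (p + h) x ⊎ Q (p + h) (p + h + fromNat n * h) x
      split x (a , (b , b′) , o) with <-≤-connex (x j) (p + h)
      ... | inj₁ lt = inj₁ (a , (b , lt) , o)
      ... | inj₂ ge = inj₂ (a , (ge , subst (x j <_) (sym (+-step p n h)) b′) , o)

    P : Subset d
    P x = points B (shearMap i j c x)

    Q⇒P : ∀ x → Q (lower B j) (upper B j) x → P x
    Q⇒P x (a , b , o) r with r Fin.≟ i
    ... | yes refl = a
    ... | no ri with r Fin.≟ j
    ...   | yes refl = b
    ...   | no rj = o r ri rj

    P⇒Q : ∀ x → P x → Q (lower B j) (upper B j) x
    P⇒Q x p = subst (λ y → l ≤ y × y < u) (≔-hit x i _) (p i) ,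
      subst (λ y → lower B j ≤ y × y < upper B j) (≔-miss x i _ (i≢j ∘ sym)) (p j) ,
      λ r ri rj → subst (λ y → lower B r ≤ y × y < upper B r) (≔-miss x i _ ri) (p r)

    L : ℚ
    L = upper B j - lower B j

    0≤L : 0ℚ ≤ L
    0≤L = diff-≤ (ordered B j)

    end : ∀ {a} → a ≡ L → lower B j + a ≡ upper B j
    end refl = lem (lower B j) (upper B j)
      where
      opaque
        unfolding ring
        lem : ∀ l u → l + (u - l) ≡ u
        lem = solve-∀ ring

    inner : InnerContent P (vol B)
    inner = inner-limit λ ε hε → go ε (subdivide 0≤L (0≤* (0≤* (0≤∣∣ c) 0≤L) 0≤R) hε)
      where
      opaque
        unfolding ring
        lem : ∀ W c N h R → W * (N * h * R) ≡ N * ((W - c * h) * (h * R)) + c * (N * h) * R * h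
        lem = solve-∀ ring
      go : ∀ ε → ∃[ n ] ∃[ h ] (0ℚ < L → 0ℚ < h) × 0ℚ ≤ h × fromNat (suc n) * h ≡ L × ∣ c ∣ * L * R * h ≤ ε →
        ∃[ v′ ] vol B ≤ v′ + ε × InnerContent P v′
      go ε (n , h , _ , 0≤h , Nh , small) = fromNat (suc n) * ((W - ∣ c ∣ * h) * (h * R)) ,
        ℚ.≤-trans (ℚ.≤-reflexive
            (trans vol-B (trans (cong (λ L → W * (L * R)) (sym Nh)) (lem W ∣ c ∣ (fromNat (suc n)) h R))))
          (+-monoʳ-≤ _ (subst (λ L → ∣ c ∣ * L * R * h ≤ ε) (sym Nh) small)) ,
        inner-mono (λ x s → Q⇒P x (subst (λ q → Q (lower B j) q x) (end Nh) s)) ℚ.≤-refl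
            (inner-slices (suc n) (lower B j) h 0≤h)

    outer : OuterContent P (vol B)
    outer = outer-limit λ ε hε → go ε (subdivide 0≤L (0≤* (0≤* (0≤∣∣ c) 0≤L) 0≤R) hε)
      where
      opaque
        unfolding ring
        lem : ∀ W c N h R → N * ((W + c * h) * (h * R)) ≡ W * (N * h * R) + c * (N * h) * R * h
        lem = solve-∀ ring
      go : ∀ ε → ∃[ n ] ∃[ h ] (0ℚ < L → 0ℚ < h) × 0ℚ ≤ h × fromNat (suc n) * h ≡ L × ∣ c ∣ * L * R * h ≤ ε →
        ∃[ v′ ] v′ ≤ vol B + ε × OuterContent P v′
      go ε (n , h , _ , 0≤h , Nh , small) = fromNat (suc n) * ((W + ∣ c ∣ * h) * (h * R)) ,
        ℚ.≤-trans (ℚ.≤-reflexive (trans (lem W ∣ c ∣ (fromNat (suc n)) h R)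
            (cong (_+ ∣ c ∣ * (fromNat (suc n) * h) * R * h) (trans (cong (λ L → W * (L * R)) Nh) (sym vol-B)))))
          (+-monoʳ-≤ (vol B) (subst (λ L → ∣ c ∣ * L * R * h ≤ ε) (sym Nh) small)) ,
        outer-mono (λ x s → subst (λ q → Q (lower B j) q x) (sym (end Nh)) (P⇒Q x s)) ℚ.≤-refl
            (outer-slices (suc n) (lower B j) h 0≤h)

  inner-shear : ∀ (i j : Fin d) c → i ≢ j → InnerContent S v → InnerContent (λ x → S (shearMap i j c x)) v
  inner-shear i j c i≢j I = subst (InnerContent _) (*-identityˡ _) (inner-preimage (shearMap i j c) 0≤1
    (λ B → subst (InnerContent _) (sym (*-identityˡ _)) (ShearBox.inner B i j i≢j c)) I)

  outer-shear : ∀ (i j : Fin d) c → i ≢ j → OuterContent S v → OuterContent (λ x → S (shearMap i j c x)) v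
  outer-shear i j c i≢j O = subst (OuterContent _) (*-identityˡ _) (outer-preimage (shearMap i j c) 0≤1
    (λ B → subst (OuterContent _) (sym (*-identityˡ _)) (ShearBox.outer B i j i≢j c)) O)

  -- Content under invertible matrices

  record Content (S : Subset d) (v : ℚ) : Set where
    constructor content
    field
      inner : InnerContent S v
      outer : OuterContent S v

  Extensional : Subset d → Set
  Extensional S = ∀ {x y} → (∀ i → x i ≡ y i) → S x → S y

  content-resp : (∀ x → S x → S′ x) → (∀ x → S′ x → S x) → v₁ ≡ v₂ → Content S v₁ → Content S′ v₂
  content-resp f g refl (content I O) = content (inner-mono f ℚ.≤-refl I) (outer-mono g ℚ.≤-refl O)

  ∣∣-⁻¹-* : ∀ {p q} → p ≢ 0ℚ → q ≢ 0ℚ → ∣ p ∣ ⁻¹ * ∣ q ∣ ⁻¹ ≡ ∣ p * q ∣ ⁻¹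
  ∣∣-⁻¹-* {p} {q} hp hq = *-cancel-≡ {∣ p * q ∣} (λ e → *-≢0 hp hq (∣∣≡0 e))
      (trans (cong (_* (∣ p ∣ ⁻¹ * ∣ q ∣ ⁻¹)) (∣∣-* p q))
    (trans (lem ∣ p ∣ ∣ q ∣ (∣ p ∣ ⁻¹) (∣ q ∣ ⁻¹))
        (trans (cong₂ _*_ (⁻¹-inverse (hp ∘ ∣∣≡0)) (⁻¹-inverse (hq ∘ ∣∣≡0)))
      (trans (*-identityˡ 1ℚ) (sym (⁻¹-inverse (λ e → *-≢0 hp hq (∣∣≡0 e))))))))
    where
    opaque
      unfolding ring
      lem : ∀ p q x y → p * q * (x * y) ≡ p * x * (q * y)
      lem = solve-∀ ring

  -- The set is a preimage under A, hence the reciprocal of the determinant. `Extensional` is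
  -- assumed because `A ▹ x` agrees with the composite of shears and scalings only pointwise.
  content-elem : ∀ {A : M d} → Elem A → Extensional S → Content S v → Content (λ x → S (A ▹ x)) (∣ det A ∣ ⁻¹ * v)
  content-elem {d} {A = A} (base e) ext C = content-resp (λ x → ext λ i → sym (trans (▹-congˡ e x i) (▹-δ x i)))
      (λ x → ext λ i → trans (▹-congˡ e x i) (▹-δ x i))
    (trans (sym (*-identityˡ _))
        (cong (_* _) (sym (trans (cong (λ a → ∣ a ∣ ⁻¹) (trans (det-cong e) (det-δ d))) 1⁻¹)))) C
    where
    1⁻¹ : ∣ 1ℚ ∣ ⁻¹ ≡ 1ℚ
    1⁻¹ = trans (sym (*-identityˡ _)) (trans (cong (_* ∣ 1ℚ ∣ ⁻¹) (sym (∣∣-pos 0≤1)))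
        (⁻¹-inverse (λ e → ℚ.1≢0 (∣∣≡0 e))))
  content-elem {S = S} {A = A} (shear {B = B} i j c i≢j E h hr) ext (content I O) =
    content-resp (λ x → ext (λ r → sym (eq x r))) (λ x → ext (eq x))
        (cong (λ a → ∣ a ∣ ⁻¹ * _) (sym (det-shear i j c i≢j h hr)))
      (content-elem E (λ e → ext (map-ext e)) (content (inner-shear i j c i≢j I) (outer-shear i j c i≢j O)))
    where
    map-ext : ∀ {x y} → (∀ r → x r ≡ y r) → ∀ r → shearMap i j c x r ≡ shearMap i j c y r
    map-ext e r with r Fin.≟ i
    ... | yes _ = cong₂ (λ a b → a + c * b) (e i) (e j)
    ... | no _ = e r
    opaque
      unfolding ring
      lem : ∀ b c d x → (b + c * d) * x ≡ c * (d * x) + b * x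
      lem = solve-∀ ring
    eq : ∀ x r → (A ▹ x) r ≡ shearMap i j c (B ▹ x) r
    eq x r with r Fin.≟ i
    ... | yes refl = trans (sum-linear c {g = λ k → B j k * x k} {h = λ k → B i k * x k} λ k →
        trans (cong (_* x k) (h k)) (lem (B i k) c (B j k) (x k))) (+-comm _ _)
    ... | no ne = sum-cong λ k → cong (_* x k) (hr r ne k)
  content-elem {S = S} {v = v} {A = A} (scale {B = B} i c c≢0 E h hr) ext (content I O) =
    content-resp (λ x → ext (λ r → sym (eq x r))) (λ x → ext (eq x))
      (trans (sym (*-assoc _ _ v))
          (cong (_* v) (trans (*-comm _ _)
          (trans (∣∣-⁻¹-* c≢0 (det≢0 E)) (cong (λ a → ∣ a ∣ ⁻¹) (sym (det-scale i c h hr)))))))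
      (content-elem E (λ e → ext (map-ext e)) (content (inner-scale i c c≢0 I) (outer-scale i c c≢0 O)))
    where
    map-ext : ∀ {x y} → (∀ r → x r ≡ y r) → ∀ r → scaleMap i c x r ≡ scaleMap i c y r
    map-ext e r with r Fin.≟ i
    ... | yes _ = cong (c *_) (e i)
    ... | no _ = e r
    eq : ∀ x r → (A ▹ x) r ≡ scaleMap i c (B ▹ x) r
    eq x r with r Fin.≟ i
    ... | yes refl = trans (sum-cong λ k → trans (cong (_* x k) (h k)) (*-assoc c (B i k) (x k)))
        (sum-*ˡ c (λ k → B i k * x k))
    ... | no ne = sum-cong λ k → cong (_* x k) (hr r ne k)

open JordanContent

-- The standard simplex

^-≥0 : ∀ {x} n → 0ℚ ≤ x → 0ℚ ≤ x ^ n
^-≥0 zero h = 0≤1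
^-≥0 (suc n) h = 0≤* h (^-≥0 n h)

^->0 : ∀ {x} n → 0ℚ < x → 0ℚ < x ^ n
^->0 zero h = 0<1
^->0 (suc n) h = 0<* h (^->0 n h)

^-mono : ∀ {x y} n → 0ℚ ≤ y → y ≤ x → y ^ n ≤ x ^ n
^-mono zero 0≤y y≤x = ℚ.≤-refl
^-mono (suc n) 0≤y y≤x = *-mono (^-≥0 n 0≤y) (ℚ.≤-trans 0≤y y≤x) y≤x (^-mono n 0≤y y≤x)

1^ : ∀ n → 1ℚ ^ n ≡ 1ℚ
1^ zero = refl
1^ (suc n) = trans (*-identityˡ _) (1^ n)

-- Together with `^-lower` this is the mean value theorem for t ↦ t ^ (n + 1). It replaces the
-- integral of t ^ n when slabs of thickness x - y are added up.
^-upper : ∀ {x y} n → 0ℚ ≤ y → y ≤ x → x ^ suc n ≤ y ^ suc n + fromNat (suc n) * ((x - y) * x ^ n)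
^-upper {x} {y} zero 0≤y y≤x = ℚ.≤-reflexive (lem x y)
  where
  opaque
    unfolding ring
    lem : ∀ x y → x * 1ℚ ≡ y * 1ℚ + 1ℚ * ((x - y) * 1ℚ)
    lem = solve-∀ ring
^-upper {x} {y} (suc n) 0≤y y≤x = ℚ.≤-trans (*-monoˡ (ℚ.≤-trans 0≤y y≤x) (^-upper n 0≤y y≤x))
  (≤-by ((x - y) * (x ^ suc n - y ^ suc n)) (0≤* (diff-≤ y≤x) (diff-≤ (^-mono (suc n) 0≤y y≤x)))
    (trans (cong (λ N → y ^ suc (suc n) + N * ((x - y) * x ^ suc n)) (fromNat-suc (suc n)))
        (lem x y (x ^ n) (y ^ n) (fromNat (suc n)))))
  where
  opaque
    unfolding ring
    lem : ∀ x y a b N → y * (y * b) + (1ℚ + N) * ((x - y) * (x * a)) ≡ x * (y * b + N * ((x - y) * a)) + (x - y) *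
        (x * a - y * b)
    lem = solve-∀ ring

^-lower : ∀ {x y} n → 0ℚ ≤ y → y ≤ x → y ^ suc n + fromNat (suc n) * ((x - y) * y ^ n) ≤ x ^ suc n
^-lower {x} {y} zero 0≤y y≤x = ℚ.≤-reflexive (lem x y)
  where
  opaque
    unfolding ring
    lem : ∀ x y → y * 1ℚ + 1ℚ * ((x - y) * 1ℚ) ≡ x * 1ℚ
    lem = solve-∀ ring
^-lower {x} {y} (suc n) 0≤y y≤x = undiff-≤ (subst (0ℚ ≤_)
    (trans (lem x y (x ^ n) (y ^ n) (fromNat (suc n)))
        (cong (λ N → x ^ suc (suc n) - (y ^ suc (suc n) + N * ((x - y) * y ^ suc n))) (sym (fromNat-suc (suc n)))))
    (0≤+ (0≤* 0≤y (diff-≤ (^-lower n 0≤y y≤x))) (0≤* (diff-≤ y≤x) (diff-≤ (^-mono (suc n) 0≤y y≤x)))))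
  where
  opaque
    unfolding ring
    lem : ∀ x y a b N → y * (x * a - (y * b + N * ((x - y) * b))) + (x - y) * (x * a - y * b) ≡ x * (x * a) -
        (y * (y * b) + (1ℚ + N) * ((x - y) * (y * b)))
    lem = solve-∀ ring

-- 1 / d!, the content of the standard simplex.
κ : ℕ → ℚ
κ zero = 1ℚ
κ (suc d) = κ d * fromNat (suc d) ⁻¹

0<κ : ∀ d → 0ℚ < κ d
0<κ zero = 0<1
0<κ (suc d) = 0<* (0<κ d) (0<⁻¹ (0<fromNat d))

κ-suc : ∀ d → κ (suc d) * fromNat (suc d) ≡ κ d
κ-suc d = trans (lem (κ d) _ _) (trans (cong (κ d *_) (⁻¹-inverse (>⇒≢0 (0<fromNat d)))) (*-identityʳ (κ d)))
  where
  opaque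
    unfolding ring
    lem : ∀ k i n → k * i * n ≡ k * (n * i)
    lem = solve-∀ ring

κ-! : ∀ d → fromNat (d ℕ.!) * κ d ≡ 1ℚ
κ-! zero = *-identityˡ 1ℚ
κ-! (suc d) = trans (cong (_* κ (suc d)) (fromNat-* (suc d) (d ℕ.!)))
  (trans (lem (fromNat (suc d)) (fromNat (d ℕ.!)) (κ (suc d))) (trans (cong (fromNat (d ℕ.!) *_) (κ-suc d)) (κ-! d)))
  where
  opaque
    unfolding ring
    lem : ∀ n f k → n * f * k ≡ f * (k * n)
    lem = solve-∀ ring

T : ∀ d → ℚ → Subset d
T d r x = (∀ i → 0ℚ ≤ x i) × sum x ≤ r

-- What is left of the simplex after the slabs with first coordinate below a have been cut off.
T⁺ : ∀ d → ℚ → ℚ → Subset (suc d)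
T⁺ d a s x = a ≤ x zero × (∀ i → 0ℚ ≤ x (suc i)) × sum x ≤ s

-- Slabs of thickness h orthogonal to the first axis: over each of them the simplex lies between two
-- prisms over copies of `T d`, whose content is known by induction.
module Slabs (d : ℕ) (IH : ∀ r → 0ℚ < r → Content (T d r) (κ d * r ^ d)) (h : ℚ) (0<h : 0ℚ < h) where

  k : ℕ → ℚ
  k n = fromNat n * h

  k-suc : ∀ n → k (suc n) ≡ h + k n
  k-suc n = trans (cong (_* h) (fromNat-suc n)) (lem (fromNat n) h)
    where
    opaque
      unfolding ring
      lem : ∀ n h → (1ℚ + n) * h ≡ h + n * h
      lem = solve-∀ ring

  0≤k : ∀ n → 0ℚ ≤ k n
  0≤k n = 0≤* (0≤fromNat n) (ℚ.<⇒≤ 0<h)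

  0<k : ∀ n → 0ℚ < k (suc n)
  0<k n = 0<* (0<fromNat n) 0<h

  k≤k : ∀ n → k n ≤ k (suc n)
  k≤k n = *-monoʳ (ℚ.<⇒≤ 0<h) (fromNat-≤ (ℕ.n≤1+n n))

  k-diff : ∀ n → k (suc n) - k n ≡ h
  k-diff n = trans (cong (_- k n) (k-suc n)) (lem h (k n))
    where
    opaque
      unfolding ring
      lem : ∀ h n → h + n - n ≡ h
      lem = solve-∀ ring

  a≤a+h : ∀ a → a ≤ a + h
  a≤a+h a = ≤-by h (ℚ.<⇒≤ 0<h) refl

  layer : ∀ a → a + h - a ≡ h
  layer = lem h
    where
    opaque
      unfolding ring
      lem : ∀ h a → a + h - a ≡ h
      lem = solve-∀ ring

  distribute : ∀ y z w → κ (suc d) * (y + fromNat (suc d) * (w * z)) ≡ w * (κ d * z) + κ (suc d) * y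
  distribute y z w = trans (lem (κ (suc d)) (fromNat (suc d)) y z w) (cong (λ a → w * (a * z) + κ (suc d) * y)
      (κ-suc d))
    where
    opaque
      unfolding ring
      lem : ∀ k n y z w → k * (y + n * (w * z)) ≡ w * (k * n * z) + k * y
      lem = solve-∀ ring

  -- Each slab is replaced by the prism over its smallest section, the one at its upper end; this
  -- loses one slab of the n + 1 that lie below s.
  inner-slabs : ∀ n a s → s ≡ a + k (suc n) → InnerContent (T⁺ d a s) (κ (suc d) * k n ^ suc d)
  inner-slabs zero a s e =
      inner-∅ (ℚ.≤-reflexive (trans (cong (λ z → κ (suc d) * (z * k 0 ^ d)) (*-zeroˡ h))
      (trans (cong (κ (suc d) *_) (*-zeroˡ _)) (*-zeroʳ (κ (suc d))))))
  inner-slabs (suc n) a s e = inner-mono (λ x p → p) value (inner-∪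
    (λ x p q → ℚ.<-irrefl refl (ℚ.<-≤-trans (proj₂ (proj₁ p)) (proj₁ q)))
    (λ x p → proj₁ (proj₁ p) , proj₁ (proj₂ p) , ℚ.≤-trans (+-mono-≤ (ℚ.<⇒≤ (proj₂ (proj₁ p))) (proj₂ (proj₂ p)))
      (ℚ.≤-reflexive (trans (+-assoc a h _) (trans (cong (_+_ a) (sym (k-suc (suc n)))) (sym e)))))
    (λ x p → ℚ.≤-trans (a≤a+h a) (proj₁ p) , proj₂ p)
    (inner-prism {S′ = λ x → (a ≤ x zero × x zero < a + h) × T d (k (suc n)) (x ∘ suc)} a (a + h) (a≤a+h a)
        (λ x l u t → (l , u) , t) (Content.inner (IH (k (suc n)) (0<k n))))
    (inner-slabs n (a + h) s (trans e (trans (cong (_+_ a) (k-suc (suc n))) (sym (+-assoc a h _))))))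
    where
    value : κ (suc d) * k (suc n) ^ suc d ≤ (a + h - a) * (κ d * k (suc n) ^ d) + κ (suc d) * k n ^ suc d
    value = ℚ.≤-trans (*-monoˡ (ℚ.<⇒≤ (0<κ (suc d))) (^-upper d (0≤k n) (k≤k n)))
      (ℚ.≤-reflexive (trans (distribute (k n ^ suc d) (k (suc n) ^ d) (k (suc n) - k n))
        (cong (λ w → w * (κ d * k (suc n) ^ d) + κ (suc d) * k n ^ suc d) (trans (k-diff n) (sym (layer a))))))

  -- There are two slabs of slack: one because the largest section of a slab is the one at its lower
  -- end, and one because a section of size 0 is outside the scope of `IH`.
  outer-slabs : ∀ n a s → s ≡ a + k n → OuterContent (T⁺ d a s) (κ (suc d) * k (suc (suc n)) ^ suc d)
  outer-slabs n a s e = outer-mono (λ x p → p) value (outer-∪ split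
    (outer-prism {S′ = λ x → (a ≤ x zero × x zero < a + h) × T d (k (suc n)) (x ∘ suc)} a (a + h) (a≤a+h a)
        (λ x p → p) (Content.outer (IH (k (suc n)) (0<k n))))
    (rest n e))
    where
    value : (a + h - a) * (κ d * k (suc n) ^ d) + κ (suc d) * k (suc n) ^ suc d ≤ κ (suc d) * k (suc (suc n)) ^ suc d
    value = ℚ.≤-trans (ℚ.≤-reflexive (trans (cong (λ w → w * (κ d * k (suc n) ^ d) + κ (suc d) * k (suc n) ^ suc d)
        (trans (layer a) (sym (k-diff (suc n)))))
        (sym (distribute (k (suc n) ^ suc d) (k (suc n) ^ d) (k (suc (suc n)) - k (suc n))))))
      (*-monoˡ (ℚ.<⇒≤ (0<κ (suc d))) (^-lower d (0≤k (suc n)) (k≤k (suc n))))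
    tail-sum : ∀ x → T⁺ d a s x → sum (x ∘ suc) ≤ k (suc n)
    tail-sum x (p , _ , q) = ℚ.≤-trans (subst₂ _≤_ (lem a (sum (x ∘ suc))) (trans (cong (_- a) e) (lem a (k n)))
        (+-monoˡ-≤ (- a) (ℚ.≤-trans (+-monoˡ-≤ (sum (x ∘ suc)) p) q))) (k≤k n)
      where
      opaque
        unfolding ring
        lem : ∀ a y → a + y - a ≡ y
        lem = solve-∀ ring
    split : ∀ x → T⁺ d a s x → ((a ≤ x zero × x zero < a + h) × T d (k (suc n)) (x ∘ suc)) ⊎ T⁺ d (a + h) s x
    split x p with <-≤-connex (x zero) (a + h)
    ... | inj₁ lt = inj₁ ((proj₁ p , lt) , proj₁ (proj₂ p) , tail-sum x p)
    ... | inj₂ ge = inj₂ (ge , proj₂ p)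
    rest : ∀ n → s ≡ a + k n → OuterContent (T⁺ d (a + h) s) (κ (suc d) * k (suc n) ^ suc d)
    rest zero e = outer-mono (λ x p → p) (0≤* (ℚ.<⇒≤ (0<κ (suc d))) (^-≥0 (suc d) (0≤k 1))) (outer-∅ λ x p →
      ℚ.<-irrefl refl (ℚ.<-≤-trans
          (<-by h 0<h (cong (_+ h) (sym (trans e (trans (cong (_+_ a) (*-zeroˡ h)) (+-identityʳ a))))))
        (ℚ.≤-trans (proj₁ p) (ℚ.≤-trans (≤-by (sum (x ∘ suc)) (sum-≥0 (proj₁ (proj₂ p))) refl) (proj₂ (proj₂ p))))))
    rest (suc n) e = outer-slabs n (a + h) s (trans e (trans (cong (_+_ a) (k-suc n)) (sym (+-assoc a h _))))

content-T : ∀ d r → 0ℚ < r → Content (T d r) (κ d * r ^ d)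
content-T zero r 0<r = content
  (subst (InnerContent _) (sym (*-identityˡ 1ℚ)) (inner-box point λ x _ → (λ ()) , ℚ.<⇒≤ 0<r))
  (subst (OuterContent _) (sym (*-identityˡ 1ℚ)) (outer-box point λ x _ ()))
  where
  point : Box 0
  point = record { lower = λ () ; upper = λ () ; ordered = λ () }
content-T (suc d) r 0<r = content
  (inner-mono (λ x p → (λ { zero → proj₁ p ; (suc i) → proj₁ (proj₂ p) i }) , proj₂ (proj₂ p)) ℚ.≤-refl inner)
  (outer-mono (λ x p → proj₁ p zero , (λ i → proj₁ p (suc i)) , proj₂ p) ℚ.≤-refl outer)
  where
  0≤r : 0ℚ ≤ r
  0≤r = ℚ.<⇒≤ 0<r
  inner : InnerContent (T⁺ d 0ℚ r) (κ (suc d) * r ^ suc d)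
  inner = inner-limit λ ε hε → go ε (subdivide {r} {κ d * r ^ d} 0≤r (0≤* (ℚ.<⇒≤ (0<κ d)) (^-≥0 d 0≤r)) hε)
    where
    go : ∀ ε → ∃[ n ] ∃[ h ] (0ℚ < r → 0ℚ < h) × 0ℚ ≤ h × fromNat (suc n) * h ≡ r × κ d * r ^ d * h ≤ ε →
      ∃[ v′ ] κ (suc d) * r ^ suc d ≤ v′ + ε × InnerContent (T⁺ d 0ℚ r) v′
    go ε (n , h , 0<h , _ , refl , small) = κ (suc d) * k n ^ suc d ,
      ℚ.≤-trans (*-monoˡ (ℚ.<⇒≤ (0<κ (suc d))) (^-upper d (0≤k n) (k≤k n)))
        (ℚ.≤-trans (ℚ.≤-reflexive (trans (distribute (k n ^ suc d) (k (suc n) ^ d) (k (suc n) - k n))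
          (trans (cong (λ w → w * (κ d * k (suc n) ^ d) + κ (suc d) * k n ^ suc d) (k-diff n))
              (lem h (κ d * k (suc n) ^ d) (κ (suc d) * k n ^ suc d)))))
          (+-monoʳ-≤ (κ (suc d) * k n ^ suc d) small)) ,
      inner-slabs n 0ℚ r (sym (+-identityˡ _))
      where
      open Slabs d (content-T d) h (0<h 0<r)
      opaque
        unfolding ring
        lem : ∀ h a b → h * a + b ≡ b + a * h
        lem = solve-∀ ring
  -- The outer approximation has size r + 2 h with h ≤ r, hence at most 3 r; this gives an error
  -- constant independent of the mesh.
  3ℚ : ℚ
  3ℚ = 1ℚ + 2ℚ
  outer : OuterContent (T⁺ d 0ℚ r) (κ (suc d) * r ^ suc d)
  outer = outer-limit λ ε hε →
      go ε (subdivide {r} {κ d * 2ℚ * (3ℚ * r) ^ d} 0≤r (0≤* (0≤* (ℚ.<⇒≤ (0<κ d)) (ℚ.<⇒≤ 0<2)) (^-≥0 d 0≤3r)) hε)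
    where
    0≤3r : 0ℚ ≤ 3ℚ * r
    0≤3r = 0≤* (0≤+ 0≤1 (ℚ.<⇒≤ 0<2)) 0≤r
    go : ∀ ε → ∃[ n ] ∃[ h ] (0ℚ < r → 0ℚ < h) × 0ℚ ≤ h × fromNat (suc n) * h ≡ r × κ d * 2ℚ * (3ℚ * r) ^ d * h ≤ ε →
      ∃[ v′ ] v′ ≤ κ (suc d) * r ^ suc d + ε × OuterContent (T⁺ d 0ℚ r) v′
    go ε (n , h , 0<h , 0≤h , refl , small) = κ (suc d) * k m ^ suc d ,
      ℚ.≤-trans (*-monoˡ (ℚ.<⇒≤ (0<κ (suc d)))
          (ℚ.≤-trans (^-upper d 0≤r r≤)
          (+-monoʳ-≤ (r ^ suc d) (*-monoˡ (0≤fromNat (suc d)) (*-monoˡ (diff-≤ r≤) (^-mono d (0≤k m) ≤3r))))))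
        (ℚ.≤-trans (ℚ.≤-reflexive (trans (distribute (r ^ suc d) ((3ℚ * r) ^ d) (k m - r))
          (trans (cong (λ w → w * (κ d * (3ℚ * r) ^ d) + κ (suc d) * r ^ suc d) m-r)
              (lem h (κ d) ((3ℚ * r) ^ d) (κ (suc d) * r ^ suc d)))))
          (+-monoʳ-≤ (κ (suc d) * r ^ suc d) small)) ,
      outer-slabs (suc n) 0ℚ r (sym (+-identityˡ _))
      where
      open Slabs d (content-T d) h (0<h 0<r)
      m : ℕ
      m = suc (suc (suc n))
      km : k m ≡ r + (h + h)
      km = trans (k-suc (suc (suc n))) (trans (cong (_+_ h) (k-suc (suc n))) (lem′ h r))
        where
        opaque
          unfolding ring
          lem′ : ∀ h r → h + (h + r) ≡ r + (h + h)
          lem′ = solve-∀ ring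
      m-r : k m - r ≡ h + h
      m-r = trans (cong (_- r) km) (lem′ r h)
        where
        opaque
          unfolding ring
          lem′ : ∀ r h → r + (h + h) - r ≡ h + h
          lem′ = solve-∀ ring
      r≤ : r ≤ k m
      r≤ = ℚ.≤-trans (k≤k (suc n)) (k≤k (suc (suc n)))
      h≤r : h ≤ r
      h≤r = ≤-by (k n) (0≤k n) (k-suc n)
      ≤3r : k m ≤ 3ℚ * r
      ≤3r = ℚ.≤-trans (ℚ.≤-reflexive km) (ℚ.≤-trans (+-monoʳ-≤ r (+-mono-≤ h≤r h≤r)) (ℚ.≤-reflexive (lem′ r)))
        where
        opaque
          unfolding ring
          lem′ : ∀ r → r + (r + r) ≡ (1ℚ + (1ℚ + 1ℚ)) * r
          lem′ = solve-∀ ring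
      opaque
        unfolding ring
        lem : ∀ h k x y → (h + h) * (k * x) + y ≡ y + k * (1ℚ + 1ℚ) * x * h
        lem = solve-∀ ring

-- Simplices

Hull : ∀ {d n} → (Fin d → Fin n → ℚ) → Subset d
Hull V x = ∃[ λs ] (∀ j → 0ℚ ≤ λs j) × sum λs ≡ 1ℚ × (∀ i → (V ▹ λs) i ≡ x i)

-- The columns of V in homogeneous coordinates.
hom : ∀ {d n} → (Fin d → Fin n → ℚ) → Fin (suc d) → Fin n → ℚ
hom V zero j = 1ℚ
hom V (suc i) j = V i j

edges : ∀ {d n} → (Fin d → Fin (suc n) → ℚ) → Fin d → Fin n → ℚ
edges V i k = V i (suc k) - V i zero

edges-▹ : ∀ {d n} (V : Fin d → Fin (suc n) → ℚ) (μ : Fin (suc n) → ℚ) i →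
  (V ▹ μ) i ≡ V i zero * sum μ + (edges V ▹ (μ ∘ suc)) i
edges-▹ V μ i = trans
    (cong (_+_ (V i zero * μ zero)) (sum-linear (V i zero) {g = μ ∘ suc} {h = λ k → edges V i k * μ (suc k)} λ k →
    lem (V i (suc k)) (V i zero) (μ (suc k))))
  (lem′ (V i zero) (μ zero) _ _)
  where
  opaque
    unfolding ring
    lem : ∀ a b m → a * m ≡ b * m + (a - b) * m
    lem = solve-∀ ring
    lem′ : ∀ a m s e → a * m + (a * s + e) ≡ a * (m + s) + e
    lem′ = solve-∀ ring

elem-edges : ∀ {d} {V : Fin d → Fin (suc d) → ℚ} → Elem (hom V) → Elem (edges V)
elem-edges {d} {V} E = trivialKernel⇒elem (edges V) λ {μ} z k →
    elem-injective E {ν μ} (λ { zero → hom-zero μ ; (suc i) →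
    trans (edges-▹ V (ν μ) i) (trans (cong₂ (λ a b → V i zero * a + b) (sum-ν μ) (z i)) (lem (V i zero))) }) (suc k)
  where
  ν : (Fin d → ℚ) → Fin (suc d) → ℚ
  ν μ zero = - sum μ
  ν μ (suc k) = μ k
  sum-ν : ∀ μ → sum (ν μ) ≡ 0ℚ
  sum-ν μ = trans (+-comm _ _) (+-inverseʳ (sum μ))
  hom-zero : ∀ μ → sum (λ j → 1ℚ * ν μ j) ≡ 0ℚ
  hom-zero μ = trans (sum-cong λ j → *-identityˡ (ν μ j)) (sum-ν μ)
  opaque
    unfolding ring
    lem : ∀ a → a * 0ℚ + 0ℚ ≡ 0ℚ
    lem = solve-∀ ring

-- Multiplication by `C` subtracts the first column from all the others, which leaves (1 , 0 , ... ,
-- 0) in the first row.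
det-edges : ∀ {d} {V : Fin d → Fin (suc d) → ℚ} → Elem (hom V) → det (hom V) ≡ det (edges V)
det-edges {d} {V} E = begin
  det (hom V)                          ≡⟨ *-identityʳ _ ⟨
  det (hom V) * 1ℚ                     ≡⟨ cong (det (hom V) *_) det-C ⟨
  det (hom V) * det C                  ≡⟨ det-⊡ E C ⟨
  det (hom V ⊡ C)                      ≡⟨ det-firstRow {A = hom V ⊡ C}
      (λ k → trans (product-suc zero k) (+-inverseʳ 1ℚ)) ⟩
  (hom V ⊡ C) zero zero * det (minor (hom V ⊡ C) zero)
    ≡⟨ cong₂ _*_ (product-zero zero) (det-cong λ i k → product-suc (suc i) k) ⟩
  1ℚ * det (edges V)                   ≡⟨ *-identityˡ _ ⟩
  det (edges V)                        ∎
  where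
  open ≡-Reasoning
  C : M (suc d)
  C zero zero = 1ℚ
  C zero (suc k) = - 1ℚ
  C (suc i) zero = 0ℚ
  C (suc i) (suc k) = δ i k
  det-C : det C ≡ 1ℚ
  det-C = trans (det-firstColumn {A = C} (λ i → refl)) (trans (*-identityˡ _) (det-δ d))
  opaque
    unfolding ring
    lem : ∀ a → a * 1ℚ + 0ℚ ≡ a
    lem = solve-∀ ring
  product-zero : ∀ i → (hom V ⊡ C) i zero ≡ hom V i zero
  product-zero i = trans (cong (_+_ (hom V i zero * 1ℚ)) (sum-0 λ j → *-zeroʳ (hom V i (suc j)))) (lem _)
  opaque
    unfolding ring
    lem′ : ∀ a b → a * - 1ℚ + b ≡ b - a
    lem′ = solve-∀ ring
  product-suc : ∀ i k → (hom V ⊡ C) i (suc k) ≡ hom V i (suc k) - hom V i zero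
  product-suc i k = trans (cong (_+_ (hom V i zero * - 1ℚ)) (sum-δʳ k (λ j → hom V i (suc j)))) (lem′ _ _)

-- With `N` inverse to the matrix of edges at v₀, the map x ↦ N (x - v₀) computes the barycentric
-- coordinates except the one at v₀. The simplex is thus the preimage of the standard simplex.
content-simplex : ∀ {d} {V : Fin d → Fin (suc d) → ℚ} → Elem (hom V) → Content (Hull V) (∣ det (hom V) ∣ * κ d)
content-simplex {d} {V} E = content-resp to from value
  (content (inner-translate p (Content.inner C)) (outer-translate p (Content.outer C)))
  where
  B N : M d
  B = edges V
  E-B : Elem B
  E-B = elem-edges E
  N = proj₁ (elem-inverse E-B)
  BN : B ⊡ N ≈ δ
  BN = proj₁ (proj₂ (elem-inverse E-B))
  NB : N ⊡ B ≈ δ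
  NB = proj₂ (proj₂ (elem-inverse E-B))
  E-N : Elem N
  E-N = leftInverse⇒elem {N = B} BN
  p : Fin d → ℚ
  p i = - V i zero
  ext : Extensional (T d 1ℚ)
  ext e (h , s) = (λ i → subst (0ℚ ≤_) (e i) (h i)) , subst (_≤ 1ℚ) (sum-cong e) s
  C : Content (λ x → T d 1ℚ (N ▹ x)) (∣ det N ∣ ⁻¹ * (κ d * 1ℚ ^ d))
  C = content-elem E-N ext (content-T d 1ℚ 0<1)
  det-N : ∣ det N ∣ ⁻¹ ≡ ∣ det B ∣
  det-N = *-cancel-≡ {∣ det N ∣} (λ e → det≢0 E-N (∣∣≡0 e)) (trans (⁻¹-inverse (λ e → det≢0 E-N (∣∣≡0 e)))
    (trans (sym (∣∣-pos 0≤1)) (trans (cong ∣_∣ (sym (det-inverse E-N NB))) (∣∣-* _ _))))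
  value : ∣ det N ∣ ⁻¹ * (κ d * 1ℚ ^ d) ≡ ∣ det (hom V) ∣ * κ d
  value = cong₂ _*_ (trans det-N (cong ∣_∣ (sym (det-edges E)))) (trans (cong (κ d *_) (1^ d)) (*-identityʳ (κ d)))
  to : ∀ x → T d 1ℚ (N ▹ (λ i → x i + p i)) → Hull V x
  to x (h , s) = λs , (λ { zero → diff-≤ s ; (suc k) → h k }) , sum-λs , λ i →
      trans (edges-▹ V λs i)
          (trans (cong₂ (λ a b → V i zero * a + b) sum-λs (trans (▹-⊡ B N _ i) (trans (▹-congˡ BN _ i) (▹-δ _ i))))
          (lem′ (V i zero) (x i)))
    where
    y : Fin d → ℚ
    y = N ▹ (λ i → x i + p i)
    λs : Fin (suc d) → ℚ
    λs zero = 1ℚ - sum y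
    λs (suc k) = y k
    opaque
      unfolding ring
      lem : ∀ a → 1ℚ - a + a ≡ 1ℚ
      lem = solve-∀ ring
    sum-λs : sum λs ≡ 1ℚ
    sum-λs = lem (sum y)
    opaque
      unfolding ring
      lem′ : ∀ v x → v * 1ℚ + (x - v) ≡ x
      lem′ = solve-∀ ring
  from : ∀ x → Hull V x → T d 1ℚ (N ▹ (λ i → x i + p i))
  from x (λs , h , s , e) = ext (λ k → sym (y≡ k)) ((λ k → h (suc k)) ,
      ≤-by (λs zero) (h zero) (trans (sym s) (+-comm _ _)))
    where
    opaque
      unfolding ring
      lem : ∀ v b → v * 1ℚ + b - v ≡ b
      lem = solve-∀ ring
    x-v : ∀ i → x i + p i ≡ (B ▹ (λs ∘ suc)) i
    x-v i = trans (cong (_- V i zero)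
        (trans (sym (e i)) (trans (edges-▹ V λs i) (cong (λ a → V i zero * a + (B ▹ (λs ∘ suc)) i) s))))
        (lem (V i zero) _)
    y≡ : ∀ k → (N ▹ (λ i → x i + p i)) k ≡ λs (suc k)
    y≡ k = trans (▹-cong N x-v k) (trans (▹-⊡ N B _ k) (trans (▹-congˡ NB _ k) (▹-δ _ k)))

open import Algebra.Properties.CommutativeSemiring.Exp (CommutativeRing.commutativeSemiring +-*-commutativeRing)
  using (^-distrib-*)

-- Majorization

-- Unlike `sum`, these grow at the far end, which suits statements about all prefixes of one
-- sequence.
psum pprod : (ℕ → ℚ) → ℕ → ℚ
psum f zero = 0ℚ
psum f (suc n) = psum f n + f n
pprod f zero = 1ℚ
pprod f (suc n) = pprod f n * f n

pprod->0 : ∀ {f} n → (∀ i → i ℕ.< n → 0ℚ < f i) → 0ℚ < pprod f n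
pprod->0 zero h = 0<1
pprod->0 (suc n) h = 0<* (pprod->0 n (λ i lt → h i (ℕ.m≤n⇒m≤1+n lt))) (h n ℕ.≤-refl)

psum->0 : ∀ {f} n → (∀ i → i ℕ.< suc n → 0ℚ < f i) → 0ℚ < psum f (suc n)
psum->0 {f} zero h = subst (0ℚ <_) (sym (+-identityˡ (f 0))) (h 0 (s≤s z≤n))
psum->0 {f} (suc n) h = 0<+ (psum->0 n (λ i lt → h i (ℕ.m≤n⇒m≤1+n lt))) (ℚ.<⇒≤ (h (suc n) ℕ.≤-refl))

psum-cong : ∀ {f h} n → (∀ i → i ℕ.< n → f i ≡ h i) → psum f n ≡ psum h n
psum-cong zero e = refl
psum-cong (suc n) e = cong₂ _+_ (psum-cong n (λ i lt → e i (ℕ.m≤n⇒m≤1+n lt))) (e n ℕ.≤-refl)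

pprod-cong : ∀ {f h} n → (∀ i → i ℕ.< n → f i ≡ h i) → pprod f n ≡ pprod h n
pprod-cong zero e = refl
pprod-cong (suc n) e = cong₂ _*_ (pprod-cong n (λ i lt → e i (ℕ.m≤n⇒m≤1+n lt))) (e n ℕ.≤-refl)

pprod-shift : ∀ f k n → pprod f k * pprod (λ i → f (k ℕ.+ i)) n ≡ pprod f (k ℕ.+ n)
pprod-shift f k zero = trans (*-identityʳ _) (cong (pprod f) (sym (ℕ.+-identityʳ k)))
pprod-shift f k (suc n) = trans (sym (*-assoc _ _ _)) (trans (cong (_* f (k ℕ.+ n)) (pprod-shift f k n))
    (cong (pprod f) (sym (ℕ.+-suc k n))))

psum-shift : ∀ f k n → psum f k + psum (λ i → f (k ℕ.+ i)) n ≡ psum f (k ℕ.+ n)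
psum-shift f k zero = trans (+-identityʳ _) (cong (psum f) (sym (ℕ.+-identityʳ k)))
psum-shift f k (suc n) = trans (sym (+-assoc _ _ _)) (trans (cong (_+ f (k ℕ.+ n)) (psum-shift f k n))
    (cong (psum f) (sym (ℕ.+-suc k n))))

sq-≥0 : ∀ x → 0ℚ ≤ x * x
sq-≥0 x with ℚ.≤-total 0ℚ x
... | inj₁ h = 0≤* h h
... | inj₂ h = subst (0ℚ ≤_) (lem x) (0≤* 0≤-x 0≤-x)
  where
  opaque
    unfolding ring
    lem : ∀ x → - x * - x ≡ x * x
    lem = solve-∀ ring
  0≤-x : 0ℚ ≤ - x
  0≤-x = subst (_≤ - x) neg-0 (neg-≤ h)

sq≡0 : ∀ {x} → x * x ≡ 0ℚ → x ≡ 0ℚ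
sq≡0 {x} e with x ℚ.≟ 0ℚ
... | yes z = z
... | no nz = contradiction e (*-≢0 nz nz)

-- The gap W(n) = Aⁿ⁺¹ - Bⁿ((n + 1) A - n B) satisfies W(n + 1) = A W(n) + (n + 1) Bⁿ (A - B)².
weighted-am-gm : ∀ {A B} n → 0ℚ ≤ A → 0ℚ ≤ B →
  B ^ suc n * (fromNat (suc (suc n)) * A - fromNat (suc n) * B) + B ^ n * ((A - B) * (A - B)) ≤ A ^ suc (suc n)
weighted-am-gm {A} {B} zero hA hB =
    ℚ.≤-reflexive (trans (cong (λ c → B * 1ℚ * (c * A - 1ℚ * B) + 1ℚ * ((A - B) * (A - B))) (fromNat-suc 1))
    (lem A B))
  where
  opaque
    unfolding ring
    lem : ∀ A B → B * 1ℚ * ((1ℚ + 1ℚ) * A - 1ℚ * B) + 1ℚ * ((A - B) * (A - B)) ≡ A * (A * 1ℚ)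
    lem = solve-∀ ring
weighted-am-gm {A} {B} (suc n) hA hB = subst₂ (λ c c′ → B ^ suc (suc n) * (c * A - c′ * B) + B ^ suc n *
    ((A - B) * (A - B)) ≤ A ^ suc (suc (suc n)))
  (sym (trans (fromNat-suc (suc (suc n))) (cong (_+_ 1ℚ) (fromNat-suc (suc n))))) (sym (fromNat-suc (suc n)))
  (≤-by (A * (A ^ suc (suc n) - B ^ suc n * ((1ℚ + N) * A - N * B)) + N * (B ^ suc n * ((A - B) * (A - B))))
    (0≤+ (0≤* hA (diff-≤ gap)) (0≤* (0≤fromNat (suc n)) (0≤* (^-≥0 (suc n) hB) (sq-≥0 (A - B)))))
    (lem A (A ^ suc (suc n)) B (B ^ suc n) N))
  where
  N : ℚ
  N = fromNat (suc n)
  gap : B ^ suc n * ((1ℚ + N) * A - N * B) ≤ A ^ suc (suc n)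
  gap = ℚ.≤-trans (≤-by (B ^ n * ((A - B) * (A - B))) (0≤* (^-≥0 n hB) (sq-≥0 (A - B))) refl)
    (subst (λ c → B ^ suc n * (c * A - N * B) + B ^ n * ((A - B) * (A - B)) ≤ A ^ suc (suc n)) (fromNat-suc (suc n))
        (weighted-am-gm n hA hB))
  opaque
    unfolding ring
    lem : ∀ A a B b N → A * a ≡ B * b * ((1ℚ + (1ℚ + N)) * A - (1ℚ + N) * B) + b * ((A - B) * (A - B)) +
      (A * (a - b * ((1ℚ + N) * A - N * B)) + N * (b * ((A - B) * (A - B))))
    lem = solve-∀ ring

-- `A` bounds the mean instead of being equal to it. The second component is the case of equality,
-- from which the extremal denominators are eventually read off.
AmGm : (ℕ → ℚ) → ℕ → Set
AmGm ρ n = ∀ {A} → (∀ i → i ℕ.< n → 0ℚ < ρ i) → 0ℚ < A → psum ρ n ≤ fromNat n * A →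
  pprod ρ n ≤ A ^ n × (A ^ n ≤ pprod ρ n → ∀ i → i ℕ.< n → ρ i ≡ A)

-- When the last number r is split off, `B` is the bound that remains for the mean of the others,
-- and r = (n + 2) A - (n + 1) B. `weighted-am-gm` then compares B ^ (n + 1) r with A ^ (n + 2).
am-gm-step : ∀ {ρ} n → AmGm ρ (suc n) → AmGm ρ (suc (suc n))
am-gm-step {ρ} n rec {A} pos 0<A le = ℚ.≤-trans step₁ step₂ , equality
  where
  r N B : ℚ
  r = ρ (suc n)
  N = fromNat (suc n)
  B = (fromNat (suc (suc n)) * A - r) * N ⁻¹
  0<r : 0ℚ < r
  0<r = pos (suc n) ℕ.≤-refl
  pos′ : ∀ i → i ℕ.< suc n → 0ℚ < ρ i
  pos′ i lt = pos i (ℕ.m≤n⇒m≤1+n lt)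
  NB : N * B ≡ fromNat (suc (suc n)) * A - r
  NB = trans (lem N _ (N ⁻¹)) (trans (cong ((fromNat (suc (suc n)) * A - r) *_) (⁻¹-inverse (>⇒≢0 (0<fromNat n))))
      (*-identityʳ _))
    where
    opaque
      unfolding ring
      lem : ∀ n x i → n * (x * i) ≡ x * (n * i)
      lem = solve-∀ ring
  sum≤ : psum ρ (suc n) ≤ N * B
  sum≤ = subst (psum ρ (suc n) ≤_) (sym NB) (subst (_≤ fromNat (suc (suc n)) * A - r) (lem (psum ρ (suc n)) r)
      (+-monoˡ-≤ (- r) le))
    where
    opaque
      unfolding ring
      lem : ∀ s r → s + r - r ≡ s
      lem = solve-∀ ring
  0<B : 0ℚ < B
  0<B = *-cancel-< (0≤fromNat (suc n)) (subst (_< N * B) (sym (*-zeroʳ N)) (ℚ.<-≤-trans (psum->0 n pos′) sum≤))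
  IH = rec pos′ 0<B sum≤
  step₁ : pprod ρ (suc n) * r ≤ B ^ suc n * r
  step₁ = *-monoʳ (ℚ.<⇒≤ 0<r) (proj₁ IH)
  r≡ : r ≡ fromNat (suc (suc n)) * A - N * B
  r≡ = trans (lem (fromNat (suc (suc n)) * A) r) (cong (λ x → fromNat (suc (suc n)) * A - x) (sym NB))
    where
    opaque
      unfolding ring
      lem : ∀ s r → r ≡ s - (s - r)
      lem = solve-∀ ring
  gap : B ^ suc n * r + B ^ n * ((A - B) * (A - B)) ≤ A ^ suc (suc n)
  gap = subst (λ r → B ^ suc n * r + B ^ n * ((A - B) * (A - B)) ≤ A ^ suc (suc n)) (sym r≡)
      (weighted-am-gm n (ℚ.<⇒≤ 0<A) (ℚ.<⇒≤ 0<B))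
  step₂ : B ^ suc n * r ≤ A ^ suc (suc n)
  step₂ = ℚ.≤-trans (≤-by (B ^ n * ((A - B) * (A - B))) (0≤* (^-≥0 n (ℚ.<⇒≤ 0<B)) (sq-≥0 (A - B))) refl) gap
  -- Equality leaves no room for the term B ^ n (A - B)² in `gap`.
  A≡B : A ^ suc (suc n) ≤ pprod ρ (suc n) * r → A ≡ B
  A≡B h = x-y≡0⇒x≡y (sq≡0 (*-cancel-≡ (>⇒≢0 (^->0 n 0<B)) (trans (ℚ.≤-antisym
      (subst₂ _≤_ (lem′ (B ^ suc n * r) _) (+-inverseʳ _)
          (+-monoˡ-≤ (- (B ^ suc n * r)) (ℚ.≤-trans gap (ℚ.≤-trans h step₁))))
      (0≤* (^-≥0 n (ℚ.<⇒≤ 0<B)) (sq-≥0 (A - B)))) (sym (*-zeroʳ (B ^ n))))))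
    where
    opaque
      unfolding ring
      lem′ : ∀ x y → x + y - x ≡ y
      lem′ = solve-∀ ring
  equality : A ^ suc (suc n) ≤ pprod ρ (suc n) * r → ∀ i → i ℕ.< suc (suc n) → ρ i ≡ A
  equality h i lt with ℕ.m≤n⇒m<n∨m≡n (ℕ.s≤s⁻¹ lt)
  ... | inj₂ refl = trans r≡ (trans (cong (λ x → fromNat (suc (suc n)) * A - N * x) (sym (A≡B h)))
      (trans (cong (λ x → x * A - N * A) (fromNat-suc (suc n))) (lem N A)))
    where
    opaque
      unfolding ring
      lem : ∀ n a → (1ℚ + n) * a - n * a ≡ a
      lem = solve-∀ ring
  ... | inj₁ lt′ = trans (proj₂ IH (*-cancel-≤ 0<r (subst₂ _≤_ (*-comm _ r) (*-comm _ r) (ℚ.≤-trans step₂ h))) i lt′)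
      (sym (A≡B h))

am-gm : ∀ {ρ} n → AmGm ρ n
am-gm zero {A} pos 0<A le = ℚ.≤-refl , λ _ _ ()
am-gm {ρ} (suc zero) {A} pos 0<A le = subst₂ _≤_ (sym (*-identityˡ (ρ 0))) (sym (*-identityʳ A)) ρ≤A ,
  λ { h zero _ → ℚ.≤-antisym ρ≤A (subst₂ _≤_ (*-identityʳ A) (*-identityˡ (ρ 0)) h) ; h (suc i) (s≤s ()) }
  where
  ρ≤A : ρ 0 ≤ A
  ρ≤A = subst₂ _≤_ (+-identityˡ (ρ 0)) (*-identityˡ A) le
am-gm {ρ} (suc (suc n)) {A} = am-gm-step n (am-gm (suc n))

^-<1 : ∀ {x} n → 0ℚ ≤ x → x < 1ℚ → x ^ suc n < 1ℚ
^-<1 {x} zero h lt = subst (_< 1ℚ) (sym (*-identityʳ x)) lt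
^-<1 {x} (suc n) h lt = ℚ.≤-<-trans (*-monoˡ h (ℚ.<⇒≤ (^-<1 n h lt))) (subst (_< 1ℚ) (sym (*-identityʳ x)) lt)

-- A mean below 1 would force a product below 1. Equality is the case `A = 1ℚ` of `am-gm`.
am-gm-1 : ∀ {ρ} n → (∀ i → i ℕ.< n → 0ℚ < ρ i) → 1ℚ ≤ pprod ρ n →
  fromNat n ≤ psum ρ n × (psum ρ n ≤ fromNat n → ∀ i → i ℕ.< n → ρ i ≡ 1ℚ)
am-gm-1 zero pos h = ℚ.≤-refl , λ _ _ ()
am-gm-1 {ρ} (suc n) pos h = ℚ.≮⇒≥ not-below , λ le →
    proj₂ (am-gm (suc n) pos 0<1 (subst (psum ρ (suc n) ≤_) (sym (*-identityʳ _)) le))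
    (subst (_≤ pprod ρ (suc n)) (sym (1^ (suc n))) h)
  where
  N A : ℚ
  N = fromNat (suc n)
  A = N ⁻¹ * psum ρ (suc n)
  0<A : 0ℚ < A
  0<A = 0<* (0<⁻¹ (0<fromNat n)) (psum->0 n pos)
  NA : N * A ≡ psum ρ (suc n)
  NA = trans (sym (*-assoc N _ _)) (trans (cong (_* psum ρ (suc n)) (⁻¹-inverse (>⇒≢0 (0<fromNat n))))
      (*-identityˡ _))
  not-below : ¬ psum ρ (suc n) < N
  not-below lt = ℚ.<-irrefl refl (ℚ.<-≤-trans (^-<1 n (ℚ.<⇒≤ 0<A) A<1)
      (ℚ.≤-trans h (proj₁ (am-gm (suc n) pos 0<A (ℚ.≤-reflexive (sym NA))))))
    where
    A<1 : A < 1ℚ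
    A<1 = *-cancel-< (0≤fromNat (suc n)) (subst₂ _<_ (sym NA) (sym (*-identityʳ N)) lt)

-- Abel summation turns the prefix inequalities, in AM-GM form, into an inequality of sums.
majorization : ∀ {σ y} n → (∀ i → i ℕ.< n → 0ℚ < σ i) → (∀ i → i ℕ.< n → 0ℚ < y i) →
  (∀ i → suc i ℕ.< n → σ (suc i) ≤ σ i) → (∀ i → i ℕ.≤ n → pprod σ i ≤ pprod y i) →
  psum σ n ≤ psum y n × (psum y n ≤ psum σ n → ∀ i → i ℕ.< n → σ i ≡ y i)
majorization zero hσ hy anti pre = ℚ.≤-refl , λ _ _ ()
majorization {σ} {y} (suc n) hσ hy anti pre = undiff-≤ (subst (0ℚ ≤_) (D≡ (suc n) ℕ.≤-refl) 0≤D) , equality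
  where
  ρ : ℕ → ℚ
  ρ i = y i * σ i ⁻¹
  0<ρ : ∀ i → i ℕ.< suc n → 0ℚ < ρ i
  0<ρ i lt = 0<* (hy i lt) (0<⁻¹ (hσ i lt))
  σρ : ∀ i → i ℕ.< suc n → σ i * ρ i ≡ y i
  σρ i lt = trans (lem (σ i) (y i) (σ i ⁻¹)) (trans (cong (y i *_) (⁻¹-inverse (>⇒≢0 (hσ i lt)))) (*-identityʳ (y i)))
    where
    opaque
      unfolding ring
      lem : ∀ s y i → s * (y * i) ≡ y * (s * i)
      lem = solve-∀ ring
  prod-ρ : ∀ i → i ℕ.≤ suc n → pprod σ i * pprod ρ i ≡ pprod y i
  prod-ρ zero le = *-identityˡ 1ℚ
  prod-ρ (suc i) lt = trans (lem (pprod σ i) (σ i) (pprod ρ i) (ρ i)) (cong₂ _*_ (prod-ρ i (ℕ.<⇒≤ lt)) (σρ i lt))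
    where
    opaque
      unfolding ring
      lem : ∀ a b c d → a * b * (c * d) ≡ a * c * (b * d)
      lem = solve-∀ ring
  -- `Λ i` is the slack in AM-GM for the first i ratios `ρ = y / σ`, and `D` is the difference of
  -- the sums of y and σ. Summation by parts gives D ≥ σ n Λ (n + 1) because σ descends, so D = 0
  -- makes the slack vanish and all ratios equal to 1.
  Λ D : ℕ → ℚ
  Λ i = psum ρ i - fromNat i
  D = psum (λ i → σ i * (ρ i - 1ℚ))
  1≤prod : ∀ i → i ℕ.≤ suc n → 1ℚ ≤ pprod ρ i
  1≤prod i le = *-cancel-≤ (pprod->0 i (λ j lt → hσ j (ℕ.≤-trans lt le)))
      (subst₂ _≤_ (sym (*-identityʳ _)) (sym (prod-ρ i le)) (pre i le))
  amgm = λ i (le : i ℕ.≤ suc n) → am-gm-1 {ρ} i (λ j lt → 0<ρ j (ℕ.≤-trans lt le)) (1≤prod i le)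
  0≤Λ : ∀ i → i ℕ.≤ suc n → 0ℚ ≤ Λ i
  0≤Λ i le = diff-≤ (proj₁ (amgm i le))
  Λ-suc : ∀ i → Λ (suc i) ≡ Λ i + (ρ i - 1ℚ)
  Λ-suc i = trans (cong (λ c → psum ρ i + ρ i - c) (fromNat-suc i)) (lem (psum ρ i) (ρ i) (fromNat i))
    where
    opaque
      unfolding ring
      lem : ∀ s r n → s + r - (1ℚ + n) ≡ s - n + (r - 1ℚ)
      lem = solve-∀ ring
  abel : ∀ i → i ℕ.< suc n → σ i * Λ (suc i) ≤ D (suc i)
  abel zero lt = ℚ.≤-reflexive (trans (cong (σ 0 *_) (Λ-suc 0)) (lem (σ 0) (ρ 0)))
    where
    opaque
      unfolding ring
      lem : ∀ s r → s * (0ℚ - 0ℚ + (r - 1ℚ)) ≡ 0ℚ + s * (r - 1ℚ)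
      lem = solve-∀ ring
  abel (suc i) lt = ℚ.≤-trans (ℚ.≤-reflexive (trans (cong (σ (suc i) *_) (Λ-suc (suc i))) (distribˡ _ _ _)))
    (+-monoˡ-≤ _ (ℚ.≤-trans (*-monoʳ (0≤Λ (suc i) (ℕ.<⇒≤ lt)) (anti i lt)) (abel i (ℕ.<⇒≤ lt))))
  D≡ : ∀ i → i ℕ.≤ suc n → D i ≡ psum y i - psum σ i
  D≡ zero le = sym (+-inverseʳ 0ℚ)
  D≡ (suc i) lt = trans (cong₂ _+_ (D≡ i (ℕ.<⇒≤ lt)) (trans (lem (σ i) (ρ i)) (cong (_- σ i) (σρ i lt))))
      (lem′ (psum y i) (psum σ i) (y i) (σ i))
    where
    opaque
      unfolding ring
      lem : ∀ s r → s * (r - 1ℚ) ≡ s * r - s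
      lem = solve-∀ ring
      opaque
        unfolding ring
        lem′ : ∀ a b c d → a - b + (c - d) ≡ a + c - (b + d)
        lem′ = solve-∀ ring
  0<σn : 0ℚ < σ n
  0<σn = hσ n ℕ.≤-refl
  0≤D : 0ℚ ≤ D (suc n)
  0≤D = ℚ.≤-trans (0≤* (ℚ.<⇒≤ 0<σn) (0≤Λ (suc n) ℕ.≤-refl)) (abel n ℕ.≤-refl)
  equality : psum y (suc n) ≤ psum σ (suc n) → ∀ i → i ℕ.< suc n → σ i ≡ y i
  equality h i lt = trans (sym (trans (cong (σ i *_) ρ≡1) (*-identityʳ (σ i)))) (σρ i lt)
    where
    D≤0 : D (suc n) ≤ 0ℚ
    D≤0 = subst₂ _≤_ (sym (D≡ (suc n) ℕ.≤-refl)) (+-inverseʳ _) (+-monoˡ-≤ (- psum σ (suc n)) h)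
    Λ≤0 : Λ (suc n) ≤ 0ℚ
    Λ≤0 = *-cancel-≤ 0<σn (subst (σ n * Λ (suc n) ≤_) (sym (*-zeroʳ (σ n))) (ℚ.≤-trans (abel n ℕ.≤-refl) D≤0))
    ρ≡1 : ρ i ≡ 1ℚ
    ρ≡1 = proj₂ (amgm (suc n) ℕ.≤-refl)
        (undiff-≤ (subst (0ℚ ≤_) (lem (psum ρ (suc n)) (fromNat (suc n))) (subst (_≤ - Λ (suc n)) neg-0 (neg-≤ Λ≤0))))
        i lt
      where
      opaque
        unfolding ring
        lem : ∀ s n → - (s - n) ≡ n - s
        lem = solve-∀ ring

-- Inserting z into a descending sequence

module Insertion (x : ℕ → ℚ) (z : ℚ) where

  position : ∀ n → (∀ i → suc i ℕ.< n → x (suc i) ≤ x i) →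
    ∃[ j ] j ℕ.≤ n × (∀ i → i ℕ.< j → z ≤ x i) × (∀ i → j ℕ.≤ i → i ℕ.< n → x i < z)
  position zero anti = 0 , z≤n , (λ i ()) , λ i _ ()
  position (suc n) anti with position n (λ i lt → anti i (ℕ.m≤n⇒m≤1+n lt))
  ... | j , j≤n , below , above with ℕ.m≤n⇒m<n∨m≡n j≤n
  ...   | inj₁ j<n = j , ℕ.m≤n⇒m≤1+n j≤n , below , above′
    where
    above′ : ∀ i → j ℕ.≤ i → i ℕ.< suc n → x i < z
    above′ i j≤i lt with ℕ.m≤n⇒m<n∨m≡n (ℕ.s≤s⁻¹ lt)
    ... | inj₁ i<n = above i j≤i i<n
    above′ zero j≤i lt | inj₂ refl = contradiction j<n λ ()
    above′ (suc i) j≤i lt | inj₂ refl = ℚ.≤-<-trans (anti i lt) (above i (ℕ.s≤s⁻¹ j<n) ℕ.≤-refl)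
  ...   | inj₂ refl with <-≤-connex (x n) z
  ...     | inj₁ lt = n , ℕ.n≤1+n n , below , λ i n≤i i<sn → subst (λ k → x k < z) (ℕ.≤-antisym n≤i (ℕ.s≤s⁻¹ i<sn)) lt
  ...     | inj₂ ge = suc n , ℕ.≤-refl , below′ , λ i sn≤i i<sn → contradiction (ℕ.≤-trans i<sn sn≤i)
      (ℕ.<-irrefl refl)
    where
    below′ : ∀ i → i ℕ.< suc n → z ≤ x i
    below′ i lt with ℕ.m≤n⇒m<n∨m≡n (ℕ.s≤s⁻¹ lt)
    ... | inj₁ i<n = below i i<n
    ... | inj₂ refl = ge

  insert : ℕ → ℕ → ℚ
  insert j i with ℕ.<-cmp i j
  ... | tri< _ _ _ = x i
  ... | tri≈ _ _ _ = z
  ... | tri> _ _ _ = x (ℕ.pred i)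

  insert-< : ∀ {j i} → i ℕ.< j → insert j i ≡ x i
  insert-< {j} {i} lt with ℕ.<-cmp i j
  ... | tri< _ _ _ = refl
  ... | tri≈ ¬lt _ _ = contradiction lt ¬lt
  ... | tri> ¬lt _ _ = contradiction lt ¬lt

  insert-≡ : ∀ j → insert j j ≡ z
  insert-≡ j with ℕ.<-cmp j j
  ... | tri< _ ¬e _ = contradiction refl ¬e
  ... | tri≈ _ _ _ = refl
  ... | tri> _ ¬e _ = contradiction refl ¬e

  insert-> : ∀ {j i} → j ℕ.≤ i → insert j (suc i) ≡ x i
  insert-> {j} {i} le with ℕ.<-cmp (suc i) j
  ... | tri< _ _ ¬gt = contradiction (s≤s le) ¬gt
  ... | tri≈ _ _ ¬gt = contradiction (s≤s le) ¬gt
  ... | tri> _ _ _ = refl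

  pprod-insert-≤ : ∀ {j i} → i ℕ.≤ j → pprod (insert j) i ≡ pprod x i
  pprod-insert-≤ {j} {i} le = pprod-cong i λ k lt → insert-< (ℕ.≤-trans lt le)

  pprod-insert-> : ∀ {j} m → pprod (insert j) (suc (j ℕ.+ m)) ≡ pprod x (j ℕ.+ m) * z
  pprod-insert-> {j} zero = subst (λ k → pprod (insert j) (suc k) ≡ pprod x k * z) (sym (ℕ.+-identityʳ j))
    (cong₂ _*_ (pprod-insert-≤ {j} ℕ.≤-refl) (insert-≡ j))
  pprod-insert-> {j} (suc m) = subst (λ k → pprod (insert j) (suc k) ≡ pprod x k * z) (sym (ℕ.+-suc j m))
    (trans (cong₂ _*_ (pprod-insert-> {j} m) (insert-> (ℕ.m≤m+n j m))) (lem (pprod x (j ℕ.+ m)) z (x (j ℕ.+ m))))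
    where
    opaque
      unfolding ring
      lem : ∀ p z x → p * z * x ≡ p * x * z
      lem = solve-∀ ring

  psum-insert-> : ∀ {j} m → psum (insert j) (suc (j ℕ.+ m)) ≡ psum x (j ℕ.+ m) + z
  psum-insert-> {j} zero = subst (λ k → psum (insert j) (suc k) ≡ psum x k + z) (sym (ℕ.+-identityʳ j))
    (cong₂ _+_ (psum-cong j λ k lt → insert-< {j} lt) (insert-≡ j))
  psum-insert-> {j} (suc m) = subst (λ k → psum (insert j) (suc k) ≡ psum x k + z) (sym (ℕ.+-suc j m))
    (trans (cong₂ _+_ (psum-insert-> {j} m) (insert-> (ℕ.m≤m+n j m))) (lem (psum x (j ℕ.+ m)) z (x (j ℕ.+ m))))
    where
    opaque
      unfolding ring
      lem : ∀ p z x → p + z + x ≡ p + x + z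
      lem = solve-∀ ring

-- z is inserted at its sorted position; the two families of prefix inequalities cover every such position.
majorization-insert : ∀ (x : ℕ → ℚ) z y n → (∀ i → i ℕ.< n → 0ℚ < x i) → 0ℚ < z → (∀ i → i ℕ.≤ n → 0ℚ < y i) →
  (∀ i → suc i ℕ.< n → x (suc i) ≤ x i) → (∀ i → i ℕ.≤ n → pprod x i ≤ pprod y i) →
  (∀ i → i ℕ.≤ n → pprod x i * z ≤ pprod y (suc i)) →
  psum x n + z ≤ psum y (suc n) × (psum y (suc n) ≤ psum x n + z →
    pprod x n * z ≡ pprod y (suc n) × ∃[ j ] j ℕ.≤ n × (∀ i → i ℕ.< j → x i ≡ y i) × z ≡ y j × (∀ i → j ℕ.≤ i →
        i ℕ.< n → x i ≡ y (suc i)))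
majorization-insert x z y n hx hz hy anti pre₁ pre₂ with Insertion.position x z n anti
... | j , j≤n , below , above = subst (_≤ psum y (suc n)) sum≡ (proj₁ maj) ,
    λ h → let eq = proj₂ maj (subst (psum y (suc n) ≤_) (sym sum≡) h) in
      trans (sym (prod-> j≤n)) (pprod-cong (suc n) eq) , j , j≤n ,
          (λ i lt → trans (sym (insert-< lt)) (eq i (ℕ.≤-trans lt (ℕ.m≤n⇒m≤1+n j≤n)))) ,
      trans (sym (insert-≡ j)) (eq j (s≤s j≤n)) ,
      λ i j≤i i<n → trans (sym (insert-> j≤i)) (eq (suc i) (s≤s i<n))
  where
  open Insertion x z
  j+ : ∀ {i} → j ℕ.≤ i → j ℕ.+ (i ℕ.∸ j) ≡ i
  j+ = ℕ.m+[n∸m]≡n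
  prod-> : ∀ {i} → j ℕ.≤ i → pprod (insert j) (suc i) ≡ pprod x i * z
  prod-> {i} le = subst (λ k → pprod (insert j) (suc k) ≡ pprod x k * z) (j+ le) (pprod-insert-> {j} (i ℕ.∸ j))
  sum≡ : psum (insert j) (suc n) ≡ psum x n + z
  sum≡ = subst (λ k → psum (insert j) (suc k) ≡ psum x k + z) (j+ j≤n) (psum-insert-> {j} (n ℕ.∸ j))
  pos : ∀ i → i ℕ.< suc n → 0ℚ < insert j i
  pos i lt with ℕ.<-cmp i j
  ... | tri< i<j _ _ = hx i (ℕ.≤-trans i<j j≤n)
  ... | tri≈ _ _ _ = hz
  pos (suc i) lt | tri> _ _ _ = hx i (ℕ.s≤s⁻¹ lt)
  anti′ : ∀ i → suc i ℕ.< suc n → insert j (suc i) ≤ insert j i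
  anti′ i lt with ℕ.<-cmp i j
  ... | tri> _ _ j<i = subst (_≤ x (ℕ.pred i)) (sym (insert-> (ℕ.<⇒≤ j<i))) (pred-anti i j<i lt)
    where
    pred-anti : ∀ i → j ℕ.< i → suc i ℕ.< suc n → x i ≤ x (ℕ.pred i)
    pred-anti (suc i) _ lt = anti i (ℕ.s≤s⁻¹ lt)
  ... | tri≈ _ refl _ = subst (_≤ z) (sym (insert-> ℕ.≤-refl)) (ℚ.<⇒≤ (above i ℕ.≤-refl (ℕ.s≤s⁻¹ lt)))
  ... | tri< i<j _ _ with ℕ.m≤n⇒m<n∨m≡n i<j
  ...   | inj₁ si<j = subst (_≤ x i) (sym (insert-< si<j)) (anti i (ℕ.≤-trans si<j j≤n))
  ...   | inj₂ refl = subst (_≤ x i) (sym (insert-≡ (suc i))) (below i ℕ.≤-refl)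
  pre : ∀ i → i ℕ.≤ suc n → pprod (insert j) i ≤ pprod y i
  pre i le with ℕ.<-cmp i j
  ... | tri< i<j _ _ = subst (_≤ pprod y i) (sym (pprod-insert-≤ (ℕ.<⇒≤ i<j))) (pre₁ i (ℕ.≤-trans (ℕ.<⇒≤ i<j) j≤n))
  ... | tri≈ _ refl _ = subst (_≤ pprod y i) (sym (pprod-insert-≤ {i} ℕ.≤-refl)) (pre₁ i j≤n)
  pre (suc i) le | tri> _ _ j<i = subst (_≤ pprod y (suc i)) (sym (prod-> (ℕ.s≤s⁻¹ j<i))) (pre₂ i (ℕ.s≤s⁻¹ le))
  maj = majorization {insert j} {y} (suc n) pos (λ i lt → hy i (ℕ.s≤s⁻¹ lt)) anti′ pre

-- Unit fractions

inverse-unique : ∀ {p q} → p * q ≡ 1ℚ → q ≡ p ⁻¹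
inverse-unique {p} {q} e = *-cancel-≡ p≢0 (trans e (sym (⁻¹-inverse p≢0)))
  where
  p≢0 : p ≢ 0ℚ
  p≢0 z = ℚ.1≢0 (trans (sym e) (trans (cong (_* q) z) (*-zeroˡ q)))

⁻¹-* : ∀ {p q} → p ≢ 0ℚ → q ≢ 0ℚ → (p * q) ⁻¹ ≡ p ⁻¹ * q ⁻¹
⁻¹-* {p} {q} hp hq = sym
    (inverse-unique (trans (lem p q (p ⁻¹) (q ⁻¹)) (trans (cong₂ _*_ (⁻¹-inverse hp) (⁻¹-inverse hq))
    (*-identityˡ 1ℚ))))
  where
  opaque
    unfolding ring
    lem : ∀ p q x y → p * q * (x * y) ≡ p * x * (q * y)
    lem = solve-∀ ring

⁻¹-injective : ∀ {p q} → 0ℚ < p → 0ℚ < q → p ⁻¹ ≡ q ⁻¹ → p ≡ q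
⁻¹-injective {p} {q} hp hq e = trans (inverse-unique (trans (*-comm (p ⁻¹) p) (⁻¹-inverse (>⇒≢0 hp))))
  (trans (cong _⁻¹ e) (sym (inverse-unique (trans (*-comm (q ⁻¹) q) (⁻¹-inverse (>⇒≢0 hq))))))

⁻¹-antimono : ∀ {p q} → 0ℚ < p → p ≤ q → q ⁻¹ ≤ p ⁻¹
⁻¹-antimono {p} {q} hp le =
    *-cancel-≤ hp (*-cancel-≤ 0<q
    (subst₂ _≤_ (sym (trans (lem q p (q ⁻¹)) (trans (cong (_* p) (⁻¹-inverse (>⇒≢0 0<q))) (*-identityˡ p))))
    (sym (trans (cong (q *_) (⁻¹-inverse (>⇒≢0 hp))) (*-identityʳ q))) le))
  where
  0<q : 0ℚ < q
  0<q = ℚ.<-≤-trans hp le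
  opaque
    unfolding ring
    lem : ∀ q p i → q * (p * i) ≡ q * i * p
    lem = solve-∀ ring

^-mono-< : ∀ {x y} n → 0ℚ ≤ y → y < x → y ^ suc n < x ^ suc n
^-mono-< {x} {y} zero 0≤y lt = subst₂ _<_ (sym (*-identityʳ y)) (sym (*-identityʳ x)) lt
^-mono-< {x} {y} (suc n) 0≤y lt = ℚ.≤-<-trans (*-monoˡ 0≤y (ℚ.<⇒≤ (^-mono-< n 0≤y lt)))
  (*-monoʳ-< (ℚ.≤-<-trans (^-≥0 (suc n) 0≤y) (^-mono-< n 0≤y lt)) lt)

-- Indices start at 0, so `s k` and `τ k` stand for s_{g,k+1} and t_{g,k+1}. The recursion through
-- `τ (suc k) = τ k * s k` is the one for which 1 / s k + 1 / τ (k + 1) = 1 / τ k telescopes.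
module Sylvester (g : ℚ) (1≤g : 1ℚ ≤ g) where

  0<g : 0ℚ < g
  0<g = ℚ.<-≤-trans 0<1 1≤g

  τ s : ℕ → ℚ
  τ zero = g
  τ (suc k) = τ k * s k
  s k = τ k + 1ℚ

  1≤τ : ∀ k → 1ℚ ≤ τ k
  1≤τ zero = 1≤g
  1≤τ (suc k) = ℚ.≤-trans (1≤τ k) (≤-by (τ k * τ k) (sq-≥0 (τ k)) (lem (τ k)))
    where
    opaque
      unfolding ring
      lem : ∀ t → t * (t + 1ℚ) ≡ t + t * t
      lem = solve-∀ ring

  0<τ : ∀ k → 0ℚ < τ k
  0<τ k = ℚ.<-≤-trans 0<1 (1≤τ k)

  0<s : ∀ k → 0ℚ < s k
  0<s k = 0<+ (0<τ k) 0≤1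

  τ-suc-≥ : ∀ k → τ k ≤ τ (suc k)
  τ-suc-≥ k = ≤-by (τ k * τ k) (sq-≥0 (τ k)) (lem (τ k))
    where
    opaque
      unfolding ring
      lem : ∀ t → t * (t + 1ℚ) ≡ t + t * t
      lem = solve-∀ ring

  τ-mono : ∀ k m → τ k ≤ τ (k ℕ.+ m)
  τ-mono k zero = ℚ.≤-reflexive (cong τ (sym (ℕ.+-identityʳ k)))
  τ-mono k (suc m) = ℚ.≤-trans (τ-mono k m) (subst (λ i → τ (k ℕ.+ m) ≤ τ i) (sym (ℕ.+-suc k m)) (τ-suc-≥ (k ℕ.+ m)))

  s⁻¹+τ⁻¹ : ∀ k → s k ⁻¹ + τ (suc k) ⁻¹ ≡ τ k ⁻¹
  s⁻¹+τ⁻¹ k = inverse-unique (trans (cong (λ x → τ k * (s k ⁻¹ + x)) (⁻¹-* (>⇒≢0 (0<τ k)) (>⇒≢0 (0<s k))))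
    (trans (lem (τ k) (s k ⁻¹) (τ k ⁻¹)) (trans (cong (λ x → τ k * s k ⁻¹ + x * s k ⁻¹) (⁻¹-inverse (>⇒≢0 (0<τ k))))
    (trans (lem′ (τ k) (s k ⁻¹)) (⁻¹-inverse (>⇒≢0 (0<s k)))))))
    where
    opaque
      unfolding ring
      lem : ∀ t i j → t * (i + j * i) ≡ t * i + t * j * i
      lem = solve-∀ ring
      opaque
        unfolding ring
        lem′ : ∀ t i → t * i + 1ℚ * i ≡ (t + 1ℚ) * i
        lem′ = solve-∀ ring

  -- The base case is 4 t ≤ (t + 1)². In the induction step τ² is multiplied by a factor s² ≥ 2 τ k,
  -- since τ increases. The exponents are those of `prefix-z`, where m counts the terms that follow
  -- the prefix.
  power-growth : ∀ k m → 2ℚ ^ suc (suc m) * τ k ^ suc (suc (suc m)) ≤ τ (suc (k ℕ.+ m)) * τ (suc (k ℕ.+ m))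
  power-growth k zero = subst (λ i → 2ℚ ^ 2 * τ k ^ 3 ≤ τ (suc i) * τ (suc i)) (sym (ℕ.+-identityʳ k))
    (≤-by (τ k * (τ k - 1ℚ) * (τ k * (τ k - 1ℚ))) (sq-≥0 (τ k * (τ k - 1ℚ))) (lem (τ k)))
    where
    opaque
      unfolding ring
      lem : ∀ t → t * (t + 1ℚ) * (t * (t + 1ℚ)) ≡ (1ℚ + 1ℚ) * ((1ℚ + 1ℚ) * 1ℚ) * (t * (t * (t * 1ℚ))) + t * (t - 1ℚ) *
          (t * (t - 1ℚ))
      lem = solve-∀ ring
  power-growth k (suc m) = subst (λ i → 2ℚ ^ suc (suc (suc m)) * τ k ^ suc (suc (suc (suc m))) ≤ τ (suc i) * τ
      (suc i)) (sym (ℕ.+-suc k m))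
    (ℚ.≤-trans (ℚ.≤-reflexive (lem 2ℚ (2ℚ ^ suc (suc m)) (τ k) (τ k ^ suc (suc (suc m)))))
    (ℚ.≤-trans (*-monoˡ (0≤* (ℚ.<⇒≤ 0<2) (ℚ.<⇒≤ (0<τ k))) (power-growth k m))
      (≤-by (t * t * ((t * t + 1ℚ) + 2ℚ * (t - τ k)))
          (0≤* (sq-≥0 t) (0≤+ (0≤+ (sq-≥0 t) 0≤1) (0≤* (ℚ.<⇒≤ 0<2) (diff-≤ mono)))) (lem′ t (τ k)))))
    where
    t : ℚ
    t = τ (suc (k ℕ.+ m))
    mono : τ k ≤ t
    mono = subst (λ i → τ k ≤ τ i) (ℕ.+-suc k m) (τ-mono k (suc m))
    opaque
      unfolding ring
      lem : ∀ c x t y → c * x * (t * y) ≡ c * t * (x * y)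
      lem = solve-∀ ring
      opaque
        unfolding ring
        lem′ : ∀ t k → t * (t + 1ℚ) * (t * (t + 1ℚ)) ≡ (1ℚ + 1ℚ) * k * (t * t) + t * t *
            ((t * t + 1ℚ) + (1ℚ + 1ℚ) * (t - k))
        lem′ = solve-∀ ring

-- In dimension N′ + 2, with aⱼ = g / βⱼ for the barycentric coordinates βⱼ of the origin.
record UnitFractions (g : ℚ) (N′ : ℕ) (a : ℕ → ℚ) : Set where
  field
    1≤g : 1ℚ ≤ g
    int-g : IsInt g
    int-a : ∀ i → IsInt (a i)
    0<a : ∀ i → 0ℚ < a i
    ascending : ∀ i → i ℕ.< suc (suc N′) → a i ≤ a (suc i)
    total : psum (λ i → a i ⁻¹) (suc (suc (suc N′))) ≡ g ⁻¹

3ℚ 6ℚ : ℚ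
3ℚ = 2ℚ + 1ℚ
6ℚ = 2ℚ * 3ℚ

0<3 : 0ℚ < 3ℚ
0<3 = 0<+ 0<2 0≤1

-- A statement about unit fractions only: `6-6-6` is an arithmetical possibility, which `no-6-6-6`
-- excludes by means of the vertices.
data Extremal (g : ℚ) (N′ : ℕ) (a : ℕ → ℚ) (1≤g : 1ℚ ≤ g) : Set where
  sylvester : (∀ i → i ℕ.< suc N′ → a i ≡ Sylvester.s g 1≤g i) →
    a (suc N′) ≡ 2ℚ * Sylvester.τ g 1≤g (suc N′) → a (suc (suc N′)) ≡ 2ℚ * Sylvester.τ g 1≤g (suc N′) →
        Extremal g N′ a 1≤g
  2-6-6-6 : N′ ≡ 1 → g ≡ 1ℚ → a 0 ≡ 2ℚ → a 1 ≡ 6ℚ → a 2 ≡ 6ℚ → a 3 ≡ 6ℚ → Extremal g N′ a 1≤g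
  6-6-6 : N′ ≡ 0 → g ≡ 2ℚ → a 0 ≡ 6ℚ → a 1 ≡ 6ℚ → a 2 ≡ 6ℚ → Extremal g N′ a 1≤g

-- The bound for the product of the denominators

module _ {g N′ a} (U : UnitFractions g N′ a) where

  open UnitFractions U
  open Sylvester g 1≤g

  private
    N : ℕ
    N = suc N′

    x X : ℕ → ℚ
    x i = a i ⁻¹
    X = pprod x

    -- `z` dominates the sum of the two smallest fractions `x N` and `x (suc N)`, and takes their
    -- place.
    p z : ℚ
    p = x N
    z = 2ℚ * p

    0<x : ∀ i → 0ℚ < x i
    0<x i = 0<⁻¹ (0<a i)

    ax : ∀ i → a i * x i ≡ 1ℚ
    ax i = ⁻¹-inverse (>⇒≢0 (0<a i))

    0<X : ∀ k → 0ℚ < X k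
    0<X k = pprod->0 k λ i _ → 0<x i

    x-descending : ∀ i → i ℕ.< suc N → x (suc i) ≤ x i
    x-descending i lt = ⁻¹-antimono (0<a i) (ascending i lt)

    x≤1 : ∀ i → x i ≤ 1ℚ
    x≤1 i = subst₂ _≤_ (*-identityˡ (x i)) (ax i) (*-monoʳ (ℚ.<⇒≤ (0<x i)) (int-pos (int-a i) (0<a i)))

    p≤x : ∀ i m → i ℕ.+ m ≡ N → p ≤ x i
    p≤x i zero e = ℚ.≤-reflexive (cong x (trans (sym e) (ℕ.+-identityʳ i)))
    p≤x i (suc m) e = ℚ.≤-trans (p≤x (suc i) m (trans (sym (ℕ.+-suc i m)) e))
      (x-descending i (ℕ.m≤n⇒m≤1+n
          (subst (suc i ℕ.≤_) e (subst (suc i ℕ.≤_) (sym (ℕ.+-suc i m)) (s≤s (ℕ.m≤m+n i m))))))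

    X-descending : ∀ k m → X (k ℕ.+ m) ≤ X k
    X-descending k zero = ℚ.≤-reflexive (cong X (ℕ.+-identityʳ k))
    X-descending k (suc m) = ℚ.≤-trans (ℚ.≤-reflexive (cong X (ℕ.+-suc k m)))
      (ℚ.≤-trans (subst (X (k ℕ.+ m) * x (k ℕ.+ m) ≤_) (*-identityʳ _)
          (*-monoˡ (ℚ.<⇒≤ (0<X (k ℕ.+ m))) (x≤1 (k ℕ.+ m)))) (X-descending k m))

    X≤1 : ∀ k → X k ≤ 1ℚ
    X≤1 k = X-descending 0 k

  -- The remainder 1/g - x₀ - … - xₖ₋₁ is a positive multiple of 1/(g a₀ ⋯ aₖ₋₁).
  remainder-≥ : ∀ k → k ℕ.< suc (suc (suc N′)) → pprod x k ≤ 1ℚ - g * psum x k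
  remainder-≥ k lt = *-cancel-≤ 0<Πa (subst (_≤ pprod a k * r) (sym (ΠaX k)) (int-pos (int-r k) (0<* 0<Πa 0<r)))
    where
    r : ℚ
    r = 1ℚ - g * psum x k
    0<Πa : 0ℚ < pprod a k
    0<Πa = pprod->0 k λ i _ → 0<a i
    ΠaX : ∀ k → pprod a k * X k ≡ 1ℚ
    ΠaX zero = *-identityˡ 1ℚ
    ΠaX (suc k) = trans (lem (pprod a k) (a k) (X k) (x k)) (trans (cong₂ _*_ (ΠaX k) (ax k)) (*-identityˡ 1ℚ))
      where
      opaque
        unfolding ring
        lem : ∀ A a X x → A * a * (X * x) ≡ A * X * (a * x)
        lem = solve-∀ ring
    int-Πa : ∀ k → IsInt (pprod a k)
    int-Πa zero = int-1
    int-Πa (suc k) = int-* (int-Πa k) (int-a k)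
    int-r : ∀ k → IsInt (pprod a k * (1ℚ - g * psum x k))
    int-r zero = subst IsInt (lem g) int-1
      where
      opaque
        unfolding ring
        lem : ∀ g → 1ℚ ≡ 1ℚ * (1ℚ - g * 0ℚ)
        lem = solve-∀ ring
    int-r (suc k) = subst IsInt (trans (cong (λ y → a k * (pprod a k * (1ℚ - g * psum x k)) - g * pprod a k * y)
        (sym (ax k)))
        (lem (pprod a k) (a k) g (psum x k) (x k)))
      (int-+ (int-* (int-a k) (int-r k)) (int-neg (int-* (int-* int-g (int-Πa k)) int-1)))
      where
      opaque
        unfolding ring
        lem : ∀ A a g S x → a * (A * (1ℚ - g * S)) - g * A * (a * x) ≡ A * a * (1ℚ - g * (S + x))
        lem = solve-∀ ring
    m : ℕ
    m = suc (suc N′) ℕ.∸ k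
    k+m : k ℕ.+ suc m ≡ suc (suc (suc N′))
    k+m = trans (ℕ.+-suc k m) (cong suc (ℕ.m+[n∸m]≡n (ℕ.s≤s⁻¹ lt)))
    below : psum x k < g ⁻¹
    below = subst (psum x k <_) (trans (psum-shift x k (suc m)) (trans (cong (psum x) k+m) total))
      (<-by (psum (λ i → x (k ℕ.+ i)) (suc m)) (psum->0 m (λ i _ → 0<x (k ℕ.+ i))) refl)
    0<r : 0ℚ < r
    0<r = diff-< (subst (g * psum x k <_) (⁻¹-inverse (>⇒≢0 0<g)) (*-monoˡ-< 0<g below))

  private
    -- The Sylvester solution with its two last fractions 1 / (2 τ N) merged into 1 / τ N, in
    -- analogy to `z`. The total is 1 / g by `psum-ŷ-N`.
    ŷ Ŷ : ℕ → ℚ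
    ŷ i with i ℕ.<? N
    ... | yes _ = s i ⁻¹
    ... | no _ = τ N ⁻¹
    Ŷ = pprod ŷ

    ŷ-< : ∀ {i} → i ℕ.< N → ŷ i ≡ s i ⁻¹
    ŷ-< {i} lt with i ℕ.<? N
    ... | yes _ = refl
    ... | no nlt = contradiction lt nlt

    ŷ-N : ŷ N ≡ τ N ⁻¹
    ŷ-N with N ℕ.<? N
    ... | yes lt = contradiction lt (ℕ.<-irrefl refl)
    ... | no _ = refl

    0<ŷ : ∀ i → 0ℚ < ŷ i
    0<ŷ i with i ℕ.<? N
    ... | yes _ = 0<⁻¹ (0<s i)
    ... | no _ = 0<⁻¹ (0<τ N)

    Ŷτ : ∀ k → k ℕ.≤ N → Ŷ k * τ k ≡ g
    Ŷτ zero le = *-identityˡ g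
    Ŷτ (suc k) lt = trans (cong (λ y → Ŷ k * y * (τ k * s k)) (ŷ-< lt))
      (trans (lem (Ŷ k) (s k ⁻¹) (τ k) (s k)) (trans (cong₂ _*_ (Ŷτ k (ℕ.<⇒≤ lt)) (⁻¹-inverse (>⇒≢0 (0<s k))))
          (*-identityʳ g)))
      where
      opaque
        unfolding ring
        lem : ∀ Y i t s → Y * i * (t * s) ≡ Y * t * (s * i)
        lem = solve-∀ ring

    Ŷτ² : Ŷ (suc N) * (τ N * τ N) ≡ g
    Ŷτ² = trans (cong (λ y → Ŷ N * y * (τ N * τ N)) ŷ-N) (trans (lem (Ŷ N) (τ N ⁻¹) (τ N))
      (trans (cong₂ _*_ (Ŷτ N ℕ.≤-refl) (⁻¹-inverse (>⇒≢0 (0<τ N)))) (*-identityʳ g)))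
      where
      opaque
        unfolding ring
        lem : ∀ Y i t → Y * i * (t * t) ≡ Y * t * (t * i)
        lem = solve-∀ ring

    psum-ŷ : ∀ k → k ℕ.≤ N → psum ŷ k + τ k ⁻¹ ≡ g ⁻¹
    psum-ŷ zero le = +-identityˡ _
    psum-ŷ (suc k) lt = trans (+-assoc _ _ _) (trans (cong (λ y → psum ŷ k + (y + τ (suc k) ⁻¹)) (ŷ-< lt))
      (trans (cong (_+_ (psum ŷ k)) (s⁻¹+τ⁻¹ k)) (psum-ŷ k (ℕ.<⇒≤ lt))))

    psum-ŷ-N : psum ŷ (suc N) ≡ g ⁻¹
    psum-ŷ-N = trans (cong (_+_ (psum ŷ N)) ŷ-N) (psum-ŷ N ℕ.≤-refl)

    0<z : 0ℚ < z
    0<z = 0<* 0<2 (0<x N)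

    two : ∀ y → 2ℚ * y ≡ y + y
    two = lem
      where
      opaque
        unfolding ring
        lem : ∀ y → (1ℚ + 1ℚ) * y ≡ y + y
        lem = solve-∀ ring

    x+x≤z : x N + x (suc N) ≤ z
    x+x≤z = subst (x N + x (suc N) ≤_) (sym (two p)) (+-monoʳ-≤ p (x-descending N ℕ.≤-refl))

  -- `big` says that the product of the denominators is at least the claimed maximum; the aim is to
  -- show that it is then equal to it. `small` is what the prefix inequality with z needs at i = N′,
  -- where no later term of the prefix can compensate for the factor 2.
  module _ (big : X (suc N) * (2ℚ * (τ N * τ N)) ≤ g) (small : 2ℚ * X N′ ≤ g) where

    private
      powers : ∀ i j → i ℕ.+ j ℕ.≤ suc N → X i * p ^ j ≤ X (i ℕ.+ j)
      powers i zero le = ℚ.≤-reflexive (trans (*-identityʳ _) (cong X (sym (ℕ.+-identityʳ i))))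
      powers i (suc j) le = ℚ.≤-trans (ℚ.≤-reflexive (lem (X i) p (p ^ j)))
        (ℚ.≤-trans (*-mono (ℚ.<⇒≤ (0<x N)) (ℚ.<⇒≤ (0<X (i ℕ.+ j))) (powers i j (ℕ.<⇒≤ le′))
            (p≤x (i ℕ.+ j) (N ℕ.∸ (i ℕ.+ j)) (ℕ.m+[n∸m]≡n (ℕ.s≤s⁻¹ le′))))
          (ℚ.≤-reflexive (cong X (sym (ℕ.+-suc i j)))))
        where
        le′ : suc (i ℕ.+ j) ℕ.≤ suc N
        le′ = subst (ℕ._≤ suc N) (ℕ.+-suc i j) le
        opaque
          unfolding ring
          lem : ∀ X p q → X * (p * q) ≡ X * q * p
          lem = solve-∀ ring

      -- Raise both sides to the power N + 1 - i and use X i * p ^ (N + 1 - i) ≤ X (N + 1).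
      prefix-z : ∀ i m → i ℕ.+ m ≡ N′ → X i * z ≤ Ŷ (suc i)
      prefix-z i m e = *-cancel-≤ (0<τ (suc i))
          (subst₂ _≤_ (*-comm (X i * z) _) (trans (sym (Ŷτ (suc i) (s≤s (subst (i ℕ.≤_) e (ℕ.m≤m+n i m)))))
          (*-comm (Ŷ (suc i)) _)) (ℚ.≮⇒≥ not-above))
        where
        t u : ℚ
        t = τ (suc i)
        u = X i * z * t
        q₁ q : ℕ
        q₁ = suc m
        q = suc q₁
        i+q : i ℕ.+ q ≡ suc N
        i+q = trans (ℕ.+-suc i q₁) (cong suc (trans (ℕ.+-suc i m) (cong suc e)))
        -- `expand` splits u ^ q times the square of `τ N` into this left-hand side and a factor
        -- that `powers` and `big` bound by g. For m = 0 the claim is `small`; otherwise the power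
        -- of `X i` is at most 1, the power of g is at least 1, and `power-growth` suffices.
        key : ∀ m → i ℕ.+ m ≡ N′ → 2ℚ ^ suc m * t ^ suc (suc m) * X i ^ suc m ≤ g ^ suc m * (τ N * τ N)
        key zero e with refl ← trans (sym (ℕ.+-identityʳ i)) e = subst₂ _≤_ (lem (X i) t) (lem′ g t)
            (*-monoʳ (sq-≥0 t) small)
          where
          opaque
            unfolding ring
            lem : ∀ X t → (1ℚ + 1ℚ) * X * (t * t) ≡ (1ℚ + 1ℚ) * 1ℚ * (t * (t * 1ℚ)) * (X * 1ℚ)
            lem = solve-∀ ring
            opaque
              unfolding ring
              lem′ : ∀ g t → g * (t * t) ≡ g * 1ℚ * (t * t)
              lem′ = solve-∀ ring
        key (suc m) e = ℚ.≤-trans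
            (*-monoˡ (0≤* (^-≥0 (suc (suc m)) (ℚ.<⇒≤ 0<2)) (^-≥0 (suc (suc (suc m))) (ℚ.<⇒≤ (0<τ (suc i)))))
            (subst (X i ^ suc (suc m) ≤_) (1^ (suc (suc m))) (^-mono (suc (suc m)) (ℚ.<⇒≤ (0<X i)) (X≤1 i))))
          (ℚ.≤-trans (ℚ.≤-reflexive (*-identityʳ _)) (ℚ.≤-trans (power-growth (suc i) m)
            (subst (λ k → τ k * τ k ≤ g ^ suc (suc m) * (τ N * τ N)) (sym (cong suc (trans (sym (ℕ.+-suc i m)) e)))
              (subst (_≤ g ^ suc (suc m) * (τ N * τ N)) (*-identityˡ _) (*-monoʳ (sq-≥0 (τ N))
                (subst (_≤ g ^ suc (suc m)) (1^ (suc (suc m))) (^-mono (suc (suc m)) 0≤1 1≤g)))))))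
        expand : u ^ q * (τ N * τ N) ≡ 2ℚ ^ q₁ * t ^ q * X i ^ q₁ * (X i * p ^ q * (2ℚ * (τ N * τ N)))
        expand = trans (cong (_* (τ N * τ N))
            (trans (^-distrib-* (X i * z) t q)
            (cong (_* t ^ q) (trans (^-distrib-* (X i) z q) (cong (X i ^ q *_) (^-distrib-* 2ℚ p q))))))
          (lem (X i) (X i ^ q₁) 2ℚ (2ℚ ^ q₁) (p ^ q) (t ^ q) (τ N * τ N))
          where
          opaque
            unfolding ring
            lem : ∀ X X₁ c c₁ P T S → X * X₁ * (c * c₁ * P) * T * S ≡ c₁ * T * X₁ * (X * P * (c * S))
            lem = solve-∀ ring
        0≤2τ² : 0ℚ ≤ 2ℚ * (τ N * τ N)
        0≤2τ² = 0≤* (ℚ.<⇒≤ 0<2) (sq-≥0 (τ N))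
        bound : u ^ q ≤ g ^ q
        bound = *-cancel-≤ (0<* (0<τ N) (0<τ N)) (subst₂ _≤_ (*-comm (u ^ q) _) (*-comm (g ^ q) _)
          (ℚ.≤-trans (ℚ.≤-reflexive expand) (ℚ.≤-trans
            (*-mono (0≤* (0≤* (ℚ.<⇒≤ (0<X i)) (^-≥0 q (ℚ.<⇒≤ (0<x N)))) 0≤2τ²)
                (0≤* (^-≥0 q₁ (ℚ.<⇒≤ 0<g)) (sq-≥0 (τ N))) (key m e)
              (ℚ.≤-trans (*-monoʳ 0≤2τ² (ℚ.≤-trans (powers i q (ℕ.≤-reflexive i+q)) (ℚ.≤-reflexive (cong X i+q))))
                  big))
            (ℚ.≤-reflexive (lem (g ^ q₁) (τ N * τ N) g)))))
          where
          opaque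
            unfolding ring
            lem : ∀ a b g → a * b * g ≡ g * a * b
            lem = solve-∀ ring
        not-above : ¬ g < u
        not-above lt = ℚ.<-irrefl refl (ℚ.<-≤-trans (^-mono-< q₁ (ℚ.<⇒≤ 0<g) lt) bound)

      prefix-z-N : X N * z ≤ Ŷ (suc N)
      prefix-z-N = *-cancel-≤ (0<* (0<τ N) (0<τ N)) (subst₂ _≤_ (lem (X N) p (τ N * τ N))
          (trans (sym Ŷτ²) (*-comm (Ŷ (suc N)) _)) big)
        where
        opaque
          unfolding ring
          lem : ∀ X p S → X * p * ((1ℚ + 1ℚ) * S) ≡ S * (X * ((1ℚ + 1ℚ) * p))
          lem = solve-∀ ring

      prefix-z′ : ∀ i → i ℕ.≤ N → X i * z ≤ Ŷ (suc i)
      prefix-z′ i le with ℕ.m≤n⇒m<n∨m≡n le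
      ... | inj₁ lt = prefix-z i (N′ ℕ.∸ i) (ℕ.m+[n∸m]≡n (ℕ.s≤s⁻¹ lt))
      ... | inj₂ refl = prefix-z-N

      -- At the last k with X k > Ŷ k, majorization bounds the remainder after k terms by τₖ⁻¹, against remainder-≥.
      no-excess : ∀ k → k ℕ.≤ N → (∀ j → k ℕ.< j → j ℕ.≤ N → X j ≤ Ŷ j) → X k ≤ Ŷ k
      no-excess k k≤N later = ℚ.≮⇒≥ λ lt → ℚ.<-irrefl refl (ℚ.<-≤-trans lt (X≤Ŷ lt))
        where
        n : ℕ
        n = N ℕ.∸ k
        k+n : k ℕ.+ n ≡ N
        k+n = ℕ.m+[n∸m]≡n k≤N
        k+ : ∀ {i} → i ℕ.≤ n → k ℕ.+ i ℕ.≤ N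
        k+ {i} le = subst (k ℕ.+ i ℕ.≤_) k+n (ℕ.+-monoʳ-≤ k le)
        x′ y′ : ℕ → ℚ
        x′ i = x (k ℕ.+ i)
        y′ i = ŷ (k ℕ.+ i)
        module _ (lt : Ŷ k < X k) where
          -- The inequalities X ≤ Ŷ beyond k survive the removal of the first k terms, because the
          -- factor `X k` divided out on the left exceeds the factor `Ŷ k` on the right.
          pre₁ : ∀ i → i ℕ.≤ n → pprod x′ i ≤ pprod y′ i
          pre₁ zero le = ℚ.≤-refl
          pre₁ (suc i) le = *-cancel-≤ (0<X k) (subst (_≤ X k * pprod y′ (suc i)) (sym (pprod-shift x k (suc i)))
            (ℚ.≤-trans (later (k ℕ.+ suc i) (ℕ.m<m+n k (s≤s z≤n)) (k+ le))
              (subst (_≤ X k * pprod y′ (suc i)) (pprod-shift ŷ k (suc i))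
                  (*-monoʳ (ℚ.<⇒≤ (pprod->0 {y′} (suc i) λ j _ → 0<ŷ (k ℕ.+ j))) (ℚ.<⇒≤ lt)))))
          pre₂ : ∀ i → i ℕ.≤ n → pprod x′ i * z ≤ pprod y′ (suc i)
          pre₂ i le = *-cancel-≤ (0<X k)
              (subst (_≤ X k * pprod y′ (suc i)) (trans (cong (_* z) (sym (pprod-shift x k i))) (*-assoc _ _ z))
            (ℚ.≤-trans (prefix-z′ (k ℕ.+ i) (k+ le))
                (subst (_≤ X k * pprod y′ (suc i)) (trans (pprod-shift ŷ k (suc i)) (cong Ŷ (ℕ.+-suc k i)))
              (*-monoʳ (ℚ.<⇒≤ (pprod->0 {y′} (suc i) λ j _ → 0<ŷ (k ℕ.+ j))) (ℚ.<⇒≤ lt)))))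
          maj : psum x′ n + z ≤ psum y′ (suc n)
          maj = proj₁ (majorization-insert x′ z y′ n (λ i _ → 0<x (k ℕ.+ i)) 0<z (λ i _ → 0<ŷ (k ℕ.+ i))
            (λ i lt′ → subst (λ j → x j ≤ x (k ℕ.+ i)) (sym (ℕ.+-suc k i))
                (x-descending (k ℕ.+ i) (ℕ.m≤n⇒m≤1+n (subst (ℕ._≤ N) (ℕ.+-suc k i) (k+ (ℕ.<⇒≤ lt′))))))
            pre₁ pre₂)
          remainder-≤ : g ⁻¹ - psum x k ≤ τ k ⁻¹
          remainder-≤ = subst₂ _≤_ (cong (_- psum x k) (trans (lem₀ (psum x N) (x N) (x (suc N))) total)) refl
            (ℚ.≤-trans (subst₂ _≤_ (trans (lem₁ (psum x k) (psum x′ n) (x N + x (suc N)))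
                (cong (λ c → c + (x N + x (suc N)) - psum x k) (trans (psum-shift x k n) (cong (psum x) k+n)))) refl
                (ℚ.≤-trans (+-monoʳ-≤ (psum x′ n) x+x≤z) maj))
              (ℚ.≤-reflexive (trans (lem₂ (psum ŷ k) (psum y′ (suc n)))
                  (trans (cong (_- psum ŷ k)
                  (trans (psum-shift ŷ k (suc n)) (trans (cong (psum ŷ) (trans (ℕ.+-suc k n) (cong suc k+n)))
                  (trans psum-ŷ-N (sym (psum-ŷ k k≤N))))))
                (sym (lem₂ (psum ŷ k) (τ k ⁻¹)))))))
            where
            opaque
              unfolding ring
              lem₀ : ∀ S p q → S + (p + q) ≡ S + p + q
              lem₀ = solve-∀ ring
              opaque
                unfolding ring
                lem₁ : ∀ k n c → n + c ≡ k + n + c - k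
                lem₁ = solve-∀ ring
                lem₂ : ∀ k n → n ≡ k + n - k
                lem₂ = solve-∀ ring
          X≤Ŷ : X k ≤ Ŷ k
          X≤Ŷ = ℚ.≤-trans (remainder-≥ k (s≤s (ℕ.m≤n⇒m≤1+n k≤N)))
              (ℚ.≤-trans (ℚ.≤-reflexive (trans (cong (_- g * psum x k) (sym (⁻¹-inverse (>⇒≢0 0<g))))
              (lem g (g ⁻¹) (psum x k))))
            (ℚ.≤-trans (*-monoˡ (ℚ.<⇒≤ 0<g) remainder-≤)
                (ℚ.≤-reflexive (trans (cong (_* τ k ⁻¹) (sym (Ŷτ k k≤N)))
                (trans (*-assoc _ _ _) (trans (cong (Ŷ k *_) (⁻¹-inverse (>⇒≢0 (0<τ k)))) (*-identityʳ _)))))))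
            where
            opaque
              unfolding ring
              lem : ∀ g i S → g * i - g * S ≡ g * (i - S)
              lem = solve-∀ ring

      -- Descending induction on k, with `m` as a bound for N - k, since `no-excess` presupposes the
      -- inequality at all later places.
      X≤Ŷ : ∀ m k → N ℕ.≤ k ℕ.+ m → k ℕ.≤ N → X k ≤ Ŷ k
      X≤Ŷ zero k le k≤N = no-excess k k≤N λ j k<j j≤N →
          contradiction (ℕ.≤-trans (ℕ.≤-trans k<j j≤N) (subst (N ℕ.≤_) (ℕ.+-identityʳ k) le)) (ℕ.<-irrefl refl)
      X≤Ŷ (suc m) k le k≤N = no-excess k k≤N λ j k<j j≤N →
          X≤Ŷ m j (ℕ.≤-trans le (subst (ℕ._≤ j ℕ.+ m) (sym (ℕ.+-suc k m)) (ℕ.+-monoˡ-≤ m k<j))) j≤N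

      total′ : psum x N + (x N + x (suc N)) ≡ g ⁻¹
      total′ = trans (sym (+-assoc _ _ _)) total

      maj = majorization-insert x z ŷ N (λ i _ → 0<x i) 0<z (λ i _ → 0<ŷ i)
          (λ i lt → x-descending i (ℕ.m≤n⇒m≤1+n (ℕ.<⇒≤ lt)))
        (λ k le → X≤Ŷ N k (ℕ.m≤n+m N k) le) prefix-z′

      -- The x together with z have a sum of at least 1 / g, which is the sum of ŷ. So the
      -- majorization inequality is an equality, and the sorted sequences coincide.
      equal = proj₂ maj (ℚ.≤-trans (ℚ.≤-reflexive (trans psum-ŷ-N (sym total′))) (+-monoʳ-≤ (psum x N) x+x≤z))

      x-N+1 : x (suc N) ≡ x N
      x-N+1 = ℚ.≤-antisym (x-descending N ℕ.≤-refl)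
          (+-cancel-≤ (subst (_≤ x N + x (suc N)) (two p)
          (+-cancel-≤ {psum x N} (ℚ.≤-trans (proj₁ maj) (ℚ.≤-reflexive (trans psum-ŷ-N (sym total′)))))))
        where
        +-cancel-≤ : ∀ {c p q} → c + p ≤ c + q → p ≤ q
        +-cancel-≤ {c} {p} {q} h = subst₂ _≤_ (lem c p) (lem c q) (+-monoˡ-≤ (- c) h)
          where
          opaque
            unfolding ring
            lem : ∀ c p → c + p - c ≡ p
            lem = solve-∀ ring

    product-extremal : X (suc N) * (2ℚ * (τ N * τ N)) ≡ g
    product-extremal = trans (lem (X N) p (τ N * τ N)) (trans (cong (_* (τ N * τ N)) (proj₁ equal)) Ŷτ²)
      where
      opaque
        unfolding ring
        lem : ∀ X p S → X * p * ((1ℚ + 1ℚ) * S) ≡ X * ((1ℚ + 1ℚ) * p) * S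
        lem = solve-∀ ring

    private
      a-from-x : ∀ {i c} → 0ℚ < c → x i ≡ c ⁻¹ → a i ≡ c
      a-from-x {i} 0<c e = ⁻¹-injective (0<a i) 0<c e

      halve : ∀ {c} → 0ℚ < c → z ≡ c ⁻¹ → a N ≡ 2ℚ * c
      halve {c} 0<c e = a-from-x (0<* 0<2 0<c)
          (inverse-unique (trans (lem c p) (trans (cong (c *_) e) (⁻¹-inverse (>⇒≢0 0<c)))))
        where
        opaque
          unfolding ring
          lem : ∀ c p → (1ℚ + 1ℚ) * c * p ≡ c * ((1ℚ + 1ℚ) * p)
          lem = solve-∀ ring

      a-N+1 : a (suc N) ≡ a N
      a-N+1 = ⁻¹-injective (0<a (suc N)) (0<a N) x-N+1

    private
      -- Here z stands at a place j before the last, so that the later terms are shifted: a N′ = τ N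
      -- and a N = 2 s j. Ascending order gives τ N ≤ 2 s j, hence τ N′ ≤ 2. For N′ = 0 this and
      -- `small` give g = 2; for N′ = 1 it gives g = 1, and j = 0 is excluded by 6 > 4; for larger
      -- N′ it contradicts τ 2 ≥ 6.
      module Late (j : ℕ) (j<N : j ℕ.< N) (before : ∀ i → i ℕ.< j → x i ≡ ŷ i) (at : z ≡ ŷ j) (x-N′ : x N′ ≡ ŷ N)
          where

        a-N′ : a N′ ≡ τ N
        a-N′ = a-from-x (0<τ N) (trans x-N′ ŷ-N)

        a-N : a N ≡ 2ℚ * s j
        a-N = halve (0<s j) (trans at (ŷ-< j<N))

        τN≤ : τ N ≤ 2ℚ * s j
        τN≤ = subst₂ _≤_ a-N′ a-N (ascending N′ (ℕ.n≤1+n N))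

        τN′≤2 : τ N′ ≤ 2ℚ
        τN′≤2 = *-cancel-≤ (0<s N′) (subst₂ _≤_ (*-comm (τ N′) _) (*-comm 2ℚ _)
            (ℚ.≤-trans τN≤ (*-monoˡ (ℚ.<⇒≤ 0<2) (+-monoˡ-≤ 1ℚ
          (subst (λ i → τ j ≤ τ i) (ℕ.m+[n∸m]≡n (ℕ.s≤s⁻¹ j<N)) (τ-mono j (N′ ℕ.∸ j)))))))

        τ-1≥2 : 2ℚ ≤ τ 1
        τ-1≥2 = *-mono-1 (+-monoˡ-≤ 1ℚ 1≤g)
          where
          *-mono-1 : 2ℚ ≤ g + 1ℚ → 2ℚ ≤ g * (g + 1ℚ)
          *-mono-1 h = ℚ.≤-trans h (subst (_≤ g * (g + 1ℚ)) (*-identityˡ _) (*-monoʳ (ℚ.<⇒≤ (0<s 0)) 1≤g))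

        6≤τ-2 : 6ℚ ≤ τ 2
        6≤τ-2 = *-mono (0≤+ (ℚ.<⇒≤ 0<2) 0≤1) (ℚ.<⇒≤ (0<τ 1)) τ-1≥2 (+-monoˡ-≤ 1ℚ τ-1≥2)

        4<6 : 2ℚ * 2ℚ < 6ℚ
        4<6 = *-monoˡ-< 0<2 (<-by 1ℚ 0<1 refl)

        2<6 : 2ℚ < 6ℚ
        2<6 = ℚ.<-trans (<-by 2ℚ 0<2 (two 2ℚ)) 4<6

        cases : ∀ n → N′ ≡ n → Extremal g N′ a 1≤g
        cases zero e = 6-6-6 e g≡2 (trans a-0 (cong (λ g → g * (g + 1ℚ)) g≡2)) (trans a-1 6≡)
            (trans (subst (λ k → a (suc (suc k)) ≡ a (suc k)) e a-N+1) (trans a-1 6≡))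
          where
          g≡2 : g ≡ 2ℚ
          g≡2 = ℚ.≤-antisym (subst (λ k → τ k ≤ 2ℚ) e τN′≤2)
              (subst (_≤ g) (*-identityʳ 2ℚ) (subst (λ k → 2ℚ * X k ≤ g) e small))
          a-0 : a 0 ≡ τ 1
          a-0 = subst (λ k → a k ≡ τ (suc k)) e a-N′
          j≡0 : j ≡ 0
          j≡0 = ℕ.n≤0⇒n≡0 (subst (j ℕ.≤_) e (ℕ.s≤s⁻¹ j<N))
          a-1 : a 1 ≡ 2ℚ * s 0
          a-1 = trans (cong (a ∘ suc) (sym e)) (trans a-N (cong (λ k → 2ℚ * s k) j≡0))
          6≡ : 2ℚ * s 0 ≡ 6ℚ
          6≡ = cong (λ g → 2ℚ * (g + 1ℚ)) g≡2
        cases (suc zero) e with ℕ.m≤n⇒m<n∨m≡n (subst (j ℕ.≤_) e (ℕ.s≤s⁻¹ j<N))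
        ... | inj₁ j<1 = contradiction (ℚ.≤-trans (ℚ.≤-trans 6≤τ-2 (subst (λ k → τ (suc k) ≤ 2ℚ * s j) e τN≤))
            (*-monoˡ (ℚ.<⇒≤ 0<2) (subst (λ k → s k ≤ 2ℚ) (sym (ℕ.n≤0⇒n≡0 (ℕ.s≤s⁻¹ j<1))) (+-monoˡ-≤ 1ℚ g≤1))))
                (λ h → ℚ.<-irrefl refl (ℚ.<-≤-trans 4<6 h))
          where
          g≤1 : g ≤ 1ℚ
          g≤1 = ℚ.≮⇒≥ λ lt → ℚ.<-irrefl refl
              (ℚ.<-≤-trans (+-monoˡ-< 1ℚ lt) (ℚ.≤-trans (subst (_≤ τ 1) (*-identityˡ _) (*-monoʳ (ℚ.<⇒≤ (0<s 0)) 1≤g))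
              (subst (λ k → τ k ≤ 2ℚ) e τN′≤2)))
        ... | inj₂ j≡1 = 2-6-6-6 e g≡1
            (trans (a-from-x (0<s 0) (trans (before 0 (subst (0 ℕ.<_) (sym j≡1) (s≤s z≤n))) (ŷ-< (s≤s z≤n))))
            (cong (_+ 1ℚ) g≡1))
            (trans (subst (λ k → a k ≡ τ (suc k)) e a-N′) (cong (λ t → t * (t + 1ℚ)) τ-1)) (trans a-2 6≡)
                (trans (subst (λ k → a (suc (suc k)) ≡ a (suc k)) e a-N+1) (trans a-2 6≡))
          where
          g≤1 : g ≤ 1ℚ
          g≤1 = ℚ.≮⇒≥ λ lt → ℚ.<-irrefl refl
              (ℚ.<-≤-trans (+-monoˡ-< 1ℚ lt) (ℚ.≤-trans (subst (_≤ τ 1) (*-identityˡ _) (*-monoʳ (ℚ.<⇒≤ (0<s 0)) 1≤g))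
              (subst (λ k → τ k ≤ 2ℚ) e τN′≤2)))
          g≡1 : g ≡ 1ℚ
          g≡1 = ℚ.≤-antisym g≤1 1≤g
          τ-1 : τ 1 ≡ 2ℚ
          τ-1 = trans (cong (λ g → g * (g + 1ℚ)) g≡1) (*-identityˡ 2ℚ)
          a-2 : a 2 ≡ 2ℚ * s 1
          a-2 = trans (cong (a ∘ suc) (sym e)) (trans a-N (cong (λ k → 2ℚ * s k) j≡1))
          6≡ : 2ℚ * s 1 ≡ 6ℚ
          6≡ = cong (λ t → 2ℚ * (t + 1ℚ)) τ-1
        cases (suc (suc n)) e =
            contradiction (ℚ.≤-trans 6≤τ-2 (ℚ.≤-trans (τ-mono 2 n) (subst (λ k → τ k ≤ 2ℚ) e τN′≤2)))
            (λ h → ℚ.<-irrefl refl (ℚ.<-≤-trans 2<6 h))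

      classify : ∃[ j ] j ℕ.≤ N × (∀ i → i ℕ.< j → x i ≡ ŷ i) × z ≡ ŷ j × (∀ i → j ℕ.≤ i → i ℕ.< N →
          x i ≡ ŷ (suc i)) → Extremal g N′ a 1≤g
      classify (j , j≤N , before , at , after) with ℕ.m≤n⇒m<n∨m≡n j≤N
      ... | inj₁ j<N = Late.cases j j<N before at (after N′ (ℕ.s≤s⁻¹ j<N) ℕ.≤-refl) N′ refl
      ... | inj₂ refl = sylvester (λ i lt → a-from-x (0<s i) (trans (before i lt) (ŷ-< lt))) a-N (trans a-N+1 a-N)
        where
        a-N : a N ≡ 2ℚ * τ N
        a-N = halve (0<τ N) (trans at ŷ-N)

    extremal : Extremal g N′ a 1≤g
    extremal = classify (proj₂ equal)

  -- The first remainder yields (1 + g) x 0 ≤ 1, so 2 x 0 ≤ 1 ≤ g, and further factors of `X N′` are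
  -- at most 1.
  small-if-long : N′ ≢ 0 → 2ℚ * X N′ ≤ g
  small-if-long = go N′ refl
    where
    2x₀≤1 : 2ℚ * x 0 ≤ 1ℚ
    2x₀≤1 = ℚ.≤-trans (*-monoʳ (ℚ.<⇒≤ (0<x 0)) (+-monoʳ-≤ 1ℚ 1≤g))
      (subst₂ _≤_ (lem g (x 0)) (lem′ (x 0) g) (+-monoˡ-≤ (g * x 0) (remainder-≥ 1 (s≤s (s≤s z≤n)))))
      where
      opaque
        unfolding ring
        lem : ∀ g x → 1ℚ * x + g * x ≡ (1ℚ + g) * x
        lem = solve-∀ ring
        lem′ : ∀ x g → 1ℚ - g * (0ℚ + x) + g * x ≡ 1ℚ
        lem′ = solve-∀ ring
    go : ∀ n → N′ ≡ n → N′ ≢ 0 → 2ℚ * X N′ ≤ g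
    go zero e ne = contradiction e ne
    go (suc n) e _ = subst (λ k → 2ℚ * X k ≤ g) (sym e)
        (ℚ.≤-trans (*-monoˡ (ℚ.<⇒≤ 0<2) (ℚ.≤-trans (X-descending 1 n) (ℚ.≤-reflexive (*-identityˡ (x 0)))))
        (ℚ.≤-trans 2x₀≤1 1≤g))

  -- The order is total, and the unwanted alternative is the hypothesis `big`, under which
  -- `product-extremal` gives equality.
  product-≥ : 2ℚ * X N′ ≤ g → g ≤ X (suc N) * (2ℚ * (τ N * τ N)) × (X (suc N) * (2ℚ * (τ N * τ N)) ≡ g →
      Extremal g N′ a 1≤g)
  product-≥ small = bound , λ e → extremal (ℚ.≤-reflexive e) small
    where
    bound : g ≤ X (suc N) * (2ℚ * (τ N * τ N))
    bound with ℚ.≤-total (X (suc N) * (2ℚ * (τ N * τ N))) g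
    ... | inj₁ le = ℚ.≤-reflexive (sym (product-extremal le small))
    ... | inj₂ ge = ge

-- Unit fractions for d = 2 and g = 1

module _ {a} (U : UnitFractions 1ℚ 0 a) where

  open UnitFractions U

  private
    x : ℕ → ℚ
    x i = a i ⁻¹

    total′ : x 0 + x 1 + x 2 ≡ 1ℚ
    total′ = trans (cong (λ y → y + x 1 + x 2) (sym (+-identityˡ (x 0))))
        (trans total (sym (inverse-unique (*-identityˡ 1ℚ))))

    x-descending : ∀ i → i ℕ.< 2 → x (suc i) ≤ x i
    x-descending i lt = ⁻¹-antimono (0<a i) (ascending i lt)

    x1≤x0 : x 1 ≤ x 0
    x1≤x0 = x-descending 0 (s≤s z≤n)
    x2≤x1 : x 2 ≤ x 1
    x2≤x1 = x-descending 1 (s≤s (s≤s z≤n))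

    1≤3x₀ : 1ℚ ≤ 3ℚ * x 0
    1≤3x₀ = subst₂ _≤_ total′ (lem (x 0)) (+-mono-≤ (+-monoʳ-≤ (x 0) x1≤x0) (ℚ.≤-trans x2≤x1 x1≤x0))
      where
      opaque
        unfolding ring
        lem : ∀ x → x + x + x ≡ (1ℚ + 1ℚ + 1ℚ) * x
        lem = solve-∀ ring

    Product : Set
    Product = 1ℚ ≤ x 0 * x 1 * (3ℚ * 3ℚ) × (x 0 * x 1 * (3ℚ * 3ℚ) ≡ 1ℚ → a 0 ≡ 3ℚ × a 1 ≡ 3ℚ × a 2 ≡ 3ℚ)

    -- The largest of three fractions with sum 1 is at least 1 / 3; if it is also at most 1 / 3,
    -- then all three are equal.
    thirds : 3ℚ ≤ a 0 → Product
    thirds 3≤a₀ = ℚ.≤-reflexive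
        (sym (trans (cong₂ (λ p q → p * q * (3ℚ * 3ℚ)) x₀ x₁)
        (trans (lem (3ℚ ⁻¹) 3ℚ) (trans (cong₂ _*_ t t) (*-identityˡ 1ℚ))))) ,
        λ _ → from x₀ , from x₁ , from x₂
      where
      t : 3ℚ * 3ℚ ⁻¹ ≡ 1ℚ
      t = ⁻¹-inverse (>⇒≢0 0<3)
      opaque
        unfolding ring
        lem : ∀ i c → i * i * (c * c) ≡ c * i * (c * i)
        lem = solve-∀ ring
      from : ∀ {i} → x i ≡ 3ℚ ⁻¹ → a i ≡ 3ℚ
      from {i} = ⁻¹-injective (0<a i) 0<3
      x₀≤ : x 0 ≤ 3ℚ ⁻¹
      x₀≤ = ⁻¹-antimono 0<3 3≤a₀
      x₀ : x 0 ≡ 3ℚ ⁻¹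
      x₀ = ℚ.≤-antisym x₀≤ (*-cancel-≤ 0<3 (subst (_≤ 3ℚ * x 0) (sym t) 1≤3x₀))
      opaque
        unfolding ring
        lem₁ : ∀ x → (1ℚ + 1ℚ + 1ℚ) * x - x - x ≡ x
        lem₁ = solve-∀ ring
        lem₂ : ∀ x y z → x + y + z - x - y ≡ z
        lem₂ = solve-∀ ring
      x₂≥ : 3ℚ ⁻¹ ≤ x 2
      x₂≥ = subst₂ _≤_ (trans (cong (λ c → c - 3ℚ ⁻¹ - 3ℚ ⁻¹) (sym t)) (lem₁ (3ℚ ⁻¹)))
          (trans (cong (λ c → c - x 0 - x 1) (sym total′)) (lem₂ (x 0) (x 1) (x 2)))
        (+-mono-≤ (+-monoʳ-≤ 1ℚ (neg-≤ x₀≤)) (neg-≤ (ℚ.≤-trans x1≤x0 x₀≤)))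
      x₁ : x 1 ≡ 3ℚ ⁻¹
      x₁ = ℚ.≤-antisym (ℚ.≤-trans x1≤x0 x₀≤) (ℚ.≤-trans x₂≥ x2≤x1)
      x₂ : x 2 ≡ 3ℚ ⁻¹
      x₂ = ℚ.≤-antisym (ℚ.≤-trans x2≤x1 (ℚ.≤-reflexive x₁)) x₂≥

    -- The remainder bound and the hypothesis force a₀ = 2. Then 1 / a₁ ≥ 1 / 4, so that a₀ a₁ ≤ 8 <
    -- 9 and the equality clause is vacuous.
    half-case : a 0 ≤ 2ℚ → Product
    half-case a₀≤2 = ℚ.<⇒≤ strict , λ e → contradiction strict (λ lt → ℚ.<-irrefl (sym e) lt)
      where
      1≤2x₀ : 1ℚ ≤ 2ℚ * x 0
      1≤2x₀ = subst (_≤ 2ℚ * x 0) (⁻¹-inverse (>⇒≢0 (0<a 0))) (*-monoʳ (ℚ.<⇒≤ (0<⁻¹ (0<a 0))) a₀≤2)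
      2x₀≤1 : 2ℚ * x 0 ≤ 1ℚ
      2x₀≤1 = subst₂ _≤_ (lem (x 0)) (lem′ (x 0)) (+-monoˡ-≤ (x 0) (remainder-≥ U 1 (s≤s (s≤s z≤n))))
        where
        opaque
          unfolding ring
          lem : ∀ x → 1ℚ * x + x ≡ (1ℚ + 1ℚ) * x
          lem = solve-∀ ring
          lem′ : ∀ x → 1ℚ - 1ℚ * (0ℚ + x) + x ≡ 1ℚ
          lem′ = solve-∀ ring
      2x₀ : 2ℚ * x 0 ≡ 1ℚ
      2x₀ = ℚ.≤-antisym 2x₀≤1 1≤2x₀
      4x₁ : 1ℚ ≤ 2ℚ * (2ℚ * x 1)
      4x₁ = subst₂ _≤_ (trans (lem (x 0) (x 1) (x 2)) (trans (cong₂ (λ a b → 2ℚ * a - b) total′ 2x₀) lem″))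
          (lem′ (x 1)) (*-monoˡ (ℚ.<⇒≤ 0<2) (+-monoʳ-≤ (x 1) x2≤x1))
        where
        opaque
          unfolding ring
          lem : ∀ a b c → (1ℚ + 1ℚ) * (b + c) ≡ (1ℚ + 1ℚ) * (a + b + c) - (1ℚ + 1ℚ) * a
          lem = solve-∀ ring
          lem′ : ∀ b → (1ℚ + 1ℚ) * (b + b) ≡ (1ℚ + 1ℚ) * ((1ℚ + 1ℚ) * b)
          lem′ = solve-∀ ring
          lem‴ : ∀ x → (1ℚ + 1ℚ) * x - x ≡ x
          lem‴ = solve-∀ ring
        lem″ : 2ℚ * 1ℚ - 1ℚ ≡ 1ℚ
        lem″ = lem‴ 1ℚ
      strict : 1ℚ < x 0 * x 1 * (3ℚ * 3ℚ)
      strict = <-by (x 0 * x 1 + (2ℚ * (2ℚ * x 1) - 1ℚ))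
          (subst (0ℚ <_) (+-comm _ _)
          (subst (0ℚ <_) (+-comm _ _) (0<+ (0<* (0<⁻¹ (0<a 0)) (0<⁻¹ (0<a 1))) (diff-≤ 4x₁))))
        (trans (lem (x 0) (x 1)) (trans (cong (λ c → 1ℚ + (x 0 * x 1 + (c * (2ℚ * (2ℚ * x 1)) - 1ℚ))) 2x₀)
            (cong (λ c → 1ℚ + (x 0 * x 1 + (c - 1ℚ))) (*-identityˡ _))))
        where
        opaque
          unfolding ring
          lem : ∀ x y → x * y * ((1ℚ + 1ℚ + 1ℚ) * (1ℚ + 1ℚ + 1ℚ)) ≡ 1ℚ +
              (x * y + ((1ℚ + 1ℚ) * x * ((1ℚ + 1ℚ) * ((1ℚ + 1ℚ) * y)) - 1ℚ))
          lem = solve-∀ ring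

  product-2-1 : 1ℚ ≤ x 0 * x 1 * (3ℚ * 3ℚ) × (x 0 * x 1 * (3ℚ * 3ℚ) ≡ 1ℚ → a 0 ≡ 3ℚ × a 1 ≡ 3ℚ × a 2 ≡ 3ℚ)
  product-2-1 with <-≤-connex 2ℚ (a 0)
  ... | inj₂ le = half-case le
  ... | inj₁ lt = thirds (subst₂ _≤_ (+-comm 1ℚ 2ℚ) (lem 2ℚ (a 0))
      (+-monoˡ-≤ 2ℚ (int-pos (int-+ (int-a 0) (int-neg (int-+ int-1 int-1))) (diff-< lt))))
    where
    opaque
      unfolding ring
      lem : ∀ c a → a - c + c ≡ a
      lem = solve-∀ ring

-- Fano simplices

module FanoSimplices where

  private
    variable
      d n : ℕ
      S : Subset d

  opaque
    unfolding _+_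

    Δ⇒Hull : ∀ (P : Matrix ℚ d n) {x} → Δ[ P ] x → Hull P x
    Δ⇒Hull P h = h

    Hull⇒Δ : ∀ (P : Matrix ℚ d n) {x} → Hull P x → Δ[ P ] x
    Hull⇒Δ P h = h

    affinelyIndependent : ∀ (V : Matrix ℚ d n) → AffinelyIndependent V →
      ∀ μ → sum μ ≡ 0ℚ → (∀ i → (V ▹ μ) i ≡ 0ℚ) → ∀ j → μ j ≡ 0ℚ
    affinelyIndependent V h = h

    interior-origin : Interior S origin → ∃[ ε ] 0ℚ < ε × (∀ x → (∀ i → ∣ x i ∣ < ε) → S x)
    interior-origin (ε , 0<ε , h) = ε , 0<ε , λ x small → h x λ i → subst (λ y → ℚ.∣ y ∣ < ε)
        (sym (ℚ.+-identityʳ (x i))) (small i)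

    dual⁺ : ∀ {u : Fin d → ℚ} → (∀ v → S v → - 1ℚ ≤ sum (λ i → u i * v i)) → Dual S u
    dual⁺ h = h

    dual⁻ : ∀ {u : Fin d → ℚ} → Dual S u → ∀ v → S v → - 1ℚ ≤ sum (λ i → u i * v i)
    dual⁻ h = h

    ⋆⁺ : ∀ k {x y : Fin d → ℚ} → S x → (∀ i → fromNat k * x i ≡ y i) → (k ⋆ S) y
    ⋆⁺ k {x} s e = x , s , e

    ⋆⁻ : ∀ k {y : Fin d → ℚ} → (k ⋆ S) y → ∃[ x ] S x × (∀ i → fromNat k * x i ≡ y i)
    ⋆⁻ k h = h

  1⋆-lattice : ∀ {S : Subset d} → IsLatticeSimplex S → IsLatticeSimplex (1 ⋆ S)
  1⋆-lattice {S = S} (V , ind , to , from) = V , ind ,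
    (λ h → let x , s , e = ⋆⁻ 1 h in Hull⇒Δ (toℚ V) (resp e (Δ⇒Hull (toℚ V) (to s)))) ,
    (λ h → ⋆⁺ {S = S} 1 (from h) λ i → *-identityˡ _)
    where
    resp : ∀ {x y : Fin _ → ℚ} → (∀ i → fromNat 1 * x i ≡ y i) → Hull (toℚ V) x → Hull (toℚ V) y
    resp e (λs , h , s , eq) = λs , h , s , λ i → trans (eq i) (trans (sym (*-identityˡ _)) (e i))

  -- Sums over ℕ-indexed sequences

  -- Continued by the last value, so that positivity and integrality hold at every index.
  extend : (Fin (suc n) → ℚ) → ℕ → ℚ
  extend {n} f i with i ℕ.<? suc n
  ... | yes lt = f (Fin.fromℕ< lt)
  ... | no _ = f (Fin.fromℕ n)

  extend-toℕ : ∀ (f : Fin (suc n) → ℚ) j → extend f (toℕ j) ≡ f j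
  extend-toℕ {n} f j with toℕ j ℕ.<? suc n
  ... | yes lt = cong f (Fin.fromℕ<-toℕ j lt)
  ... | no nlt = contradiction (Fin.toℕ<n j) nlt

  extend-∀ : ∀ (P : ℚ → Set) (f : Fin (suc n) → ℚ) → (∀ j → P (f j)) → ∀ i → P (extend f i)
  extend-∀ {n} P f h i with i ℕ.<? suc n
  ... | yes lt = h (Fin.fromℕ< lt)
  ... | no _ = h (Fin.fromℕ n)

  psum-sum : ∀ (f : ℕ → ℚ) n → psum f n ≡ sum {n} (λ j → f (toℕ j))
  psum-sum f zero = refl
  psum-sum f (suc n) = sym (trans (sum-init-last {n} (λ j → f (toℕ j)))
    (cong₂ _+_ (trans (sum-cong {n} λ j → cong f (Fin.toℕ-inject₁ j)) (sym (psum-sum f n)))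
        (cong f (Fin.toℕ-fromℕ n))))

  pprod-product : ∀ (f : ℕ → ℚ) n → pprod f n ≡ product {n} (λ j → f (toℕ j))
  pprod-product f zero = refl
  pprod-product f (suc n) = sym (trans (product-init-last {n} (λ j → f (toℕ j)))
    (cong₂ _*_ (trans (product-cong {n} λ j → cong f (Fin.toℕ-inject₁ j)) (sym (pprod-product f n)))
        (cong f (Fin.toℕ-fromℕ n))))

  sort : (f : Fin n → ℚ) → Σ[ π ∈ Permutation′ n ] ∀ (i j : Fin n) → i Fin.≤ j → f (π ⟨$⟩ʳ i) ≤ f (π ⟨$⟩ʳ j)
  sort {zero} f = Perm.id , λ ()
  sort {suc n} f = π , sorted
    where
    minimum : ∀ {n} (f : Fin (suc n) → ℚ) → ∃[ m ] ∀ j → f m ≤ f j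
    minimum {zero} f = zero , λ { zero → ℚ.≤-refl }
    minimum {suc n} f with minimum (f ∘ suc)
    ... | m , min with ℚ.≤-total (f zero) (f (suc m))
    ...   | inj₁ le = zero , λ { zero → ℚ.≤-refl ; (suc j) → ℚ.≤-trans le (min j) }
    ...   | inj₂ ge = suc m , λ { zero → ge ; (suc j) → min j }
    m : Fin (suc n)
    m = proj₁ (minimum f)
    rest = sort (f ∘ punchIn m)
    ρ : Permutation′ n
    ρ = proj₁ rest
    π : Permutation′ (suc n)
    π = Perm.insert zero m ρ
    π-suc : ∀ i → π ⟨$⟩ʳ suc i ≡ punchIn m (ρ ⟨$⟩ʳ i)
    π-suc = Perm.insert-punchIn zero m ρ
    sorted : ∀ i j → i Fin.≤ j → f (π ⟨$⟩ʳ i) ≤ f (π ⟨$⟩ʳ j)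
    sorted zero j _ = proj₂ (minimum f) (π ⟨$⟩ʳ j)
    sorted (suc i) (suc j) (s≤s le) = subst₂ _≤_ (cong f (sym (π-suc i))) (cong f (sym (π-suc j))) (proj₂ rest i j le)

  -- For a Fano simplex of Gorenstein index g, β are the barycentric coordinates of the origin and normal i is g times
  -- the vertex of the dual opposite to vertex i.
  record FanoData {d} (S : Subset d) (g : ℚ) : Set where
    field
      V : Matrix ℤ d (suc d)
      independent : ∀ μ → sum μ ≡ 0ℚ → (∀ i → (toℚ V ▹ μ) i ≡ 0ℚ) → ∀ j → μ j ≡ 0ℚ
      to : ∀ {x} → S x → Hull (toℚ V) x
      from : ∀ {x} → Hull (toℚ V) x → S x
      primitive-V : ∀ j → Primitive (λ i → V i j)
      β : Fin (suc d) → ℚ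
      0<β : ∀ j → 0ℚ < β j
      sum-β : sum β ≡ 1ℚ
      V▹β : ∀ i → (toℚ V ▹ β) i ≡ 0ℚ
      normal : Fin (suc d) → Fin d → ℚ
      int-normal : ∀ i c → IsInt (normal i c)
      normal-off : ∀ {i j} → i ≢ j → sum (λ c → normal i c * toℚ V c j) ≡ - g

    A : Fin (suc d) → ℚ
    A i = g * β i ⁻¹

    -- From ∑ⱼ βⱼ ⟨normal i , vⱼ⟩ = 0.
    normal-diag : ∀ i → sum (λ c → normal i c * toℚ V c i) ≡ A i - g
    normal-diag i = *-cancel-≡ (>⇒≢0 (0<β i))
        (trans (βi·) (trans (lem g (β i)) (trans (cong (λ y → g * y - β i * g) (sym (⁻¹-inverse (>⇒≢0 (0<β i)))))
        (lem′ g (β i) (β i ⁻¹)))))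
      where
      y : Fin (suc d) → ℚ
      y j = sum (λ c → normal i c * toℚ V c j)
      opaque
        unfolding ring
        lem : ∀ g b → g + b * - g ≡ g * 1ℚ - b * g
        lem = solve-∀ ring
        lem′ : ∀ g b i → g * (b * i) - b * g ≡ b * (g * i - g)
        lem′ = solve-∀ ring
      total : sum (λ j → y j * β j) ≡ 0ℚ
      total = trans (sym (▹-⊡ (λ (_ : Fin 1) c → normal i c) (toℚ V) β zero)) (sum-0 λ c →
          trans (cong (normal i c *_) (V▹β c)) (*-zeroʳ (normal i c)))
      shifted : sum (λ j → β j * (y j + g)) ≡ g
      shifted = trans (sum-linear 1ℚ {g = λ j → y j * β j} {h = λ j → g * β j} λ j → lem″ (β j) (y j) g)
        (trans (cong₂ (λ a b → 1ℚ * a + b) total (trans (sum-*ˡ g β) (trans (cong (g *_) sum-β) (*-identityʳ g))))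
            (lem₀ g))
        where
        opaque
          unfolding ring
          lem″ : ∀ b y g → b * (y + g) ≡ 1ℚ * (y * b) + g * b
          lem″ = solve-∀ ring
          lem₀ : ∀ g → 1ℚ * 0ℚ + g ≡ g
          lem₀ = solve-∀ ring
      βi· : β i * y i ≡ g + β i * - g
      βi· = trans (lem₁ (β i) (y i) g)
          (cong (_+ β i * - g) (trans
          (sym (sum-single i λ j ne → trans (cong (λ a → β j * (a + g)) (normal-off (ne ∘ sym)))
          (trans (cong (β j *_) (+-inverseˡ g)) (*-zeroʳ (β j))))) shifted))
        where
        opaque
          unfolding ring
          lem₁ : ∀ b y g → b * y ≡ b * (y + g) + b * - g
          lem₁ = solve-∀ ring

  fanoData-permute : ∀ {S : Subset d} {g} → FanoData S g → Permutation′ (suc d) → FanoData S g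
  fanoData-permute {d} F π = record
    { V = λ i j → V i (p j)
    ; independent = λ μ s z j → trans (cong μ (sym (Perm.inverseˡ π)))
        (independent (λ k → μ (q k)) (trans (unpermute μ) s)
            (λ i → trans (trans (sum-permute (λ k → toℚ V i k * μ (q k)) π)
            (sum-cong {f = λ k → toℚ V i (p k) * μ (q (p k))} {g = λ k → toℚ V i (p k) * μ k} λ k →
            cong (λ k′ → toℚ V i (p k) * μ k′) (Perm.inverseˡ π))) (z i)) (p j))
    ; to = λ s → let λs , h , sm , e = to s in
        (λ j → λs (p j)) , (λ j → h (p j)) , trans (sym (sum-permute λs π)) sm ,
        λ i → trans (sym (sum-permute (λ k → toℚ V i k * λs k) π)) (e i)
    ; from = λ { (λs , h , sm , e) → from ((λ k → λs (q k)) , (λ k → h (q k)) , trans (unpermute λs) sm ,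
        λ i → trans (trans (sum-permute (λ k → toℚ V i k * λs (q k)) π)
            (sum-cong {f = λ k → toℚ V i (p k) * λs (q (p k))} {g = λ k → toℚ V i (p k) * λs k} λ k →
            cong (λ k′ → toℚ V i (p k) * λs k′) (Perm.inverseˡ π))) (e i)) }
    ; primitive-V = λ j → primitive-V (p j)
    ; β = λ j → β (p j)
    ; 0<β = λ j → 0<β (p j)
    ; sum-β = trans (sym (sum-permute β π)) sum-β
    ; V▹β = λ i → trans (sym (sum-permute (λ k → toℚ V i k * β k) π)) (V▹β i)
    ; normal = λ i → normal (p i)
    ; int-normal = λ i → int-normal (p i)
    ; normal-off = λ ne → normal-off λ e → ne (trans (sym (Perm.inverseˡ π)) (trans (cong q e) (Perm.inverseˡ π)))
    }
    where
    open FanoData F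
    p q : Fin (suc d) → Fin (suc d)
    p = π ⟨$⟩ʳ_
    q = π ⟨$⟩ˡ_
    unpermute : ∀ (μ : Fin (suc d) → ℚ) → sum (λ k → μ (q k)) ≡ sum μ
    unpermute μ = trans (sum-permute (λ k → μ (q k)) π) (sum-cong {f = λ k → μ (q (p k))} {g = μ} λ k →
        cong μ (Perm.inverseˡ π))

  elem-hom : ∀ {V : Fin d → Fin (suc d) → ℚ} → (∀ μ → sum μ ≡ 0ℚ → (∀ i → (V ▹ μ) i ≡ 0ℚ) → ∀ j → μ j ≡ 0ℚ) →
      Elem (hom V)
  elem-hom {V = V} ind = trivialKernel⇒elem (hom V) λ {μ} z →
      ind μ (trans (sum-cong λ j → sym (*-identityˡ (μ j))) (z zero)) (λ i → z (suc i))

  sum-positive : ∀ {f : Fin n → ℚ} → (∀ j → 0ℚ ≤ f j) → sum f ≡ 1ℚ → ∃[ j ] 0ℚ < f j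
  sum-positive {n} {f} h s with Fin.any? (λ j → 0ℚ ℚ.<? f j)
  ... | yes p = p
  ... | no np = contradiction (trans (sym s) (sum-0 λ j → ℚ.≤-antisym (ℚ.≮⇒≥ λ lt → np (j , lt)) (h j))) ℚ.1≢0

  sum-≥0-≡0 : ∀ {f : Fin n → ℚ} → (∀ j → 0ℚ ≤ f j) → sum f ≡ 0ℚ → ∀ j → f j ≡ 0ℚ
  sum-≥0-≡0 {suc n} {f} h s j = ℚ.≤-antisym (subst (f j ≤_) (trans (sym (sum-remove {i = j} f)) s)
    (≤-by _ (sum-≥0 λ k → h (punchIn j k)) refl)) (h j)

  δ-≥0 : ∀ (i j : Fin n) → 0ℚ ≤ δ i j
  δ-≥0 zero zero = 0≤1
  δ-≥0 zero (suc j) = ℚ.≤-refl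
  δ-≥0 (suc i) zero = ℚ.≤-refl
  δ-≥0 (suc i) (suc j) = δ-≥0 i j

  hull-vertex : ∀ (V : Fin d → Fin n → ℚ) j → Hull V (λ c → V c j)
  hull-vertex V j = (λ k → δ k j) , (λ k → δ-≥0 k j) , trans (sum-cong λ k → sym (*-identityˡ (δ k j)))
      (sum-δʳ j (λ _ → 1ℚ)) , λ c → sum-δʳ j (V c)

  -- Barycentric coordinates and dual vertices

  module _ {d} {S : Subset d} (fano : IsFanoSimplex S) where

    open IsFanoSimplex fano

    private
      V : Matrix ℚ d (suc d)
      V = toℚ vertices

      to : ∀ {x} → S x → Hull V x
      to s = Δ⇒Hull V (proj₁ (proj₂ simplex) s)

      from : ∀ {x} → Hull V x → S x
      from h = proj₂ (proj₂ simplex) (Hull⇒Δ V h)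

      independent : ∀ μ → sum μ ≡ 0ℚ → (∀ i → (V ▹ μ) i ≡ 0ℚ) → ∀ j → μ j ≡ 0ℚ
      independent = affinelyIndependent V (proj₁ simplex)

      H N : M (suc d)
      H = hom V

      E : Elem H
      E = elem-hom {V = V} independent

      N = proj₁ (elem-inverse E)

      HN : H ⊡ N ≈ δ
      HN = proj₁ (proj₂ (elem-inverse E))

      NH : N ⊡ H ≈ δ
      NH = proj₂ (proj₂ (elem-inverse E))

      -- The first column of the inverse of `H` is the solution of ∑ βⱼ = 1 and ∑ βⱼ vⱼ = 0.
      β : Fin (suc d) → ℚ
      β j = N j zero

      sum-β : sum β ≡ 1ℚ
      sum-β = trans (sum-cong λ j → sym (*-identityˡ (β j))) (HN zero zero)

      V▹β : ∀ i → (V ▹ β) i ≡ 0ℚ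
      V▹β i = HN (suc i) zero

      -- A point - η vᵢ close to the origin has barycentric coordinates (1 + η) β - η eᵢ.
      0<β : ∀ i → 0ℚ < β i
      0<β i = result (interior-origin interior)
        where
        c : ℚ
        c = sum λ k → ∣ V k i ∣
        0≤c : 0ℚ ≤ c
        0≤c = sum-≥0 λ k → 0≤∣∣ (V k i)
        ∣V∣≤c : ∀ k → ∣ V k i ∣ ≤ c
        ∣V∣≤c = le (λ k → ∣ V k i ∣) (λ k → 0≤∣∣ (V k i))
          where
          le : ∀ {n} (f : Fin n → ℚ) → (∀ k → 0ℚ ≤ f k) → ∀ k → f k ≤ sum f
          le {suc n} f h k = subst (f k ≤_) (sym (sum-remove {i = k} f)) (≤-by _ (sum-≥0 λ j → h (punchIn k j)) refl)
        result : ∃[ ε ] 0ℚ < ε × (∀ x → (∀ i → ∣ x i ∣ < ε) → S x) → 0ℚ < β i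
        result (ε , 0<ε , ball) with shrink (0≤+ 0≤1 0≤c) 0<ε
        ... | η , 0<η , small = go (to (ball x near))
          where
          x : Fin d → ℚ
          x k = - (η * V k i)
          near : ∀ k → ∣ x k ∣ < ε
          near k = ℚ.<-≤-trans (ℚ.≤-<-trans
              (ℚ.≤-reflexive (trans (∣∣-neg _) (trans (∣∣-* η (V k i)) (cong (_* ∣ V k i ∣) (∣∣-pos (ℚ.<⇒≤ 0<η))))))
            (ℚ.≤-<-trans (*-monoˡ (ℚ.<⇒≤ 0<η) (∣V∣≤c k)) (<-by η 0<η (lem η c)))) small
            where
            opaque
              unfolding ring
              lem : ∀ η c → (1ℚ + c) * η ≡ η * c + η
              lem = solve-∀ ring
          go : Hull V x → 0ℚ < β i
          go (λs , h , s , e) = *-cancel-< (0≤+ 0≤1 (ℚ.<⇒≤ 0<η)) (subst₂ _<_ (sym (*-zeroʳ (1ℚ + η))) (μ≡ i)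
              (subst (0ℚ <_) (trans (+-comm η (λs i))
                  (cong (_+_ (λs i)) (trans (sym (*-identityʳ η)) (cong (η *_) (sym (δ-refl i)))))) (0<+ 0<η (h i))))
            where
            μ : Fin (suc d) → ℚ
            μ j = λs j + η * δ i j
            μ≡ : ∀ j → μ j ≡ (1ℚ + η) * β j
            μ≡ = elem-cancel E {μ} {λ j → (1ℚ + η) * β j} λ r →
                trans (Hμ r) (sym (trans (sum-cong λ j → lem (H r j) (1ℚ + η) (β j))
                (trans (sum-*ˡ (1ℚ + η) (λ j → H r j * β j)) (cong ((1ℚ + η) *_) (HN r zero)))))
              where
              opaque
                unfolding ring
                lem : ∀ a b c → a * (b * c) ≡ b * (a * c)
                lem = solve-∀ ring
                lem′ : ∀ a l e d → a * (l + e * d) ≡ e * (d * a) + a * l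
                lem′ = solve-∀ ring
                lem₁ : ∀ e → e * 1ℚ + 1ℚ ≡ (1ℚ + e) * 1ℚ
                lem₁ = solve-∀ ring
                lem₂ : ∀ e v → e * v + - (e * v) ≡ (1ℚ + e) * 0ℚ
                lem₂ = solve-∀ ring
              expand : ∀ r → (H ▹ μ) r ≡ η * H r i + (H ▹ λs) r
              expand r = trans (sum-linear η {g = λ j → δ i j * H r j} {h = λ j → H r j * λs j} λ j →
                  lem′ (H r j) (λs j) η (δ i j)) (cong (λ a → η * a + (H ▹ λs) r) (sum-δˡ i (H r)))
              Hμ : ∀ r → (H ▹ μ) r ≡ (1ℚ + η) * δ r zero
              Hμ zero = trans (expand zero) (trans (cong (_+_ (η * 1ℚ)) (trans (sum-cong λ j → *-identityˡ (λs j)) s))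
                  (lem₁ η))
              Hμ (suc k) = trans (expand (suc k)) (trans (cong (_+_ (η * V k i)) (e k)) (lem₂ η (V k i)))

      coordinates : ∀ {x : Fin d → ℚ} λs → sum λs ≡ 1ℚ → (∀ i → (V ▹ λs) i ≡ x i) → ∀ i →
          sum (λ k → N i (suc k) * x k) ≡ λs i - β i
      coordinates {x} λs s e i =
          trans (lem _ _) (cong (_- β i)
          (trans (cong (_+ sum (λ k → N i (suc k) * x k)) (sym (*-identityʳ (N i zero))))
        (trans (sum-cong {f = λ k → N i k * y k} {g = λ k → N i k * (H ▹ λs) k} λ k →
            cong (N i k *_) (sym (Hλ k))) (trans (▹-⊡ N H λs i) (trans (▹-congˡ NH λs i) (▹-δ λs i))))))
        where
        y : Fin (suc d) → ℚ
        y zero = 1ℚ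
        y (suc k) = x k
        opaque
          unfolding ring
          lem : ∀ b a → a ≡ b + a - b
          lem = solve-∀ ring
        Hλ : ∀ k → (H ▹ λs) k ≡ y k
        Hλ zero = trans (sum-cong λ j → *-identityˡ (λs j)) s
        Hλ (suc k) = e k

      -- Row i of the inverse of `H` is the barycentric coordinate λᵢ as an affine function, with
      -- constant term βᵢ. Division by βᵢ normalises it to λᵢ / βᵢ = 1 + ⟨u i , x⟩, so u i is the
      -- dual vertex that belongs to the facet opposite to vᵢ.
      u : Fin (suc d) → Fin d → ℚ
      u i k = N i (suc k) * β i ⁻¹

      ⟨u,x⟩ : ∀ {x : Fin d → ℚ} λs → sum λs ≡ 1ℚ → (∀ i → (V ▹ λs) i ≡ x i) → ∀ i → sum (λ k → u i k * x k) ≡ λs i * β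
          i ⁻¹ - 1ℚ
      ⟨u,x⟩ {x} λs s e i = trans (sum-cong λ k → lem (N i (suc k)) (β i ⁻¹) (x k))
          (trans (sum-*ˡ (β i ⁻¹) (λ k → N i (suc k) * x k)) (trans (cong (β i ⁻¹ *_) (coordinates λs s e i))
        (trans (lem′ (β i ⁻¹) (λs i) (β i)) (cong (λ a → λs i * β i ⁻¹ - a) (⁻¹-inverse (>⇒≢0 (0<β i)))))))
        where
        opaque
          unfolding ring
          lem : ∀ n b x → n * b * x ≡ b * (n * x)
          lem = solve-∀ ring
          lem′ : ∀ i l b → i * (l - b) ≡ l * i - b * i
          lem′ = solve-∀ ring

      u-dual : ∀ i → Dual S (u i)
      u-dual i = dual⁺ {S = S} λ v s → let λs , h , sm , e = to s in
        subst (- 1ℚ ≤_) (sym (⟨u,x⟩ λs sm e i)) (≤-by (λs i * β i ⁻¹) (0≤* (h i) (ℚ.<⇒≤ (0<⁻¹ (0<β i)))) (+-comm _ _))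

      vertex : ∀ j → Hull V (λ c → V c j)
      vertex j = hull-vertex V j

      ⟨u,v⟩ : ∀ i j → sum (λ k → u i k * V k j) ≡ δ i j * β i ⁻¹ - 1ℚ
      ⟨u,v⟩ i j = ⟨u,x⟩ (λ k → δ k j) (proj₁ (proj₂ (proj₂ (vertex j)))) (proj₂ (proj₂ (proj₂ (vertex j)))) i

    module _ (g : ℕ) (0<g : 0ℚ < fromNat g) (lattice : IsLatticeSimplex (g ⋆ Dual S)) where

      private
        G : ℚ
        G = fromNat g

        W : Matrix ℚ d (suc d)
        W = toℚ (proj₁ lattice)

        normal : Fin (suc d) → Fin d → ℚ
        normal i c = G * u i c

        normal-off : ∀ {i j} → i ≢ j → sum (λ c → normal i c * V c j) ≡ - G
        normal-off {i} {j} ne = trans (sum-cong λ c → *-assoc G (u i c) (V c j))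
            (trans (sum-*ˡ G (λ c → u i c * V c j))
          (trans (cong (G *_) (trans (⟨u,v⟩ i j) (cong (λ a → a * β i ⁻¹ - 1ℚ) (δ-≢ ne)))) (lem G (β i ⁻¹))))
          where
          opaque
            unfolding ring
            lem : ∀ g b → g * (0ℚ * b - 1ℚ) ≡ - g
            lem = solve-∀ ring

        W-bound : ∀ l j → 0ℚ ≤ sum (λ c → W c l * V c j) + G
        W-bound l j = result (⋆⁻ g (proj₂ (proj₂ (proj₂ lattice)) (Hull⇒Δ W column)))
          where
          column : Hull W (λ c → W c l)
          column = let λs , h , s , e = vertex l in λs , h , s , λ c → sum-δʳ l (W c)
          result : ∃[ x ] Dual S x × (∀ c → G * x c ≡ W c l) → 0ℚ ≤ sum (λ c → W c l * V c j) + G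
          result (x , dx , e) = subst (0ℚ ≤_) (trans (lem G (sum (λ c → x c * V c j)))
              (cong (_+ G) (trans (sym (sum-*ˡ G (λ c → x c * V c j))) (sum-cong λ c →
                  trans (sym (*-assoc G (x c) (V c j))) (cong (_* V c j) (e c))))))
            (0≤* (ℚ.<⇒≤ 0<g) (diff-≤ (dual⁻ {S = S} dx (λ c → V c j) (from (vertex j)))))
            where
            opaque
              unfolding ring
              lem : ∀ g s → g * (s - - 1ℚ) ≡ g * s + g
              lem = solve-∀ ring

        -- normal i is a convex combination of the lattice points wₗ of g Δ*; a point with positive weight lies on the
        -- same facets as normal i, hence equals it.
        int-normal : ∀ i c → IsInt (normal i c)
        int-normal i = result (Δ⇒Hull W (proj₁ (proj₂ (proj₂ lattice)) (⋆⁺ {S = Dual S} g (u-dual i) λ _ → refl)))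
          where
          result : Hull W (normal i) → ∀ c → IsInt (normal i c)
          result (μ , h , s , e) with sum-positive h s
          ... | l , 0<μ = λ c → proj₁ lattice c l , x-y≡0⇒x≡y (ω≡0 c)
            where
            ω : Fin d → ℚ
            ω c = normal i c - W c l
            ω-off : ∀ j → i ≢ j → sum (λ c → ω c * V c j) ≡ 0ℚ
            ω-off j ne = trans (sum-linear (- 1ℚ) {g = λ c → W c l * V c j} {h = λ c → normal i c * V c j} λ c →
                lem (normal i c) (W c l) (V c j))
                (trans (cong (_+_ (- 1ℚ * sum (λ c → W c l * V c j))) (normal-off ne))
                    (trans (lem′ _ G) (trans (cong -_ (*-cancel-≡ (>⇒≢0 0<μ) (trans tight (sym (*-zeroʳ (μ l))))))
                    neg-0)))
              where
              opaque
                unfolding ring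
                lem : ∀ n w v → (n - w) * v ≡ - 1ℚ * (w * v) + n * v
                lem = solve-∀ ring
                lem′ : ∀ s g → - 1ℚ * s + - g ≡ - (s + g)
                lem′ = solve-∀ ring
              y : Fin (suc d) → ℚ
              y k = sum (λ c → W c k * V c j)
              tight : μ l * (y l + G) ≡ 0ℚ
              tight = sum-≥0-≡0 {f = λ k → μ k * (y k + G)} (λ k → 0≤* (h k) (W-bound k j))
                  (trans (sum-linear G {g = μ} {h = λ k → μ k * y k} λ k → lem₁ (μ k) (y k) G)
                  (trans (cong₂ (λ a b → G * a + b) s
                      (trans (sum-cong {f = λ k → μ k * y k} {g = λ k → sum (λ c → V c j * (W c k * μ k))} λ k →
                      trans (sym (sum-*ˡ (μ k) (λ c → W c k * V c j))) (sum-cong λ c → lem₂ (μ k) (W c k) (V c j)))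
                    (trans (∑-comm (λ k c → V c j * (W c k * μ k)))
                        (trans (sum-cong λ c → trans (sum-*ˡ (V c j) (λ k → W c k * μ k))
                        (trans (*-comm (V c j) _) (cong (_* V c j) (e c)))) (normal-off ne))))) (lem₃ G))) l
                where
                opaque
                  unfolding ring
                  lem₁ : ∀ m y g → m * (y + g) ≡ g * m + m * y
                  lem₁ = solve-∀ ring
                  lem₂ : ∀ m w v → m * (w * v) ≡ v * (w * m)
                  lem₂ = solve-∀ ring
                  lem₃ : ∀ g → g * 1ℚ + - g ≡ 0ℚ
                  lem₃ = solve-∀ ring
            ω-all : ∀ j → sum (λ c → ω c * V c j) ≡ 0ℚ
            ω-all j with i Fin.≟ j
            ... | no ne = ω-off j ne
            ... | yes refl = *-cancel-≡ (>⇒≢0 (0<β i))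
                (trans (*-comm (β i) _)
                (trans (sym (sum-single i {λ k → sum (λ c → ω c * V c k) * β k} λ k ne →
                trans (cong (_* β k) (ω-off k (ne ∘ sym))) (*-zeroˡ (β k))))
                (trans (sym (▹-⊡ (λ (_ : Fin 1) c → ω c) V β zero))
                    (trans (sum-0 λ c → trans (cong (ω c *_) (V▹β c)) (*-zeroʳ (ω c))) (sym (*-zeroʳ (β i)))))))
            row : Fin (suc d) → ℚ
            row zero = 0ℚ
            row (suc c) = ω c
            ω≡0 : ∀ c → ω c ≡ 0ℚ
            ω≡0 c = trans (sym (⊡-δʳ (λ (_ : Fin 1) k → row k) zero (suc c)))
                (trans (sum-cong λ k → cong (row k *_) (sym (HN k (suc c))))
              (trans (⊡-assoc (λ (_ : Fin 1) k → row k) H N zero (suc c)) (sum-0 λ k →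
                  trans (cong (_* N k (suc c)) (trans (cong (_+ sum (λ c → ω c * V c k)) (*-zeroˡ 1ℚ))
                  (trans (+-identityˡ _) (ω-all k)))) (*-zeroˡ _))))

      fanoData : FanoData S G
      fanoData = record
        { V = vertices ; independent = independent ; to = to ; from = from ; primitive-V = primitivity
        ; β = β ; 0<β = 0<β ; sum-β = sum-β ; V▹β = V▹β ; normal = normal ; int-normal = int-normal ; normal-off =
            normal-off }

  -- The factor of the index that belongs to S itself is 1, because S is a lattice simplex; the
  -- whole index comes from the dual.
  gorenstein-lattice : ∀ {S : Subset d} {g} → IsFanoSimplex S → IsGorensteinIndex S g → IsLatticeSimplex (g ⋆ Dual S)
  gorenstein-lattice {S = S} fano (k , l , gS , gD , refl) = subst (λ m → IsLatticeSimplex (m ⋆ Dual S))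
      (sym (trans (cong (ℕ._* l) k≡1) (ℕ.*-identityˡ l))) (Isgℚ.integral gD)
    where
    k≡1 : k ≡ 1
    k≡1 = ℕ.≤-antisym (Isgℚ.minimal gS 1 (s≤s z≤n) (1⋆-lattice {S = S} (IsFanoSimplex.vertices fano ,
        IsFanoSimplex.simplex fano))) (Isgℚ.positive gS)

open FanoSimplices

-- Divisibility

infix 4 _∣ᵢ_

-- Divisibility is expressed inside ℚ, where determinants and matrix products are computed; `∣ᵢ⇒∣`
-- and `∣⇒∣ᵢ` translate to natural numbers.
_∣ᵢ_ : ℕ → ℚ → Set
m ∣ᵢ q = ∃[ z ] q ≡ fromNat m * fromℤ z

∣ᵢ-+ : ∀ {m p q} → m ∣ᵢ p → m ∣ᵢ q → m ∣ᵢ p + q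
∣ᵢ-+ {m} (a , refl) (b , refl) = a ℤ.+ b , trans (sym (distribˡ (fromNat m) (fromℤ a) (fromℤ b)))
    (cong (fromNat m *_) (sym (fromℤ-+ a b)))

∣ᵢ-* : ∀ {m p q} → IsInt p → m ∣ᵢ q → m ∣ᵢ p * q
∣ᵢ-* {m} (a , refl) (b , refl) = a ℤ.* b , trans (lem (fromℤ a) (fromNat m) (fromℤ b))
    (cong (fromNat m *_) (sym (fromℤ-* a b)))
  where
  opaque
    unfolding ring
    lem : ∀ a m b → a * (m * b) ≡ m * (a * b)
    lem = solve-∀ ring

∣ᵢ-0 : ∀ {m} → m ∣ᵢ 0ℚ
∣ᵢ-0 {m} = ℤ.+ 0 , sym (*-zeroʳ (fromNat m))

∣ᵢ-neg : ∀ {m p} → m ∣ᵢ p → m ∣ᵢ - p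
∣ᵢ-neg {m} {p} h = subst (m ∣ᵢ_) (lem p) (∣ᵢ-* (int-neg int-1) h)
  where
  opaque
    unfolding ring
    lem : ∀ p → - 1ℚ * p ≡ - p
    lem = solve-∀ ring

∣ᵢ-sum : ∀ {m n} {f : Fin n → ℚ} → (∀ i → m ∣ᵢ f i) → m ∣ᵢ sum f
∣ᵢ-sum {n = zero} h = ∣ᵢ-0
∣ᵢ-sum {n = suc n} h = ∣ᵢ-+ (h zero) (∣ᵢ-sum (h ∘ suc))

∣ᵢ⇒∣ : ∀ {m} a → m ∣ᵢ fromℤ a → m ℕ.∣ ℤ.∣ a ∣
∣ᵢ⇒∣ {m} a (z , e) = ℕ.divides ℤ.∣ z ∣ (trans (cong ℤ.∣_∣ (fromℤ-injective (trans e (sym (fromℤ-* (ℤ.+ m) z)))))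
    (trans (ℤ.abs-* (ℤ.+ m) z) (ℕ.*-comm m ℤ.∣ z ∣)))

∣⇒∣ᵢ-ℕ : ∀ {m n} → m ℕ.∣ n → m ∣ᵢ fromNat n
∣⇒∣ᵢ-ℕ {m} (ℕ.divides q refl) = ℤ.+ q , trans (cong fromNat (ℕ.*-comm q m)) (fromNat-* m q)

∣⇒∣ᵢ : ∀ {m} a → m ℕ.∣ ℤ.∣ a ∣ → m ∣ᵢ fromℤ a
∣⇒∣ᵢ (ℤ.+ n) h = ∣⇒∣ᵢ-ℕ h
∣⇒∣ᵢ -[1+ n ] h = subst (_ ∣ᵢ_) (sym (fromℤ-neg (ℤ.+ suc n))) (∣ᵢ-neg (∣⇒∣ᵢ-ℕ h))

coprime-∣ : ∀ {k m n} → k ℕ.∣ m → Coprime m n → Coprime k n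
coprime-∣ h c (a , b) = c (ℕ.∣-trans a h , b)

coprime-* : ∀ {h a b} → Coprime h a → Coprime h b → Coprime h (a ℕ.* b)
coprime-* ca cb (k∣h , k∣ab) = cb (k∣h , coprime-divisor (coprime-∣ k∣h ca) k∣ab)

prodℕ : ∀ {n} → (Fin n → ℕ) → ℕ
prodℕ {zero} m = 1
prodℕ {suc n} m = m zero ℕ.* prodℕ (m ∘ suc)

coprime-prodℕ : ∀ {n h} (m : Fin n → ℕ) → (∀ j → Coprime h (m j)) → Coprime h (prodℕ m)
coprime-prodℕ {zero} m c (_ , k∣1) = ℕ.∣1⇒≡1 k∣1
coprime-prodℕ {suc n} m c = coprime-* (c zero) (coprime-prodℕ (m ∘ suc) (c ∘ suc))

∣-prodℕ : ∀ {n} (m : Fin n → ℕ) j → m j ℕ.∣ prodℕ m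
∣-prodℕ m zero = ℕ.m∣m*n _
∣-prodℕ m (suc j) = ℕ.∣-trans (∣-prodℕ (m ∘ suc) j) (ℕ.n∣m*n (m zero))

-- The quotient m / gcd (m , D) divides every entry of v, hence equals 1 by primitivity.
primitive-∣ : ∀ {d} m D (v : Fin d → ℤ) → .{{NonZero m}} → (∀ c → m ℕ.∣ D ℕ.* ℤ.∣ v c ∣) → Primitive v → m ℕ.∣ D
primitive-∣ m D v h prim = subst (ℕ._∣ D) (sym m≡e) (gcd[m,n]∣n m D)
  where
  e : ℕ
  e = gcd m D
  instance
    e≢0 : NonZero e
    e≢0 = ℕ.≢-nonZero (gcd[m,n]≢0 m D (inj₁ (ℕ.≢-nonZero⁻¹ m)))
  m≡ : m ℕ./ e ℕ.* e ≡ m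
  m≡ = m/n*n≡m (gcd[m,n]∣m m D)
  D≡ : D ℕ./ e ℕ.* e ≡ D
  D≡ = m/n*n≡m (gcd[m,n]∣n m D)
  divides-v : ∀ c → m ℕ./ e ℕ.∣ ℤ.∣ v c ∣
  divides-v c = coprime-divisor (coprime-/gcd m D) (ℕ.*-cancelʳ-∣ e (subst₂ ℕ._∣_ (sym m≡)
    (trans (cong (ℕ._* ℤ.∣ v c ∣) (sym D≡)) (trans (ℕ.*-assoc (D ℕ./ e) e ℤ.∣ v c ∣)
        (trans (cong (D ℕ./ e ℕ.*_) (ℕ.*-comm e ℤ.∣ v c ∣)) (sym (ℕ.*-assoc (D ℕ./ e) ℤ.∣ v c ∣ e))))) (h c)))
  m≡e : m ≡ e
  m≡e = trans (sym m≡) (trans (cong (ℕ._* e) (prim (m ℕ./ e) divides-v)) (ℕ.*-identityˡ e))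

int-posℕ : ∀ {q} → IsInt q → 0ℚ < q → ∃[ n ] q ≡ fromNat n
int-posℕ (ℤ.+ n , e) h = n , e
int-posℕ (-[1+ n ] , refl) h with () ← fromℤ-<⁻¹ h

-- If ∑ g / aⱼ = 1 and D is divisible by every gcd (aⱼ , g) then g divides D: h = g / gcd (g , D) is coprime to
-- the denominators of the reduced fractions g / aⱼ and divides their numerators.
unit-sum-∣ : ∀ {n} (g D : ℕ) .{{_ : NonZero g}} (a : Fin n → ℕ) (β : Fin n → ℚ) → (∀ j → NonZero (a j)) →
  (∀ j → fromNat (a j) * β j ≡ fromNat g) → sum β ≡ 1ℚ → (∀ j m → .{{NonZero m}} → m ℕ.∣ a j → m ℕ.∣ g → m ℕ.∣ D) →
      g ℕ.∣ D
unit-sum-∣ {n} g D a β a≢0 aβ sum-β common = subst (ℕ._∣ D) (sym g≡G) (gcd[m,n]∣n g D)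
  where
  G : ℕ
  G = gcd g D
  instance
    G≢0 : NonZero G
    G≢0 = ℕ.≢-nonZero (gcd[m,n]≢0 g D (inj₁ (ℕ.≢-nonZero⁻¹ g)))
  h : ℕ
  h = g ℕ./ G
  hG : h ℕ.* G ≡ g
  hG = m/n*n≡m (gcd[m,n]∣m g D)
  module _ (j : Fin n) where
    e : ℕ
    e = gcd (a j) g
    instance
      e≢0 : NonZero e
      e≢0 = ℕ.≢-nonZero (gcd[m,n]≢0 (a j) g (inj₂ (ℕ.≢-nonZero⁻¹ g)))
    m ν f : ℕ
    m = a j ℕ./ e
    ν = g ℕ./ e
    me : m ℕ.* e ≡ a j
    me = m/n*n≡m (gcd[m,n]∣m (a j) g)
    νe : ν ℕ.* e ≡ g
    νe = m/n*n≡m (gcd[m,n]∣n (a j) g)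
    e∣G : e ℕ.∣ G
    e∣G = gcd-greatest (gcd[m,n]∣n (a j) g) (common j e (gcd[m,n]∣m (a j) g) (gcd[m,n]∣n (a j) g))
    f = G ℕ./ e
    fe : f ℕ.* e ≡ G
    fe = m/n*n≡m e∣G
    ν≡hf : ν ≡ h ℕ.* f
    ν≡hf = ℕ.*-cancelʳ-≡ ν (h ℕ.* f) e
        (trans νe (trans (sym hG) (trans (cong (h ℕ.*_) (sym fe)) (sym (ℕ.*-assoc h f e)))))
    coprime-hm : Coprime h m
    coprime-hm = coprime-∣ (subst (h ℕ.∣_) (sym ν≡hf) (ℕ.m∣m*n f)) (Coprimality.sym (coprime-/gcd (a j) g))
    mβ : fromNat m * β j ≡ fromNat h * fromNat f
    mβ = *-cancel-≡ {fromNat e} (λ z → ℕ.≢-nonZero⁻¹ e (ℤ.+-injective (fromℤ-injective z)))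
      (trans (sym (*-assoc (fromNat e) (fromNat m) (β j)))
          (trans (cong (_* β j) (trans (*-comm (fromNat e) (fromNat m))
          (trans (sym (fromNat-* m e)) (cong fromNat me))))
        (trans (aβ j) (trans (cong fromNat (trans (sym νe) (cong (ℕ._* e) ν≡hf)))
            (trans (fromNat-* (h ℕ.* f) e) (trans (*-comm _ (fromNat e)) (cong (fromNat e *_) (fromNat-* h f))))))))
  Π : ℕ
  Π = prodℕ m
  h∣Π : h ℕ.∣ Π
  h∣Π = ∣ᵢ⇒∣ (ℤ.+ Π) (subst (h ∣ᵢ_) (trans (sum-*ˡ (fromNat Π) β) (trans (cong (fromNat Π *_) sum-β) (*-identityʳ _)))
      (∣ᵢ-sum {f = λ j → fromNat Π * β j} term))
    where
    term : ∀ j → h ∣ᵢ fromNat Π * β j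
    term j with ∣⇒∣ᵢ-ℕ (∣-prodℕ m j)
    ... | z , eq = z ℤ.* ℤ.+ f j , trans (cong (_* β j) eq) (trans (lem (fromNat (m j)) (fromℤ z) (β j))
        (trans (cong (fromℤ z *_) (mβ j)) (trans (lem′ (fromℤ z) (fromNat h) (fromNat (f j)))
        (cong (fromNat h *_) (sym (fromℤ-* z (ℤ.+ f j)))))))
      where
      opaque
        unfolding ring
        lem : ∀ m z b → m * z * b ≡ z * (m * b)
        lem = solve-∀ ring
        lem′ : ∀ z h f → z * (h * f) ≡ h * (z * f)
        lem′ = solve-∀ ring
  h≡1 : h ≡ 1
  h≡1 = coprime-prodℕ m coprime-hm (ℕ.∣-refl , h∣Π)
  g≡G : g ≡ G
  g≡G = trans (sym hG) (trans (cong (ℕ._* G) h≡1) (ℕ.*-identityˡ G))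

-- The matrix of facet normals

module Normals {d} {S : Subset d} (g : ℕ) .{{g≢0 : NonZero g}} (F : FanoData S (fromNat g)) where

  open FanoData F public

  G : ℚ
  G = fromNat g

  0<G : 0ℚ < G
  0<G = pos g
    where
    pos : ∀ g → .{{NonZero g}} → 0ℚ < fromNat g
    pos (suc n) = 0<fromNat n

  H : M (suc d)
  H = hom (toℚ V)

  elem-H : Elem H
  elem-H = elem-hom {V = toℚ V} independent

  last : Fin (suc d)
  last = Fin.fromℕ d

  normals : M (suc d)
  normals i zero = G
  normals i (suc c) = normal i c

  -- The row of the last vertex is replaced so that U ⊡ H is lower triangular with ones in the last row.
  U : M (suc d)
  U = setRow normals last (δ zero)

  L : M (suc d)
  L = U ⊡ H

  row-L : ∀ {i} j → i ≢ last → L i j ≡ G + sum (λ c → normal i c * toℚ V c j)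
  row-L {i} j ne = trans (sum-cong λ k → cong (_* H k j) (setRow-miss normals last (δ zero) i ne k))
      (cong (_+ sum (λ c → normal i c * toℚ V c j)) (*-identityʳ G))

  L-off : ∀ {i j} → i ≢ last → i ≢ j → L i j ≡ 0ℚ
  L-off {i} {j} ne nij = trans (row-L j ne) (trans (cong (_+_ G) (normal-off nij)) (+-inverseʳ G))

  L-diag : ∀ {i} → i ≢ last → L i i ≡ A i
  L-diag {i} ne = trans (row-L i ne) (trans (cong (_+_ G) (normal-diag i)) (lem G (A i)))
    where
    opaque
      unfolding ring
      lem : ∀ g a → g + (a - g) ≡ a
      lem = solve-∀ ring

  L-last : ∀ j → L last j ≡ 1ℚ
  L-last j = trans (sum-cong λ k → cong (_* H k j) (setRow-hit normals last (δ zero) k)) (sum-δˡ zero (λ k → H k j))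

  int-A : ∀ i → IsInt (A i)
  int-A i = subst IsInt (lem (A i) G)
      (int-+ (subst IsInt (normal-diag i) (int-sum λ c → int-* (int-normal i c) (V c i , refl))) (ℤ.+ g , refl))
    where
    opaque
      unfolding ring
      lem : ∀ a g → a - g + g ≡ a
      lem = solve-∀ ring

  0<A : ∀ i → 0ℚ < A i
  0<A i = 0<* 0<G (0<⁻¹ (0<β i))

  Aβ : ∀ i → A i * β i ≡ G
  Aβ i = trans (lem G (β i ⁻¹) (β i)) (trans (cong (G *_) (⁻¹-inverse (>⇒≢0 (0<β i)))) (*-identityʳ G))
    where
    opaque
      unfolding ring
      lem : ∀ g i b → g * i * b ≡ g * (b * i)
      lem = solve-∀ ring

  -- A vector in the kernel of U is H ν with L ν = 0. The rows of `L` other than the last one are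
  -- multiples A i > 0 of basis vectors, so ν vanishes off the last place, and the last row of ones
  -- deals with the rest.
  elem-U : Elem U
  elem-U = trivialKernel⇒elem U λ {μ} z k → trans (sym (Hν μ k)) (sum-0 λ j → trans (cong (H k j *_) (ν≡0 μ z j))
      (*-zeroʳ (H k j)))
    where
    module _ (μ : Fin (suc d) → ℚ) where
      ν : Fin (suc d) → ℚ
      ν = proj₁ (elem-surjective elem-H μ)
      Hν : ∀ k → (H ▹ ν) k ≡ μ k
      Hν = proj₂ (elem-surjective elem-H μ)
      module _ (z : ∀ i → (U ▹ μ) i ≡ 0ℚ) where
        Lν : ∀ i → (L ▹ ν) i ≡ 0ℚ
        Lν i = trans (sym (▹-⊡ U H ν i)) (trans (▹-cong U Hν i) (z i))
        ν-off : ∀ i → i ≢ last → ν i ≡ 0ℚ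
        ν-off i ne = *-cancel-≡ (>⇒≢0 (0<A i)) (trans (cong (_* ν i) (sym (L-diag ne)))
            (trans (sym (sum-single i {λ j → L i j * ν j} λ j nj → trans (cong (_* ν j) (L-off ne (nj ∘ sym)))
            (*-zeroˡ (ν j))))
          (trans (Lν i) (sym (*-zeroʳ (A i))))))
        ν≡0 : ∀ i → ν i ≡ 0ℚ
        ν≡0 i with i Fin.≟ last
        ... | no ne = ν-off i ne
        ... | yes refl = trans
            (sym (trans (sum-single last {λ j → L last j * ν j} λ j nj → trans (cong (L last j *_) (ν-off j nj))
            (*-zeroʳ _)) (trans (cong (_* ν last) (L-last last)) (*-identityˡ _)))) (Lν last)

  N : M (suc d)
  N = proj₁ (elem-inverse elem-U)

  NU : N ⊡ U ≈ δ
  NU = proj₂ (proj₂ (elem-inverse elem-U))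

  int-U : ∀ i j → IsInt (U i j)
  int-U i j with i Fin.≟ last
  int-U i zero | yes _ = int-1
  int-U i (suc j) | yes _ = int-0
  int-U i zero | no _ = ℤ.+ g , refl
  int-U i (suc j) | no _ = int-normal i j

  int-DN : ∀ i j → IsInt (det U * N i j)
  int-DN = int-adjugate int-U NU

  D : ℕ
  D = ℤ.∣ proj₁ (int-det int-U) ∣

  D≡ : det U ≡ fromℤ (proj₁ (int-det int-U))
  D≡ = proj₂ (int-det int-U)

  ∣detU∣ : ∣ det U ∣ ≡ fromNat D
  ∣detU∣ = trans (cong ∣_∣ D≡) (sym (fromℤ-∣∣ (proj₁ (int-det int-U))))

  det-product : det U * det H ≡ product (λ i → A (Fin.inject₁ i))
  det-product = trans (sym (det-⊡ elem-U H))
      (trans (det-lower {A = L} λ {i} {j} lt →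
      L-off {i} {j} (λ { refl → ℕ.<-irrefl refl (ℕ.<-≤-trans lt (Fin.≤fromℕ j)) }) (Fin.<⇒≢ lt))
    (trans (product-init-last {d} (λ i → L i i))
        (trans (cong₂ _*_ (product-cong {d} λ i → L-diag (Fin.fromℕ≢inject₁ ∘ sym)) (L-last last)) (*-identityʳ _))))

  -- U maps (0 , vⱼ) to a vector with entries - g, A j - g and, in the replaced row, 0, all
  -- divisible by m. Multiplication by the integral matrix det U · U⁻¹ shows that m divides det U ·
  -- vⱼ, and vⱼ is primitive.
  common-∣ : ∀ j m → .{{NonZero m}} → m ∣ᵢ A j → m ∣ᵢ G → m ℕ.∣ D
  common-∣ j m m∣A m∣G = primitive-∣ m D (λ c → V c j) (λ c → subst (m ℕ.∣_) (ℤ.abs-* (proj₁ (int-det int-U)) (V c j))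
      (∣ᵢ⇒∣ (proj₁ (int-det int-U) ℤ.* V c j)
          (subst (m ∣ᵢ_) (trans (cong (_* fromℤ (V c j)) D≡) (sym (fromℤ-* _ (V c j)))) (D*V c)))) (primitive-V j)
    where
    ξ : Fin (suc d) → ℚ
    ξ zero = 0ℚ
    ξ (suc c) = toℚ V c j
    Uξ : ∀ i → m ∣ᵢ (U ▹ ξ) i
    Uξ i with i Fin.≟ last
    ... | yes refl = subst (m ∣ᵢ_) (sym (sum-δˡ zero ξ)) ∣ᵢ-0
    ... | no ne = subst (m ∣ᵢ_)
        (sym (trans (cong (_+ sum (λ c → normal i c * toℚ V c j)) (*-zeroʳ G)) (+-identityˡ _))) (value i)
      where
      value : ∀ i → m ∣ᵢ sum (λ c → normal i c * toℚ V c j)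
      value i with i Fin.≟ j
      ... | yes refl = subst (m ∣ᵢ_) (sym (normal-diag i)) (∣ᵢ-+ m∣A (∣ᵢ-neg m∣G))
      ... | no nij = subst (m ∣ᵢ_) (sym (normal-off nij)) (∣ᵢ-neg m∣G)
    D*V : ∀ c → m ∣ᵢ det U * toℚ V c j
    D*V c = subst (m ∣ᵢ_) (trans (sum-cong λ k → *-assoc (det U) (N (suc c) k) ((U ▹ ξ) k))
        (trans (sum-*ˡ (det U) (λ k → N (suc c) k * (U ▹ ξ) k))
        (cong (det U *_) (trans (▹-⊡ N U ξ (suc c)) (trans (▹-congˡ NU ξ (suc c)) (▹-δ ξ (suc c)))))))
      (∣ᵢ-sum {f = λ k → det U * N (suc c) k * (U ▹ ξ) k} λ k → ∣ᵢ-* (int-DN (suc c) k) (Uξ k))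

  Aℕ : Fin (suc d) → ℕ
  Aℕ j = proj₁ (int-posℕ (int-A j) (0<A j))

  A≡ : ∀ j → A j ≡ fromNat (Aℕ j)
  A≡ j = proj₂ (int-posℕ (int-A j) (0<A j))

  g∣D : g ℕ.∣ D
  g∣D = unit-sum-∣ g D Aℕ β (λ j → ℕ.≢-nonZero λ e → >⇒≢0 (0<A j) (trans (A≡ j) (cong fromNat e)))
      (λ j → trans (cong (_* β j) (sym (A≡ j))) (Aβ j)) sum-β
    λ j m m∣A m∣g → common-∣ j m (subst (m ∣ᵢ_) (sym (A≡ j)) (∣⇒∣ᵢ-ℕ m∣A)) (∣⇒∣ᵢ-ℕ m∣g)

  D≢0 : NonZero D
  D≢0 = ℕ.≢-nonZero λ e → det≢0 elem-U (∣∣≡0 (trans ∣detU∣ (cong fromNat e)))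

  G≤∣detU∣ : G ≤ ∣ det U ∣
  G≤∣detU∣ = subst (G ≤_) (sym ∣detU∣) (fromNat-≤ (ℕ.∣⇒≤ {{D≢0}} g∣D))

  ∣det∣-product : ∣ det U ∣ * ∣ det H ∣ ≡ product (λ i → A (Fin.inject₁ i))
  ∣det∣-product = trans (sym (∣∣-* (det U) (det H)))
      (trans (cong ∣_∣ det-product) (∣∣-pos (product-≥0 {n = d} λ i → ℚ.<⇒≤ (0<A (Fin.inject₁ i)))))

  -- Modulo m the columns i and j of `L` agree: the entries A i and A j vanish, and both columns end
  -- in 1. Multiplication by det U · U⁻¹ turns this into m ∣ g (vᵢ - vⱼ), up to sign, and g can be
  -- cancelled because it is coprime to m.
  congruence : ∣ det U ∣ ≡ G → ∀ {i j} m → i ≢ last → j ≢ last → m ∣ᵢ A i → m ∣ᵢ A j → Coprime m g → ∀ c →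
      m ∣ᵢ toℚ V c i - toℚ V c j
  congruence e {i} {j} m ni nj m∣Ai m∣Aj cop c =
      subst (m ∣ᵢ_) x≡ (∣⇒∣ᵢ x
      (coprime-divisor cop (subst (λ n → m ℕ.∣ n ℕ.* ℤ.∣ x ∣) D≡g (subst (m ℕ.∣_) (ℤ.abs-* (proj₁ (int-det int-U)) x)
      (∣ᵢ⇒∣ (proj₁ (int-det int-U) ℤ.* x) (subst (m ∣ᵢ_) (trans (cong₂ _*_ D≡ (sym x≡)) (sym (fromℤ-* _ x))) D*x))))))
    where
    x : ℤ
    x = V c i ℤ.+ ℤ.- V c j
    x≡ : fromℤ x ≡ toℚ V c i - toℚ V c j
    x≡ = trans (fromℤ-+ (V c i) (ℤ.- V c j)) (cong (_+_ (fromℤ (V c i))) (fromℤ-neg (V c j)))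
    D≡g : D ≡ g
    D≡g = ℤ.+-injective (fromℤ-injective (trans (sym ∣detU∣) e))
    column : ∀ {j} k → j ≢ last → m ∣ᵢ A j → k ≢ last → m ∣ᵢ L k j
    column {j} k nj m∣A nk with k Fin.≟ j
    ... | yes refl = subst (m ∣ᵢ_) (sym (L-diag nk)) m∣A
    ... | no nkj = subst (m ∣ᵢ_) (sym (L-off nk nkj)) ∣ᵢ-0
    difference : ∀ k → m ∣ᵢ L k i - L k j
    difference k = cases (k Fin.≟ last)
      where
      cases : Dec (k ≡ last) → m ∣ᵢ L k i - L k j
      cases (no nk) = ∣ᵢ-+ (column k ni m∣Ai nk) (∣ᵢ-neg (column k nj m∣Aj nk))
      cases (yes refl) = subst (m ∣ᵢ_) (sym (trans (cong₂ _-_ (L-last i) (L-last j)) (+-inverseʳ 1ℚ))) ∣ᵢ-0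
    NL : ∀ j → (N ▹ (λ k → L k j)) (suc c) ≡ toℚ V c j
    NL j = trans (⊡-assoc N U H (suc c) j) (trans (⊡-cong {B = H} NU (λ _ _ → refl) (suc c) j) (⊡-δˡ H (suc c) j))
    D*x : m ∣ᵢ det U * (toℚ V c i - toℚ V c j)
    D*x = subst (m ∣ᵢ_) (trans (sum-cong λ k → *-assoc (det U) (N (suc c) k) (L k i - L k j))
        (trans (sum-*ˡ (det U) (λ k → N (suc c) k * (L k i - L k j)))
        (cong (det U *_) (trans (▹-minus N (λ k → L k i) (λ k → L k j) (suc c)) (cong₂ _-_ (NL i) (NL j))))))
      (∣ᵢ-sum {f = λ k → det U * N (suc c) k * (L k i - L k j)} λ k → ∣ᵢ-* (int-DN (suc c) k) (difference k))

-- Isomorphisms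

module Isomorphisms where

  private
    variable
      d n : ℕ
      S : Subset d

  fromℤ-sum : ∀ (f : Fin n → ℤ) → fromℤ (sumℤ f) ≡ sum (λ i → fromℤ (f i))
  fromℤ-sum {zero} f = refl
  fromℤ-sum {suc n} f = trans (fromℤ-+ (f zero) _) (cong (_+_ (fromℤ (f zero))) (fromℤ-sum (f ∘ suc)))

  fromℤ-⊗ : ∀ (A B : Matrix ℤ n n) → toℚ (A ⊗ B) ≈ toℚ A ⊡ toℚ B
  fromℤ-⊗ A B i k = trans (fromℤ-sum (λ j → A i j ℤ.* B j k)) (sum-cong λ j → fromℤ-* (A i j) (B j k))

  fromℤ-identity : ∀ (i j : Fin n) → fromℤ (identity i j) ≡ δ i j
  fromℤ-identity i j with i Fin.≟ j
  ... | yes refl = sym (δ-refl i)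
  ... | no ne = sym (δ-≢ ne)

  opaque
    unfolding _+_

    image⁺ : ∀ (A : M d) {x y : Fin d → ℚ} → S x → (∀ i → (A ▹ x) i ≡ y i) → image (A ·_) S y
    image⁺ A {x} s e = x , s , e

    image⁻ : ∀ (A : M d) {y : Fin d → ℚ} → image (A ·_) S y → ∃[ x ] S x × (∀ i → (A ▹ x) i ≡ y i)
    image⁻ A h = h

  ∣∣≡1⇒sq≡1 : ∀ {x} → ∣ x ∣ ≡ 1ℚ → x * x ≡ 1ℚ
  ∣∣≡1⇒sq≡1 {x} e = trans (sym (∣∣-pos (sq-≥0 x))) (trans (∣∣-* x x) (trans (cong₂ _*_ e e) (*-identityˡ 1ℚ)))

  block-▹-suc : ∀ (B : M d) x i → (block (λ _ → 0ℚ) B ▹ x) (suc i) ≡ (B ▹ (x ∘ suc)) i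
  block-▹-suc B x i = trans (cong (_+ (B ▹ (x ∘ suc)) i) (*-zeroˡ (x zero))) (+-identityˡ _)

  hom-⊡ : ∀ {V Q : Fin d → Fin n → ℚ} (B : M d) → V ≈ B ⊡ Q → hom V ≈ block (λ _ → 0ℚ) B ⊡ hom Q
  hom-⊡ {Q = Q} B e zero j = sym (trans (cong₂ _+_ (*-identityˡ 1ℚ) (sum-0 λ k → *-zeroˡ (Q k j))) (+-identityʳ 1ℚ))
  hom-⊡ {Q = Q} B e (suc i) j = trans (e i j) (sym (block-▹-suc B (λ k → hom Q k j) i))

  det-block : ∀ (B : M d) → det (block (λ _ → 0ℚ) B) ≡ det B
  det-block B = trans (det-firstRow {A = block (λ _ → 0ℚ) B} (λ j → refl)) (*-identityˡ _)

  elem-unblock : ∀ {B : M d} → Elem (block (λ _ → 0ℚ) B) → Elem B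
  elem-unblock {d} {B} E = trivialKernel⇒elem B λ {μ} z i → elem-injective E {cons μ}
      (λ { zero → trans (cong₂ _+_ (*-zeroʳ 1ℚ) (sum-0 λ j → *-zeroˡ (μ j))) (+-identityˡ 0ℚ) ; (suc i) →
          trans (block-▹-suc B (cons μ) i) (z i) }) (suc i)
    where
    cons : (Fin d → ℚ) → Fin (suc d) → ℚ
    cons μ zero = 0ℚ
    cons μ (suc i) = μ i

  elem-factor : ∀ {A B C : M n} → Elem A → A ≈ B ⊡ C → Elem B
  elem-factor {A = A} {B} {C} E e = leftInverse⇒elem {N = C ⊡ N} (leftInverse⇒rightInverse {A = C ⊡ N} {N = B}
      λ i k → trans (⊡-assoc B C N i k) (trans (⊡-cong {B = N} (λ i j → sym (e i j)) (λ _ _ → refl) i k)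
          (proj₁ (proj₂ (elem-inverse E)) i k)))
    where
    N : M _
    N = proj₁ (elem-inverse E)

  elem-factor-hom : ∀ {V Q : Fin d → Fin (suc d) → ℚ} {B : M d} → Elem (hom V) → V ≈ B ⊡ Q → Elem (block (λ _ → 0ℚ) B)
  elem-factor-hom {V = V} {Q} {B} E eq = elem-factor {B = block (λ _ → 0ℚ) B} {C = hom Q} E (hom-⊡ {V = V} {Q} B eq)

  det-factor : ∀ {V Q : Fin d → Fin (suc d) → ℚ} {B : M d} → Elem (hom V) → V ≈ B ⊡ Q → det (hom V) ≡ det B * det
      (hom Q)
  det-factor {V = V} {Q} {B} E eq = trans (det-cong (hom-⊡ {V = V} {Q} B eq))
      (trans (det-⊡ (elem-factor-hom {V = V} {Q} E eq) (hom Q)) (cong (_* det (hom Q)) (det-block B)))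

  -- Equality of the volumes forces det B = ± 1.
  recognize : ∀ {S : Subset d} (V : Matrix ℤ d (suc d)) → Elem (hom (toℚ V)) → (∀ {x} → S x → Hull (toℚ V) x) →
      (∀ {x} → Hull (toℚ V) x → S x) →
    (Q : Matrix ℚ d (suc d)) (B : M d) → (∀ i j → IsInt (B i j)) → toℚ V ≈ B ⊡ Q → ∣ det (hom (toℚ V)) ∣ ≡ ∣ det
        (hom Q) ∣ → S ≅ Δ[ Q ]
  recognize {d} {S} V E to from Q B int-B eq vol = φ ,
      (λ h → let x , s , e = image⁻ {S = S} (toℚ Nℤ) h in Hull⇒Δ Q (forward (to s) e)) ,
      λ h → let x , hx , e = backward (Δ⇒Hull Q h) in image⁺ {S = S} (toℚ Nℤ) (from hx) e
    where
    E-B : Elem B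
    E-B = elem-unblock (elem-factor-hom {V = toℚ V} {Q} E eq)
    det-V : det (hom (toℚ V)) ≡ det B * det (hom Q)
    det-V = det-factor {V = toℚ V} {Q} E eq
    ∣det-B∣ : ∣ det B ∣ ≡ 1ℚ
    ∣det-B∣ = *-cancel-≡ {∣ det (hom Q) ∣} (λ z → det≢0 E (∣∣≡0 (trans vol z)))
      (trans (*-comm _ _) (trans (sym (∣∣-* (det B) (det (hom Q))))
          (trans (cong ∣_∣ (sym det-V)) (trans vol (sym (*-identityʳ _))))))
    N : M d
    N = proj₁ (elem-inverse E-B)
    BN : B ⊡ N ≈ δ
    BN = proj₁ (proj₂ (elem-inverse E-B))
    NB : N ⊡ B ≈ δ
    NB = proj₂ (proj₂ (elem-inverse E-B))
    -- The entries of det B · N are integral, and a further factor det B gives N itself because (det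
    -- B)² = 1.
    int-N : ∀ i j → IsInt (N i j)
    int-N i j = subst IsInt (trans (sym (*-assoc (det B) (det B) (N i j)))
        (trans (cong (_* N i j) (∣∣≡1⇒sq≡1 ∣det-B∣)) (*-identityˡ _)))
      (int-* (int-det int-B) (int-adjugate int-B NB i j))
    Bℤ Nℤ : Matrix ℤ d d
    Bℤ i j = proj₁ (int-B i j)
    Nℤ i j = proj₁ (int-N i j)
    B≈ : toℚ Bℤ ≈ B
    B≈ i j = sym (proj₂ (int-B i j))
    N≈ : toℚ Nℤ ≈ N
    N≈ i j = sym (proj₂ (int-N i j))
    φ : GL d
    φ = record
      { matrix = Nℤ ; inverse = Bℤ
      ; inverseˡ = λ i j → fromℤ-injective
          (trans (fromℤ-⊗ Bℤ Nℤ i j) (trans (⊡-cong B≈ N≈ i j) (trans (BN i j) (sym (fromℤ-identity i j)))))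
      ; inverseʳ = λ i j → fromℤ-injective
          (trans (fromℤ-⊗ Nℤ Bℤ i j) (trans (⊡-cong N≈ B≈ i j) (trans (NB i j) (sym (fromℤ-identity i j))))) }
    NV : ∀ λs i → (toℚ Nℤ ▹ (toℚ V ▹ λs)) i ≡ (Q ▹ λs) i
    NV λs i = trans (▹-congˡ N≈ (toℚ V ▹ λs) i)
        (trans (▹-cong N (λ j → trans (▹-congˡ eq λs j) (sym (▹-⊡ B Q λs j))) i)
      (trans (▹-⊡ N B (Q ▹ λs) i) (trans (▹-congˡ NB (Q ▹ λs) i) (▹-δ (Q ▹ λs) i))))
    forward : ∀ {x y} → Hull (toℚ V) x → (∀ i → (toℚ Nℤ ▹ x) i ≡ y i) → Hull Q y
    forward (λs , h , s , e) f = λs , h , s , λ i → trans (sym (NV λs i)) (trans (▹-cong (toℚ Nℤ) e i) (f i))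
    backward : ∀ {y} → Hull Q y → ∃[ x ] Hull (toℚ V) x × (∀ i → (toℚ Nℤ ▹ x) i ≡ y i)
    backward (λs , h , s , e) = toℚ V ▹ λs , (λs , h , s , λ _ → refl) , λ i → trans (NV λs i) (e i)

  -- No matching of the vertices is required: if each of two simplices contains the vertices of the
  -- other, their matrices differ by stochastic matrices that are inverse to each other. Both have
  -- determinants of absolute value at most 1, and the product of these is 1.
  ∣det∣-factor : ∀ {A B Λ : M n} → Elem A → A ≈ B ⊡ Λ → (∀ i j → 0ℚ ≤ Λ i j) → (∀ j → sum (λ i → Λ i j) ≡ 1ℚ) →
    (Λ′ : M n) → B ≈ A ⊡ Λ′ → (∀ i j → 0ℚ ≤ Λ′ i j) → (∀ j → sum (λ i → Λ′ i j) ≡ 1ℚ) → ∣ det A ∣ ≡ ∣ det B ∣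
  ∣det∣-factor {n} {A} {B} {Λ} E e h s Λ′ e′ h′ s′ = trans (sym (*-identityʳ _))
      (trans (cong (∣ det A ∣ *_) (sym ∣det-Λ′∣)) (trans (sym (∣∣-* (det A) (det Λ′)))
      (cong ∣_∣ (sym (trans (det-cong e′) (det-⊡ E Λ′))))))
    where
    Λ′Λ : Λ′ ⊡ Λ ≈ δ
    Λ′Λ i k = elem-cancel E {λ j → (Λ′ ⊡ Λ) j k} {λ j → δ j k} (λ r → trans (⊡-assoc A Λ′ Λ r k)
      (trans (⊡-cong {B = Λ} (λ i j → sym (e′ i j)) (λ _ _ → refl) r k) (trans (sym (e r k)) (sym (⊡-δʳ A r k))))) i
    E-Λ : Elem Λ
    E-Λ = leftInverse⇒elem {N = Λ′} Λ′Λ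
    E-Λ′ : Elem Λ′
    E-Λ′ = leftInverse⇒elem {N = Λ} (leftInverse⇒rightInverse {A = Λ} {N = Λ′} Λ′Λ)
    ≤1 : ∀ {Λ : M n} → Elem Λ → (∀ i j → 0ℚ ≤ Λ i j) → (∀ j → sum (λ i → Λ i j) ≡ 1ℚ) → ∣ det Λ ∣ ≤ 1ℚ
    ≤1 {Λ} E h s = subst (λ x → ∣ x ∣ ≤ 1ℚ) (det-ᵀ E) (det-substochastic {A = Λ ᵀ} (λ i j → h j i)
        (λ i → ℚ.≤-reflexive (s i)))
    product≡1 : ∣ det Λ′ ∣ * ∣ det Λ ∣ ≡ 1ℚ
    product≡1 = trans (sym (∣∣-* (det Λ′) (det Λ))) (trans (cong ∣_∣ (det-inverse E-Λ′ Λ′Λ)) (∣∣-pos 0≤1))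
    ∣det-Λ′∣ : ∣ det Λ′ ∣ ≡ 1ℚ
    ∣det-Λ′∣ = ℚ.≤-antisym (≤1 E-Λ′ h′ s′) (subst₂ _≤_ product≡1 (*-identityʳ _)
        (*-monoˡ (0≤∣∣ (det Λ′)) (≤1 E-Λ h s)))

  hull-factor : ∀ {V Q : Fin d → Fin (suc d) → ℚ} → (∀ j → Hull Q (λ c → V c j)) →
    ∃[ Λ ] hom V ≈ hom Q ⊡ Λ × (∀ i j → 0ℚ ≤ Λ i j) × (∀ j → sum (λ i → Λ i j) ≡ 1ℚ)
  hull-factor {d} {V} {Q} h = Λ ,
      (λ { zero j → sym (trans (sum-cong λ k → *-identityˡ (Λ k j)) (column j)) ; (suc i) j →
      sym (proj₂ (proj₂ (proj₂ (h j))) i) }) ,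
      (λ i j → proj₁ (proj₂ (h j)) i) , column
    where
    Λ : M (suc d)
    Λ i j = proj₁ (h j) i
    column : ∀ j → sum (λ i → Λ i j) ≡ 1ℚ
    column j = proj₁ (proj₂ (proj₂ (h j)))

  ∣∣-int-unit : ∀ {a b} → IsInt a → IsInt b → a * b ≡ 1ℚ → ∣ a ∣ ≡ 1ℚ
  ∣∣-int-unit {a} {b} (x , refl) (y , refl) e =
      ℚ.≤-antisym (subst₂ _≤_ (*-identityʳ _) product≡1 (*-monoˡ (0≤∣∣ a) 1≤∣b∣)) 1≤∣a∣
    where
    product≡1 : ∣ a ∣ * ∣ b ∣ ≡ 1ℚ
    product≡1 = trans (sym (∣∣-* a b)) (trans (cong ∣_∣ e) (∣∣-pos 0≤1))
    int-∣∣ : ∀ z → IsInt ∣ fromℤ z ∣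
    int-∣∣ z = ℤ.+ ℤ.∣ z ∣ , sym (fromℤ-∣∣ z)
    1≤∣a∣ : 1ℚ ≤ ∣ a ∣
    1≤∣a∣ = int-pos (int-∣∣ x) (0<∣∣ λ z → ℚ.1≢0 (trans (sym e) (trans (cong (_* b) z) (*-zeroˡ b))))
    1≤∣b∣ : 1ℚ ≤ ∣ b ∣
    1≤∣b∣ = int-pos (int-∣∣ y) (0<∣∣ λ z → ℚ.1≢0 (trans (sym e) (trans (cong (a *_) z) (*-zeroʳ a))))

  iso⇒∣det∣ : ∀ {S : Subset d} (V : Matrix ℤ d (suc d)) → Elem (hom (toℚ V)) → (∀ {x} → S x → Hull (toℚ V) x) →
      (∀ {x} → Hull (toℚ V) x → S x) →
    (Q : Matrix ℚ d (suc d)) → S ≅ Δ[ Q ] → ∣ det (hom (toℚ V)) ∣ ≡ ∣ det (hom Q) ∣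
  iso⇒∣det∣ {d} {S} V E to from Q (φ , ⊆Q , Q⊆) =
      trans (sym ∣det-V′∣) (∣det∣-factor E-V′ (proj₁ (proj₂ ΛV)) (proj₁ (proj₂ (proj₂ ΛV))) (proj₂ (proj₂ (proj₂ ΛV)))
      (proj₁ ΛQ) (proj₁ (proj₂ ΛQ)) (proj₁ (proj₂ (proj₂ ΛQ))) (proj₂ (proj₂ (proj₂ ΛQ))))
    where
    open GL φ
    A B V̂ : M _
    A = toℚ matrix
    B = toℚ inverse
    V̂ = block (λ _ → 0ℚ) A
    V′ : Fin d → Fin (suc d) → ℚ
    V′ = A ⊡ toℚ V
    BA : B ⊡ A ≈ δ
    BA i j = trans (sym (fromℤ-⊗ inverse matrix i j)) (trans (cong fromℤ (inverseˡ i j)) (fromℤ-identity i j))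
    AB : A ⊡ B ≈ δ
    AB = leftInverse⇒rightInverse {A = A} {N = B} BA
    E-A : Elem A
    E-A = leftInverse⇒elem {N = B} BA
    hom-V′ : hom V′ ≈ V̂ ⊡ hom (toℚ V)
    hom-V′ = hom-⊡ {V = V′} {toℚ V} A (λ _ _ → refl)
    E-V̂ : Elem V̂
    E-V̂ = elem-block (λ _ → 0ℚ) E-A
    E-V′ : Elem (hom V′)
    E-V′ = trivialKernel⇒elem (hom V′) λ {μ} z → elem-injective E (elem-injective E-V̂ λ i →
        trans (▹-⊡ V̂ (hom (toℚ V)) μ i) (trans (sym (▹-congˡ hom-V′ μ i)) (z i)))
    int-det-toℚ : ∀ (X : Matrix ℤ d d) → IsInt (det (toℚ X))
    int-det-toℚ X = int-det λ i j → X i j , refl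
    ∣det-A∣ : ∣ det A ∣ ≡ 1ℚ
    ∣det-A∣ = ∣∣-int-unit {det A} {det B} (int-det-toℚ matrix) (int-det-toℚ inverse) (det-inverse E-A AB)
    ∣det-V′∣ : ∣ det (hom V′) ∣ ≡ ∣ det (hom (toℚ V)) ∣
    ∣det-V′∣ = trans (cong ∣_∣ (trans (det-cong hom-V′) (det-⊡ E-V̂ (hom (toℚ V)))))
        (trans (∣∣-* _ _) (trans (cong (_* ∣ det (hom (toℚ V)) ∣) (trans (cong ∣_∣ (det-block A)) ∣det-A∣))
        (*-identityˡ _)))
    ΛV = hull-factor {V = V′} {Q} λ j → Δ⇒Hull Q (⊆Q (image⁺ {S = S} A (from (hull-vertex (toℚ V) j)) (λ _ → refl)))
    ΛQ = hull-factor {V = Q} {V′} λ j → column (image⁻ {S = S} A (Q⊆ (Hull⇒Δ Q (hull-vertex Q j))))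
      where
      column : ∀ {y} → ∃[ x ] S x × (∀ i → (A ▹ x) i ≡ y i) → Hull V′ y
      column (x , sx , e) with to sx
      ... | λs , h , s , f = λs , h , s , λ i → trans (sym (▹-⊡ A (toℚ V) λs i)) (trans (▹-cong A f i) (e i))

  -- The simplices P₂

  /-≡ : ∀ z n .{{_ : NonZero n}} → (z ℚ./ n) ≡ fromℤ z * fromNat n ⁻¹
  /-≡ z (suc m) = *-cancel-≡ {fromNat (suc m)} (>⇒≢0 (0<fromNat m))
      (trans (cleared z m) (sym (trans (lem (fromNat (suc m)) (fromℤ z) _)
      (trans (cong (fromℤ z *_) (⁻¹-inverse (>⇒≢0 (0<fromNat m)))) (*-identityʳ _)))))
    where
    opaque
      unfolding ring
      lem : ∀ n z i → n * (z * i) ≡ z * (n * i)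
      lem = solve-∀ ring
    opaque
      unfolding _+_
      cleared : ∀ z m → fromNat (suc m) * (z ℚ./ suc m) ≡ fromℤ z
      cleared z m = ℚ.toℚᵘ-injective (ℚᵘ.≃-trans (ℚ.toℚᵘ-homo-* (fromNat (suc m)) (z ℚ./ suc m))
        (ℚᵘ.≃-trans (ℚᵘ.*-congˡ {ℚ.toℚᵘ (fromNat (suc m))} (ℚ.toℚᵘ-fromℚᵘ (ℚᵘ.mkℚᵘ z m)))
          (ℚᵘ.*≡* (trans (ℤ.*-identityʳ _)
              (trans (ℤ.*-comm (ℤ.+ suc m) z) (cong (λ k → z ℤ.* ℤ.+ k) (sym (ℕ.+-identityʳ (suc m)))))))))

  punchIn-fromℕ : ∀ {n} (j : Fin n) → punchIn (fromℕ n) j ≡ inject₁ j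
  punchIn-fromℕ zero = refl
  punchIn-fromℕ (suc j) = cong suc (punchIn-fromℕ j)

  snoc-inject₁ : ∀ {A : Set} (xs : Fin n → A) x i → snoc xs x (inject₁ i) ≡ xs i
  snoc-inject₁ {n} xs x i = trans (cong (snoc xs x) (sym (punchIn-fromℕ i))) (insertAt-punchIn xs (fromℕ n) x i)

  snoc-last : ∀ {A : Set} (xs : Fin n → A) x → snoc xs x (fromℕ n) ≡ x
  snoc-last {n} xs x = insertAt-lookup xs (fromℕ n) x

  -- Matrices of the shape of P₂, with γₖ = g / sₖ.
  record Shape n (γ : Fin n → ℚ) (q : ℚ) (Q : Matrix ℚ (suc n) (suc (suc n))) : Set where
    field
      basis : ∀ i k → Q (inject₁ i) (inject₁ (inject₁ k)) ≡ δ i k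
      basis-last : ∀ k → Q (fromℕ n) (inject₁ (inject₁ k)) ≡ 0ℚ
      lastButOne : ∀ i → Q (inject₁ i) (inject₁ (fromℕ n)) ≡ (1ℚ - γ i) * q
      lastButOne-last : Q (fromℕ n) (inject₁ (fromℕ n)) ≡ q
      final : ∀ i → Q (inject₁ i) (fromℕ (suc n)) ≡ - ((1ℚ + γ i) * q)
      final-last : Q (fromℕ n) (fromℕ (suc n)) ≡ - q
      0<q : 0ℚ < q
      -- Equivalent to ∑ γₖ + 1 / q = 1, which is ∑ 1 / sₖ + 1 / t = 1 / g multiplied by g.
      sum-γ : sum γ * q + 1ℚ ≡ q

  module _ {n γ q Q} (shape : Shape n γ q Q) where

    open Shape shape

    private
      last : Fin (suc n)
      last = fromℕ n

      split : ∀ (f : Fin (suc n) → ℚ) → sum f ≡ sum (f ∘ inject₁) + f last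
      split f = sum-init-last f

    -- Adding multiples of the other rows makes the first row of hom Q equal to (0 , … , 0 , 2 q).
    ∣det-shape∣ : ∣ det (hom Q) ∣ ≡ 2ℚ * q * q
    ∣det-shape∣ = trans (cong ∣_∣
        (trans (sym (*-identityˡ _)) (trans (cong (_* det (hom Q)) (sym det-R))
        (trans (sym (det-⊡ E-R (hom Q))) det-X))))
        (trans (∣∣-* _ q) (cong₂ _*_
            (trans (∣∣-* _ (2ℚ * q)) (trans (cong₂ _*_ (∣sgn∣ (fromℕ (suc n))) (∣∣-pos (0≤* (ℚ.<⇒≤ 0<2) (ℚ.<⇒≤ 0<q))))
            (*-identityˡ _))) (∣∣-pos (ℚ.<⇒≤ 0<q))))
      where
      C y : ℚ
      C = sum λ i → (1ℚ - γ i) * q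
      -- Subtracting the rows with the unit vectors leaves 1 - C in the last but one column; y
      -- solves 1 - C + y q = 0.
      y = (C - 1ℚ) * q ⁻¹
      yq : y * q ≡ C - 1ℚ
      yq = trans (lem (C - 1ℚ) (q ⁻¹) q) (trans (cong ((C - 1ℚ) *_) (⁻¹-inverse (>⇒≢0 0<q))) (*-identityʳ _))
        where
        opaque
          unfolding ring
          lem : ∀ c i q → c * i * q ≡ c * (q * i)
          lem = solve-∀ ring
      u : Fin (suc n) → ℚ
      u = snoc (λ _ → - 1ℚ) y
      R X : M (suc (suc n))
      R = block u δ
      X = R ⊡ hom Q
      E-R : Elem R
      E-R = elem-block u (base λ _ _ → refl)
      det-R : det R ≡ 1ℚ
      det-R = trans (det-firstColumn {A = R} (λ i → refl)) (trans (*-identityˡ _) (det-δ (suc n)))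
      row₀ : ∀ j → X zero j ≡ 1ℚ + (- 1ℚ * sum (λ i → Q (inject₁ i) j) + y * Q last j)
      row₀ j = cong₂ _+_ (*-identityˡ 1ℚ)
          (trans (split (λ k → u k * Q k j))
          (cong₂ _+_ (trans (sum-cong {n} λ i → cong (_* Q (inject₁ i) j) (snoc-inject₁ (λ _ → - 1ℚ) y i))
          (sum-*ˡ (- 1ℚ) (λ i → Q (inject₁ i) j))) (cong (_* Q last j) (snoc-last {n} (λ _ → - 1ℚ) y))))
      row-suc : ∀ i j → X (suc i) j ≡ Q i j
      row-suc i j = trans (cong₂ _+_ (*-zeroˡ 1ℚ) (sum-δˡ i (λ k → Q k j))) (+-identityˡ _)
      sum-δ : ∀ k → sum (λ i → δ i k) ≡ 1ℚ
      sum-δ k = trans (sum-cong λ i → sym (*-identityˡ (δ i k))) (sum-δʳ k (λ _ → 1ℚ))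
      X-0 : ∀ j → X zero (inject₁ j) ≡ 0ℚ
      X-0 j with view j
      ... | ‵inject₁ k = trans (row₀ _)
          (trans (cong₂ (λ a b → 1ℚ + (- 1ℚ * a + y * b)) (trans (sum-cong λ i → basis i k) (sum-δ k)) (basis-last k))
          (lem y))
        where
        opaque
          unfolding ring
          lem : ∀ y → 1ℚ + (- 1ℚ * 1ℚ + y * 0ℚ) ≡ 0ℚ
          lem = solve-∀ ring
      ... | ‵fromℕ = trans (row₀ _)
          (trans (cong₂ (λ a b → 1ℚ + (- 1ℚ * a + b)) (sum-cong lastButOne) (trans (cong (y *_) lastButOne-last) yq))
          (lem C))
        where
        opaque
          unfolding ring
          lem : ∀ c → 1ℚ + (- 1ℚ * c + (c - 1ℚ)) ≡ 0ℚ
          lem = solve-∀ ring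
      X-last : X zero (fromℕ (suc n)) ≡ 2ℚ * q
      X-last = trans (row₀ _)
          (trans (cong₂ (λ a b → 1ℚ + (- 1ℚ * a + b))
          (trans (sum-linear (- 2ℚ) {g = λ i → γ i * q} {h = λ i → - ((1ℚ - γ i) * q)} λ i →
          trans (final i) (lem₀ (γ i) q))
            (cong₂ (λ a b → - 2ℚ * a + b) (sum-*ʳ q γ) (trans (sum-cong {n} λ i → lem₃ ((1ℚ - γ i) * q))
                (sum-*ˡ (- 1ℚ) (λ i → (1ℚ - γ i) * q)))))
          (trans (cong (y *_) final-last) (trans (lem₁ y q) (cong -_ yq))))
              (trans (lem₂ (sum γ * q) C) (cong (2ℚ *_) sum-γ)))
        where
        opaque
          unfolding ring
          lem₀ : ∀ γ q → - ((1ℚ + γ) * q) ≡ - (1ℚ + 1ℚ) * (γ * q) + - ((1ℚ - γ) * q)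
          lem₀ = solve-∀ ring
          lem₁ : ∀ y q → y * - q ≡ - (y * q)
          lem₁ = solve-∀ ring
          lem₂ : ∀ s c → 1ℚ + (- 1ℚ * (- (1ℚ + 1ℚ) * s + - 1ℚ * c) + - (c - 1ℚ)) ≡ (1ℚ + 1ℚ) * (s + 1ℚ)
          lem₂ = solve-∀ ring
          lem₃ : ∀ x → - x ≡ - 1ℚ * x
          lem₃ = solve-∀ ring
      X₁ : M (suc n)
      X₁ = minor X (fromℕ (suc n))
      X₁≡ : ∀ r c → X₁ r c ≡ Q r (inject₁ c)
      X₁≡ r c = trans (row-suc r _) (cong (Q r) (punchIn-fromℕ c))
      upper : ∀ {r c} → c Fin.< r → X₁ r c ≡ 0ℚ
      upper {r} {c} lt with view c | view r
      ... | ‵fromℕ | _ = contradiction (ℕ.<-≤-trans lt (Fin.≤fromℕ r)) (ℕ.<-irrefl refl)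
      ... | ‵inject₁ k | ‵fromℕ = trans (X₁≡ _ _) (basis-last k)
      ... | ‵inject₁ k | ‵inject₁ i =
          trans (X₁≡ _ _) (trans (basis i k) (δ-≢ {i = i} {k} λ { refl → ℕ.<-irrefl refl lt }))
      det-X₁ : det X₁ ≡ q
      det-X₁ = trans (det-upper {A = X₁} (λ {i} {j} → upper {i} {j})) (trans (product-init-last {n} (λ i → X₁ i i))
          (trans (cong₂ _*_
          (trans (product-cong {n} λ i → trans (X₁≡ _ _) (trans (basis i i) (δ-refl i))) (ones n))
              (trans (X₁≡ _ _) lastButOne-last)) (*-identityˡ q)))
        where
        ones : ∀ n → product {n} (λ _ → 1ℚ) ≡ 1ℚ
        ones zero = refl
        ones (suc n) = trans (*-identityˡ _) (ones n)
      det-X : det X ≡ sgn (fromℕ (suc n)) * (2ℚ * q) * q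
      det-X = trans (sum-single (fromℕ (suc n)) {λ j → sgn j * X zero j * det (minor X j)} vanish)
          (cong₂ (λ a b → sgn (fromℕ (suc n)) * a * b) X-last det-X₁)
        where
        opaque
          unfolding ring
          lem : ∀ s m → s * 0ℚ * m ≡ 0ℚ
          lem = solve-∀ ring
        vanish : ∀ j → j ≢ fromℕ (suc n) → sgn j * X zero j * det (minor X j) ≡ 0ℚ
        vanish j ne with view j
        ... | ‵fromℕ = contradiction refl ne
        ... | ‵inject₁ k = trans (cong (λ a → sgn (inject₁ k) * a * det (minor X (inject₁ k))) (X-0 k)) (lem _ _)

    -- The last column z of B is read off from z q = v_N - ∑ cₖ vₖ, using that q⁻¹ = 1 - ∑ γₖ.
    module ShapeFactor (V : Matrix ℚ (suc n) (suc (suc n)))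
      (V-final : ∀ i → V i (fromℕ (suc n)) ≡ - V i (inject₁ last) - 2ℚ * q * sum
          (λ k → γ k * V i (inject₁ (inject₁ k)))) where

      v : Fin (suc n) → Fin n → ℚ
      v i k = V i (inject₁ (inject₁ k))

      w z : Fin (suc n) → ℚ
      w i = V i (inject₁ last)
      -- Grouped by the differences w - vₖ, since these are divisible by sₖ while γₖ = g / sₖ; the
      -- integrality of B depends on this form.
      z i = w i - sum (λ k → γ k * (w i - v i k)) - sum (v i)

      B : M (suc n)
      B i = snoc (v i) (z i)

      zq : ∀ i → z i * q ≡ w i - sum (λ k → v i k * ((1ℚ - γ k) * q))
      zq i = trans (cong (λ a → (w i - a - sum (v i)) * q)
          (trans (sum-linear (w i) {g = γ} {h = λ k → - 1ℚ * (γ k * v i k)} λ k → lem₁ (γ k) (w i) (v i k))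
          (cong (_+_ (w i * sum γ)) (sum-*ˡ (- 1ℚ) (λ k → γ k * v i k)))))
        (trans (lem₂ (w i) (sum γ) (sum (λ k → γ k * v i k)) (sum (v i)) q)
            (trans (cong (λ a → w i * (q - a) - (q * sum (v i) + - q * sum (λ k → γ k * v i k))) sum-γq)
          (trans (cong₂ _-_ (lem₃ (w i) q)
              (sym (trans (sum-linear (- q) {g = λ k → γ k * v i k} {h = λ k → q * v i k} λ k → lem₄ (v i k) (γ k) q)
            (trans (+-comm _ _) (cong (_+ - q * sum (λ k → γ k * v i k)) (sum-*ˡ q (v i))))))) refl)))
        where
        opaque
          unfolding ring
          lem₁ : ∀ g w v → g * (w - v) ≡ w * g + - 1ℚ * (g * v)
          lem₁ = solve-∀ ring
          lem₂ : ∀ w g s t q → (w - (w * g + - 1ℚ * s) - t) * q ≡ w * (q - g * q) - (q * t + - q * s)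
          lem₂ = solve-∀ ring
          lem₃ : ∀ w q → w * (q - (q - 1ℚ)) ≡ w
          lem₃ = solve-∀ ring
          lem₄ : ∀ v g q → v * ((1ℚ - g) * q) ≡ - q * (g * v) + q * v
          lem₄ = solve-∀ ring
          lem₅ : ∀ s → s ≡ s + 1ℚ - 1ℚ
          lem₅ = solve-∀ ring
        sum-γq : sum γ * q ≡ q - 1ℚ
        sum-γq = trans (lem₅ _) (cong (_- 1ℚ) sum-γ)

      column : ∀ i j → (B ⊡ Q) i j ≡ sum (λ k → v i k * Q (inject₁ k) j) + z i * Q last j
      column i j = trans (split (λ k → B i k * Q k j))
          (cong₂ _+_ (sum-cong {n} λ k → cong (_* Q (inject₁ k) j) (snoc-inject₁ (v i) (z i) k))
          (cong (_* Q last j) (snoc-last (v i) (z i))))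

      factor : V ≈ B ⊡ Q
      factor i j with view j
      ... | ‵fromℕ = sym (trans (column i _)
          (trans (cong₂ _+_ (trans (sum-cong {n} λ k → trans (cong (v i k *_) (final k)) (lem₁ (v i k) (γ k) q))
          (trans (sum-linear (- (2ℚ * q)) {g = λ k → γ k * v i k} {h = λ k → - 1ℚ * (v i k * ((1ℚ - γ k) * q))} λ k →
          refl)
            (cong (_+_ (- (2ℚ * q) * sum (λ k → γ k * v i k))) (sum-*ˡ (- 1ℚ) (λ k → v i k * ((1ℚ - γ k) * q))))))
                (trans (cong (z i *_) final-last) (trans (lem₂ (z i) q) (cong -_ (zq i)))))
          (trans (lem₃ (2ℚ * q) (sum (λ k → γ k * v i k)) (sum (λ k → v i k * ((1ℚ - γ k) * q))) (w i))
              (sym (V-final i)))))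
        where
        opaque
          unfolding ring
          lem₁ : ∀ v g q → v * - ((1ℚ + g) * q) ≡ - ((1ℚ + 1ℚ) * q) * (g * v) + - 1ℚ * (v * ((1ℚ - g) * q))
          lem₁ = solve-∀ ring
          lem₂ : ∀ z q → z * - q ≡ - (z * q)
          lem₂ = solve-∀ ring
          lem₃ : ∀ c s t w → - c * s + - 1ℚ * t + - (w - t) ≡ - w - c * s
          lem₃ = solve-∀ ring
      ... | ‵inject₁ j′ with view j′
      ...   | ‵fromℕ = sym (trans (column i _)
          (trans (cong₂ _+_ (sum-cong {n} λ k → cong (v i k *_) (lastButOne k)) (trans (cong (z i *_) lastButOne-last)
          (zq i))) (lem _ (w i))))
        where
        opaque
          unfolding ring
          lem : ∀ t w → t + (w - t) ≡ w
          lem = solve-∀ ring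
      ...   | ‵inject₁ k′ =
          sym (trans (column i _)
          (trans (cong₂ _+_ (trans (sum-cong {n} λ k → cong (v i k *_) (basis k k′)) (sum-δʳ k′ (v i)))
          (trans (cong (z i *_) (basis-last k′)) (*-zeroʳ (z i)))) (+-identityʳ _)))

      int-B : (∀ i j → IsInt (V i j)) → (∀ i k → IsInt (γ k * (w i - v i k))) → ∀ i j → IsInt (B i j)
      int-B int-V int-γ i j with view j
      ... | ‵fromℕ = subst IsInt (sym (snoc-last (v i) (z i)))
          (int-+ (int-+ (int-V i _) (int-neg (int-sum (int-γ i))))
          (int-neg (int-sum {f = v i} λ k → int-V i (inject₁ (inject₁ k)))))
      ... | ‵inject₁ k = subst IsInt (sym (snoc-inject₁ (v i) (z i) k)) (int-V i _)

open Isomorphisms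

open import Defs using (s; t; P; bound)
open import Data.Integer.Base using (+_)
open import Data.Rational.Base using (_/_)

-- Sylvester numbers as rationals

module SylvesterNat (g : ℕ) .{{_ : NonZero g}} where

  t′ : ℕ → ℕ
  t′ k = t g (suc k)

  s≡suc : ∀ k → s g (suc k) ≡ suc (t′ k)
  s≡suc zero = trans (ℕ.+-comm g 1) (cong (λ n → suc (n ℕ.∸ 1)) (ℕ.+-comm 1 g))
  s≡suc (suc k) = trans (ℕ.+-comm _ 1) (cong (λ n → suc (n ℕ.∸ 1)) (ℕ.+-comm 1 (s g (suc k) ℕ.* (s g (suc k) ℕ.∸ 1))))

  t-zero : t′ 0 ≡ g
  t-zero = ℕ.m+n∸n≡m g 1

  t-suc : ∀ k → t′ (suc k) ≡ suc (t′ k) ℕ.* t′ k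
  t-suc k = trans (ℕ.m+n∸n≡m _ 1) (cong (ℕ._* t′ k) (s≡suc k))

  g∣t : ∀ k → g ℕ.∣ t′ k
  g∣t zero = ℕ.∣-reflexive (sym t-zero)
  g∣t (suc k) = subst (g ℕ.∣_) (sym (t-suc k)) (ℕ.∣-trans (g∣t k) (ℕ.n∣m*n (suc (t′ k))))

  s∣t : ∀ k n → k ℕ.< n → s g (suc k) ℕ.∣ t′ n
  s∣t k (suc n) lt with ℕ.m≤n⇒m<n∨m≡n (ℕ.s≤s⁻¹ lt)
  ... | inj₁ k<n = subst (s g (suc k) ℕ.∣_) (sym (t-suc n)) (ℕ.∣-trans (s∣t k n k<n) (ℕ.n∣m*n (suc (t′ n))))
  ... | inj₂ refl = subst₂ ℕ._∣_ (sym (s≡suc k)) (sym (t-suc k)) (ℕ.m∣m*n (t′ k))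

  -- Here s = t + 1, and g divides t.
  coprime-s : ∀ k → Coprime (s g (suc k)) g
  coprime-s k {e} (e∣s , e∣g) = ℕ.∣1⇒≡1 (ℕ.∣m+n∣m⇒∣n (subst (e ℕ.∣_) (trans (s≡suc k) (ℕ.+-comm 1 (t′ k))) e∣s)
      (ℕ.∣-trans e∣g (g∣t k)))

  1≤G : 1ℚ ≤ fromNat g
  1≤G = fromNat-≤ (ℕ.>-nonZero⁻¹ g)

  open Sylvester (fromNat g) 1≤G public using (τ; 0<τ; 0<s; s⁻¹+τ⁻¹) renaming (s to σ)

  t≡τ : ∀ k → fromNat (t′ k) ≡ τ k
  t≡τ zero = cong fromNat t-zero
  t≡τ (suc k) = trans (cong fromNat (t-suc k)) (trans (fromNat-* (suc (t′ k)) (t′ k))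
      (trans (cong₂ _*_ (trans (fromNat-suc (t′ k)) (trans (+-comm 1ℚ _) (cong (_+ 1ℚ) (t≡τ k)))) (t≡τ k))
      (*-comm _ (τ k))))

  s≡σ : ∀ k → fromNat (s g (suc k)) ≡ σ k
  s≡σ k = trans (cong fromNat (s≡suc k)) (trans (fromNat-suc (t′ k)) (trans (+-comm 1ℚ _) (cong (_+ 1ℚ) (t≡τ k))))

  psum-σ : ∀ k → psum (λ i → σ i ⁻¹) k + τ k ⁻¹ ≡ fromNat g ⁻¹
  psum-σ zero = +-identityˡ _
  psum-σ (suc k) = trans (+-assoc _ _ _) (trans (cong (_+_ (psum (λ i → σ i ⁻¹) k)) (s⁻¹+τ⁻¹ k)) (psum-σ k))

  private
    G : ℚ
    G = fromNat g

    0<G : 0ℚ < G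
    0<G = ℚ.<-≤-trans 0<1 1≤G

  q : ℕ → ℚ
  q n = τ n * G ⁻¹

  qG : ∀ n → q n * G ≡ τ n
  qG n = trans (lem (τ n) (G ⁻¹) G) (trans (cong (τ n *_) (⁻¹-inverse (>⇒≢0 0<G))) (*-identityʳ (τ n)))
    where
    opaque
      unfolding ring
      lem : ∀ t i g → t * i * g ≡ t * (g * i)
      lem = solve-∀ ring

  γ : ∀ {n} → Fin n → ℚ
  γ k = G * σ (toℕ k) ⁻¹

  sum-γ : ∀ n → sum {n} γ * q n + 1ℚ ≡ q n
  sum-γ n = trans (cong (λ a → a * q n + 1ℚ) (trans (sum-*ˡ {n} G (λ k → σ (toℕ k) ⁻¹))
      (cong (G *_) (trans (sym (psum-sum (λ i → σ i ⁻¹) n)) (trans (lem (psum (λ i → σ i ⁻¹) n) (τ n ⁻¹))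
      (cong (_- τ n ⁻¹) (psum-σ n)))))))
    (trans (lem′ G (G ⁻¹) (τ n) (τ n ⁻¹)) (trans (cong₂ (λ a b → τ n * a * G ⁻¹ - a * b + 1ℚ) (⁻¹-inverse (>⇒≢0 0<G))
        (⁻¹-inverse (>⇒≢0 (0<τ n)))) (lem″ (τ n) (G ⁻¹))))
    where
    opaque
      unfolding ring
      lem : ∀ p t → p ≡ p + t - t
      lem = solve-∀ ring
      lem′ : ∀ g h t u → g * (h - u) * (t * h) + 1ℚ ≡ t * (g * h) * h - g * h * (t * u) + 1ℚ
      lem′ = solve-∀ ring
      lem″ : ∀ t h → t * 1ℚ * h - 1ℚ * 1ℚ + 1ℚ ≡ t * h
      lem″ = solve-∀ ring

  bound-G² : ∀ n → bound g (suc n) * (G * G) ≡ 2ℚ * (τ n * τ n)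
  bound-G² n = trans (cong (_* (G * G)) (/-≡ (+ (2 ℕ.* t′ n ℕ.^ 2)) (g ℕ.^ 2) {{ℕ.m^n≢0 g 2}}))
      (trans (cong₂ (λ a b → a * b ⁻¹ * (G * G)) numerator denominator)
    (trans (lem (2ℚ * (τ n * τ n)) ((G * G) ⁻¹) (G * G))
        (trans (cong (2ℚ * (τ n * τ n) *_) (⁻¹-inverse (*-≢0 (>⇒≢0 0<G) (>⇒≢0 0<G)))) (*-identityʳ _))))
    where
    opaque
      unfolding ring
      lem : ∀ a i g → a * i * g ≡ a * (g * i)
      lem = solve-∀ ring
    square : ∀ m → fromNat (m ℕ.^ 2) ≡ fromNat m * fromNat m
    square m = trans (cong fromNat (cong (m ℕ.*_) (ℕ.*-identityʳ m))) (fromNat-* m m)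
    numerator : fromNat (2 ℕ.* t′ n ℕ.^ 2) ≡ 2ℚ * (τ n * τ n)
    numerator = trans (fromNat-* 2 (t′ n ℕ.^ 2))
        (cong₂ _*_ (fromNat-suc 1) (trans (square (t′ n)) (cong₂ _*_ (t≡τ n) (t≡τ n))))
    denominator : fromNat (g ℕ.^ 2) ≡ G * G
    denominator = square g

  module _ (n : ℕ) where

    private
      Q : Matrix ℚ (suc n) (suc (suc n))
      Q = P₂ g (suc n)

      q-raw : q n ≡ (+ t g (suc n) / g)
      q-raw = sym (trans (/-≡ (+ t g (suc n)) g) (cong (_* G ⁻¹) (t≡τ n)))

      over-s : ∀ z (k : Fin n) → (_/_ z (s g (suc (toℕ k))) {{s-nonZero g (suc (toℕ k))}}) ≡ fromℤ z * σ (toℕ k) ⁻¹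
      over-s z k = trans (/-≡ z (s g (suc (toℕ k))) {{s-nonZero g (suc (toℕ k))}})
          (cong (λ a → fromℤ z * a ⁻¹) (s≡σ (toℕ k)))

      coefficient : ∀ z ε (k : Fin n) → fromℤ z ≡ σ (toℕ k) + ε * G →
          (_/_ z (s g (suc (toℕ k))) {{s-nonZero g (suc (toℕ k))}}) * (+ t g (suc n) / g) ≡ (1ℚ + ε * γ k) * q n
      coefficient z ε k e =
          cong₂ _*_ (trans (over-s z k) (trans (cong (_* σ (toℕ k) ⁻¹) e) (trans (lem (σ (toℕ k)) ε G (σ (toℕ k) ⁻¹))
          (cong (_+ ε * γ k) (⁻¹-inverse (>⇒≢0 (0<s (toℕ k)))))))) (sym q-raw)
        where
        opaque
          unfolding ring
          lem : ∀ s e g i → (s + e * g) * i ≡ s * i + e * (g * i)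
          lem = solve-∀ ring

      -- These and the following vectors repeat the local definitions of `P₂`. They unfold to the
      -- same terms and so give access to its columns.
      cᵥ bᵥ : Fin n → ℚ
      cᵥ k = (_/_ (+ s g (suc (toℕ k)) ℤ.- + g) (s g (suc (toℕ k))) {{s-nonZero g (suc (toℕ k))}}) ℚ.*
          (+ t g (suc n) / g)
      bᵥ k = (_/_ (+ s g (suc (toℕ k)) ℤ.+ + g) (s g (suc (toℕ k))) {{s-nonZero g (suc (toℕ k))}}) ℚ.*
          (+ t g (suc n) / g)

      basisᵥ : Fin n → Fin (suc n) → ℚ
      basisᵥ k = snoc (map fromℤ (identity k)) 0ℚ

      lastButOneᵥ finalᵥ : Fin (suc n) → ℚ
      lastButOneᵥ = snoc cᵥ (+ t g (suc n) / g)
      finalᵥ = snoc (map ℚ.-_ bᵥ) (ℚ.- (+ t g (suc n) / g))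

      columns : Fin (suc (suc n)) → Fin (suc n) → ℚ
      columns = snoc (snoc basisᵥ lastButOneᵥ) finalᵥ

      column-basis : ∀ k → columns (inject₁ (inject₁ k)) ≡ basisᵥ k
      column-basis k = trans (snoc-inject₁ (snoc basisᵥ lastButOneᵥ) finalᵥ (inject₁ k))
          (snoc-inject₁ basisᵥ lastButOneᵥ k)

      column-lastButOne : columns (inject₁ (fromℕ n)) ≡ lastButOneᵥ
      column-lastButOne = trans (snoc-inject₁ (snoc basisᵥ lastButOneᵥ) finalᵥ (fromℕ n))
          (snoc-last basisᵥ lastButOneᵥ)

      column-final : columns (fromℕ (suc n)) ≡ finalᵥ
      column-final = snoc-last (snoc basisᵥ lastButOneᵥ) finalᵥ

      at : ∀ {f h : Fin (suc n) → ℚ} i → f ≡ h → f i ≡ h i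
      at i refl = refl

      basis : ∀ i k → Q (inject₁ i) (inject₁ (inject₁ k)) ≡ δ i k
      basis i k = trans (at (inject₁ i) (column-basis k)) (trans (snoc-inject₁ (map fromℤ (identity k)) 0ℚ i)
          (trans (fromℤ-identity k i) (δ-sym k i)))

      basis-last : ∀ k → Q (fromℕ n) (inject₁ (inject₁ k)) ≡ 0ℚ
      basis-last k = trans (at (fromℕ n) (column-basis k)) (snoc-last (map fromℤ (identity k)) 0ℚ)

      lastButOne-last : Q (fromℕ n) (inject₁ (fromℕ n)) ≡ (+ t g (suc n) / g)
      lastButOne-last = trans (at (fromℕ n) column-lastButOne) (snoc-last cᵥ _)

      opaque
        unfolding _+_

        lastButOne : ∀ i → Q (inject₁ i) (inject₁ (fromℕ n)) ≡ (_/_ (+ s g (suc (toℕ i)) ℤ.- + g) (s g (suc (toℕ i)))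
            {{s-nonZero g (suc (toℕ i))}}) * (+ t g (suc n) / g)
        lastButOne i = trans (at (inject₁ i) column-lastButOne) (snoc-inject₁ cᵥ (+ t g (suc n) / g) i)

        final : ∀ i → Q (inject₁ i) (fromℕ (suc n)) ≡ -
            ((_/_ (+ s g (suc (toℕ i)) ℤ.+ + g) (s g (suc (toℕ i))) {{s-nonZero g (suc (toℕ i))}}) *
            (+ t g (suc n) / g))
        final i = trans (at (inject₁ i) column-final) (snoc-inject₁ (map ℚ.-_ bᵥ) (ℚ.- (+ t g (suc n) / g)) i)

        final-last : Q (fromℕ n) (fromℕ (suc n)) ≡ - (+ t g (suc n) / g)
        final-last = trans (at (fromℕ n) column-final) (snoc-last (map ℚ.-_ bᵥ) (ℚ.- (+ t g (suc n) / g)))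

    shape-P₂ : Shape n γ (q n) (P₂ g (suc n))
    shape-P₂ = record
      { basis = basis
      ; basis-last = basis-last
      ; lastButOne = λ i → trans (lastButOne i)
          (trans (coefficient _ (- 1ℚ) i (trans (fromℤ-+ (+ s g (suc (toℕ i))) (ℤ.- + g))
          (cong₂ _+_ (s≡σ (toℕ i)) (trans (fromℤ-neg (+ g)) (lem₁ G))))) (cong (λ a → (1ℚ + a) * q n) (lem₂ (γ i))))
      ; lastButOne-last = trans lastButOne-last (sym q-raw)
      ; final = λ i → trans (final i)
          (cong -_ (trans (coefficient _ 1ℚ i (trans (fromℤ-+ (+ s g (suc (toℕ i))) (+ g))
          (cong₂ _+_ (s≡σ (toℕ i)) (sym (*-identityˡ G))))) (cong (λ a → (1ℚ + a) * q n) (*-identityˡ (γ i)))))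
      ; final-last = trans final-last (cong -_ (sym q-raw))
      ; 0<q = 0<* (0<τ n) (0<⁻¹ 0<G)
      ; sum-γ = sum-γ n }
      where
      opaque
        unfolding ring
        lem₁ : ∀ g → - g ≡ - 1ℚ * g
        lem₁ = solve-∀ ring
        lem₂ : ∀ g → - 1ℚ * g ≡ - g
        lem₂ = solve-∀ ring

    ∣det-P₂∣ : ∣ det (hom (P₂ g (suc n))) ∣ ≡ bound g (suc n)
    ∣det-P₂∣ = trans (∣det-shape∣ shape-P₂) (*-cancel-≡ {G * G} (*-≢0 (>⇒≢0 0<G) (>⇒≢0 0<G))
        (trans (lem G (q n)) (trans (cong₂ (λ a b → 2ℚ * (a * b)) (qG n) (qG n))
        (trans (sym (bound-G² n)) (*-comm _ (G * G))))))
      where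
      opaque
        unfolding ring
        lem : ∀ g q → g * g * ((1ℚ + 1ℚ) * q * q) ≡ (1ℚ + 1ℚ) * (q * g * (q * g))
        lem = solve-∀ ring

opaque
  unfolding _+_

  ∣det-P∣ : ∣ det (hom (toℚ P)) ∣ ≡ + 9 / 1
  ∣det-P∣ = refl

  ∣det-P₁∣ : ∣ det (hom (toℚ P₁)) ∣ ≡ bound 1 3
  ∣det-P₁∣ = refl

-- The volume bound

opaque
  unfolding _+_

  isVolume : ∀ {d} {S : Subset d} {v} → Content S v → IsVolume S v
  isVolume {v = v} (content I O) = record
    { inner = λ ε 0<ε → let w , lw , n , Bs , dis , inc , eq = I ε 0<ε in
        n , Bs , (λ j k ne (p , q) → dis j k ne _ p q) , (λ (j , p) → inc j _ p) , subst (v ℚ.- ε ≤_) (sym eq)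
            (move-+ lw)
    ; outer = λ ε 0<ε → let w , lw , n , Bs , cov , eq = O ε 0<ε in
        n , Bs , (λ p → cov _ p) , subst (_≤ v ℚ.+ ε) (sym eq) lw }

  isNormalizedVolume : ∀ {d} {S : Subset d} {v} → Content S (v * κ d) → IsNormalizedVolume S v
  isNormalizedVolume {d} {v = v} C = v * κ d , isVolume C , trans (sym (*-identityˡ v))
      (trans (cong (_* v) (sym (κ-! d))) (lem (fromNat (d ℕ.!)) (κ d) v))
    where
    lem : ∀ f k v → f ℚ.* k ℚ.* v ≡ f ℚ.* (v ℚ.* k)
    lem f k v = trans (ℚ.*-assoc f k v) (cong (f ℚ.*_) (ℚ.*-comm k v))

  3ℚ≡ : 3ℚ ≡ fromNat 3
  3ℚ≡ = refl

  6ℚ≡ : 6ℚ ≡ fromNat 6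
  6ℚ≡ = refl

  9ℚ≡ : 3ℚ * 3ℚ ≡ + 9 / 1
  9ℚ≡ = refl

extend-< : ∀ {n} (f : Fin (suc n) → ℚ) {i} (lt : i ℕ.< suc n) → extend f i ≡ f (Fin.fromℕ< lt)
extend-< {n} f {i} lt with i ℕ.<? suc n
... | yes _ = refl
... | no nlt = contradiction lt nlt

pprod-⁻¹ : ∀ (a : ℕ → ℚ) → (∀ i → 0ℚ < a i) → ∀ k → pprod a k * pprod (λ i → a i ⁻¹) k ≡ 1ℚ
pprod-⁻¹ a pos zero = *-identityˡ 1ℚ
pprod-⁻¹ a pos (suc k) = trans (lem (pprod a k) (a k) _ _)
    (trans (cong₂ _*_ (pprod-⁻¹ a pos k) (⁻¹-inverse (>⇒≢0 (pos k)))) (*-identityˡ 1ℚ))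
  where
  opaque
    unfolding ring
    lem : ∀ A a X x → A * a * (X * x) ≡ A * X * (a * x)
    lem = solve-∀ ring

-- Ascending order puts the largest denominator last, which is the place that the product of the
-- diagonal of `L` omits.
record SortedFano {d} (S : Subset d) (g : ℕ) : Set where
  field
    fano : FanoData S (fromNat g)
    sorted : ∀ i j → i Fin.≤ j → FanoData.A fano i ≤ FanoData.A fano j

opaque
  sortedFano : ∀ {d} {S : Subset d} g .{{_ : NonZero g}} → IsFanoSimplex S → IsGorensteinIndex S g → SortedFano S g
  sortedFano {d} {S} g fano gor = record { fano = fanoData-permute F (proj₁ sorting) ; sorted = proj₂ sorting }
    where
    F : FanoData S (fromNat g)
    F = fanoData fano g (ℚ.<-≤-trans 0<1 (SylvesterNat.1≤G g)) (gorenstein-lattice {S = S} fano gor)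
    sorting : Σ[ π ∈ Perm.Permutation′ (suc d) ] (∀ i j → i Fin.≤ j → FanoData.A F (π ⟨$⟩ʳ i) ≤ FanoData.A F
        (π ⟨$⟩ʳ j))
    sorting = sort (FanoData.A F)

module Main (N′ g : ℕ) .{{g≢0 : NonZero g}} (Δ : Subset (suc (suc N′))) (F : SortedFano Δ g) where

  n d : ℕ
  n = suc N′
  d = suc n

  open SylvesterNat g public

  open SortedFano F public using (sorted)
  open Normals g (SortedFano.fano F) public

  Vol : ℚ
  Vol = ∣ det H ∣

  volume : IsNormalizedVolume Δ Vol
  volume = isNormalizedVolume {S = Δ} (content-resp (λ x → from) (λ x → to) refl (content-simplex elem-H))

  a : ℕ → ℚ
  a = extend A

  a-toℕ : ∀ j → a (toℕ j) ≡ A j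
  a-toℕ = extend-toℕ A

  unitFractions : UnitFractions G N′ a
  unitFractions = record
    { 1≤g = 1≤G ; int-g = + g , refl
    ; int-a = extend-∀ IsInt A int-A ; 0<a = extend-∀ (0ℚ <_) A 0<A
    ; ascending = λ i lt → subst₂ _≤_ (sym (extend-< A (ℕ.m≤n⇒m≤1+n lt))) (sym (extend-< A (s≤s lt)))
        (sorted _ _ (subst₂ ℕ._≤_ (sym (Fin.toℕ-fromℕ< (ℕ.m≤n⇒m≤1+n lt))) (sym (Fin.toℕ-fromℕ< (s≤s lt)))
            (ℕ.n≤1+n i)))
    ; total = trans (psum-sum (λ i → a i ⁻¹) (suc d))
        (trans (sum-cong {suc d} λ j → trans (cong _⁻¹ (a-toℕ j)) (A⁻¹ j))
        (trans (sum-*ʳ (G ⁻¹) β) (trans (cong (_* G ⁻¹) sum-β) (*-identityˡ _)))) }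
    where
    A⁻¹ : ∀ j → A j ⁻¹ ≡ β j * G ⁻¹
    A⁻¹ j = sym (inverse-unique (trans (sym (*-assoc (A j) (β j) (G ⁻¹)))
        (trans (cong (_* G ⁻¹) (Aβ j)) (⁻¹-inverse (>⇒≢0 0<G)))))

  X : ℕ → ℚ
  X = pprod (λ i → a i ⁻¹)

  Πa : ℚ
  Πa = pprod a d

  0<a : ∀ i → 0ℚ < a i
  0<a = UnitFractions.0<a unitFractions

  ΠaX : Πa * X d ≡ 1ℚ
  ΠaX = pprod-⁻¹ a 0<a d

  0<Πa : 0ℚ < Πa
  0<Πa = pprod->0 d λ i _ → 0<a i

  0<Vol : 0ℚ < Vol
  0<Vol = 0<∣∣ (det≢0 elem-H)

  Vol*det-U : Vol * ∣ det U ∣ ≡ Πa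
  Vol*det-U = trans (*-comm Vol _)
      (trans ∣det∣-product (trans (product-cong {d} λ j → trans (sym (a-toℕ (inject₁ j)))
      (cong a (Fin.toℕ-inject₁ j))) (sym (pprod-product a d))))

  Vol*G≤ : Vol * G ≤ Πa
  Vol*G≤ = subst (Vol * G ≤_) Vol*det-U (*-monoˡ (ℚ.<⇒≤ 0<Vol) G≤∣detU∣)

  Vol*G≡⇒ : Vol * G ≡ Πa → ∣ det U ∣ ≡ G
  Vol*G≡⇒ e = *-cancel-≡ (>⇒≢0 0<Vol) (trans Vol*det-U (sym e))

  -- Weights inversely proportional to the `A j` are proportional to the barycentric coordinates of
  -- the origin, hence define a linear relation between the vertices.
  weights : ∀ c (w : Fin (suc d) → ℚ) → (∀ j → w j * A j ≡ c) → ∀ i → (toℚ V ▹ w) i ≡ 0ℚ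
  weights c w wA i = *-cancel-≡ (>⇒≢0 0<G) (trans (sym (sum-*ˡ G (λ j → toℚ V i j * w j)))
      (trans (sum-cong λ j → trans (lem₁ G (toℚ V i j) (w j)) (trans (cong (λ y → toℚ V i j * (w j * y)) (sym (Aβ j)))
      (trans (lem₂ (toℚ V i j) (w j) (A j) (β j)) (cong (λ y → y * (toℚ V i j * β j)) (wA j)))))
          (trans (sum-*ˡ c (λ j → toℚ V i j * β j))
          (trans (cong (c *_) (V▹β i)) (trans (*-zeroʳ c) (sym (*-zeroʳ G)))))))
    where
    opaque
      unfolding ring
      lem₁ : ∀ g v w → g * (v * w) ≡ v * (w * g)
      lem₁ = solve-∀ ring
      lem₂ : ∀ v w a b → v * (w * (a * b)) ≡ w * a * (v * b)
      lem₂ = solve-∀ ring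

  module General (small : 2ℚ * X N′ ≤ G) where

    2τ² : ℚ
    2τ² = 2ℚ * (τ n * τ n)

    product-bound = product-≥ unitFractions small

    Πa*G≤ : Πa * G ≤ 2τ²
    Πa*G≤ = ℚ.≤-trans (*-monoˡ (ℚ.<⇒≤ 0<Πa) (proj₁ product-bound))
        (ℚ.≤-reflexive (trans (sym (*-assoc Πa (X d) 2τ²)) (trans (cong (_* 2τ²) ΠaX) (*-identityˡ 2τ²))))

    Vol*GG≤ : Vol * (G * G) ≤ Πa * G
    Vol*GG≤ = subst (_≤ Πa * G) (*-assoc Vol G G) (*-monoʳ (ℚ.<⇒≤ 0<G) Vol*G≤)

    0<GG : 0ℚ < G * G
    0<GG = 0<* 0<G 0<G

    Vol≤bound : Vol ≤ bound g d
    Vol≤bound = *-cancel-≤ 0<GG (subst₂ _≤_ (*-comm Vol _) (trans (sym (bound-G² n)) (*-comm (bound g d) _))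
        (ℚ.≤-trans Vol*GG≤ Πa*G≤))

    -- The bound is the chain g² Vol ≤ g a₀ ⋯ a_{d-1} ≤ 2 t². Equality at the ends makes the first
    -- step give the determinant and the second one the denominators.
    equality : Vol ≡ bound g d → ∣ det U ∣ ≡ G × Extremal G N′ a 1≤G
    equality e = Vol*G≡⇒ (*-cancel-≡ (>⇒≢0 0<G)
        (trans (lem G Vol) (trans (ℚ.≤-antisym Vol*GG≤ (ℚ.≤-trans Πa*G≤ (ℚ.≤-reflexive (sym Vol*GG≡))))
        (*-comm Πa G)))) ,
        proj₂ product-bound (*-cancel-≡ (>⇒≢0 0<Πa)
            (trans (sym (*-assoc Πa (X d) 2τ²))
            (trans (cong (_* 2τ²) ΠaX)
            (trans (*-identityˡ 2τ²) (ℚ.≤-antisym (ℚ.≤-trans (ℚ.≤-reflexive (sym Vol*GG≡)) Vol*GG≤) Πa*G≤)))))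
      where
      Vol*GG≡ : Vol * (G * G) ≡ 2τ²
      Vol*GG≡ = trans (cong (_* (G * G)) e) (bound-G² n)
      opaque
        unfolding ring
        lem : ∀ g v → g * (v * g) ≡ v * (g * g)
        lem = solve-∀ ring

  -- The vertex with index n is congruent to the k-th one modulo sₖ, since sₖ divides both aₖ = sₖ
  -- and 2 t and is coprime to g. This is the integrality that `ShapeFactor` asks for.
  iso-P₂ : ∣ det U ∣ ≡ G → Vol ≡ bound g d → (∀ i → i ℕ.< n → a i ≡ σ i) → a n ≡ 2ℚ * τ n → a (suc n) ≡ 2ℚ * τ n →
      Δ ≅ Δ[ P₂ g d ]
  iso-P₂ det-U e a-σ a-n a-sn = recognize V elem-H to from (P₂ g d) SF.B (SF.int-B (λ i j → V i j , refl) int-γ)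
      SF.factor (trans e (sym (∣det-P₂∣ n)))
    where
    lastᶜ : Fin (suc d)
    lastᶜ = fromℕ (suc n)
    A-σ : ∀ (k : Fin n) → A (inject₁ (inject₁ k)) ≡ σ (toℕ k)
    A-σ k = trans (sym (a-toℕ (inject₁ (inject₁ k))))
        (trans (cong a (trans (Fin.toℕ-inject₁ (inject₁ k)) (Fin.toℕ-inject₁ k))) (a-σ (toℕ k) (Fin.toℕ<n k)))
    A-n : A (inject₁ (fromℕ n)) ≡ 2ℚ * τ n
    A-n = trans (sym (a-toℕ (inject₁ (fromℕ n))))
        (trans (cong a (trans (Fin.toℕ-inject₁ (fromℕ n)) (Fin.toℕ-fromℕ n))) a-n)
    A-sn : A lastᶜ ≡ 2ℚ * τ n
    A-sn = trans (sym (a-toℕ lastᶜ)) (trans (cong a (Fin.toℕ-fromℕ (suc n))) a-sn)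
    c : ℚ
    c = 2ℚ * τ n
    -- The weights are 1 at the last two vertices and 2 q γₖ at the others, so the relation between
    -- the vertices can be solved for the last one.
    w : Fin (suc d) → ℚ
    w j = c * A j ⁻¹
    cancel : ∀ x → 0ℚ < x → c * x ⁻¹ * x ≡ c
    cancel x 0<x = trans (lem c (x ⁻¹) x) (trans (cong (c *_) (⁻¹-inverse (>⇒≢0 0<x))) (*-identityʳ c))
      where
      opaque
        unfolding ring
        lem : ∀ c i x → c * i * x ≡ c * (x * i)
        lem = solve-∀ ring
    0<c : 0ℚ < c
    0<c = 0<* 0<2 (0<τ n)
    w-1 : ∀ {j} → A j ≡ c → w j ≡ 1ℚ
    w-1 e = trans (cong (λ x → c * x ⁻¹) e) (⁻¹-inverse (>⇒≢0 0<c))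
    w-γ : ∀ k → w (inject₁ (inject₁ k)) ≡ 2ℚ * q n * γ k
    w-γ k = trans (cong₂ (λ x y → 2ℚ * x * y ⁻¹) (sym (qG n)) (A-σ k)) (lem 2ℚ (q n) G (σ (toℕ k) ⁻¹))
      where
      opaque
        unfolding ring
        lem : ∀ t q g i → t * (q * g) * i ≡ t * q * (g * i)
        lem = solve-∀ ring
    V-final : ∀ i → toℚ V i lastᶜ ≡ - toℚ V i (inject₁ (fromℕ n)) - 2ℚ * q n * sum
        (λ k → γ k * toℚ V i (inject₁ (inject₁ k)))
    V-final i = lem (toℚ V i (inject₁ (fromℕ n))) (toℚ V i lastᶜ)
        (2ℚ * q n * sum (λ k → γ k * toℚ V i (inject₁ (inject₁ k))))
        (trans (sym expand) (weights c w (λ j → cancel (A j) (0<A j)) i))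
      where
      lem : ∀ x y s → s + x * 1ℚ + y * 1ℚ ≡ 0ℚ → y ≡ - x - s
      lem x y s e = trans (lem′ x y s) (trans (cong (λ y → y - x - s) e) (lem″ x s))
        where
        opaque
          unfolding ring
          lem′ : ∀ x y s → y ≡ s + x * 1ℚ + y * 1ℚ - x - s
          lem′ = solve-∀ ring
          lem″ : ∀ x s → 0ℚ - x - s ≡ - x - s
          lem″ = solve-∀ ring
      opaque
        unfolding ring
        lem₁ : ∀ v c g → v * (c * g) ≡ c * (g * v)
        lem₁ = solve-∀ ring
      f : Fin (suc d) → ℚ
      f j = toℚ V i j * w j
      expand : sum f ≡ 2ℚ * q n * sum (λ k → γ k * toℚ V i (inject₁ (inject₁ k))) + toℚ V i (inject₁ (fromℕ n)) * 1ℚ +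
          toℚ V i lastᶜ * 1ℚ
      expand = trans (sum-init-last f) (cong₂ _+_ (trans (sum-init-last (λ j → f (inject₁ j))) (cong₂ _+_
          (trans (sum-cong {n} λ k → trans (cong (toℚ V i (inject₁ (inject₁ k)) *_) (w-γ k))
              (lem₁ _ (2ℚ * q n) (γ k))) (sum-*ˡ (2ℚ * q n) (λ k → γ k * toℚ V i (inject₁ (inject₁ k)))))
          (cong (toℚ V i (inject₁ (fromℕ n)) *_) (w-1 A-n)))) (cong (toℚ V i lastᶜ *_) (w-1 A-sn)))
    module SF = ShapeFactor (shape-P₂ n) (toℚ V) V-final
    not-last : ∀ {j : Fin d} → inject₁ j ≢ last
    not-last = Fin.fromℕ≢inject₁ ∘ sym
    int-γ : ∀ i k → IsInt (γ k * (toℚ V i (inject₁ (fromℕ n)) - toℚ V i (inject₁ (inject₁ k))))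
    int-γ i k = scaled (congruence det-U {inject₁ (fromℕ n)} {inject₁ (inject₁ k)} (s g (suc (toℕ k))) not-last
        not-last s∣A-n s∣A-k (coprime-s (toℕ k)) i)
      where
      s∣A-n : s g (suc (toℕ k)) ∣ᵢ A (inject₁ (fromℕ n))
      s∣A-n = subst (s g (suc (toℕ k)) ∣ᵢ_) (sym A-n)
          (∣ᵢ-* (int-+ int-1 int-1) (subst (s g (suc (toℕ k)) ∣ᵢ_) (t≡τ n) (∣⇒∣ᵢ-ℕ (s∣t (toℕ k) n (Fin.toℕ<n k)))))
      s∣A-k : s g (suc (toℕ k)) ∣ᵢ A (inject₁ (inject₁ k))
      s∣A-k = subst (s g (suc (toℕ k)) ∣ᵢ_) (trans (s≡σ (toℕ k)) (sym (A-σ k))) (∣⇒∣ᵢ-ℕ ℕ.∣-refl)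
      scaled : ∀ {x} → s g (suc (toℕ k)) ∣ᵢ x → IsInt (γ k * x)
      scaled (z , refl) = + g ℤ.* z , trans (cong (λ y → γ k * (y * fromℤ z)) (s≡σ (toℕ k)))
          (trans (lem G (σ (toℕ k) ⁻¹) (σ (toℕ k)) (fromℤ z))
          (trans (cong (λ x → G * (x * fromℤ z)) (⁻¹-inverse (>⇒≢0 (0<s (toℕ k)))))
              (trans (cong (G *_) (*-identityˡ _)) (sym (fromℤ-* (+ g) z)))))
        where
        opaque
          unfolding ring
          lem : ∀ g i s z → g * i * (s * z) ≡ g * (s * i * z)
          lem = solve-∀ ring

-- Weights (1 , 1 , 1) in the plane

module _ (V : Matrix ℤ 2 3) (z : ∀ i → 3 ∣ᵢ toℚ V i (suc zero) - toℚ V i zero)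
  (balanced : ∀ i → toℚ V i zero + (toℚ V i (suc zero) + (toℚ V i (suc (suc zero)) + 0ℚ)) ≡ 0ℚ) where

  -- Its columns are v₀ and (v₁ - v₀) / 3, because the first two columns of `P` are (1 , 0) and (1 ,
  -- 3). The third column takes care of itself by `balanced`.
  matrix-P : M 2
  matrix-P i zero = toℚ V i zero
  matrix-P i (suc zero) = fromℤ (proj₁ (z i))

  int-matrix-P : ∀ i j → IsInt (matrix-P i j)
  int-matrix-P i zero = V i zero , refl
  int-matrix-P i (suc zero) = proj₁ (z i) , refl

  private
    opaque
      unfolding ring
      second : ∀ x y → y * 1ℚ + (x * fromNat 3 + 0ℚ) ≡ y + fromNat 3 * x
      second = solve-∀ ring
      third : ∀ x y → x * fromℤ -[1+ 1 ] + (y * fromℤ -[1+ 2 ] + 0ℚ) ≡ - x - (x + fromNat 3 * y)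
      third = solve-∀ ring
      first : ∀ x y → x * 1ℚ + (y * 0ℚ + 0ℚ) ≡ x
      first = solve-∀ ring
      lem₁ : ∀ x y → y + (x - y) ≡ x
      lem₁ = solve-∀ ring
      lem₂ : ∀ x y z → x + (y + (z + 0ℚ)) - x - y ≡ z
      lem₂ = solve-∀ ring
      lem₃ : ∀ x y → 0ℚ - x - y ≡ - x - y
      lem₃ = solve-∀ ring

    v₁ : ∀ i → toℚ V i zero + fromNat 3 * fromℤ (proj₁ (z i)) ≡ toℚ V i (suc zero)
    v₁ i = trans (cong (_+_ (toℚ V i zero)) (sym (proj₂ (z i)))) (lem₁ _ _)

  v₂-balanced : ∀ i → toℚ V i (suc (suc zero)) ≡ - toℚ V i zero - toℚ V i (suc zero)
  v₂-balanced i = trans (sym (lem₂ (toℚ V i zero) (toℚ V i (suc zero)) (toℚ V i (suc (suc zero)))))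
      (trans (cong (λ s → s - toℚ V i zero - toℚ V i (suc zero)) (balanced i)) (lem₃ _ _))

  factor-P : toℚ V ≈ matrix-P ⊡ toℚ P
  factor-P i zero = sym (first _ _)
  factor-P i (suc zero) = sym (trans (second _ _) (v₁ i))
  factor-P i (suc (suc zero)) =
      trans (v₂-balanced i) (sym (trans (third _ _) (cong (λ a → - toℚ V i zero - a) (v₁ i))))

-- Weights (3 , 1 , 1 , 1) in dimension 3

module _ (V : Matrix ℤ 3 4) (z₁ : ∀ i → 2 ∣ᵢ toℚ V i (suc zero) - toℚ V i zero)
    (z₂ : ∀ i → 6 ∣ᵢ toℚ V i (suc (suc zero)) - toℚ V i (suc zero))
  (balanced : ∀ i → toℚ V i zero * fromNat 3 +
      (toℚ V i (suc zero) * 1ℚ + (toℚ V i (suc (suc zero)) * 1ℚ + (toℚ V i (suc (suc (suc zero))) * 1ℚ + 0ℚ))) ≡ 0ℚ)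
      where

  -- Its columns are v₀, (v₁ - v₀) / 2 and (v₂ - v₁) / 6, read off from the triangular part of `P₁`.
  matrix-P₁ : M 3
  matrix-P₁ i zero = toℚ V i zero
  matrix-P₁ i (suc zero) = fromℤ (proj₁ (z₁ i))
  matrix-P₁ i (suc (suc zero)) = fromℤ (proj₁ (z₂ i))

  int-matrix-P₁ : ∀ i j → IsInt (matrix-P₁ i j)
  int-matrix-P₁ i zero = V i zero , refl
  int-matrix-P₁ i (suc zero) = proj₁ (z₁ i) , refl
  int-matrix-P₁ i (suc (suc zero)) = proj₁ (z₂ i) , refl

  private
    opaque
      unfolding ring
      first : ∀ x y z → x * 1ℚ + (y * 0ℚ + (z * 0ℚ + 0ℚ)) ≡ x
      first = solve-∀ ring
      second : ∀ x y z → x * 1ℚ + (y * fromNat 2 + (z * 0ℚ + 0ℚ)) ≡ x + fromNat 2 * y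
      second = solve-∀ ring
      third : ∀ x y z → x * 1ℚ + (y * fromNat 2 + (z * fromNat 6 + 0ℚ)) ≡ x + fromNat 2 * y + fromNat 6 * z
      third = solve-∀ ring
      fourth : ∀ x y z → x * fromℤ -[1+ 4 ] + (y * fromℤ -[1+ 3 ] + (z * fromℤ -[1+ 5 ] + 0ℚ)) ≡
        - (x * fromNat 3) - (x + fromNat 2 * y) - (x + fromNat 2 * y + fromNat 6 * z)
      fourth = solve-∀ ring
      lem₁ : ∀ x y → y + (x - y) ≡ x
      lem₁ = solve-∀ ring
      lem₂ : ∀ x y z w → x + (y * 1ℚ + (z * 1ℚ + (w * 1ℚ + 0ℚ))) - x - y - z ≡ w
      lem₂ = solve-∀ ring
      lem₃ : ∀ x y z → 0ℚ - x - y - z ≡ - x - y - z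
      lem₃ = solve-∀ ring

    v₁ : ∀ i → toℚ V i zero + fromNat 2 * fromℤ (proj₁ (z₁ i)) ≡ toℚ V i (suc zero)
    v₁ i = trans (cong (_+_ (toℚ V i zero)) (sym (proj₂ (z₁ i)))) (lem₁ _ _)

    v₂ : ∀ i → toℚ V i zero + fromNat 2 * fromℤ (proj₁ (z₁ i)) + fromNat 6 * fromℤ (proj₁ (z₂ i)) ≡ toℚ V i
        (suc (suc zero))
    v₂ i = trans (cong₂ _+_ (v₁ i) (sym (proj₂ (z₂ i)))) (lem₁ _ _)

  factor-P₁ : toℚ V ≈ matrix-P₁ ⊡ toℚ P₁
  factor-P₁ i zero = sym (first _ _ _)
  factor-P₁ i (suc zero) = sym (trans (second _ _ _) (v₁ i))
  factor-P₁ i (suc (suc zero)) = sym (trans (third _ _ _) (v₂ i))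
  factor-P₁ i (suc (suc (suc zero))) =
      trans (trans (sym (lem₂ (toℚ V i zero * fromNat 3) (toℚ V i (suc zero)) (toℚ V i (suc (suc zero)))
      (toℚ V i (suc (suc (suc zero))))))
      (trans (cong (λ s → s - toℚ V i zero * fromNat 3 - toℚ V i (suc zero) - toℚ V i (suc (suc zero))) (balanced i))
          (lem₃ _ _ _)))
    (sym (trans (fourth _ _ _) (cong₂ (λ a b → - (toℚ V i zero * fromNat 3) - a - b) (v₁ i) (v₂ i))))

-- Recognition of P and P₁

∣ᵢ-self : ∀ {m x} → x ≡ fromNat m → m ∣ᵢ x
∣ᵢ-self {m} e = + 1 , trans e (sym (*-identityʳ (fromNat m)))

coprime-1 : ∀ m → Coprime m 1
coprime-1 m (_ , k∣1) = ℕ.∣1⇒≡1 k∣1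

-- The equations for d and g are arguments, so that matching on them fixes the dimension and removes
-- the transport from the conclusion.
case-2-1 : ∀ N′ g .{{_ : NonZero g}} (Δ : Subset (suc (suc N′))) (F : SortedFano Δ g) →
  (d≡2 : suc (suc N′) ≡ 2) → g ≡ 1 → Main.Vol N′ g Δ F ≤ + 9 / 1 ×
    (Main.Vol N′ g Δ F ≡ + 9 / 1 ⇔ subst Subset d≡2 Δ ≅ Δ[ toℚ P ])
case-2-1 .0 .1 Δ F refl refl = bound₉ , mk⇔ ⇒ λ iso → trans (iso⇒∣det∣ V elem-H to from (toℚ P) iso) ∣det-P∣
  where
  open Main 0 1 Δ F
  x₀x₁ 9ℚ : ℚ
  x₀x₁ = a 0 ⁻¹ * a 1 ⁻¹
  9ℚ = 3ℚ * 3ℚ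
  product≥ = product-2-1 unitFractions
  Πa*x : Πa * x₀x₁ ≡ 1ℚ
  Πa*x = trans (cong (λ y → Πa * (y * a 1 ⁻¹)) (sym (*-identityˡ (a 0 ⁻¹)))) ΠaX
  Πa≤9 : Πa ≤ 9ℚ
  Πa≤9 = subst₂ _≤_ (*-identityʳ Πa) (trans (sym (*-assoc Πa x₀x₁ 9ℚ)) (trans (cong (_* 9ℚ) Πa*x) (*-identityˡ 9ℚ)))
      (*-monoˡ (ℚ.<⇒≤ 0<Πa) (proj₁ product≥))
  Vol≤Πa : Vol ≤ Πa
  Vol≤Πa = subst (_≤ Πa) (*-identityʳ Vol) Vol*G≤
  bound₉ : Vol ≤ + 9 / 1
  bound₉ = subst (Vol ≤_) 9ℚ≡ (ℚ.≤-trans Vol≤Πa Πa≤9)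
  ⇒ : Vol ≡ + 9 / 1 → Δ ≅ Δ[ toℚ P ]
  ⇒ e = recognize V elem-H to from (toℚ P) (matrix-P V z balanced) (int-matrix-P V z balanced) (factor-P V z balanced)
      (trans e (sym ∣det-P∣))
    where
    Vol≡9 : Vol ≡ 9ℚ
    Vol≡9 = trans e (sym 9ℚ≡)
    Vol≡Πa : Vol ≡ Πa
    Vol≡Πa = ℚ.≤-antisym Vol≤Πa (ℚ.≤-trans Πa≤9 (ℚ.≤-reflexive (sym Vol≡9)))
    thirds = proj₂ product≥ (trans (*-comm x₀x₁ 9ℚ) (trans (cong (_* x₀x₁) (trans (sym Vol≡9) Vol≡Πa)) Πa*x))
    A≡3 : ∀ j → A j ≡ 3ℚ
    A≡3 zero = trans (sym (a-toℕ zero)) (proj₁ thirds)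
    A≡3 (suc zero) = trans (sym (a-toℕ (suc zero))) (proj₁ (proj₂ thirds))
    A≡3 (suc (suc zero)) = trans (sym (a-toℕ (suc (suc zero)))) (proj₂ (proj₂ thirds))
    3∣A : ∀ j → 3 ∣ᵢ A j
    3∣A j = ∣ᵢ-self (trans (A≡3 j) 3ℚ≡)
    z : ∀ i → 3 ∣ᵢ toℚ V i (suc zero) - toℚ V i zero
    z = congruence (Vol*G≡⇒ (trans (*-identityʳ Vol) Vol≡Πa)) {suc zero} {zero} 3
        (λ ()) (λ ()) (3∣A (suc zero)) (3∣A zero) (coprime-1 3)
    balanced : ∀ i → toℚ V i zero + (toℚ V i (suc zero) + (toℚ V i (suc (suc zero)) + 0ℚ)) ≡ 0ℚ
    balanced i = trans (sym (sum-cong {f = λ j → toℚ V i j * 1ℚ} {g = toℚ V i} λ j → *-identityʳ _))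
        (weights 3ℚ (λ _ → 1ℚ) (λ j → trans (*-identityˡ (A j)) (A≡3 j)) i)

iso-P₁ : ∀ N′ g .{{_ : NonZero g}} (Δ : Subset (suc (suc N′))) (F : SortedFano Δ g) → N′ ≡ 1 → g ≡ 1 →
  ∣ det (Main.U N′ g Δ F) ∣ ≡ fromNat g → Main.Vol N′ g Δ F ≡ bound g (suc (suc N′)) →
  Main.a N′ g Δ F 0 ≡ 2ℚ → Main.a N′ g Δ F 1 ≡ 6ℚ → Main.a N′ g Δ F 2 ≡ 6ℚ → Main.a N′ g Δ F 3 ≡ 6ℚ →
  Σ[ d≡3 ∈ suc (suc N′) ≡ 3 ] g ≡ 1 × subst Subset d≡3 Δ ≅ Δ[ toℚ P₁ ]
iso-P₁ .1 .1 Δ F refl refl det-U e a₀ a₁ a₂ a₃ = refl , refl ,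
    recognize V elem-H to from (toℚ P₁) (matrix-P₁ V z₁ z₂ balanced) (int-matrix-P₁ V z₁ z₂ balanced)
        (factor-P₁ V z₁ z₂ balanced) (trans e (sym ∣det-P₁∣))
  where
  open Main 1 1 Δ F
  0F 1F 2F 3F : Fin 4
  0F = zero
  1F = suc zero
  2F = suc (suc zero)
  3F = suc (suc (suc zero))
  A₀ : A 0F ≡ 2ℚ
  A₀ = trans (sym (a-toℕ 0F)) a₀
  A₁ : A 1F ≡ 6ℚ
  A₁ = trans (sym (a-toℕ 1F)) a₁
  A₂ : A 2F ≡ 6ℚ
  A₂ = trans (sym (a-toℕ 2F)) a₂
  A₃ : A 3F ≡ 6ℚ
  A₃ = trans (sym (a-toℕ 3F)) a₃
  6∣A : ∀ {j} → A j ≡ 6ℚ → 6 ∣ᵢ A j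
  6∣A e = ∣ᵢ-self (trans e 6ℚ≡)
  2∣6 : 2 ∣ᵢ 6ℚ
  2∣6 = subst (2 ∣ᵢ_) (sym 6ℚ≡) (∣⇒∣ᵢ-ℕ (ℕ.divides 3 refl))
  z₁ : ∀ i → 2 ∣ᵢ toℚ V i 1F - toℚ V i 0F
  z₁ = congruence det-U {1F} {0F} 2
      (λ ()) (λ ()) (subst (2 ∣ᵢ_) (sym A₁) 2∣6) (∣ᵢ-self (trans A₀ (sym (fromNat-suc 1)))) (coprime-1 2)
  z₂ : ∀ i → 6 ∣ᵢ toℚ V i 2F - toℚ V i 1F
  z₂ = congruence det-U {2F} {1F} 6 (λ ()) (λ ()) (6∣A A₂) (6∣A A₁) (coprime-1 6)
  w : Fin 4 → ℚ
  w zero = fromNat 3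
  w (suc _) = 1ℚ
  wA : ∀ j → w j * A j ≡ 6ℚ
  wA zero = trans (cong₂ _*_ (sym 3ℚ≡) A₀) (*-comm _ 2ℚ)
  wA (suc zero) = trans (*-identityˡ _) A₁
  wA (suc (suc zero)) = trans (*-identityˡ _) A₂
  wA (suc (suc (suc zero))) = trans (*-identityˡ _) A₃
  balanced : ∀ i → toℚ V i 0F * fromNat 3 + (toℚ V i 1F * 1ℚ + (toℚ V i 2F * 1ℚ + (toℚ V i 3F * 1ℚ + 0ℚ))) ≡ 0ℚ
  balanced = weights 6ℚ w wA

-- Weights (1 , 1 , 1) and index 2

parity : ∀ {x} → IsInt x → 2 ∣ᵢ x ⊎ 2 ∣ᵢ x + 1ℚ
parity (z , refl) = result (half-ℕ ℤ.∣ z ∣)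
  where
  half-ℕ : ∀ m → 2 ℕ.∣ m ⊎ 2 ℕ.∣ suc m
  half-ℕ zero = inj₁ (2 ℕ.∣0)
  half-ℕ (suc m) with half-ℕ m
  ... | inj₁ h = inj₂ (ℕ.∣m∣n⇒∣m+n ℕ.∣-refl h)
  ... | inj₂ h = inj₁ h
  opaque
    unfolding ring
    lem : ∀ x → (1ℚ + x) - (1ℚ + 1ℚ) ≡ - (- x + 1ℚ)
    lem = solve-∀ ring
    lem′ : ∀ x → - (- x) ≡ x
    lem′ = solve-∀ ring
  result : 2 ℕ.∣ ℤ.∣ z ∣ ⊎ 2 ℕ.∣ suc ℤ.∣ z ∣ → 2 ∣ᵢ fromℤ z ⊎ 2 ∣ᵢ fromℤ z + 1ℚ
  result (inj₁ h) = inj₁ (∣⇒∣ᵢ z h)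
  result (inj₂ h) = inj₂ (odd z h)
    where
    odd : ∀ z → 2 ℕ.∣ suc ℤ.∣ z ∣ → 2 ∣ᵢ fromℤ z + 1ℚ
    odd (ℤ.+ n) h = subst (2 ∣ᵢ_) (trans (fromNat-suc n) (+-comm 1ℚ _)) (∣⇒∣ᵢ-ℕ h)
    odd -[1+ n ] h = subst (2 ∣ᵢ_)
        (trans (cong -_ (trans
        (cong (_- 2ℚ) (trans (fromNat-suc (suc n))
        (cong (_+_ 1ℚ) (sym (trans (cong -_ (fromℤ-neg (ℤ.+ suc n))) (lem′ _)))))) (lem (- fromℤ -[1+ n ]))))
        (trans (lem′ _) (cong (_+ 1ℚ) (lem′ _))))
      (∣ᵢ-neg (∣ᵢ-+ (∣⇒∣ᵢ-ℕ h) (∣ᵢ-neg (∣ᵢ-self (sym (fromNat-suc 1))))))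

-- Modulo 2, vectors v = (a , b) and z = (c , e) of even determinant are dependent: v, z or v + z vanishes.
no-dependence : ∀ {a b c e} → IsInt a → IsInt b → IsInt c → IsInt e → 2 ∣ᵢ a * e - b * c →
  (2 ∣ᵢ a → 2 ∣ᵢ b → ⊥) → (2 ∣ᵢ c → 2 ∣ᵢ e → ⊥) → (2 ∣ᵢ a + c → 2 ∣ᵢ b + e → ⊥) → ⊥
no-dependence {a} {b} {c} {e} ia ib ic ie det≡0 nv nz nvz = go (parity ia) (parity ib) (parity ic) (parity ie)
  where
  2∣2 : 2 ∣ᵢ 2ℚ
  2∣2 = ∣ᵢ-self (sym (fromNat-suc 1))
  odd+odd : ∀ {x y} → 2 ∣ᵢ x + 1ℚ → 2 ∣ᵢ y + 1ℚ → 2 ∣ᵢ x + y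
  odd+odd {x} {y} h k = subst (2 ∣ᵢ_) (lem x y) (∣ᵢ-+ (∣ᵢ-+ h k) (∣ᵢ-neg 2∣2))
    where
    opaque
      unfolding ring
      lem : ∀ x y → x + 1ℚ + (y + 1ℚ) - (1ℚ + 1ℚ) ≡ x + y
      lem = solve-∀ ring
  swap : ∀ {x y} → 2 ∣ᵢ x * y → 2 ∣ᵢ y * x
  swap {x} {y} = subst (2 ∣ᵢ_) (*-comm x y)
  cancel-odd : ∀ {x y} → IsInt y → 2 ∣ᵢ x + 1ℚ → 2 ∣ᵢ x * y → 2 ∣ᵢ y
  cancel-odd {x} {y} iy h k = subst (2 ∣ᵢ_) (lem x y) (∣ᵢ-+ (∣ᵢ-* iy h) (∣ᵢ-neg k))
    where
    opaque
      unfolding ring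
      lem : ∀ x y → y * (x + 1ℚ) - x * y ≡ y
      lem = solve-∀ ring
  even-sum : ∀ {x y} → 2 ∣ᵢ x + y → 2 ∣ᵢ x → 2 ∣ᵢ y
  even-sum {x} {y} h k = subst (2 ∣ᵢ_) (lem x y) (∣ᵢ-+ h (∣ᵢ-neg k))
    where
    opaque
      unfolding ring
      lem : ∀ x y → x + y - x ≡ y
      lem = solve-∀ ring
  go : 2 ∣ᵢ a ⊎ 2 ∣ᵢ a + 1ℚ → 2 ∣ᵢ b ⊎ 2 ∣ᵢ b + 1ℚ → 2 ∣ᵢ c ⊎ 2 ∣ᵢ c + 1ℚ → 2 ∣ᵢ e ⊎ 2 ∣ᵢ e + 1ℚ → ⊥
  go (inj₁ ea) (inj₁ eb) _ _ = nv ea eb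
  go (inj₁ ea) (inj₂ ob) pc pe = rest pe
    where
    ec : 2 ∣ᵢ c
    ec = cancel-odd ic ob (subst (2 ∣ᵢ_) (lem (a * e) (b * c)) (∣ᵢ-+ (swap (∣ᵢ-* ie ea)) (∣ᵢ-neg det≡0)))
      where
      opaque
        unfolding ring
        lem : ∀ x y → x - (x - y) ≡ y
        lem = solve-∀ ring
    rest : 2 ∣ᵢ e ⊎ 2 ∣ᵢ e + 1ℚ → ⊥
    rest (inj₁ ee) = nz ec ee
    rest (inj₂ oe) = nvz (∣ᵢ-+ ea ec) (odd+odd ob oe)
  go (inj₂ oa) (inj₁ eb) pc pe = rest pc
    where
    ee : 2 ∣ᵢ e
    ee = cancel-odd ie oa (subst (2 ∣ᵢ_) (lem (a * e) (b * c)) (∣ᵢ-+ det≡0 (swap (∣ᵢ-* ic eb))))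
      where
      opaque
        unfolding ring
        lem : ∀ x y → x - y + y ≡ x
        lem = solve-∀ ring
    rest : 2 ∣ᵢ c ⊎ 2 ∣ᵢ c + 1ℚ → ⊥
    rest (inj₁ ec) = nz ec ee
    rest (inj₂ oc) = nvz (odd+odd oa oc) (∣ᵢ-+ eb ee)
  go (inj₂ oa) (inj₂ ob) pc pe = rest pc pe
    where
    c-e : 2 ∣ᵢ c + e
    c-e = subst (2 ∣ᵢ_) (lem a b c e) (∣ᵢ-+ (∣ᵢ-+ (∣ᵢ-neg det≡0) (∣ᵢ-* ie oa))
        (∣ᵢ-+ (∣ᵢ-neg (∣ᵢ-* ic ob)) (∣ᵢ-* ic 2∣2)))
      where
      opaque
        unfolding ring
        lem : ∀ a b c e → - (a * e - b * c) + e * (a + 1ℚ) + (- (c * (b + 1ℚ)) + c * (1ℚ + 1ℚ)) ≡ c + e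
        lem = solve-∀ ring
    rest : 2 ∣ᵢ c ⊎ 2 ∣ᵢ c + 1ℚ → 2 ∣ᵢ e ⊎ 2 ∣ᵢ e + 1ℚ → ⊥
    rest (inj₁ ec) _ = nz ec (even-sum c-e ec)
    rest (inj₂ oc) (inj₁ ee) = nz (even-sum (subst (2 ∣ᵢ_) (+-comm c e) c-e) ee) ee
    rest (inj₂ oc) (inj₂ oe) = nvz (odd+odd oa oc) (odd+odd ob oe)

opaque
  unfolding _+_

  18≡ : bound 2 2 ≡ 3ℚ * 3ℚ * 2ℚ
  18≡ = refl

∣∣-even : ∀ {x} → IsInt x → 2 ∣ᵢ ∣ x ∣ → 2 ∣ᵢ x
∣∣-even {x} (z , refl) h = ∣⇒∣ᵢ z (∣ᵢ⇒∣ (ℤ.+ ℤ.∣ z ∣) (subst (2 ∣ᵢ_) (sym (fromℤ-∣∣ z)) h))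

det-2×2 : ∀ (B : M 2) → det B ≡ B zero zero * B (suc zero) (suc zero) - B (suc zero) zero * B zero (suc zero)
det-2×2 B = lem (B zero zero) (B zero (suc zero)) (B (suc zero) zero) (B (suc zero) (suc zero))
  where
  opaque
    unfolding ring
    lem : ∀ a b c e → 1ℚ * a * (1ℚ * e * 1ℚ + 0ℚ) + (- 1ℚ * b * (1ℚ * c * 1ℚ + 0ℚ) + 0ℚ) ≡ a * e - c * b
    lem = solve-∀ ring

-- The congruence modulo 3 still gives V = B P, but the volume is 18 = 2 · 9, so det B = ± 2 and the
-- columns b₀, b₁ of B are dependent modulo 2. Modulo 2 the vertices are b₀, b₀ + b₁ and b₁, so one
-- of them is even and not primitive.
no-6-6-6 : ∀ N′ g .{{_ : NonZero g}} (Δ : Subset (suc (suc N′))) (F : SortedFano Δ g) → N′ ≡ 0 → g ≡ 2 →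
  ∣ det (Main.U N′ g Δ F) ∣ ≡ fromNat g → Main.Vol N′ g Δ F ≡ bound g (suc (suc N′)) →
  Main.a N′ g Δ F 0 ≡ 6ℚ → Main.a N′ g Δ F 1 ≡ 6ℚ → Main.a N′ g Δ F 2 ≡ 6ℚ → ⊥
no-6-6-6 .0 .2 Δ F refl refl det-U e a₀ a₁ a₂ = no-dependence {B zero zero} {B (suc zero) zero} {B zero (suc zero)}
    {B (suc zero) (suc zero)}
    (int-B zero zero) (int-B (suc zero) zero) (int-B zero (suc zero)) (int-B (suc zero) (suc zero)) even-det
    (λ h k → imprimitive zero λ { zero → h ; (suc zero) → k })
    (λ h k → imprimitive (suc (suc zero)) λ { zero → even-v₂ zero h ; (suc zero) → even-v₂ (suc zero) k })
    (λ h k → imprimitive (suc zero) λ { zero → even-v₁ zero h ; (suc zero) → even-v₁ (suc zero) k })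
  where
  open Main 0 2 Δ F
  A≡6 : ∀ j → A j ≡ 6ℚ
  A≡6 zero = trans (sym (a-toℕ zero)) a₀
  A≡6 (suc zero) = trans (sym (a-toℕ (suc zero))) a₁
  A≡6 (suc (suc zero)) = trans (sym (a-toℕ (suc (suc zero)))) a₂
  3∣A : ∀ j → 3 ∣ᵢ A j
  3∣A j = subst (3 ∣ᵢ_) (sym (trans (A≡6 j) 6ℚ≡)) (∣⇒∣ᵢ-ℕ (ℕ.divides 2 refl))
  z : ∀ i → 3 ∣ᵢ toℚ V i (suc zero) - toℚ V i zero
  z = congruence det-U {suc zero} {zero} 3 (λ ()) (λ ()) (3∣A (suc zero)) (3∣A zero) (toWitness {a? = coprime? 3 2} _)
  balanced : ∀ i → toℚ V i zero + (toℚ V i (suc zero) + (toℚ V i (suc (suc zero)) + 0ℚ)) ≡ 0ℚ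
  balanced i = trans (sym (sum-cong {f = λ j → toℚ V i j * 1ℚ} {g = toℚ V i} λ j → *-identityʳ _))
      (weights 6ℚ (λ _ → 1ℚ) (λ j → trans (*-identityˡ (A j)) (A≡6 j)) i)
  B : M 2
  B = matrix-P V z balanced
  int-B : ∀ i j → IsInt (B i j)
  int-B = int-matrix-P V z balanced
  2∣2 : 2 ∣ᵢ 2ℚ
  2∣2 = ∣ᵢ-self (sym (fromNat-suc 1))
  imprimitive : ∀ j → (∀ i → 2 ∣ᵢ toℚ V i j) → ⊥
  imprimitive j h with primitive-V j 2 (λ i → ∣ᵢ⇒∣ (V i j) (h i))
  ... | ()
  v₁ : ∀ i → toℚ V i (suc zero) ≡ B i zero + 3ℚ * B i (suc zero)
  v₁ i = trans (sym (cancel (toℚ V i (suc zero)) (toℚ V i zero)))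
      (cong (_+_ (toℚ V i zero)) (trans (proj₂ (z i)) (cong (_* fromℤ (proj₁ (z i))) (sym 3ℚ≡))))
    where
    opaque
      unfolding ring
      cancel : ∀ x y → y + (x - y) ≡ x
      cancel = solve-∀ ring
  even-v₁ : ∀ i → 2 ∣ᵢ B i zero + B i (suc zero) → 2 ∣ᵢ toℚ V i (suc zero)
  even-v₁ i h = subst (2 ∣ᵢ_) (trans (lem (B i zero) (B i (suc zero))) (sym (v₁ i)))
      (∣ᵢ-+ h (∣ᵢ-* (int-B i (suc zero)) 2∣2))
    where
    opaque
      unfolding ring
      lem : ∀ x y → x + y + y * (1ℚ + 1ℚ) ≡ x + (1ℚ + 1ℚ + 1ℚ) * y
      lem = solve-∀ ring
  even-v₂ : ∀ i → 2 ∣ᵢ B i (suc zero) → 2 ∣ᵢ toℚ V i (suc (suc zero))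
  even-v₂ i h = subst (2 ∣ᵢ_) (trans (lem (B i zero) (B i (suc zero)))
      (trans (cong (λ y → - B i zero - y) (sym (v₁ i))) (sym (v₂-balanced V z balanced i))))
      (∣ᵢ-neg (∣ᵢ-+ (∣ᵢ-* (int-B i zero) 2∣2) (∣ᵢ-* (int-+ (int-+ int-1 int-1) int-1) h)))
    where
    opaque
      unfolding ring
      lem : ∀ x y → - (x * (1ℚ + 1ℚ) + (1ℚ + 1ℚ + 1ℚ) * y) ≡ - x - (x + (1ℚ + 1ℚ + 1ℚ) * y)
      lem = solve-∀ ring
  ∣det-B∣ : ∣ det B ∣ ≡ 2ℚ
  ∣det-B∣ = *-cancel-≡ {3ℚ * 3ℚ} (>⇒≢0 (0<* 0<3 0<3))
      (trans (*-comm (3ℚ * 3ℚ) _) (trans (cong (∣ det B ∣ *_) (trans 9ℚ≡ (sym ∣det-P∣)))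
    (trans (sym (∣∣-* (det B) _))
        (trans (cong ∣_∣ (sym (det-factor {V = toℚ V} {toℚ P} {B} elem-H (factor-P V z balanced)))) (trans e 18≡)))))
  even-det : 2 ∣ᵢ B zero zero * B (suc zero) (suc zero) - B (suc zero) zero * B zero (suc zero)
  even-det = subst (2 ∣ᵢ_) (det-2×2 B) (∣∣-even (int-det int-B) (subst (2 ∣ᵢ_) (sym ∣det-B∣) 2∣2))

-- Assembly of the general case

≅P₁⇒Vol : ∀ N′ g .{{_ : NonZero g}} (Δ : Subset (suc (suc N′))) (F : SortedFano Δ g) →
  Σ[ d≡3 ∈ suc (suc N′) ≡ 3 ] g ≡ 1 × subst Subset d≡3 Δ ≅ Δ[ toℚ P₁ ] → Main.Vol N′ g Δ F ≡ bound g (suc (suc N′))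
≅P₁⇒Vol .1 .1 Δ F (refl , refl , iso) = trans (iso⇒∣det∣ V elem-H to from (toℚ P₁) iso) ∣det-P₁∣
  where
  open Main 1 1 Δ F

≅P₂⇒Vol : ∀ N′ g .{{_ : NonZero g}} (Δ : Subset (suc (suc N′))) (F : SortedFano Δ g) →
  Δ ≅ Δ[ P₂ g (suc (suc N′)) ] → Main.Vol N′ g Δ F ≡ bound g (suc (suc N′))
≅P₂⇒Vol N′ g Δ F iso = trans (iso⇒∣det∣ V elem-H to from (P₂ g (suc (suc N′))) iso) (∣det-P₂∣ (suc N′))
  where
  open Main N′ g Δ F

case-general : ∀ N′ g .{{_ : NonZero g}} (Δ : Subset (suc (suc N′))) (F : SortedFano Δ g) →
    ¬ (suc (suc N′) ≡ 2 × g ≡ 1) →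
  Main.Vol N′ g Δ F ≤ bound g (suc (suc N′)) ×
  (Main.Vol N′ g Δ F ≡ bound g (suc (suc N′)) ⇔
      ((Σ[ d≡3 ∈ suc (suc N′) ≡ 3 ] g ≡ 1 × subst Subset d≡3 Δ ≅ Δ[ toℚ P₁ ]) ⊎ Δ ≅ Δ[ P₂ g (suc (suc N′)) ]))
case-general N′ g Δ F not-2-1 = Vol≤bound , mk⇔ ⇒ λ { (inj₁ iso) → ≅P₁⇒Vol N′ g Δ F iso ; (inj₂ iso) →
    ≅P₂⇒Vol N′ g Δ F iso }
  where
  open Main N′ g Δ F
  small : 2ℚ * X N′ ≤ G
  small = by-dimension (N′ ℕ.≟ 0)
    where
    2≤G : ∀ g → .{{NonZero g}} → g ≢ 1 → 2ℚ ≤ fromNat g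
    2≤G 1 ne = contradiction refl ne
    2≤G (suc (suc m)) _ = subst₂ _≤_ (+-identityʳ 2ℚ)
        (sym (trans (fromNat-suc (suc m)) (trans (cong (_+_ 1ℚ) (fromNat-suc m)) (sym (+-assoc 1ℚ 1ℚ _)))))
        (+-mono-≤ ℚ.≤-refl (0≤fromNat m))
    by-dimension : Dec (N′ ≡ 0) → 2ℚ * X N′ ≤ G
    by-dimension (no ne) = small-if-long unitFractions ne
    by-dimension (yes z) = subst (λ k → 2ℚ * X k ≤ G) (sym z) (subst (_≤ G) (sym (*-identityʳ 2ℚ)) (2≤G g λ g≡1 →
        not-2-1 (cong (λ k → suc (suc k)) z , g≡1)))
  open General small
  ⇒ : Vol ≡ bound g d → (Σ[ d≡3 ∈ d ≡ 3 ] g ≡ 1 × subst Subset d≡3 Δ ≅ Δ[ toℚ P₁ ]) ⊎ Δ ≅ Δ[ P₂ g d ]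
  ⇒ e = classify (equality e)
    where
    classify : ∣ det U ∣ ≡ G × Extremal G N′ a 1≤G → (Σ[ d≡3 ∈ d ≡ 3 ] g ≡ 1 × subst Subset d≡3 Δ ≅ Δ[ toℚ P₁ ]) ⊎ Δ ≅
        Δ[ P₂ g d ]
    classify (det-U , sylvester a-σ a-n a-sn) = inj₂ (iso-P₂ det-U e a-σ a-n a-sn)
    classify (det-U , 2-6-6-6 N≡1 G≡1 a₀ a₁ a₂ a₃) = inj₁ (iso-P₁ N′ g Δ F N≡1 (ℤ.+-injective (fromℤ-injective G≡1))
        det-U e a₀ a₁ a₂ a₃)
    classify (det-U , 6-6-6 N≡0 G≡2 a₀ a₁ a₂) =
        ⊥-elim (no-6-6-6 N′ g Δ F N≡0 (ℤ.+-injective (fromℤ-injective (trans G≡2 (sym (fromNat-suc 1))))) det-U e a₀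
        a₁ a₂)

theorem1p1 :
    ∀ (d g : ℕ) → 2 ℕ.≤ d → .{{_ : NonZero g}} →
    (Δ : Subset d) → IsFanoSimplex Δ → IsGorensteinIndex Δ g →
    ∃[ V ] IsNormalizedVolume Δ V ×
      ((d≡2 : d ≡ 2) → g ≡ 1 →
        V ≤ + 9 / 1 ×
        (V ≡ + 9 / 1 ⇔ subst Subset d≡2 Δ ≅ Δ[ toℚ P ])) ×
      (¬ (d ≡ 2 × g ≡ 1) →
        V ≤ bound g d ×
        (V ≡ bound g d ⇔
          ((Σ[ d≡3 ∈ d ≡ 3 ] g ≡ 1 × subst Subset d≡3 Δ ≅ Δ[ toℚ P₁ ])
            ⊎ Δ ≅ Δ[ P₂ g d ])))
theorem1p1 (suc (suc N′)) g (s≤s (s≤s z≤n)) Δ fano gor = Main.Vol N′ g Δ F , Main.volume N′ g Δ F ,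
    case-2-1 N′ g Δ F , case-general N′ g Δ F
  where
  F : SortedFano Δ g
  F = sortedFano g fano gor
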